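{- Let $q$ be such that $1/q\in\mathbb{Z}\setminus\{ -1,1\}$. Then at least one of the numbers $\zeta_q(3),\zeta_q(5),\zeta_q(7),\zeta_q(9)$ is irrational.
   Context: For a complex number $q$ with $|q|<1$ and a positive integer $s$, $\zeta_q(s)=\sum_{k\geq1}q^k\sum_{d\mid k}d^{s-1}=\sum_{k\geq 1}k^{s-1}\frac{q^k}{1-q^k}$. -}

module Defs where

open import Data.Nat as ℕ using (ℕ; zero; suc)
open import Data.Nat.Divisibility using (_∣?_)
open import Data.Integer as ℤ using (ℤ; +_)
open import Data.Rational using (ℚ; 0ℚ; 1ℚ; _+_; _*_; _-_; ∣_∣; _<_; _/_)
open import Data.Product using (Σ; ∃; _×_)
open import Relation.Nullary.Decidable using (does)
open import Data.Bool using (if_then_else_)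

_^ℚ_ : ℚ → ℕ → ℚ
q ^ℚ zero = 1ℚ
q ^ℚ suc k = q * (q ^ℚ k)

σ : ℕ → ℕ → ℕ
σ t k = go k
  where
  go : ℕ → ℕ
  go zero = 0
  go (suc d) = (if does (suc d ∣? k) then suc d ℕ.^ t else 0) ℕ.+ go d

ζpartial : ℚ → ℕ → ℕ → ℚ
ζpartial q s zero = 0ℚ
ζpartial q s (suc N) = ζpartial q s N + (q ^ℚ suc N) * ((+ σ (s ℕ.∸ 1) (suc N)) / 1)

ConvergesTo : (ℕ → ℚ) → ℚ → Set
ConvergesTo a r = ∀ (ε : ℚ) → 0ℚ < ε → ∃ λ N → ∀ n → N ℕ.≤ n → ∣ a n - r ∣ < ε

ζRational : ℚ → ℕ → Set
ζRational q s = ∃ λ (r : ℚ) → ConvergesTo (ζpartial q s) r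

{-# OPTIONS --safe #-}
-- For m ≥ 4 let R(x) = x^(35m+4) (1 - x² q^(16m)) ∏_{1 ≤ k ≤ 20m} (1 - x q^(16m+k)) (1 - x q^(-k)) / ∏ (1 - x q^j),
-- where j runs over the ten intervals [hm, (16-h)m], h = 0, 1, 1, 2, 2, 3, 3, 4, 4, 5.  By partial fractions,
-- Σ_k R(q^k) is a linear combination of sums over i of powers of ω_i = 1 / (1 - q^i).  Since R(q^(-16m) / x) = - R(x),
-- twice the sum involves these powers only through polynomials that are odd under ω ↦ 1 - ω, which are combinations of
-- (2ω - 1)(ω² - ω)^t with t ≤ 4, and the sums of the latter are combinations of ζ_q(3), ζ_q(5), ζ_q(7), ζ_q(9).
-- A product Δ of q-factorials [im]! to suitable (also negative) powers clears the denominators of the coefficients: for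
-- each cyclotomic factor this is an inequality between floors of multiples of m / l, settled by finitely many cases.
-- The first nonzero term dominates the sum, and Δ times it is at most 2^110 |q|^m.  If all four values were
-- rational, multiplying by a common denominator would produce nonzero integers of absolute value less than 1.
module Submission where

-- No real number is constructed: if the four values are rational, every limit that occurs is
-- rational, and the linear form is a limit inside ℚ. No cyclotomic polynomial occurs either: |p^k -
-- 1| with p = 1/q is a strong divisibility sequence, and this alone yields integers `Φ` d with |p^k
-- - 1| equal to the product of `Φ` d over the divisors d of k. Uniqueness of partial fractions is
-- never proved. One array of coefficients is constructed that fits every `Model`; local expansions
-- at the poles give formulas for it, the value at infinity and the value at x = 0 give two linear
-- relations, and values at x = q^k give the series. The relation at x = 0, where R vanishes, says
-- that the coefficients of the positive powers sum to 0. Therefore only t ≥ 1 occurs in (2ω - 1)(ω²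
-- - ω)^t, which excludes ζ_q(1). The margin is narrow: to leading order `Δ` is |p|^(691.5 m²),
-- while the first nonzero term is |q|^(700 m²). Exponents of cyclotomic factors and of p must
-- therefore be tracked exactly to order m², whereas constant powers of 2 are harmless.

-- Strong divisibility of p^k - 1 and its cyclotomic factorisation.

module Divisibility where

  open import Data.Nat
  open import Data.Nat.Properties
  open import Data.Nat.Divisibility
  open import Data.Nat.GCD
  open import Data.Nat.LCM
  open import Data.Integer as ℤ using (ℤ)
  import Data.Integer.Properties as ℤP
  import Data.Integer.Divisibility.Signed as ℤD
  open import Data.Integer.Tactic.RingSolver using (solve-∀)
  open import Data.Product using (_,_)
  open import Data.Empty using (⊥-elim)
  open import Data.Bool using (if_then_else_)
  open import Relation.Nullary using (¬_; yes; no; does)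
  open import Relation.Binary.PropositionalEquality

  -- After multiplication by d = gcd x y the goal is that g d divides x y. Now g d divides x g since
  -- d divides x, and it divides x c = gcd (c g) (c b), because g d divides lcm b c * gcd b c = b c.
  -- Hence it divides gcd (x g) (x c) = x y.
  gcd-lcm-distrib : ∀ {g} b c → g ≢ 0 → g ∣ lcm b c → g ∣ lcm (gcd g b) (gcd g c)
  gcd-lcm-distrib {g} b c g≢0 g∣l = *-cancelˡ-∣ d {{≢-nonZero d≢0}}
    (subst₂ _∣_ (*-comm g d) (sym (gcd*lcm x y)) gd∣xy)
    where
    x = gcd g b
    y = gcd g c
    d = gcd x y
    d∣x = gcd[m,n]∣m x y
    d∣y = gcd[m,n]∣n x y
    d∣b = ∣-trans d∣x (gcd[m,n]∣n g b)
    d∣c = ∣-trans d∣y (gcd[m,n]∣n g c)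
    d≢0 : d ≢ 0
    d≢0 e = g≢0 (gcd[m,n]≡0⇒m≡0 (gcd[m,n]≡0⇒m≡0 {x} {y} e))
    gd∣xg : g * d ∣ x * g
    gd∣xg = subst (_∣ x * g) (*-comm d g) (*-monoˡ-∣ g d∣x)
    gd∣xc : g * d ∣ x * c
    gd∣xc = subst (g * d ∣_) (trans (sym (c*gcd[m,n]≡gcd[cm,cn] c g b)) (*-comm c x))
      (gcd-greatest (subst (g * d ∣_) (*-comm g c) (*-monoʳ-∣ g d∣c))
        (subst (g * d ∣_) (trans (trans (*-comm (lcm b c) (gcd b c)) (gcd*lcm b c)) (*-comm b c))
          (*-pres-∣ g∣l (gcd-greatest d∣b d∣c))))
    gd∣xy : g * d ∣ x * y
    gd∣xy = subst (g * d ∣_) (sym (c*gcd[m,n]≡gcd[cm,cn] x g c)) (gcd-greatest gd∣xg gd∣xc)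

  opaque
    ind : ℕ → ℕ → ℕ
    ind l d = if does (l ∣? d) then 1 else 0

    ind-yes : ∀ {l d} → l ∣ d → ind l d ≡ 1
    ind-yes {l} {d} h with l ∣? d
    ... | yes _ = refl
    ... | no ¬h = ⊥-elim (¬h h)

    ind-no : ∀ {l d} → ¬ (l ∣ d) → ind l d ≡ 0
    ind-no {l} {d} h with l ∣? d
    ... | yes y = ⊥-elim (h y)
    ... | no _ = refl

    ind≤1 : ∀ l d → ind l d ≤ 1
    ind≤1 l d with l ∣? d
    ... | yes _ = ≤-refl
    ... | no _ = z≤n

  ind-0 : ∀ l {d} → d < l → 0 < d → ind l d ≡ 0
  ind-0 l {suc d} d<l _ = ind-no (λ h → <⇒≱ d<l (∣⇒≤ h))

  ∏ : ℕ → (ℕ → ℕ) → ℕ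
  ∏ zero f = 1
  ∏ (suc n) f = ∏ n f * f n

  -- Everything needed from cyclotomic factors follows from these properties: `u-gcd` says that
  -- common divisors of u a and u b divide u (gcd a b).
  module StrongDivisibility
    (u : ℕ → ℕ)
    (u≢0 : (k : ℕ) → u (suc k) ≢ 0)
    (u-mono : {d k : ℕ} → d ∣ k → u d ∣ u k)
    (u-gcd : {x : ℕ} (a b : ℕ) → x ∣ u a → x ∣ u b → x ∣ u (gcd a b))
    where

    Λ : ℕ → ℕ
    Λ zero = 1
    Λ (suc d) = lcm (Λ d) (u (suc d))

    private
      u∣Λ : ∀ {i} d → i < d → u (suc i) ∣ Λ d
      u∣Λ {i} (suc d) (s≤s i≤d) with i ≟ d
      ... | yes refl = n∣lcm[m,n] (Λ d) (u (suc d))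
      ... | no i≢d = ∣-trans (u∣Λ d (≤∧≢⇒< i≤d i≢d)) (m∣lcm[m,n] (Λ d) (u (suc d)))

      gcd-quot : ∀ d → gcd (u (suc d)) (Λ d) ∣ u (suc d)
      gcd-quot d = gcd[m,n]∣m (u (suc d)) (Λ d)

    opaque
      -- The analogue of the value of the d-th cyclotomic polynomial.
      Φ : ℕ → ℕ
      Φ zero = 1
      Φ (suc d) = quotient (gcd-quot d)

      Φ-quotient : ∀ d → u (suc d) ≡ gcd (u (suc d)) (Λ d) * Φ (suc d)
      Φ-quotient d = m∣n⇒n≡m*quotient (gcd-quot d)

    private
      module _ (k-1 : ℕ) where
        k = suc k-1
        G : ℕ → ℕ
        G d = gcd (u k) (Λ d)

        G≢0 : ∀ d → G d ≢ 0
        G≢0 d e = u≢0 k-1 (gcd[m,n]≡0⇒m≡0 e)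

        G-step : ∀ d → G (suc d) ∣ lcm (G d) (gcd (u k) (u (suc d)))
        G-step d = ∣-trans (gcd-lcm-distrib (Λ d) (u (suc d)) (G≢0 (suc d)) (gcd[m,n]∣n (u k) (Λ (suc d))))
          (lcm-least
            (∣-trans (gcd-greatest (∣-trans (gcd[m,n]∣m (G (suc d)) (Λ d)) (gcd[m,n]∣m (u k) (Λ (suc d)))) (gcd[m,n]∣n (G (suc d)) (Λ d)))
              (m∣lcm[m,n] (G d) (gcd (u k) (u (suc d)))))
            (∣-trans (gcd-greatest (∣-trans (gcd[m,n]∣m (G (suc d)) (u (suc d))) (gcd[m,n]∣m (u k) (Λ (suc d)))) (gcd[m,n]∣n (G (suc d)) (u (suc d))))
              (n∣lcm[m,n] (G d) (gcd (u k) (u (suc d))))))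

        G-mono : ∀ d → G d ∣ G (suc d)
        G-mono d = gcd-greatest (gcd[m,n]∣m (u k) (Λ d)) (∣-trans (gcd[m,n]∣n (u k) (Λ d)) (m∣lcm[m,n] (Λ d) (u (suc d))))

        -- What u k and u (d + 1) have in common divides u at gcd k (d + 1). This index is at most
        -- d, so the common part is already contained in `Λ` d.
        G-no : ∀ d → ¬ (suc d ∣ k) → G (suc d) ≡ G d
        G-no d ¬h = ∣-antisym (∣-trans (G-step d) (lcm-least ∣-refl rest)) (G-mono d)
          where
          e = gcd k (suc d)
          e∣ : e ∣ suc d
          e∣ = gcd[m,n]∣n k (suc d)
          e≢ : e ≢ suc d
          e≢ eq = ¬h (subst (_∣ k) eq (gcd[m,n]∣m k (suc d)))
          ue∣Λ : ∀ e → e ∣ suc d → e ≢ suc d → u e ∣ Λ d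
          ue∣Λ zero e∣ _ = ⊥-elim (1+n≢0 (0∣⇒≡0 e∣))
          ue∣Λ (suc e) e∣ e≢ = u∣Λ d (≤-pred (≤∧≢⇒< (∣⇒≤ e∣) e≢))
          rest : gcd (u k) (u (suc d)) ∣ G d
          rest = ∣-trans (u-gcd k (suc d) (gcd[m,n]∣m (u k) (u (suc d))) (gcd[m,n]∣n (u k) (u (suc d))))
            (gcd-greatest (u-mono (gcd[m,n]∣m k (suc d))) (ue∣Λ e e∣ e≢))

        -- Here u (d + 1) divides u k, so the new gcd is lcm (G d) v. The overlap gcd (G d) v equals
        -- c = gcd v (Λ d), and v = c * Φ (d + 1), so exactly one new factor Φ (d + 1) appears.
        G-yes : ∀ d → suc d ∣ k → G (suc d) ≡ G d * Φ (suc d)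
        G-yes d h = trans G≡lcm (*-cancelˡ-≡ (lcm (G d) v) (G d * Φ (suc d)) c {{≢-nonZero c≢0}} eq)
          where
          v = u (suc d)
          c = gcd v (Λ d)
          c≢0 : c ≢ 0
          c≢0 e = u≢0 d (gcd[m,n]≡0⇒m≡0 e)
          v∣uk = u-mono h
          G≡lcm : G (suc d) ≡ lcm (G d) v
          G≡lcm = ∣-antisym
            (∣-trans (G-step d) (lcm-least (m∣lcm[m,n] (G d) v) (∣-trans (gcd[m,n]∣n (u k) v) (n∣lcm[m,n] (G d) v))))
            (lcm-least (G-mono d) (gcd-greatest v∣uk (n∣lcm[m,n] (Λ d) v)))
          gcd≡c : gcd (G d) v ≡ c
          gcd≡c = ∣-antisym
            (gcd-greatest (gcd[m,n]∣n (G d) v) (∣-trans (gcd[m,n]∣m (G d) v) (gcd[m,n]∣n (u k) (Λ d))))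
            (gcd-greatest (gcd-greatest (∣-trans (gcd[m,n]∣m v (Λ d)) v∣uk) (gcd[m,n]∣n v (Λ d))) (gcd[m,n]∣m v (Λ d)))
          open ≡-Reasoning
          eq : c * lcm (G d) v ≡ c * (G d * Φ (suc d))
          eq = begin
            c * lcm (G d) v          ≡⟨ cong (_* lcm (G d) v) (sym gcd≡c) ⟩
            gcd (G d) v * lcm (G d) v ≡⟨ gcd*lcm (G d) v ⟩
            G d * v                  ≡⟨ cong (G d *_) (Φ-quotient d) ⟩
            G d * (c * Φ (suc d))    ≡⟨ sym (*-assoc (G d) c _) ⟩
            G d * c * Φ (suc d)      ≡⟨ cong (_* Φ (suc d)) (*-comm (G d) c) ⟩
            c * G d * Φ (suc d)      ≡⟨ *-assoc c (G d) _ ⟩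
            c * (G d * Φ (suc d))    ∎

        G-prod : ∀ d → G d ≡ ∏ d (λ i → Φ (suc i) ^ ind (suc i) k)
        G-prod zero = ∣1⇒≡1 (gcd[m,n]∣n (u k) 1)
        G-prod (suc d) with suc d ∣? k
        ... | yes h = trans (G-yes d h) (cong₂ _*_ (G-prod d) (trans (sym (*-identityʳ (Φ (suc d)))) (cong (Φ (suc d) ^_) (sym (ind-yes h)))))
        ... | no h = trans (G-no d h) (trans (G-prod d) (trans (sym (*-identityʳ _)) (cong (∏ d _ *_) (cong (Φ (suc d) ^_) (sym (ind-no h))))))

    -- At d = k + 1 the gcd of u (k + 1) with `Λ` d is u (k + 1) itself; factors of larger index
    -- have exponent 0.
    u-factors : ∀ k N → suc k ≤ N → u (suc k) ≡ ∏ N (λ i → Φ (suc i) ^ ind (suc i) (suc k))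
    u-factors k N k<N = trans (trans (sym G≡u) (G-prod k (suc k))) (extend (≤⇒≤′ k<N))
      where
      f = λ i → Φ (suc i) ^ ind (suc i) (suc k)
      G≡u : gcd (u (suc k)) (Λ (suc k)) ≡ u (suc k)
      G≡u = ∣-antisym (gcd[m,n]∣m (u (suc k)) (Λ (suc k))) (gcd-greatest ∣-refl (u∣Λ (suc k) ≤-refl))
      extend : ∀ {N} → suc k ≤′ N → ∏ (suc k) f ≡ ∏ N f
      extend ≤′-refl = refl
      extend {suc N} (≤′-step h) = trans (extend h) (trans (sym (*-identityʳ _))
        (cong (∏ N f *_) (sym (cong (Φ (suc N) ^_) (ind-0 (suc N) (s≤s (≤′⇒≤ h)) (s≤s z≤n))))))

    Φ≢0 : ∀ d → Φ (suc d) ≢ 0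
    Φ≢0 d e = u≢0 d (trans (Φ-quotient d) (trans (cong (gcd (u (suc d)) (Λ d) *_) e) (*-zeroʳ (gcd (u (suc d)) (Λ d)))))

  U : ℤ → ℕ → ℤ
  U p k = p ℤ.^ k ℤ.- ℤ.+ 1

  U-+ : ∀ p a b → U p (a + b) ≡ p ℤ.^ a ℤ.* U p b ℤ.+ U p a
  U-+ p a b = trans (cong (ℤ._- ℤ.+ 1) (ℤP.^-distribˡ-+-* p a b)) (r (p ℤ.^ a) (p ℤ.^ b))
    where
    r : ∀ x y → x ℤ.* y ℤ.- ℤ.+ 1 ≡ x ℤ.* (y ℤ.- ℤ.+ 1) ℤ.+ (x ℤ.- ℤ.+ 1)
    r = solve-∀

  U-mult : ∀ p c d → U p d ℤD.∣ U p (c * d)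
  U-mult p zero d = ℤD.divides (ℤ.+ 0) (sym (ℤP.*-zeroˡ (U p d)))
  U-mult p (suc c) d = subst (U p d ℤD.∣_) (sym (U-+ p d (c * d)))
    (ℤD.∣m∣n⇒∣m+n (ℤD.∣n⇒∣m*n (p ℤ.^ d) (U-mult p c d)) ℤD.∣-refl)

  -- Since s = t + g, the number x divides p^t (p^g - 1), and p^t is 1 modulo x.
  U-bézout : ∀ p {x} g s t → x ℤD.∣ U p s → x ℤD.∣ U p t → g + t ≡ s → x ℤD.∣ U p g
  U-bézout p {x} g s t hs ht e = subst (x ℤD.∣_) (r (p ℤ.^ t) (U p g))
    (ℤD.∣m∣n⇒∣m-n step (ℤD.∣m⇒∣m*n (U p g) ht))
    where
    step : x ℤD.∣ p ℤ.^ t ℤ.* U p g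
    step = ℤD.∣m+n∣n⇒∣m (subst (x ℤD.∣_) (trans (cong (U p) (trans (sym e) (+-comm g t))) (U-+ p t g)) hs) ht
    r : ∀ y z → y ℤ.* z ℤ.- (y ℤ.- ℤ.+ 1) ℤ.* z ≡ z
    r = solve-∀

  u : ℤ → ℕ → ℕ
  u p k = ℤ.∣ U p k ∣

  u-mono : ∀ p {d k} → d ∣ k → u p d ∣ u p k
  u-mono p {d} (divides c refl) = ℤD.∣⇒∣ᵤ (U-mult p c d)

  u-gcd : ∀ p {x} a b → x ∣ u p a → x ∣ u p b → x ∣ u p (gcd a b)
  u-gcd p {x} a b ha hb = ℤD.∣⇒∣ᵤ (go (Bézout.identity (gcd-GCD a b)))
    where
    X = ℤ.+ x
    mult : ∀ c {a} → x ∣ u p a → X ℤD.∣ U p (c * a)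
    mult c {a} h = ℤD.∣-trans (ℤD.∣ᵤ⇒∣ h) (U-mult p c a)
    go : Bézout.Identity (gcd a b) a b → X ℤD.∣ U p (gcd a b)
    go (Bézout.+- s t eq) = U-bézout p (gcd a b) (s * a) (t * b) (mult s ha) (mult t hb) eq
    go (Bézout.-+ s t eq) = U-bézout p (gcd a b) (t * b) (s * a) (mult t hb) (mult s ha) eq

-- Counting zeros and poles in residue classes: the floor inequality behind the denominators.

module ResidueCounting where

  open import Data.Bool using (Bool; true; false; _∧_; _∨_; T)
  open import Data.Bool.Properties using (T-∧)
  open import Data.Empty using (⊥-elim)
  open import Data.List using (List; []; _∷_; _++_)
  open import Data.List.Relation.Unary.All using (All; []; _∷_; all?)
  open import Data.Nat
  open import Data.Nat.DivMod
  open import Data.Nat.Divisibility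
  open import Data.Nat.Properties
  open import Data.Nat.Tactic.RingSolver using (solve-∀)
  open import Data.Product using (∃; _×_; _,_; proj₁; proj₂)
  open import Data.Sum using (_⊎_; inj₁; inj₂)
  open import Data.Unit using (tt)
  open import Function.Bundles using (Equivalence)
  open import Relation.Binary.PropositionalEquality
  open import Relation.Nullary using (¬_; Dec; yes; no)
  open import Relation.Nullary.Decidable using (from-yes)
  open Divisibility

  div-unique : ∀ {a} k r l .{{_ : NonZero l}} → a ≡ k * l + r → r < l → a / l ≡ k
  div-unique k r l e r<l = trans (/-congˡ e) (trans (+-distrib-/-∣ˡ r (n∣m*n k))
    (trans (cong₂ _+_ (m*n/n≡m k l) (m<n⇒m/n≡0 r<l)) (+-identityʳ k)))

  div-bounds : ∀ {a} k l .{{_ : NonZero l}} → k * l ≤ a → a < suc k * l → a / l ≡ k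
  div-bounds {a} k l h h′ = div-unique k (a ∸ k * l) l (sym (m+[n∸m]≡n h))
    (+-cancelˡ-< (k * l) (a ∸ k * l) l (subst₂ _<_ (sym (m+[n∸m]≡n h)) (+-comm l (k * l)) h′))

  div-+* : ∀ a k l .{{_ : NonZero l}} → (a + k * l) / l ≡ a / l + k
  div-+* a k l = trans (+-distrib-/-∣ʳ a (n∣m*n k)) (cong (a / l +_) (m*n/n≡m k l))

  div-suc-yes : ∀ a l .{{_ : NonZero l}} → l ∣ suc a → suc a / l ≡ suc (a / l)
  div-suc-yes a l@(suc l-1) (divides (suc k) e) = trans (/-congˡ e) (trans (m*n/n≡m (suc k) l)
    (cong suc (sym (div-unique k l-1 l (suc-injective (trans e (r k l-1))) ≤-refl))))
    where
    r : ∀ k l → suc k * suc l ≡ suc (k * suc l + l)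
    r = solve-∀

  div-suc-no : ∀ a l .{{_ : NonZero l}} → ¬ (l ∣ suc a) → suc a / l ≡ a / l
  div-suc-no a l h = div-unique (a / l) (suc (a % l)) l (trans (cong suc (m≡m%n+[m/n]*n a l)) (+-comm (suc (a % l)) (a / l * l)))
    (≤∧≢⇒< (m%n<n a l) (λ e → h (divides (suc (a / l)) (trans (cong suc (m≡m%n+[m/n]*n a l)) (cong (_+ a / l * l) e)))))

  div-suc : ∀ a l .{{_ : NonZero l}} → suc a / l ≡ a / l + ind l (suc a)
  div-suc a l = go (l ∣? suc a)
    where
    go : Dec (l ∣ suc a) → suc a / l ≡ a / l + ind l (suc a)
    go (yes h) = trans (div-suc-yes a l h) (trans (+-comm 1 (a / l)) (cong (a / l +_) (sym (ind-yes h))))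
    go (no h) = trans (div-suc-no a l h) (trans (sym (+-identityʳ _)) (cong (a / l +_) (sym (ind-no h))))

  ∑L : List ℕ → (ℕ → ℕ) → ℕ
  ∑L [] f = 0
  ∑L (x ∷ xs) f = f x + ∑L xs f

  ∑L-cong : ∀ {xs f g} → All (λ x → f x ≡ g x) xs → ∑L xs f ≡ ∑L xs g
  ∑L-cong [] = refl
  ∑L-cong (e ∷ es) = cong₂ _+_ e (∑L-cong es)

  ∑L-cong′ : ∀ xs {f g} → (∀ x → f x ≡ g x) → ∑L xs f ≡ ∑L xs g
  ∑L-cong′ [] h = refl
  ∑L-cong′ (x ∷ xs) h = cong₂ _+_ (h x) (∑L-cong′ xs h)

  ∑L-mono : ∀ {xs f g} → All (λ x → f x ≤ g x) xs → ∑L xs f ≤ ∑L xs g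
  ∑L-mono [] = z≤n
  ∑L-mono (e ∷ es) = +-mono-≤ e (∑L-mono es)

  ∑L-+ : ∀ xs f g → ∑L xs (λ x → f x + g x) ≡ ∑L xs f + ∑L xs g
  ∑L-+ [] f g = refl
  ∑L-+ (x ∷ xs) f g = trans (cong (f x + g x +_) (∑L-+ xs f g)) (r (f x) (g x) (∑L xs f) (∑L xs g))
    where
    r : ∀ a b c d → a + b + (c + d) ≡ a + c + (b + d)
    r = solve-∀

  ∑L-*ʳ : ∀ xs f c → ∑L xs (λ x → f x * c) ≡ ∑L xs f * c
  ∑L-*ʳ [] f c = refl
  ∑L-*ʳ (x ∷ xs) f c = trans (cong (f x * c +_) (∑L-*ʳ xs f c)) (sym (*-distribʳ-+ c (f x) (∑L xs f)))

  ∑L-const : ∀ xs c → ∑L xs (λ _ → c) ≡ ∑L xs (λ _ → 1) * c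
  ∑L-const xs c = trans (∑L-cong′ xs (λ _ → sym (*-identityˡ c))) (∑L-*ʳ xs (λ _ → 1) c)

  -- The common denominator contains [im]! for i in up and its inverse for i in down. The intervals
  -- [hm, (16 - h)m] with h in offsets are those of the poles and one more copy of [0, 16m].
  up down offsets : List ℕ
  up = 1 ∷ 9 ∷ 10 ∷ 10 ∷ 11 ∷ 12 ∷ 12 ∷ 13 ∷ 13 ∷ 14 ∷ 15 ∷ 15 ∷ 16 ∷ []
  down = 2 ∷ 3 ∷ 3 ∷ 4 ∷ 4 ∷ 5 ∷ 5 ∷ 5 ∷ 6 ∷ 6 ∷ 6 ∷ 7 ∷ 7 ∷ 7 ∷ []
  offsets = 0 ∷ 0 ∷ 1 ∷ 1 ∷ 2 ∷ 2 ∷ 3 ∷ 3 ∷ 4 ∷ 4 ∷ 5 ∷ []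

  -- Here `fl` k and `ce` k are floor and ceiling of k m / l. The interval [hm, (16 - h)m] contains
  -- fl (16 - h - a) + 1 + fl (a - h) - ce (h - a) integers congruent to a m modulo l; the 11 counts
  -- the ones of the 11 intervals. The term fl 56 bounds from below the zeros of the numerator
  -- together with the interval [0, 16m].
  lhs rhs : ℕ → (ℕ → ℕ) → (ℕ → ℕ) → ℕ
  lhs a fl ce = ∑L offsets (λ h → fl (16 ∸ h ∸ a)) + 11 + ∑L down fl + ∑L offsets (λ h → fl (a ∸ h))
  rhs a fl ce = ∑L up fl + fl 56 + ∑L offsets (λ h → ce (h ∸ a))

  -- Adding l to m increases the right-hand side by 11 more than the left-hand side, so for
  -- m ≥ l it is enough that the inequality for m mod l fails by at most 11.
  okAt : (ℕ → ℕ) → (ℕ → ℕ) → ℕ → Bool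
  okAt fl ce a = (∑L down fl ≤ᵇ ∑L up fl) ∧ ((lhs a fl ce ≤ᵇ rhs a fl ce + 11) ∧ ((lhs a fl ce ≤ᵇ rhs a fl ce) ∨ (fl (16 ∸ a) + fl a ≤ᵇ 0)))

  ok : (ℕ → ℕ) → (ℕ → ℕ) → Bool
  ok fl ce = okAt fl ce 0 ∧ okAt fl ce 1 ∧ okAt fl ce 2 ∧ okAt fl ce 3 ∧ okAt fl ce 4 ∧ okAt fl ce 5

  ok-at : ∀ fl ce → T (ok fl ce) → ∀ a → a ≤ 5 → T (okAt fl ce a)
  ok-at fl ce t 0 _ = proj₁ (Equivalence.to T-∧ t)
  ok-at fl ce t 1 _ = proj₁ (Equivalence.to T-∧ (proj₂ (Equivalence.to (T-∧ {okAt fl ce 0}) t)))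
  ok-at fl ce t 2 _ = proj₁ (Equivalence.to T-∧ (proj₂ (Equivalence.to (T-∧ {okAt fl ce 1}) (proj₂ (Equivalence.to (T-∧ {okAt fl ce 0}) t)))))
  ok-at fl ce t 3 _ = proj₁ (Equivalence.to T-∧ (proj₂ (Equivalence.to (T-∧ {okAt fl ce 2}) (proj₂ (Equivalence.to (T-∧ {okAt fl ce 1}) (proj₂ (Equivalence.to (T-∧ {okAt fl ce 0}) t)))))))
  ok-at fl ce t 4 _ = proj₁ (Equivalence.to T-∧ (proj₂ (Equivalence.to (T-∧ {okAt fl ce 3}) (proj₂ (Equivalence.to (T-∧ {okAt fl ce 2}) (proj₂ (Equivalence.to (T-∧ {okAt fl ce 1}) (proj₂ (Equivalence.to (T-∧ {okAt fl ce 0}) t)))))))))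
  ok-at fl ce t 5 _ = proj₂ (Equivalence.to (T-∧ {okAt fl ce 4}) (proj₂ (Equivalence.to (T-∧ {okAt fl ce 3}) (proj₂ (Equivalence.to (T-∧ {okAt fl ce 2}) (proj₂ (Equivalence.to (T-∧ {okAt fl ce 1}) (proj₂ (Equivalence.to (T-∧ {okAt fl ce 0}) t)))))))))
  ok-at fl ce t (suc (suc (suc (suc (suc (suc a)))))) (s≤s (s≤s (s≤s (s≤s (s≤s ())))))

  -- A fraction is given by its numerator and the predecessor of its denominator.
  -- On the point A/B and on the open interval from A/B to the next fraction the
  -- floors and ceilings of kX take the following values.

  flAt : ℕ → ℕ → ℕ → ℕ
  flAt A B k = k * A / suc B

  ceAt ceAfter : ℕ → ℕ → ℕ → ℕ
  ceAt A B k = (k * A + B) / suc B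
  ceAfter A B zero = 0
  ceAfter A B (suc k) = suc (flAt A B (suc k))

  -- The next jump of the floor of kX does not come before A′ / (B′ + 1), so the floor is constant
  -- from A / (B + 1) up to that point.
  stable : ℕ → ℕ → ℕ → ℕ → ℕ → Bool
  stable A B A′ B′ k = k * A′ ≤ᵇ suc (flAt A B k) * suc B′

  allᵇ : ℕ → (ℕ → Bool) → Bool
  allᵇ zero f = true
  allᵇ (suc n) f = f n ∧ allᵇ n f

  allᵇ-sound : ∀ n f → T (allᵇ n f) → ∀ k → k < n → T (f k)
  allᵇ-sound (suc n) f t k k<n = go (k ≟ n)
    where
    go : Dec (k ≡ n) → T (f k)
    go (yes refl) = proj₁ (Equivalence.to T-∧ t)
    go (no k≢n) = allᵇ-sound n f (proj₂ (Equivalence.to (T-∧ {f n}) t)) k (≤∧≢⇒< (≤-pred k<n) k≢n)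

  checkCells : ℕ → ℕ → List (ℕ × ℕ) → Bool
  -- The last fraction must be at least 1, so that the search for a number below 1 cannot run off
  -- the list.
  checkCells A B [] = suc B ≤ᵇ A
  checkCells A B ((A′ , B′) ∷ cs) = ok (flAt A B) (ceAt A B) ∧ (ok (flAt A B) (ceAfter A B) ∧ (stable A B A′ B′ 56 ∧ (allᵇ 17 (stable A B A′ B′) ∧ checkCells A′ B′ cs)))

  -- The fractions in (0, 1] with denominator 56 or at most 16.
  cells : List (ℕ × ℕ)
  cells =
    (1 , 55) ∷ (1 , 27) ∷ (3 , 55) ∷ (1 , 15) ∷ (1 , 14) ∷ (1 , 13) ∷ (1 , 12) ∷ (1 , 11) ∷ (5 , 55) ∷ (1 , 10) ∷ (1 , 9) ∷ (3 , 27) ∷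
    (1 , 8) ∷ (1 , 7) ∷ (2 , 14) ∷ (1 , 6) ∷ (2 , 12) ∷ (9 , 55) ∷ (1 , 5) ∷ (5 , 27) ∷ (2 , 10) ∷ (3 , 15) ∷ (11 , 55) ∷ (1 , 4) ∷
    (3 , 13) ∷ (2 , 8) ∷ (3 , 12) ∷ (13 , 55) ∷ (1 , 3) ∷ (4 , 14) ∷ (15 , 55) ∷ (3 , 10) ∷ (2 , 6) ∷ (3 , 9) ∷ (17 , 55) ∷ (4 , 12) ∷
    (5 , 15) ∷ (9 , 27) ∷ (1 , 2) ∷ (19 , 55) ∷ (5 , 13) ∷ (4 , 10) ∷ (3 , 7) ∷ (5 , 12) ∷ (11 , 27) ∷ (2 , 4) ∷ (23 , 55) ∷ (5 , 11) ∷
    (3 , 6) ∷ (7 , 15) ∷ (4 , 8) ∷ (25 , 55) ∷ (5 , 10) ∷ (6 , 12) ∷ (13 , 27) ∷ (7 , 14) ∷ (27 , 55) ∷ (1 , 1) ∷ (29 , 55) ∷ (8 , 14) ∷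
    (15 , 27) ∷ (7 , 12) ∷ (6 , 10) ∷ (31 , 55) ∷ (5 , 8) ∷ (9 , 15) ∷ (4 , 6) ∷ (7 , 11) ∷ (33 , 55) ∷ (3 , 4) ∷ (17 , 27) ∷ (8 , 12) ∷
    (5 , 7) ∷ (7 , 10) ∷ (9 , 13) ∷ (37 , 55) ∷ (2 , 2) ∷ (19 , 27) ∷ (11 , 15) ∷ (9 , 12) ∷ (39 , 55) ∷ (7 , 9) ∷ (5 , 6) ∷ (8 , 10) ∷
    (41 , 55) ∷ (11 , 14) ∷ (3 , 3) ∷ (43 , 55) ∷ (10 , 12) ∷ (7 , 8) ∷ (11 , 13) ∷ (4 , 4) ∷ (45 , 55) ∷ (13 , 15) ∷ (9 , 10) ∷ (23 , 27) ∷
    (5 , 5) ∷ (47 , 55) ∷ (11 , 12) ∷ (6 , 6) ∷ (13 , 14) ∷ (7 , 7) ∷ (8 , 8) ∷ (25 , 27) ∷ (9 , 9) ∷ (10 , 10) ∷ (51 , 55) ∷ (11 , 11) ∷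
    (12 , 12) ∷ (13 , 13) ∷ (14 , 14) ∷ (15 , 15) ∷ (53 , 55) ∷ (27 , 27) ∷ (55 , 55) ∷ (1 , 0) ∷ []

  -- The whole case distinction is one closed Boolean, decided by evaluation.
  cells-checked : T (checkCells 0 0 cells)
  cells-checked = tt

  record Concl (fl ce : ℕ → ℕ) (a : ℕ) : Set where
    constructor concl
    field
      nonneg : ∑L down fl ≤ ∑L up fl
      weak : lhs a fl ce ≤ rhs a fl ce + 11
      strong : lhs a fl ce ≤ rhs a fl ce ⊎ fl (16 ∸ a) + fl a ≡ 0

  okAt-sound : ∀ fl ce a → T (okAt fl ce a) → Concl fl ce a
  okAt-sound fl ce a t₀ = concl (≤ᵇ⇒≤ (∑L down fl) _ (proj₁ (Equivalence.to T-∧ t₀))) (≤ᵇ⇒≤ (lhs a fl ce) _ (proj₁ (Equivalence.to T-∧ t)))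
      (go (lhs a fl ce ≤ᵇ rhs a fl ce) refl (proj₂ (Equivalence.to (T-∧ {lhs a fl ce ≤ᵇ rhs a fl ce + 11}) t)))
    where
    t = proj₂ (Equivalence.to (T-∧ {∑L down fl ≤ᵇ ∑L up fl}) t₀)
    go : ∀ b → (lhs a fl ce ≤ᵇ rhs a fl ce) ≡ b → T (b ∨ (fl (16 ∸ a) + fl a ≤ᵇ 0)) → lhs a fl ce ≤ rhs a fl ce ⊎ fl (16 ∸ a) + fl a ≡ 0
    go true e _ = inj₁ (≤ᵇ⇒≤ (lhs a fl ce) _ (subst T (sym e) tt))
    go false e t′ = inj₂ (n≤0⇒n≡0 (≤ᵇ⇒≤ (fl (16 ∸ a) + fl a) 0 t′))

  record Agree (fl fl′ ce ce′ : ℕ → ℕ) : Set where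
    field
      fl-small : ∀ k → k ≤ 16 → fl k ≡ fl′ k
      fl-56 : fl 56 ≡ fl′ 56
      ce-small : ∀ k → k ≤ 16 → ce k ≡ ce′ k

  down-small : All (_≤ 16) down
  down-small = from-yes (all? (_≤? 16) down)

  up-small : All (_≤ 16) up
  up-small = from-yes (all? (_≤? 16) up)

  offsets-small : All (_≤ 5) offsets
  offsets-small = from-yes (all? (_≤? 5) offsets)

  mapAll : ∀ {P Q : ℕ → Set} {xs} → (∀ x → P x → Q x) → All P xs → All Q xs
  mapAll f [] = []
  mapAll f (px ∷ pxs) = f _ px ∷ mapAll f pxs

  transport : ∀ {fl fl′ ce ce′ a} → a ≤ 5 → Agree fl fl′ ce ce′ → Concl fl ce a → Concl fl′ ce′ a
  transport {fl} {fl′} {ce} {ce′} {a} a≤5 ag (concl z w s) = concl (subst₂ _≤_ (∑L-cong (mapAll fl-small down-small)) (∑L-cong (mapAll fl-small up-small)) z) (subst₂ (λ x y → x ≤ y + 11) L R w) (go s)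
    where
    open Agree ag
    L : lhs a fl ce ≡ lhs a fl′ ce′
    L = cong₂ _+_ (cong₂ _+_ (cong (_+ 11) (∑L-cong′ offsets (λ h → fl-small (16 ∸ h ∸ a) (≤-trans (m∸n≤m (16 ∸ h) a) (m∸n≤m 16 h)))))
        (∑L-cong (mapAll fl-small down-small)))
      (∑L-cong′ offsets (λ h → fl-small (a ∸ h) (≤-trans (m∸n≤m a h) (≤-trans a≤5 (m≤m+n 5 11)))))
    R : rhs a fl ce ≡ rhs a fl′ ce′
    R = cong₂ _+_ (cong₂ _+_ (∑L-cong (mapAll fl-small up-small)) fl-56)
      (∑L-cong (mapAll (λ h h≤5 → ce-small (h ∸ a) (≤-trans (m∸n≤m h a) (≤-trans h≤5 (m≤m+n 5 11)))) offsets-small))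
    go : lhs a fl ce ≤ rhs a fl ce ⊎ fl (16 ∸ a) + fl a ≡ 0 → lhs a fl′ ce′ ≤ rhs a fl′ ce′ ⊎ fl′ (16 ∸ a) + fl′ a ≡ 0
    go (inj₁ h) = inj₁ (subst₂ _≤_ L R h)
    go (inj₂ e) = inj₂ (trans (cong₂ _+_ (sym (fl-small (16 ∸ a) (m∸n≤m 16 a))) (sym (fl-small a (≤-trans a≤5 (m≤m+n 5 11))))) e)

  module Search (l-1 ρ : ℕ) (ρ<l : ρ < suc l-1) where
    l = suc l-1

    fl ce : ℕ → ℕ
    fl k = k * ρ / l
    ce k = (k * ρ + l-1) / l

    ce-bounds : ∀ k z → k * ρ ≤ z * l → z * l < k * ρ + l → ce k ≡ z
    ce-bounds k z h h′ = div-bounds z l (≤-pred (subst (z * l <_) (+-suc (k * ρ) l-1) h′))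
      (s≤s (subst (k * ρ + l-1 ≤_) (+-comm (z * l) l-1) (+-monoˡ-≤ l-1 h)))

    private
      r₁ : ∀ x y z → x * y * z ≡ x * z * y
      r₁ = solve-∀
      r₂ : ∀ x y z → x * (y * z) ≡ x * y * z
      r₂ = solve-∀

    at-point : ∀ A B → A * l ≡ ρ * suc B → Agree (flAt A B) fl (ceAt A B) ce
    at-point A B e = record { fl-small = λ k _ → fe k ; fl-56 = fe 56 ; ce-small = λ k _ → cee k }
      where
      scale : ∀ k → k * A * l ≡ k * ρ * suc B
      scale k = trans (sym (r₂ k A l)) (trans (cong (k *_) e) (r₂ k ρ (suc B)))
      fe : ∀ k → flAt A B k ≡ fl k
      fe k = trans (sym (m*n/o*n≡m/o (k * A) l (suc B))) (trans (/-congˡ {o = suc B * l} (scale k))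
        (trans (/-congʳ {n = suc B * l} {o = l * suc B} {m = k * ρ * suc B} (*-comm (suc B) l)) (m*n/o*n≡m/o (k * ρ) (suc B) l)))
      cee : ∀ k → ceAt A B k ≡ ce k
      cee k = sym (ce-bounds k z (*-cancelʳ-≤ (k * ρ) (z * l) (suc B) (subst₂ _≤_ (scale k) (r₁ z (suc B) l) (*-monoˡ-≤ l h₁)))
          (*-cancelʳ-< (suc B) (z * l) (k * ρ + l) (subst₂ _<_ (r₁ z (suc B) l) (trans (*-distribʳ-+ l (k * A) (suc B)) (trans (cong (_+ suc B * l) (scale k)) (trans (cong (k * ρ * suc B +_) (*-comm (suc B) l)) (sym (*-distribʳ-+ (suc B) (k * ρ) l))))) (*-monoˡ-< l h₂))))
        where
        z = ceAt A B k
        h₂ : z * suc B < k * A + suc B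
        h₂ = subst (z * suc B <_) (sym (+-suc (k * A) B)) (s≤s (m/n*n≤m (k * A + B) (suc B)))
        h₁ : k * A ≤ z * suc B
        h₁ = +-cancelʳ-≤ B (k * A) (z * suc B) (subst₂ _≤_ (sym (m≡m%n+[m/n]*n (k * A + B) (suc B))) (+-comm B (z * suc B)) (+-monoˡ-≤ (z * suc B) (≤-pred (m%n<n (k * A + B) (suc B)))))

    -- Strictly between two neighbouring fractions kX is never an integer for k ≥ 1, so its ceiling
    -- is its floor plus 1. Only k ≤ 16 and k = 56 are compared, the values that enter the
    -- inequality.
    after : ∀ A B A′ B′ → A * l < ρ * suc B → ρ * suc B′ < A′ * l → T (stable A B A′ B′ 56) → T (allᵇ 17 (stable A B A′ B′)) →
      Agree (flAt A B) fl (ceAfter A B) ce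
    after A B A′ B′ lo hi s56 s = record
        { fl-small = λ k k≤ → sym (fe k (st k k≤)) ; fl-56 = sym (fe 56 (≤ᵇ⇒≤ (56 * A′) _ s56)) ; ce-small = λ k k≤ → sym (cee k (st k k≤)) }
      where
      st : ∀ k → k ≤ 16 → k * A′ ≤ suc (flAt A B k) * suc B′
      st k k≤ = ≤ᵇ⇒≤ (k * A′) _ (allᵇ-sound 17 (stable A B A′ B′) s k (s≤s k≤))
      up′ : ∀ k → k * A′ ≤ suc (flAt A B k) * suc B′ → k * ρ < suc (flAt A B k) * l
      up′ zero _ = s≤s z≤n
      up′ (suc k) h = *-cancelʳ-< (suc B′) (suc k * ρ) (suc f * l) (<-≤-trans
          (subst₂ _<_ (r₂ (suc k) ρ (suc B′)) (r₂ (suc k) A′ l) (*-monoʳ-< (suc k) hi))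
          (subst (suc k * A′ * l ≤_) (r₁ (suc f) (suc B′) l) (*-monoˡ-≤ l h)))
        where f = flAt A B (suc k)
      fe : ∀ k → k * A′ ≤ suc (flAt A B k) * suc B′ → fl k ≡ flAt A B k
      fe k h = div-bounds f l (*-cancelʳ-≤ (f * l) (k * ρ) (suc B) (≤-trans (subst (_≤ k * A * l) (r₁ f (suc B) l) (*-monoˡ-≤ l (m/n*n≤m (k * A) (suc B))))
          (subst₂ _≤_ (r₂ k A l) (r₂ k ρ (suc B)) (*-monoʳ-≤ k (<⇒≤ lo))))) (up′ k h)
        where f = flAt A B k
      cee : ∀ k → k * A′ ≤ suc (flAt A B k) * suc B′ → ce k ≡ ceAfter A B k
      cee zero h = m<n⇒m/n≡0 {l-1} {l} ≤-refl
      cee (suc k) h = ce-bounds (suc k) (suc f) (<⇒≤ (up′ (suc k) h)) (subst (suc f * l <_) (+-comm l (suc k * ρ)) (+-monoʳ-< l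
          (*-cancelʳ-< (suc B) (f * l) (suc k * ρ) (≤-<-trans (subst (_≤ suc k * A * l) (r₁ f (suc B) l) (*-monoˡ-≤ l (m/n*n≤m (suc k * A) (suc B))))
            (subst₂ _<_ (r₂ (suc k) A l) (r₂ (suc k) ρ (suc B)) (*-monoʳ-< (suc k) lo))))))
        where f = flAt A B (suc k)

    -- Moves right until the next fraction exceeds ρ / l; then ρ / l is the current fraction or lies
    -- in the open interval after it.
    search : ∀ A B cs → T (checkCells A B cs) → A * l ≤ ρ * suc B → ∀ a → a ≤ 5 → Concl fl ce a
    search A B [] t h a a≤5 = ⊥-elim (<⇒≱ (*-monoʳ-< (suc B) ρ<l) (≤-trans (*-monoˡ-≤ l (≤ᵇ⇒≤ (suc B) A t)) (subst (A * l ≤_) (*-comm ρ (suc B)) h)))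
    search A B ((A′ , B′) ∷ cs) t h a a≤5 = go (ρ * suc B′ <? A′ * l) (A * l ≟ ρ * suc B)
      where
      t₁ = proj₂ (Equivalence.to (T-∧ {ok (flAt A B) (ceAt A B)}) t)
      t₂ = proj₂ (Equivalence.to (T-∧ {ok (flAt A B) (ceAfter A B)}) t₁)
      t₃ = proj₂ (Equivalence.to (T-∧ {stable A B A′ B′ 56}) t₂)
      t₄ = proj₂ (Equivalence.to (T-∧ {allᵇ 17 (stable A B A′ B′)}) t₃)
      go : Dec (ρ * suc B′ < A′ * l) → Dec (A * l ≡ ρ * suc B) → Concl fl ce a
      go (no ¬lt) _ = search A′ B′ cs t₄ (≮⇒≥ ¬lt) a a≤5
      go (yes lt) (yes e) = transport a≤5 (at-point A B e) (okAt-sound (flAt A B) (ceAt A B) a (ok-at (flAt A B) (ceAt A B) (proj₁ (Equivalence.to (T-∧ {ok (flAt A B) (ceAt A B)}) t)) a a≤5))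
      go (yes lt) (no ne) = transport a≤5 (after A B A′ B′ (≤∧≢⇒< h ne) lt (proj₁ (Equivalence.to (T-∧ {stable A B A′ B′ 56}) t₂)) (proj₁ (Equivalence.to (T-∧ {allᵇ 17 (stable A B A′ B′)}) t₃)))
        (okAt-sound (flAt A B) (ceAfter A B) a (ok-at (flAt A B) (ceAfter A B) (proj₁ (Equivalence.to (T-∧ {ok (flAt A B) (ceAfter A B)}) t₁)) a a≤5))

    conclusion : ∀ a → a ≤ 5 → Concl fl ce a
    conclusion = search 0 0 cells cells-checked z≤n

  module KeyInequality (m l-1 : ℕ) where
    l = suc l-1
    m₁ = m / l
    ρ = m % l
    n = 16 * m

    open Search l-1 ρ (m%n<n m l) using (fl; ce; conclusion)

    flm cem : ℕ → ℕ
    flm k = k * m / l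
    cem k = (k * m + l-1) / l

    private
      km : ∀ k → k * m ≡ k * ρ + (k * m₁) * l
      km k = trans (cong (k *_) (m≡m%n+[m/n]*n m l)) (r k ρ m₁ l)
        where
        r : ∀ k a b c → k * (a + b * c) ≡ k * a + (k * b) * c
        r = solve-∀

      flm≡ : ∀ k → flm k ≡ fl k + k * m₁
      flm≡ k = trans (/-congˡ (km k)) (div-+* (k * ρ) (k * m₁) l)

      cem≡ : ∀ k → cem k ≡ ce k + k * m₁
      cem≡ k = trans (/-congˡ {o = l} (trans (cong (_+ l-1) (km k)) (r (k * ρ) (k * m₁ * l) l-1))) (div-+* (k * ρ + l-1) (k * m₁) l)
        where
        r : ∀ a b c → a + b + c ≡ a + c + b
        r = solve-∀

      slopeL slopeR : ℕ → ℕ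
      slopeL a = ∑L offsets (λ h → 16 ∸ h ∸ a) + ∑L down (λ x → x) + ∑L offsets (λ h → a ∸ h)
      slopeR a = ∑L up (λ x → x) + 56 + ∑L offsets (λ h → h ∸ a)

      lin : ∀ xs (g : ℕ → ℕ) {F G : ℕ → ℕ} → (∀ k → F k ≡ G k + k * m₁) → ∑L xs (λ h → F (g h)) ≡ ∑L xs (λ h → G (g h)) + ∑L xs g * m₁
      lin xs g {F} {G} e = trans (∑L-cong′ xs (λ h → e (g h))) (trans (∑L-+ xs (λ h → G (g h)) (λ h → g h * m₁)) (cong (∑L xs (λ h → G (g h)) +_) (∑L-*ʳ xs g m₁)))

      lhs≡ : ∀ a → lhs a flm cem ≡ lhs a fl ce + slopeL a * m₁
      lhs≡ a = trans (cong₂ _+_ (cong₂ _+_ (cong (_+ 11) (lin offsets (λ h → 16 ∸ h ∸ a) flm≡)) (lin down (λ x → x) flm≡)) (lin offsets (λ h → a ∸ h) flm≡))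
        (r (∑L offsets (λ h → fl (16 ∸ h ∸ a))) (∑L offsets (λ h → 16 ∸ h ∸ a)) (∑L down fl) (∑L down (λ x → x)) (∑L offsets (λ h → fl (a ∸ h))) (∑L offsets (λ h → a ∸ h)) m₁)
        where
        r : ∀ a a′ b b′ c c′ m → a + a′ * m + 11 + (b + b′ * m) + (c + c′ * m) ≡ a + 11 + b + c + (a′ + b′ + c′) * m
        r = solve-∀

      rhs≡ : ∀ a → rhs a flm cem ≡ rhs a fl ce + slopeR a * m₁
      rhs≡ a = trans (cong₂ _+_ (cong₂ _+_ (lin up (λ x → x) flm≡) (flm≡ 56)) (lin offsets (λ h → h ∸ a) cem≡))
        (r (∑L up fl) (∑L up (λ x → x)) (fl 56) (∑L offsets (λ h → ce (h ∸ a))) (∑L offsets (λ h → h ∸ a)) m₁)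
        where
        r : ∀ a a′ b c c′ m → a + a′ * m + (b + 56 * m) + (c + c′ * m) ≡ a + b + c + (a′ + 56 + c′) * m
        r = solve-∀

      slopes : ∀ a → a ≤ 5 → slopeR a ≡ slopeL a + 11
      slopes 0 _ = refl
      slopes 1 _ = refl
      slopes 2 _ = refl
      slopes 3 _ = refl
      slopes 4 _ = refl
      slopes 5 _ = refl
      slopes (suc (suc (suc (suc (suc (suc a)))))) (s≤s (s≤s (s≤s (s≤s (s≤s ())))))

      -- With m = ρ + m₁ l the right-hand side gains 11 m₁ on the left. For m₁ ≥ 1 this repairs a
      -- failure by at most 11. For m₁ = 0 nothing is gained, and the hypothesis excludes the
      -- exceptional alternative of `strong`.
      at-breakpoint : ∀ a → a ≤ 5 → flm (16 ∸ a) + flm a ≢ 0 → lhs a flm cem ≤ rhs a flm cem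
      at-breakpoint a a≤5 v = subst₂ _≤_ (sym (lhs≡ a)) (sym (rhs≡ a)) (go m₁ refl (conclusion a a≤5))
        where
        go : ∀ k → m₁ ≡ k → Concl fl ce a → lhs a fl ce + slopeL a * m₁ ≤ rhs a fl ce + slopeR a * m₁
        go zero e (concl _ w (inj₁ s)) = +-mono-≤ s (≤-reflexive (trans (cong (slopeL a *_) e) (trans (*-zeroʳ (slopeL a)) (sym (trans (cong (slopeR a *_) e) (*-zeroʳ (slopeR a)))))))
        go zero e (concl _ w (inj₂ z)) = ⊥-elim (v (trans (cong₂ _+_ (lem (16 ∸ a)) (lem a)) z))
          where
          lem : ∀ k → flm k ≡ fl k
          lem k = trans (flm≡ k) (trans (cong (λ x → fl k + k * x) e) (trans (cong (fl k +_) (*-zeroʳ k)) (+-identityʳ _)))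
        go (suc k) e (concl _ w s) = ≤-trans (+-monoˡ-≤ (slopeL a * m₁) w) (≤-trans (≤-reflexive (r (rhs a fl ce) 11 (slopeL a * m₁)))
            (+-monoʳ-≤ (rhs a fl ce) (≤-trans (+-monoʳ-≤ (slopeL a * m₁) 11≤) (≤-reflexive (trans (sym (*-distribʳ-+ m₁ (slopeL a) 11)) (cong (_* m₁) (sym (slopes a a≤5))))))))
          where
          r : ∀ a b c → a + b + c ≡ a + (c + b)
          r = solve-∀
          11≤ : 11 ≤ 11 * m₁
          11≤ = subst (λ x → 11 ≤ 11 * x) (sym e) (m≤m*n 11 (suc k))

      -- x ↦ (x + c) / l counts, up to a constant, the integers below x in a fixed residue class;
      -- the class of t corresponds to c ≡ - 1 - t.
      Ineq : ℕ → Set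
      Ineq c = ∑L offsets (λ h → ((16 ∸ h) * m + suc c) / l) + ∑L down flm ≤ ∑L up flm + flm 56 + ∑L offsets (λ h → (h * m + c) / l)

      -- If the residue class is that of a m, each quotient is a floor or ceiling of a multiple of m
      -- / l, shifted by the common integer Z. The 11 shifts cancel, leaving `lhs` and `rhs`.
      breakpoint : ∀ c a Z → a ≤ 5 → suc c + a * m ≡ Z * l → flm (16 ∸ a) + flm a ≢ 0 → Ineq c
      breakpoint c a Z a≤5 e v = +-cancelʳ-≤ (11 + ∑L offsets (λ h → flm (a ∸ h))) _ _
        (subst₂ _≤_ (sym eqL) (sym eqR) (+-monoˡ-≤ (11 * Z) (at-breakpoint a a≤5 v)))
        where
        topEq : ∀ h → h ≤ 5 → ((16 ∸ h) * m + suc c) / l ≡ flm (16 ∸ h ∸ a) + Z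
        topEq h h≤5 = trans (/-congˡ {o = l} y≡) (div-+* ((16 ∸ h ∸ a) * m) Z l)
          where
          a≤ : a ≤ 16 ∸ h
          a≤ = ≤-trans a≤5 (≤-trans (m≤m+n 5 6) (∸-monoʳ-≤ 16 h≤5))
          r : ∀ x a m c → (x + a) * m + c ≡ x * m + (c + a * m)
          r = solve-∀
          y≡ : (16 ∸ h) * m + suc c ≡ (16 ∸ h ∸ a) * m + Z * l
          y≡ = trans (cong (λ x → x * m + suc c) (sym (m∸n+n≡m a≤))) (trans (r (16 ∸ h ∸ a) a m (suc c)) (cong ((16 ∸ h ∸ a) * m +_) e))
        botEq : ∀ h → (h * m + c) / l + 1 + flm (a ∸ h) ≡ cem (h ∸ a) + Z
        botEq h = go (≤-total a h)
          where
          0/ : flm 0 ≡ 0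
          0/ = m<n⇒m/n≡0 {0} {l} (s≤s z≤n)
          go : a ≤ h ⊎ h ≤ a → _
          go (inj₁ a≤h) = trans (cong₂ (λ x y → x + flm y) (sym (div-+* (h * m + c) 1 l)) (m≤n⇒m∸n≡0 a≤h))
              (trans (cong ((h * m + c + 1 * l) / l +_) 0/) (trans (+-identityʳ _) (trans (/-congˡ {o = l} y≡) (div-+* ((h ∸ a) * m + l-1) Z l))))
            where
            r₁ : ∀ x a m c L → (x + a) * m + c + 1 * suc L ≡ x * m + L + (suc c + a * m)
            r₁ = solve-∀
            y≡ : h * m + c + 1 * l ≡ (h ∸ a) * m + l-1 + Z * l
            y≡ = trans (cong (λ x → x * m + c + 1 * l) (sym (m∸n+n≡m a≤h))) (trans (r₁ (h ∸ a) a m c l-1) (cong ((h ∸ a) * m + l-1 +_) e))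
          go (inj₂ h≤a) = trans (r₂ ((h * m + c) / l) F) (trans (sym (div-+* (h * m + c) (1 + F) l)) (trans (/-congˡ {o = l} y≡)
              (trans (div-+* (l-1 ∸ R) Z l) (cong (_+ Z) (trans (m<n⇒m/n≡0 {l-1 ∸ R} {l} (s≤s (m∸n≤m l-1 R))) (sym (trans (cong cem (m≤n⇒m∸n≡0 h≤a)) (m<n⇒m/n≡0 {l-1} {l} ≤-refl))))))))
            where
            d = a ∸ h
            F = flm d
            R = d * m % l
            r₂ : ∀ x f → x + 1 + f ≡ x + (1 + f)
            r₂ = solve-∀
            R≤ : R ≤ l-1
            R≤ = ≤-pred (m%n<n (d * m) l)
            r₃ : ∀ x f c y L s R → suc (x + c + ((f * suc L) + (s + R))) ≡ suc (x + c + (R + f * suc L) + s)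
            r₃ = solve-∀
            r₄ : ∀ h d m c s → suc (h * m + c + d * m + s) ≡ s + (suc c + (h + d) * m)
            r₄ = solve-∀
            r₅ : ∀ x f L → x + (1 + f) * suc L ≡ suc (x + (f * suc L + L))
            r₅ = solve-∀
            y≡ : h * m + c + (1 + F) * l ≡ (l-1 ∸ R) + Z * l
            y≡ = trans (r₅ (h * m + c) F l-1) (trans (cong (λ z → suc (h * m + c + (F * l + z))) (sym (m∸n+n≡m R≤)))
              (trans (r₃ (h * m) F c 0 l-1 (l-1 ∸ R) R) (trans (cong (λ z → suc (h * m + c + z + (l-1 ∸ R))) (sym (m≡m%n+[m/n]*n (d * m) l)))
                (trans (r₄ h d m c (l-1 ∸ R)) (cong ((l-1 ∸ R) +_) (trans (cong (λ z → suc c + z * m) (m+[n∸m]≡n h≤a)) e))))))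
        eqL : ∑L offsets (λ h → ((16 ∸ h) * m + suc c) / l) + ∑L down flm + (11 + ∑L offsets (λ h → flm (a ∸ h))) ≡ lhs a flm cem + 11 * Z
        eqL = trans (cong (λ z → z + ∑L down flm + (11 + ∑L offsets (λ h → flm (a ∸ h))))
            (trans (∑L-cong (mapAll topEq offsets-small)) (trans (∑L-+ offsets (λ h → flm (16 ∸ h ∸ a)) (λ _ → Z)) (cong (∑L offsets (λ h → flm (16 ∸ h ∸ a)) +_) (∑L-const offsets Z)))))
          (r (∑L offsets (λ h → flm (16 ∸ h ∸ a))) Z (∑L down flm) (∑L offsets (λ h → flm (a ∸ h))))
          where
          r : ∀ x z d y → x + 11 * z + d + (11 + y) ≡ x + 11 + d + y + 11 * z
          r = solve-∀
        eqR : ∑L up flm + flm 56 + ∑L offsets (λ h → (h * m + c) / l) + (11 + ∑L offsets (λ h → flm (a ∸ h))) ≡ rhs a flm cem + 11 * Z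
        eqR = trans (r (∑L up flm + flm 56) (∑L offsets (λ h → (h * m + c) / l)) (∑L offsets (λ h → flm (a ∸ h))))
          (trans (cong (∑L up flm + flm 56 +_) (trans (sym (trans (∑L-+ offsets (λ h → (h * m + c) / l + 1) (λ h → flm (a ∸ h))) (cong (_+ ∑L offsets (λ h → flm (a ∸ h))) (∑L-+ offsets (λ h → (h * m + c) / l) (λ _ → 1)))))
            (trans (∑L-cong′ offsets botEq) (trans (∑L-+ offsets (λ h → cem (h ∸ a)) (λ _ → Z)) (cong (∑L offsets (λ h → cem (h ∸ a)) +_) (∑L-const offsets Z))))))
          (sym (+-assoc (∑L up flm + flm 56) _ (11 * Z))))
          where
          r : ∀ x y z → x + y + (11 + z) ≡ x + (y + 11 + z)
          r = solve-∀

      -- A representative of - 1 - t modulo l; the multiple (n + 1) l keeps it in ℕ for all t ≤ n.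
      cOf : ℕ → ℕ
      cOf t = suc n * l ∸ suc t

      cOf-suc : ∀ t → t ≤ n → suc (cOf t) + t ≡ suc n * l
      cOf-suc t t≤n = trans (sym (+-suc (cOf t) t)) (m∸n+n≡m (≤-trans (s≤s t≤n) (m≤m*n (suc n) l)))

      -- If a m < l, the congruence of t and a m modulo l forces a m ≤ t. Then t + l ≤ n leaves room
      -- for l in (16 - a) m, so one of the two floors is positive.
      valid : ∀ t a Z → t + l ≤ n → a ≤ 5 → suc (cOf t) + a * m ≡ Z * l → flm (16 ∸ a) + flm a ≢ 0
      valid t a Z t+l≤n a≤5 e z = <⇒≱ (m/n≡0⇒m<n {(16 ∸ a) * m} {l} (m+n≡0⇒m≡0 (flm (16 ∸ a)) z)) l≤
        where
        am<l : a * m < l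
        am<l = m/n≡0⇒m<n (m+n≡0⇒n≡0 (flm (16 ∸ a)) z)
        eq : Z * l + t ≡ suc n * l + a * m
        eq = trans (cong (_+ t) (sym e)) (trans (r (suc (cOf t)) (a * m) t) (cong (_+ a * m) (cOf-suc t (≤-trans (m≤m+n t l) t+l≤n))))
          where
          r : ∀ x y z → x + y + z ≡ x + z + y
          r = solve-∀
        am≤t : a * m ≤ t
        am≤t = go (<-cmp′ Z (suc n))
          where
          <-cmp′ : ∀ x y → x ≤ y ⊎ suc y ≤ x
          <-cmp′ x y with ≤-total x y
          ... | inj₁ h = inj₁ h
          ... | inj₂ h with x ≟ y
          ...   | yes refl = inj₁ ≤-refl
          ...   | no ne = inj₂ (≤∧≢⇒< h (λ x → ne (sym x)))
          go : Z ≤ suc n ⊎ suc (suc n) ≤ Z → a * m ≤ t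
          go (inj₁ h) = +-cancelˡ-≤ (Z * l) (a * m) t (≤-trans (+-monoˡ-≤ (a * m) (*-monoˡ-≤ l h)) (≤-reflexive (sym eq)))
          go (inj₂ h) = ⊥-elim (<⇒≱ (+-monoʳ-< (suc n * l) am<l) (≤-trans (≤-reflexive (+-comm (suc n * l) l)) (≤-trans (*-monoˡ-≤ l h) (≤-trans (m≤m+n (Z * l) t) (≤-reflexive eq)))))
        l≤ : l ≤ (16 ∸ a) * m
        l≤ = +-cancelˡ-≤ (a * m) l ((16 ∸ a) * m) (≤-trans (+-monoˡ-≤ l am≤t) (≤-trans t+l≤n (≤-reflexive (trans (cong (_* m) (sym (m+[n∸m]≡n (≤-trans a≤5 (m≤m+n 5 11))))) (*-distribʳ-+ m a (16 ∸ a))))))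

      -- Replacing t - 1 by t lowers c by one. The quotients on the left cannot grow; those on the
      -- right drop only if t is congruent to some h m with h ≤ 5. So the inequality is inherited
      -- from t - 1 unless t is such a breakpoint, and t = 0 is one with a = 0.
      allIneq : ∀ t → t + l ≤ n → Ineq (cOf t)
      allIneq zero h = breakpoint (cOf 0) 0 (suc n) z≤n e (valid 0 0 (suc n) h z≤n e)
        where
        e : suc (cOf 0) + 0 * m ≡ suc n * l
        e = cOf-suc 0 z≤n
      allIneq (suc t) h = go (l ∣? s 0) (l ∣? s 1) (l ∣? s 2) (l ∣? s 3) (l ∣? s 4) (l ∣? s 5)
        where
        c = cOf (suc t)
        s : ℕ → ℕ
        s a = suc (c + a * m)
        hit : ∀ a → a ≤ 5 → l ∣ s a → Ineq c
        hit a a≤5 (divides Z e) = breakpoint c a Z a≤5 e (valid (suc t) a Z h a≤5 e)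
        sc≡ : suc c ≡ cOf t
        sc≡ = +-cancelʳ-≡ (suc t) (suc c) (cOf t) (trans (cOf-suc (suc t) (≤-trans (m≤m+n (suc t) l) h)) (sym (trans (+-suc (cOf t) t) (cOf-suc t (≤-trans (n≤1+n t) (≤-trans (m≤m+n (suc t) l) h))))))
        slide : All (λ a → ¬ (l ∣ s a)) offsets → Ineq c
        slide none = ≤-trans (+-monoˡ-≤ (∑L down flm) (∑L-mono (mapAll (λ h _ → /-monoˡ-≤ l (+-monoʳ-≤ ((16 ∸ h) * m) (n≤1+n (suc c)))) offsets-small)))
          (≤-trans (subst Ineq (sym sc≡) (allIneq t (≤-trans (n≤1+n (t + l)) h)))
            (≤-reflexive (cong (∑L up flm + flm 56 +_) (∑L-cong (mapAll (λ a ¬d → trans (/-congˡ {o = l} (+-suc (a * m) c)) (div-suc-no (a * m + c) l (subst (λ x → ¬ (l ∣ suc x)) (+-comm c (a * m)) ¬d))) none)))))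
        go : Dec (l ∣ s 0) → Dec (l ∣ s 1) → Dec (l ∣ s 2) → Dec (l ∣ s 3) → Dec (l ∣ s 4) → Dec (l ∣ s 5) → Ineq c
        go (yes d) _ _ _ _ _ = hit 0 z≤n d
        go _ (yes d) _ _ _ _ = hit 1 (s≤s z≤n) d
        go _ _ (yes d) _ _ _ = hit 2 (s≤s (s≤s z≤n)) d
        go _ _ _ (yes d) _ _ = hit 3 (s≤s (s≤s (s≤s z≤n))) d
        go _ _ _ _ (yes d) _ = hit 4 (s≤s (s≤s (s≤s (s≤s z≤n)))) d
        go _ _ _ _ _ (yes d) = hit 5 ≤-refl d
        go (no a) (no b) (no c) (no d) (no e) (no f) = slide (a ∷ a ∷ b ∷ b ∷ c ∷ c ∷ d ∷ d ∷ e ∷ e ∷ f ∷ [])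

      Ineq-shift : ∀ c → Ineq (c + l) → Ineq c
      Ineq-shift c h = +-cancelʳ-≤ 11 _ _ (subst₂ _≤_ eL eR h)
        where
        shift1 : ∀ x → (x + (c + l)) / l ≡ (x + c) / l + 1
        shift1 x = trans (/-congˡ {o = l} (trans (sym (+-assoc x c l)) (cong (x + c +_) (sym (*-identityˡ l))))) (div-+* (x + c) 1 l)
        eL : ∑L offsets (λ h → ((16 ∸ h) * m + suc (c + l)) / l) + ∑L down flm ≡ ∑L offsets (λ h → ((16 ∸ h) * m + suc c) / l) + ∑L down flm + 11
        eL = trans (cong (_+ ∑L down flm) (trans (∑L-cong′ offsets (λ h → trans (/-congˡ {o = l} (+-suc ((16 ∸ h) * m) (c + l))) (trans (shift1 (suc ((16 ∸ h) * m))) (cong (λ z → z / l + 1) (sym (+-suc ((16 ∸ h) * m) c))))))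
          (∑L-+ offsets (λ h → ((16 ∸ h) * m + suc c) / l) (λ _ → 1)))) (r (∑L offsets (λ h → ((16 ∸ h) * m + suc c) / l)) (∑L down flm))
          where
          r : ∀ x y → x + 11 + y ≡ x + y + 11
          r = solve-∀
        eR : ∑L up flm + flm 56 + ∑L offsets (λ h → (h * m + (c + l)) / l) ≡ ∑L up flm + flm 56 + ∑L offsets (λ h → (h * m + c) / l) + 11
        eR = trans (cong (∑L up flm + flm 56 +_) (trans (∑L-cong′ offsets (λ h → shift1 (h * m))) (∑L-+ offsets (λ h → (h * m + c) / l) (λ _ → 1))))
          (sym (+-assoc (∑L up flm + flm 56) _ 11))

    class : ℕ → ℕ
    class = cOf

    class-spec : ∀ j → j ≤ n → suc (class j) + j ≡ suc n * l
    class-spec = cOf-suc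

    -- The length l fits between j and n or between 0 and j. In the second case j is replaced by j -
    -- l, which lies in the same class and has room on its right.
    key : ∀ j → j ≤ n → l ≤ j ⊔ (n ∸ j) →
      ∑L offsets (λ h → ((16 ∸ h) * m + suc (class j)) / l) + ∑L down flm ≤ ∑L up flm + flm 56 + ∑L offsets (λ h → (h * m + class j) / l)
    key j j≤n h = go (≤-total j (n ∸ j))
      where
      lo : l ≤ n ∸ j → Ineq (cOf j)
      lo l≤ = allIneq j (subst (j + l ≤_) (m+[n∸m]≡n j≤n) (+-monoʳ-≤ j l≤))
      hi : l ≤ j → Ineq (cOf j)
      hi l≤j = Ineq-shift (cOf j) (subst Ineq eq (allIneq (j ∸ l) (subst (_≤ n) (sym (m∸n+n≡m l≤j)) j≤n)))
        where
        r : ∀ c j l → suc c + (j + l) ≡ suc (c + l) + j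
        r = solve-∀
        eq : cOf (j ∸ l) ≡ cOf j + l
        eq = suc-injective (+-cancelʳ-≡ j (suc (cOf (j ∸ l))) (suc (cOf j + l)) (trans (cong (suc (cOf (j ∸ l)) +_) (sym (m∸n+n≡m l≤j)))
          (trans (sym (+-assoc (suc (cOf (j ∸ l))) (j ∸ l) l)) (trans (cong (_+ l) (trans (cOf-suc (j ∸ l) (≤-trans (m∸n≤m j l) j≤n)) (sym (cOf-suc j j≤n)))) (trans (+-assoc (suc (cOf j)) j l) (r (cOf j) j l))))))
      go : j ≤ n ∸ j ⊎ n ∸ j ≤ j → Ineq (cOf j)
      go (inj₁ j≤) = lo (subst (l ≤_) (m≤n⇒m⊔n≡n j≤) h)
      go (inj₂ ≥j) = hi (subst (l ≤_) (m≥n⇒m⊔n≡m ≥j) h)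

    down≤up : ∑L down flm ≤ ∑L up flm
    down≤up = subst₂ _≤_ (sym (lin down (λ x → x) flm≡)) (sym (lin up (λ x → x) flm≡))
      (+-mono-≤ (Concl.nonneg (conclusion 0 z≤n)) (*-monoˡ-≤ m₁ (m≤m+n 70 81)))

  ∑ℕ : ℕ → (ℕ → ℕ) → ℕ
  ∑ℕ zero f = 0
  ∑ℕ (suc n) f = ∑ℕ n f + f n

  ∑ℕ-cong : ∀ n {f g} → (∀ i → i < n → f i ≡ g i) → ∑ℕ n f ≡ ∑ℕ n g
  ∑ℕ-cong zero h = refl
  ∑ℕ-cong (suc n) h = cong₂ _+_ (∑ℕ-cong n (λ i i<n → h i (m<n⇒m<1+n i<n))) (h n ≤-refl)

  ∑ℕ-+ : ∀ n f g → ∑ℕ n (λ i → f i + g i) ≡ ∑ℕ n f + ∑ℕ n g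
  ∑ℕ-+ zero f g = refl
  ∑ℕ-+ (suc n) f g = trans (cong (_+ (f n + g n)) (∑ℕ-+ n f g)) (r (∑ℕ n f) (∑ℕ n g) (f n) (g n))
    where
    r : ∀ a b c d → a + b + (c + d) ≡ a + c + (b + d)
    r = solve-∀

  ∑ℕ-split : ∀ a b f → ∑ℕ (a + b) f ≡ ∑ℕ a f + ∑ℕ b (λ i → f (a + i))
  ∑ℕ-split a zero f = trans (cong (λ c → ∑ℕ c f) (+-identityʳ a)) (sym (+-identityʳ _))
  ∑ℕ-split a (suc b) f = trans (cong (λ c → ∑ℕ c f) (+-suc a b)) (trans (cong (_+ f (a + b)) (∑ℕ-split a b f)) (+-assoc (∑ℕ a f) _ _))

  ∑ℕ-reverse : ∀ n f → ∑ℕ n (λ i → f (n ∸ suc i)) ≡ ∑ℕ n f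
  ∑ℕ-reverse zero f = refl
  ∑ℕ-reverse (suc n) f = trans (∑ℕ-split 1 n (λ i → f (suc n ∸ suc i))) (trans (cong (f n +_) (∑ℕ-reverse n f)) (+-comm (f n) _))

  ∑L-++ : ∀ xs ys f → ∑L (xs ++ ys) f ≡ ∑L xs f + ∑L ys f
  ∑L-++ [] ys f = refl
  ∑L-++ (x ∷ xs) ys f = trans (cong (f x +_) (∑L-++ xs ys f)) (sym (+-assoc (f x) _ _))

  -- The poles, each repeated according to its order: 10 intervals centred at 8m.

  block : ℕ → ℕ → List ℕ
  block c zero = []
  block c (suc L) = (c ∸ suc L) ∷ (c + suc L) ∷ block c L

  intervals : ℕ → List ℕ → List ℕ
  intervals m [] = []
  intervals m (h ∷ hs) = (8 * m ∷ block (8 * m) ((8 ∸ h) * m)) ++ intervals m hs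

  heights : List ℕ
  heights = 0 ∷ 1 ∷ 1 ∷ 2 ∷ 2 ∷ 3 ∷ 3 ∷ 4 ∷ 4 ∷ 5 ∷ []

  poles : ℕ → List ℕ
  poles m = intervals m heights

  /-superadd : ∀ a b l .{{_ : NonZero l}} → a / l + b / l ≤ (a + b) / l
  /-superadd a b l = subst (_≤ (a + b) / l) (m*n/n≡m (a / l + b / l) l)
    (/-monoˡ-≤ l (≤-trans (≤-reflexive (*-distribʳ-+ l (a / l) (b / l))) (+-mono-≤ (m/n*n≤m a l) (m/n*n≤m b l))))

  -- If suc c + j is a multiple of l, then x ↦ (x + c) / l counts the integers congruent to j.
  module Count (l-1 c j K : ℕ) (spec : suc c + j ≡ K * suc l-1) where
    l = suc l-1

    N : ℕ → ℕ
    N x = (x + c) / l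

    ind-class : ∀ x → ind l (suc (x + c)) ≡ ind l ∣ x - j ∣
    ind-class x = go (l ∣? suc (x + c)) (l ∣? ∣ x - j ∣)
      where
      l∣ : l ∣ suc c + j
      l∣ = divides K spec
      split : (∃ λ d → x ≡ j + d × ∣ x - j ∣ ≡ d) ⊎ (∃ λ d → j ≡ x + d × ∣ x - j ∣ ≡ d)
      split with ≤-total j x
      ... | inj₁ h = inj₁ (x ∸ j , sym (m+[n∸m]≡n h) , m≤n⇒∣n-m∣≡n∸m h)
      ... | inj₂ h = inj₂ (j ∸ x , sym (m+[n∸m]≡n h) , m≤n⇒∣m-n∣≡n∸m h)
      r₁ : ∀ j d c → suc (j + d + c) ≡ suc c + j + d
      r₁ = solve-∀
      r₂ : ∀ x d c → suc c + (x + d) ≡ suc (x + c) + d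
      r₂ = solve-∀
      fwd : l ∣ suc (x + c) → l ∣ ∣ x - j ∣
      fwd h with split
      ... | inj₁ (d , e , e′) = subst (l ∣_) (sym e′) (∣m+n∣m⇒∣n (subst (l ∣_) (trans (cong (λ z → suc (z + c)) e) (r₁ j d c)) h) l∣)
      ... | inj₂ (d , e , e′) = subst (l ∣_) (sym e′) (∣m+n∣m⇒∣n (subst (l ∣_) (trans (cong (suc c +_) e) (r₂ x d c)) l∣) h)
      bwd : l ∣ ∣ x - j ∣ → l ∣ suc (x + c)
      bwd h with split
      ... | inj₁ (d , e , e′) = subst (l ∣_) (sym (trans (cong (λ z → suc (z + c)) e) (r₁ j d c))) (∣m∣n⇒∣m+n l∣ (subst (l ∣_) e′ h))
      ... | inj₂ (d , e , e′) = ∣m+n∣m⇒∣n (subst (l ∣_) (trans (trans (cong (suc c +_) e) (r₂ x d c)) (+-comm (suc (x + c)) d)) l∣) (subst (l ∣_) e′ h)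
      go : Dec (l ∣ suc (x + c)) → Dec (l ∣ ∣ x - j ∣) → ind l (suc (x + c)) ≡ ind l ∣ x - j ∣
      go (yes h) _ = trans (ind-yes h) (sym (ind-yes (fwd h)))
      go (no h) (yes h′) = ⊥-elim (h (bwd h′))
      go (no h) (no h′) = trans (ind-no h) (sym (ind-no h′))

    N-suc : ∀ x → N (suc x) ≡ N x + ind l ∣ x - j ∣
    N-suc x = trans (div-suc (x + c) l) (cong (N x +_) (ind-class x))

    count : ∀ x → ∑ℕ x (λ i → ind l ∣ i - j ∣) + N 0 ≡ N x
    count zero = refl
    count (suc x) = trans (r (∑ℕ x (λ i → ind l ∣ i - j ∣)) (ind l ∣ x - j ∣) (N 0)) (trans (cong (_+ ind l ∣ x - j ∣) (count x)) (sym (N-suc x)))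
      where
      r : ∀ a b c → a + b + c ≡ a + c + b
      r = solve-∀

    count-block : ∀ C L → L ≤ C → ∑L (C ∷ block C L) (λ k → ind l ∣ k - j ∣) + N (C ∸ L) ≡ N (C + suc L)
    count-block C zero _ = trans (cong (_+ N C) (+-identityʳ _)) (trans (+-comm _ (N C)) (trans (sym (N-suc C)) (cong N (+-comm 1 C))))
    count-block C (suc L) h = trans (r (f C) (f (C ∸ suc L)) (f (C + suc L)) (∑L (block C L) f) (N (C ∸ suc L)))
        (trans (cong (λ z → f C + ∑L (block C L) f + z + f (C + suc L)) (trans (sym (N-suc (C ∸ suc L))) (cong N (sym (+-∸-assoc 1 h)))))
        (trans (cong (_+ f (C + suc L)) (count-block C L (≤-trans (n≤1+n L) h))) (trans (sym (N-suc (C + suc L))) (cong N (sym (+-suc C (suc L)))))))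
      where
      f : ℕ → ℕ
      f k = ind l ∣ k - j ∣
      r : ∀ a b d s n → a + (b + (d + s)) + n ≡ a + s + (n + b) + d
      r = solve-∀

    -- The count is the difference of two floors, with numerators w + (c + 1) and c; superadditivity
    -- of the floor bounds it below.
    window : ∀ w → w / l ≤ ∑ℕ (suc w) (λ i → ind l ∣ i - j ∣)
    window w = +-cancelʳ-≤ (N 0) _ _ (≤-trans (+-monoʳ-≤ (w / l) (/-monoˡ-≤ l (n≤1+n c))) (≤-trans (/-superadd w (suc c) l)
      (≤-reflexive (trans (/-congˡ {o = l} (+-suc w c)) (sym (count (suc w)))))))

  module PoleCount (m l-1 j : ℕ) (j≤n : j ≤ 16 * m) where
    open KeyInequality m l-1 hiding (l)
    l = suc l-1
    open Count l-1 (class j) j (suc (16 * m)) (class-spec j j≤n) hiding (l)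

    private
      f : ℕ → ℕ
      f k = ind l ∣ k - j ∣

    numCount : ℕ
    numCount = ∑ℕ (20 * m) (λ i → ind l (suc i + j) + ind l (16 * m + suc i ∸ j))

    private
      interval-count : ∀ h → h ≤ 5 → ∑L (8 * m ∷ block (8 * m) ((8 ∸ h) * m)) f + (h * m + class j) / l ≡ ((16 ∸ h) * m + suc (class j)) / l
      interval-count h h≤5 = trans (cong (λ z → ∑L (8 * m ∷ block (8 * m) ((8 ∸ h) * m)) f + N z) bot)
          (trans (count-block (8 * m) ((8 ∸ h) * m) (*-monoˡ-≤ m (m∸n≤m 8 h))) (trans (cong (λ z → (z + class j) / l) top) (/-congˡ {o = l} (sym (+-suc ((16 ∸ h) * m) (class j))))))
        where
        h≤8 : h ≤ 8
        h≤8 = ≤-trans h≤5 (m≤m+n 5 3)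
        bot : h * m ≡ 8 * m ∸ (8 ∸ h) * m
        bot = trans (cong (_* m) (sym (m∸[m∸n]≡n h≤8))) (*-distribʳ-∸ m 8 (8 ∸ h))
        top : 8 * m + suc ((8 ∸ h) * m) ≡ suc ((16 ∸ h) * m)
        top = trans (+-suc (8 * m) _) (cong suc (trans (sym (*-distribʳ-+ m 8 (8 ∸ h))) (cong (_* m) (sym (+-∸-assoc 8 h≤8)))))

      intervals-count : ∀ hs → All (_≤ 5) hs → ∑L (intervals m hs) f + ∑L hs (λ h → (h * m + class j) / l) ≡ ∑L hs (λ h → ((16 ∸ h) * m + suc (class j)) / l)
      intervals-count [] [] = refl
      intervals-count (h ∷ hs) (p ∷ ps) = trans (cong (_+ ((h * m + class j) / l + ∑L hs (λ h → (h * m + class j) / l))) (∑L-++ (8 * m ∷ block (8 * m) ((8 ∸ h) * m)) (intervals m hs) f))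
        (trans (r (∑L (8 * m ∷ block (8 * m) ((8 ∸ h) * m)) f) (∑L (intervals m hs) f) ((h * m + class j) / l) (∑L hs (λ h → (h * m + class j) / l)))
          (cong₂ _+_ (interval-count h p) (intervals-count hs ps)))
        where
        r : ∀ a b c d → a + b + (c + d) ≡ a + c + (b + d)
        r = solve-∀

      full : ℕ
      full = ∑ℕ (suc (16 * m)) f

      full-count : full + (0 * m + class j) / l ≡ ((16 ∸ 0) * m + suc (class j)) / l
      full-count = trans (count (suc (16 * m))) (/-congˡ {o = l} (sym (+-suc (16 * m) (class j))))

      -- Indexing points q^(-k) by k, the numerator vanishes for k from - 20m to - 1 and from 16m +
      -- 1 to 36m. Together with 0, ..., 16m these are 56m + 1 consecutive integers; they are
      -- shifted by 20m to stay in ℕ.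
      56≤ : flm 56 ≤ numCount + full
      56≤ = ≤-trans (window′ (56 * m)) (≤-reflexive (trans (cong (λ z → ∑ℕ z g) (r m)) (trans (∑ℕ-split (20 * m) (suc (16 * m) + 20 * m) g)
          (trans (cong (∑ℕ (20 * m) g +_) (∑ℕ-split (suc (16 * m)) (20 * m) (λ i → g (20 * m + i))))
          (trans (cong₂ _+_ lowEq (cong₂ _+_ midEq highEq)) (trans (r₂ lo full hi) (cong (_+ full) (sym (∑ℕ-+ (20 * m) (λ i → ind l (suc i + j)) (λ i → ind l (16 * m + suc i ∸ j)))))))))))
        where
        j′ = j + 20 * m
        g : ℕ → ℕ
        g i = ind l ∣ i - j′ ∣
        spec′ : suc (class j + 20 * m * l-1) + j′ ≡ (suc (16 * m) + 20 * m) * l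
        spec′ = trans (r₃ (class j) (20 * m) l-1 j) (trans (cong (_+ 20 * m * l) (class-spec j j≤n)) (sym (*-distribʳ-+ l (suc (16 * m)) (20 * m))))
          where
          r₃ : ∀ c k L j → suc (c + k * L) + (j + k) ≡ suc c + j + k * suc L
          r₃ = solve-∀
        open Count l-1 (class j + 20 * m * l-1) j′ (suc (16 * m) + 20 * m) spec′ using () renaming (window to window′)
        r : ∀ m → suc (56 * m) ≡ 20 * m + (suc (16 * m) + 20 * m)
        r = solve-∀
        r₂ : ∀ a b c → a + (b + c) ≡ a + c + b
        r₂ = solve-∀
        lo = ∑ℕ (20 * m) (λ i → ind l (suc i + j))
        hi = ∑ℕ (20 * m) (λ i → ind l (16 * m + suc i ∸ j))
        lowEq : ∑ℕ (20 * m) g ≡ lo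
        lowEq = trans (sym (∑ℕ-reverse (20 * m) g)) (∑ℕ-cong (20 * m) (λ i i< → cong (ind l)
          (trans (m≤n⇒∣m-n∣≡n∸m (≤-trans (m∸n≤m (20 * m) (suc i)) (m≤n+m (20 * m) j)))
            (trans (+-∸-assoc j (m∸n≤m (20 * m) (suc i))) (trans (cong (j +_) (m∸[m∸n]≡n i<)) (+-comm j (suc i)))))))
        midEq : ∑ℕ (suc (16 * m)) (λ i → g (20 * m + i)) ≡ full
        midEq = ∑ℕ-cong (suc (16 * m)) (λ i _ → cong (ind l) (trans (cong (λ z → ∣ 20 * m + i - z ∣) (+-comm j (20 * m))) (∣m+n-m+o∣≡∣n-o∣ (20 * m) i j)))
        highEq : ∑ℕ (20 * m) (λ i → g (20 * m + (suc (16 * m) + i))) ≡ hi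
        highEq = ∑ℕ-cong (20 * m) (λ i _ → cong (ind l) (trans (cong (λ z → ∣ 20 * m + (suc (16 * m) + i) - z ∣) (+-comm j (20 * m)))
          (trans (∣m+n-m+o∣≡∣n-o∣ (20 * m) (suc (16 * m) + i) j) (trans (m≤n⇒∣n-m∣≡n∸m (≤-trans j≤n (≤-trans (n≤1+n _) (m≤m+n (suc (16 * m)) i)))) (cong (_∸ j) (sym (+-suc (16 * m) i)))))))

    -- The exponent balance of one cyclotomic factor at pole j: pole differences and inverse
    -- factorials on the left, factorials and numerator factors on the right. The extra copy of
    -- [0, 16m] in `offsets` cancels against `full`.
    poles-count : l ≤ j ⊔ (16 * m ∸ j) → ∑L (poles m) (λ k → ind l ∣ k - j ∣) + ∑L down (λ i → i * m / l) ≤ ∑L up (λ i → i * m / l) + numCount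
    poles-count l≤ = +-cancelʳ-≤ (full + ∑L offsets bot) _ _ (≤-trans (≤-reflexive eqL) (≤-trans (key j j≤n l≤) (≤-trans (+-monoˡ-≤ (∑L offsets bot) (+-monoʳ-≤ (∑L up flm) 56≤)) (≤-reflexive (r (∑L up flm) numCount full (∑L offsets bot))))))
      where
      bot top : ℕ → ℕ
      bot h = (h * m + class j) / l
      top h = ((16 ∸ h) * m + suc (class j)) / l
      r : ∀ a b c d → a + (b + c) + d ≡ a + b + (c + d)
      r = solve-∀
      r₂ : ∀ a b c d e → a + b + (c + (d + e)) ≡ c + d + (a + e) + b
      r₂ = solve-∀
      eqL : ∑L (poles m) f + ∑L down flm + (full + ∑L offsets bot) ≡ ∑L offsets top + ∑L down flm
      eqL = trans (r₂ (∑L (poles m) f) (∑L down flm) full (bot 0) (∑L heights bot))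
        (cong (_+ ∑L down flm) (cong₂ _+_ full-count (intervals-count heights (from-yes (all? (_≤? 5) heights)))))

    down≤up′ : ∑L down (λ i → i * m / l) ≤ ∑L up (λ i → i * m / l)
    down≤up′ = down≤up

open import Defs
open import Algebra.Bundles using (CommutativeRing)
open import Data.Bool using (if_then_else_)
open import Data.Empty using (⊥-elim)
open import Data.Integer as ℤ using (ℤ; -[1+_])
import Data.Integer.Properties as ℤP
open import Data.List using (List; []; _∷_; _++_; length; map; zip; replicate)
open import Data.List.Properties using (length-++; length-map)
open import Data.List.Relation.Unary.All using (All; []; _∷_)
open import Data.Maybe using (Maybe; just; nothing)
open import Data.Nat as ℕ using (ℕ; zero; suc; z≤n; s≤s)
import Data.Nat.DivMod as ℕD
open import Data.Nat.Divisibility using (_∣?_; divides) renaming (_∣_ to _∣ℕ_)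
import Data.Nat.Properties as ℕP
open import Data.Nat.Tactic.RingSolver using () renaming (solve-∀ to ℕ-solve-∀)
open import Data.Product using (∃; _×_; _,_; proj₁; proj₂)
open import Data.Rational
open import Data.Rational.Properties
import Data.Rational.Unnormalised as ℚᵘ
import Data.Rational.Unnormalised.Properties as ℚᵘP
open import Data.Sum using (_⊎_; inj₁; inj₂)
open import Data.Unit using (⊤; tt)
open import Level using (0ℓ)
import Relation.Binary.Reasoning.Setoid
open import Relation.Binary.Definitions using (tri<; tri≈; tri>)
open import Relation.Binary.PropositionalEquality
open import Relation.Nullary using (¬_; Dec; yes; no; does)
open import Relation.Nullary.Decidable using (from-yes)
open import Tactic.RingSolver using (solve-∀)
open import Tactic.RingSolver.Core.AlmostCommutativeRing using (AlmostCommutativeRing; fromCommutativeRing)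

open Divisibility
open ResidueCounting

-- Arithmetic in ℚ: embedded integers, inverses, powers, finite sums and products.

ℚring : AlmostCommutativeRing 0ℓ 0ℓ
ℚring = fromCommutativeRing +-*-commutativeRing isZero
  where
  isZero : ∀ x → Maybe (0ℚ ≡ x)
  isZero x with 0ℚ ≟ x
  ... | yes e = just e
  ... | no _ = nothing

*-swap-middle : ∀ a b c d → (a * b) * (c * d) ≡ (a * c) * (b * d)
*-swap-middle = solve-∀ ℚring

+-swap-middle : ∀ a b c d → (a + b) + (c + d) ≡ (a + c) + (b + d)
+-swap-middle = solve-∀ ℚring

opaque
  ι : ℤ → ℚ
  ι z = z / 1

  toιᵘ : ∀ z → toℚᵘ (ι z) ℚᵘ.≃ ℚᵘ.mkℚᵘ z 0
  toιᵘ z = toℚᵘ-fromℚᵘ (ℚᵘ.mkℚᵘ z 0)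

  ι-+ : ∀ a b → ι (a ℤ.+ b) ≡ ι a + ι b
  ι-+ a b = toℚᵘ-injective (ℚᵘP.≃-trans (toιᵘ (a ℤ.+ b)) (ℚᵘP.≃-trans
    (ℚᵘ.*≡* (cong (ℤ._* ℤ.+ 1) (cong₂ ℤ._+_ (sym (ℤP.*-identityʳ a)) (sym (ℤP.*-identityʳ b)))))
    (ℚᵘP.≃-sym (ℚᵘP.≃-trans (toℚᵘ-homo-+ (ι a) (ι b)) (ℚᵘP.+-cong (toιᵘ a) (toιᵘ b))))))

  ι-* : ∀ a b → ι (a ℤ.* b) ≡ ι a * ι b
  ι-* a b = toℚᵘ-injective (ℚᵘP.≃-trans (toιᵘ (a ℤ.* b)) (ℚᵘP.≃-trans
    (ℚᵘ.*≡* refl)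
    (ℚᵘP.≃-sym (ℚᵘP.≃-trans (toℚᵘ-homo-* (ι a) (ι b)) (ℚᵘP.*-cong (toιᵘ a) (toιᵘ b))))))

  ι-injective : ∀ {a b} → ι a ≡ ι b → a ≡ b
  ι-injective {a} {b} e with ℚᵘP.≃-trans (ℚᵘP.≃-sym (toιᵘ a)) (ℚᵘP.≃-trans (toℚᵘ-cong e) (toιᵘ b))
  ... | ℚᵘ.*≡* h = trans (sym (ℤP.*-identityʳ a)) (trans h (ℤP.*-identityʳ b))

  ι-neg : ∀ a → ι (ℤ.- a) ≡ - ι a
  ι-neg a = toℚᵘ-injective (ℚᵘP.≃-trans (toιᵘ (ℤ.- a)) (ℚᵘP.≃-sym
    (ℚᵘP.≃-trans (toℚᵘ-homo‿- (ι a)) (ℚᵘP.-‿cong (toιᵘ a)))))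

  ι-mono-≤ : ∀ {a b} → a ℤ.≤ b → ι a ≤ ι b
  ι-mono-≤ {a} {b} h = toℚᵘ-cancel-≤ (ℚᵘP.≤-respˡ-≃ (ℚᵘP.≃-sym (toιᵘ a)) (ℚᵘP.≤-respʳ-≃ (ℚᵘP.≃-sym (toιᵘ b))
    (ℚᵘ.*≤* (ℤP.*-monoʳ-≤-nonNeg (ℤ.+ 1) h))))

  ι≡/1 : ∀ z → ι z ≡ z / 1
  ι≡/1 z = refl

  ι0 : ι (ℤ.+ 0) ≡ 0ℚ
  ι0 = refl

  ι1 : ι (ℤ.+ 1) ≡ 1ℚ
  ι1 = refl

ι-cancel-< : ∀ {a b} → ι a < ι b → a ℤ.< b
ι-cancel-< {a} {b} h = ℤP.≰⇒> (λ b≤a → <⇒≢ (<-≤-trans h (ι-mono-≤ b≤a)) refl)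

ι-abs : ∀ a → ∣ ι a ∣ ≡ ι (ℤ.+ ℤ.∣ a ∣)
ι-abs (ℤ.+ n) = 0≤p⇒∣p∣≡p (subst (_≤ ι (ℤ.+ n)) ι0 (ι-mono-≤ (ℤ.+≤+ z≤n)))
ι-abs -[1+ n ] = trans (cong ∣_∣ (ι-neg (ℤ.+ suc n))) (trans (∣-p∣≡∣p∣ (ι (ℤ.+ suc n))) (0≤p⇒∣p∣≡p (subst (_≤ ι (ℤ.+ suc n)) ι0 (ι-mono-≤ (ℤ.+≤+ z≤n)))))

ιℕ : ℕ → ℚ
ιℕ n = ι (ℤ.+ n)

ιℕ-+ : ∀ a b → ιℕ (a ℕ.+ b) ≡ ιℕ a + ιℕ b
ιℕ-+ a b = ι-+ (ℤ.+ a) (ℤ.+ b)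

ιℕ-* : ∀ a b → ιℕ (a ℕ.* b) ≡ ιℕ a * ιℕ b
ιℕ-* a b = trans (cong ι (ℤP.pos-* a b)) (ι-* (ℤ.+ a) (ℤ.+ b))

ιℕ-mono : ∀ {a b} → a ℕ.≤ b → ιℕ a ≤ ιℕ b
ιℕ-mono h = ι-mono-≤ (ℤ.+≤+ h)

0≤ιℕ : ∀ n → 0ℚ ≤ ιℕ n
0≤ιℕ n = subst (_≤ ιℕ n) ι0 (ιℕ-mono z≤n)

ιℕ-suc : ∀ n → ιℕ (suc n) ≡ 1ℚ + ιℕ n
ιℕ-suc n = trans (ιℕ-+ 1 n) (cong (_+ ιℕ n) ι1)

ιℕ-pos : ∀ n → 0ℚ < ιℕ (suc n)
ιℕ-pos n = <-≤-trans (positive⁻¹ 1ℚ) (subst (_≤ ιℕ (suc n)) ι1 (ιℕ-mono {1} {suc n} (s≤s z≤n)))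

Integral : ℚ → Set
Integral x = ∃ λ z → x ≡ ι z

integral-+ : ∀ {x y} → Integral x → Integral y → Integral (x + y)
integral-+ (a , refl) (b , refl) = a ℤ.+ b , sym (ι-+ a b)

integral-* : ∀ {x y} → Integral x → Integral y → Integral (x * y)
integral-* (a , refl) (b , refl) = a ℤ.* b , sym (ι-* a b)

integral-neg : ∀ {x} → Integral x → Integral (- x)
integral-neg (a , refl) = ℤ.- a , sym (ι-neg a)

integral-ι : ∀ z → Integral (ι z)
integral-ι z = z , refl

small-integral : ∀ {x} → Integral x → ∣ x ∣ < 1ℚ → x ≡ 0ℚ
small-integral (z , refl) h with ι-cancel-< {ℤ.+ ℤ.∣ z ∣} {ℤ.+ 1} (subst₂ _<_ (ι-abs z) (sym ι1) h)
... | ℤ.+<+ (s≤s k) = trans (cong ι (ℤP.∣i∣≡0⇒i≡0 {z} (ℕP.n≤0⇒n≡0 k))) ι0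

abs≡ : ∀ {x} → 0ℚ ≤ x → ∣ x ∣ ≡ x
abs≡ = 0≤p⇒∣p∣≡p

x≤abs : ∀ x → x ≤ ∣ x ∣
x≤abs x with ≤-total 0ℚ x
... | inj₁ h = ≤-reflexive (sym (abs≡ h))
... | inj₂ h = ≤-trans h (0≤∣p∣ x)

-x≤abs : ∀ x → - x ≤ ∣ x ∣
-x≤abs x = subst (- x ≤_) (∣-p∣≡∣p∣ x) (x≤abs (- x))

*-mono-nonNeg : ∀ {a b c d} → 0ℚ ≤ a → a ≤ b → 0ℚ ≤ c → c ≤ d → a * c ≤ b * d
*-mono-nonNeg {a} {b} {c} {d} 0≤a a≤b 0≤c c≤d = ≤-trans
  (*-monoʳ-≤-nonNeg c {{nonNegative 0≤c}} a≤b)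
  (*-monoˡ-≤-nonNeg b {{nonNegative (≤-trans 0≤a a≤b)}} c≤d)

0≤* : ∀ {a b} → 0ℚ ≤ a → 0ℚ ≤ b → 0ℚ ≤ a * b
0≤* {a} {b} 0≤a 0≤b = subst (_≤ a * b) (*-zeroˡ 0ℚ) (*-mono-nonNeg ≤-refl 0≤a ≤-refl 0≤b)

0<* : ∀ {a b} → 0ℚ < a → 0ℚ < b → 0ℚ < a * b
0<* {a} {b} ha hb = positive⁻¹ (a * b) {{pos*pos⇒pos a {{positive ha}} b {{positive hb}}}}

0≤+ : ∀ {a b} → 0ℚ ≤ a → 0ℚ ≤ b → 0ℚ ≤ a + b
0≤+ {a} {b} ha hb = subst (_≤ a + b) (+-identityˡ 0ℚ) (+-mono-≤ ha hb)

*-monoˡ : ∀ {r a b} → 0ℚ ≤ r → a ≤ b → r * a ≤ r * b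
*-monoˡ {r} h = *-monoˡ-≤-nonNeg r {{nonNegative h}}

*-monoʳ : ∀ {r a b} → 0ℚ ≤ r → a ≤ b → a * r ≤ b * r
*-monoʳ {r} h = *-monoʳ-≤-nonNeg r {{nonNegative h}}

0<⇒≢0 : ∀ {x} → 0ℚ < x → x ≢ 0ℚ
0<⇒≢0 h e = <⇒≢ h (sym e)

abs>0 : ∀ {x} → x ≢ 0ℚ → 0ℚ < ∣ x ∣
abs>0 {x} h with <-cmp 0ℚ x
... | tri< a _ _ = subst (0ℚ <_) (sym (abs≡ (<⇒≤ a))) a
... | tri≈ _ e _ = ⊥-elim (h (sym e))
... | tri> _ _ c = <-≤-trans (neg-antimono-< c) (-x≤abs x)

-≤ : ∀ {a b c} → a ≤ b + c → a - c ≤ b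
-≤ {a} {b} {c} h = subst (a - c ≤_) (r b c) (+-monoˡ-≤ (- c) h)
  where
  r : ∀ b c → b + c - c ≡ b
  r = solve-∀ ℚring

∣x-y∣≤ : ∀ x y → ∣ x - y ∣ ≤ ∣ x ∣ + ∣ y ∣
∣x-y∣≤ x y = subst (∣ x - y ∣ ≤_) (cong (∣ x ∣ +_) (∣-p∣≡∣p∣ y)) (∣p+q∣≤∣p∣+∣q∣ x (- y))

-- inv 0 = 0

opaque
  inv : ℚ → ℚ
  inv x with x ≟ 0ℚ
  ... | yes _ = 0ℚ
  ... | no h = (1/ x) {{≢-nonZero h}}

  *-inv : ∀ {x} → x ≢ 0ℚ → x * inv x ≡ 1ℚ
  *-inv {x} h with x ≟ 0ℚ
  ... | yes e = ⊥-elim (h e)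
  ... | no h′ = *-inverseʳ x {{≢-nonZero h′}}

*-cancelˡ-≢0 : ∀ {r x y} → r ≢ 0ℚ → r * x ≡ r * y → x ≡ y
*-cancelˡ-≢0 {r} {x} {y} h e = begin
  x                  ≡⟨ sym (*-identityˡ x) ⟩
  1ℚ * x             ≡⟨ cong (_* x) (sym (*-inv h)) ⟩
  (r * inv r) * x    ≡⟨ r₁ r (inv r) x ⟩
  inv r * (r * x)    ≡⟨ cong (inv r *_) e ⟩
  inv r * (r * y)    ≡⟨ sym (r₁ r (inv r) y) ⟩
  (r * inv r) * y    ≡⟨ cong (_* y) (*-inv h) ⟩
  1ℚ * y             ≡⟨ *-identityˡ y ⟩
  y ∎
  where
  open ≡-Reasoning
  r₁ : ∀ a b c → (a * b) * c ≡ b * (a * c)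
  r₁ = solve-∀ ℚring

inv-unique : ∀ {x y} → x * y ≡ 1ℚ → inv x ≡ y
inv-unique {x} {y} e = *-cancelˡ-≢0 x≢0 (trans (*-inv x≢0) (sym e))
  where
  x≢0 : x ≢ 0ℚ
  x≢0 refl = 1≢0 (trans (sym e) (*-zeroˡ y))

*≡1⇒≢0 : ∀ {x y} → x * y ≡ 1ℚ → x ≢ 0ℚ
*≡1⇒≢0 {x} {y} e refl = 1≢0 (trans (sym e) (*-zeroˡ y))

*-≢0 : ∀ {x y} → x ≢ 0ℚ → y ≢ 0ℚ → x * y ≢ 0ℚ
*-≢0 {x} {y} hx hy e = hy (*-cancelˡ-≢0 hx (trans e (sym (*-zeroʳ x))))

infixr 8 _↑_
_↑_ : ℚ → ℕ → ℚ
_↑_ = _^ℚ_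

↑-+ : ∀ x a b → x ↑ (a ℕ.+ b) ≡ x ↑ a * x ↑ b
↑-+ x zero b = sym (*-identityˡ _)
↑-+ x (suc a) b = trans (cong (x *_) (↑-+ x a b)) (sym (*-assoc x _ _))

↑-*ˡ : ∀ x y n → (x * y) ↑ n ≡ x ↑ n * y ↑ n
↑-*ˡ x y zero = refl
↑-*ˡ x y (suc n) = trans (cong (x * y *_) (↑-*ˡ x y n)) (*-swap-middle x y (x ↑ n) (y ↑ n))

1↑ : ∀ n → 1ℚ ↑ n ≡ 1ℚ
1↑ zero = refl
1↑ (suc n) = trans (*-identityˡ _) (1↑ n)

↑-* : ∀ x a b → x ↑ (a ℕ.* b) ≡ (x ↑ b) ↑ a
↑-* x zero b = refl
↑-* x (suc a) b = trans (↑-+ x b (a ℕ.* b)) (cong (x ↑ b *_) (↑-* x a b))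

↑-≢0 : ∀ {x} n → x ≢ 0ℚ → x ↑ n ≢ 0ℚ
↑-≢0 zero h = 1≢0
↑-≢0 (suc n) h = *-≢0 h (↑-≢0 n h)

0≤↑ : ∀ {x} n → 0ℚ ≤ x → 0ℚ ≤ x ↑ n
0≤↑ zero h = <⇒≤ (positive⁻¹ 1ℚ)
0≤↑ (suc n) h = 0≤* h (0≤↑ n h)

0<↑ : ∀ {x} n → 0ℚ < x → 0ℚ < x ↑ n
0<↑ zero h = positive⁻¹ 1ℚ
0<↑ (suc n) h = 0<* h (0<↑ n h)

↑-abs : ∀ x n → ∣ x ↑ n ∣ ≡ ∣ x ∣ ↑ n
↑-abs x zero = refl
↑-abs x (suc n) = trans (∣p*q∣≡∣p∣*∣q∣ x (x ↑ n)) (cong (∣ x ∣ *_) (↑-abs x n))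

↑-mono : ∀ {x y} n → 0ℚ ≤ x → x ≤ y → x ↑ n ≤ y ↑ n
↑-mono zero _ _ = ≤-refl
↑-mono (suc n) h k = *-mono-nonNeg h k (0≤↑ n h) (↑-mono n h k)

↑≤1 : ∀ {x} n → 0ℚ ≤ x → x ≤ 1ℚ → x ↑ n ≤ 1ℚ
↑≤1 {x} n h k = subst (x ↑ n ≤_) (1↑ n) (↑-mono n h k)

1≤↑ : ∀ {x} n → 1ℚ ≤ x → 1ℚ ≤ x ↑ n
1≤↑ {x} n h = subst (_≤ x ↑ n) (1↑ n) (↑-mono n (<⇒≤ (positive⁻¹ 1ℚ)) h)

↑-anti : ∀ {x a b} → 0ℚ ≤ x → x ≤ 1ℚ → a ℕ.≤ b → x ↑ b ≤ x ↑ a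
↑-anti {x} {a} {b} h k a≤b = subst (λ c → x ↑ c ≤ x ↑ a) (ℕP.m+[n∸m]≡n a≤b)
  (subst₂ _≤_ (sym (↑-+ x a (b ℕ.∸ a))) (*-identityʳ _) (*-monoˡ (0≤↑ a h) (↑≤1 (b ℕ.∸ a) h k)))

↑-mono-exp : ∀ {x a b} → 1ℚ ≤ x → a ℕ.≤ b → x ↑ a ≤ x ↑ b
↑-mono-exp {x} {a} {b} h a≤b = subst (λ c → x ↑ a ≤ x ↑ c) (ℕP.m+[n∸m]≡n a≤b)
  (subst₂ _≤_ (*-identityʳ _) (sym (↑-+ x a (b ℕ.∸ a))) (*-monoˡ (0≤↑ a (≤-trans (<⇒≤ (positive⁻¹ 1ℚ)) h)) (1≤↑ (b ℕ.∸ a) h)))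

ιℕ-^ : ∀ a n → ιℕ (a ℕ.^ n) ≡ ιℕ a ↑ n
ιℕ-^ a zero = ι1
ιℕ-^ a (suc n) = trans (ιℕ-* a (a ℕ.^ n)) (cong (ιℕ a *_) (ιℕ-^ a n))

∑ : ℕ → (ℕ → ℚ) → ℚ
∑ zero f = 0ℚ
∑ (suc n) f = ∑ n f + f n

∑-cong : ∀ n {f g : ℕ → ℚ} → (∀ i → i ℕ.< n → f i ≡ g i) → ∑ n f ≡ ∑ n g
∑-cong zero h = refl
∑-cong (suc n) h = cong₂ _+_ (∑-cong n (λ i i<n → h i (ℕP.m<n⇒m<1+n i<n))) (h n ℕP.≤-refl)

∑-+ : ∀ n (f g : ℕ → ℚ) → ∑ n (λ i → f i + g i) ≡ ∑ n f + ∑ n g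
∑-+ zero f g = sym (+-identityˡ 0ℚ)
∑-+ (suc n) f g = trans (cong (_+ (f n + g n)) (∑-+ n f g)) (+-swap-middle (∑ n f) (∑ n g) (f n) (g n))

∑-*ˡ : ∀ n c (f : ℕ → ℚ) → ∑ n (λ i → c * f i) ≡ c * ∑ n f
∑-*ˡ zero c f = sym (*-zeroʳ c)
∑-*ˡ (suc n) c f = trans (cong (_+ c * f n) (∑-*ˡ n c f)) (sym (*-distribˡ-+ c _ _))

∑-*ʳ : ∀ n c (f : ℕ → ℚ) → ∑ n (λ i → f i * c) ≡ ∑ n f * c
∑-*ʳ n c f = trans (∑-cong n (λ i _ → *-comm (f i) c)) (trans (∑-*ˡ n c f) (*-comm c _))

∑-0 : ∀ n {f : ℕ → ℚ} → (∀ i → i ℕ.< n → f i ≡ 0ℚ) → ∑ n f ≡ 0ℚ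
∑-0 zero h = refl
∑-0 (suc n) h = trans (cong₂ _+_ (∑-0 n (λ i i<n → h i (ℕP.m<n⇒m<1+n i<n))) (h n ℕP.≤-refl)) (+-identityˡ 0ℚ)

∑-neg : ∀ n (f : ℕ → ℚ) → ∑ n (λ i → - f i) ≡ - ∑ n f
∑-neg zero f = refl
∑-neg (suc n) f = trans (cong (_+ - f n) (∑-neg n f)) (sym (neg-distrib-+ (∑ n f) (f n)))

∑-- : ∀ n (f g : ℕ → ℚ) → ∑ n (λ i → f i - g i) ≡ ∑ n f - ∑ n g
∑-- n f g = trans (∑-+ n f (λ i → - g i)) (cong (∑ n f +_) (∑-neg n g))

∑-swap : ∀ n k (f : ℕ → ℕ → ℚ) → ∑ n (λ i → ∑ k (f i)) ≡ ∑ k (λ j → ∑ n (λ i → f i j))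
∑-swap zero k f = sym (∑-0 k (λ _ _ → refl))
∑-swap (suc n) k f = trans (cong (_+ ∑ k (f n)) (∑-swap n k f)) (sym (∑-+ k (λ j → ∑ n (λ i → f i j)) (f n)))

∑-split : ∀ a b (f : ℕ → ℚ) → ∑ (a ℕ.+ b) f ≡ ∑ a f + ∑ b (λ i → f (a ℕ.+ i))
∑-split a zero f = trans (cong (λ c → ∑ c f) (ℕP.+-identityʳ a)) (sym (+-identityʳ _))
∑-split a (suc b) f = trans (cong (λ c → ∑ c f) (ℕP.+-suc a b))
  (trans (cong (_+ f (a ℕ.+ b)) (∑-split a b f)) (+-assoc (∑ a f) _ _))

∑-head : ∀ n (f : ℕ → ℚ) → ∑ (suc n) f ≡ f 0 + ∑ n (λ i → f (suc i))
∑-head n f = trans (∑-split 1 n f) (cong (_+ ∑ n (λ i → f (suc i))) (+-identityˡ (f 0)))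

∑-abs : ∀ n (f : ℕ → ℚ) → ∣ ∑ n f ∣ ≤ ∑ n (λ i → ∣ f i ∣)
∑-abs zero f = ≤-refl
∑-abs (suc n) f = ≤-trans (∣p+q∣≤∣p∣+∣q∣ (∑ n f) (f n)) (+-monoˡ-≤ ∣ f n ∣ (∑-abs n f))

∑-mono : ∀ n {f g : ℕ → ℚ} → (∀ i → i ℕ.< n → f i ≤ g i) → ∑ n f ≤ ∑ n g
∑-mono zero h = ≤-refl
∑-mono (suc n) h = +-mono-≤ (∑-mono n (λ i i<n → h i (ℕP.m<n⇒m<1+n i<n))) (h n ℕP.≤-refl)

∑-const : ∀ n c → ∑ n (λ _ → c) ≡ ιℕ n * c
∑-const zero c = trans (sym (*-zeroˡ c)) (cong (_* c) (sym ι0))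
∑-const (suc n) c = trans (cong (_+ c) (∑-const n c)) (trans (r (ιℕ n) c) (cong (_* c) (sym (ιℕ-suc n))))
  where
  r : ∀ a c → a * c + c ≡ (1ℚ + a) * c
  r = solve-∀ ℚring

∑-single : ∀ n k (f : ℕ → ℚ) → k ℕ.< n → (∀ i → i ≢ k → f i ≡ 0ℚ) → ∑ n f ≡ f k
∑-single (suc n) k f k<n h with k ℕP.≟ n
... | yes refl = trans (cong (_+ f n) (∑-0 n (λ i i<n → h i (ℕP.<⇒≢ i<n)))) (+-identityˡ _)
... | no k≢n = trans (cong₂ _+_ (∑-single n k f (ℕP.≤∧≢⇒< (ℕP.≤-pred k<n) k≢n) h) (h n (λ e → k≢n (sym e)))) (+-identityʳ _)

integral-∑ : ∀ n {f : ℕ → ℚ} → (∀ i → i ℕ.< n → Integral (f i)) → Integral (∑ n f)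
integral-∑ zero h = ℤ.+ 0 , sym ι0
integral-∑ (suc n) h = integral-+ (integral-∑ n (λ i i<n → h i (ℕP.m<n⇒m<1+n i<n))) (h n ℕP.≤-refl)

∏ℚ : ℕ → (ℕ → ℚ) → ℚ
∏ℚ zero f = 1ℚ
∏ℚ (suc n) f = ∏ℚ n f * f n

∏ℚ-cong : ∀ n {f g : ℕ → ℚ} → (∀ i → i ℕ.< n → f i ≡ g i) → ∏ℚ n f ≡ ∏ℚ n g
∏ℚ-cong zero h = refl
∏ℚ-cong (suc n) h = cong₂ _*_ (∏ℚ-cong n (λ i i<n → h i (ℕP.m<n⇒m<1+n i<n))) (h n ℕP.≤-refl)

∏ℚ-* : ∀ n (f g : ℕ → ℚ) → ∏ℚ n (λ i → f i * g i) ≡ ∏ℚ n f * ∏ℚ n g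
∏ℚ-* zero f g = refl
∏ℚ-* (suc n) f g = trans (cong (_* (f n * g n)) (∏ℚ-* n f g)) (*-swap-middle (∏ℚ n f) (∏ℚ n g) (f n) (g n))

∏ℚ-≢0 : ∀ n {f : ℕ → ℚ} → (∀ i → f i ≢ 0ℚ) → ∏ℚ n f ≢ 0ℚ
∏ℚ-≢0 zero h = 1≢0
∏ℚ-≢0 (suc n) h = *-≢0 (∏ℚ-≢0 n h) (h n)

∏ℚ-split : ∀ a b (f : ℕ → ℚ) → ∏ℚ (a ℕ.+ b) f ≡ ∏ℚ a f * ∏ℚ b (λ i → f (a ℕ.+ i))
∏ℚ-split a zero f = trans (cong (λ c → ∏ℚ c f) (ℕP.+-identityʳ a)) (sym (*-identityʳ (∏ℚ a f)))
∏ℚ-split a (suc b) f = trans (cong (λ c → ∏ℚ c f) (ℕP.+-suc a b))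
  (trans (cong (_* f (a ℕ.+ b)) (∏ℚ-split a b f)) (*-assoc (∏ℚ a f) _ _))

integral-∏ : ∀ n {f : ℕ → ℚ} → (∀ i → Integral (f i)) → Integral (∏ℚ n f)
integral-∏ zero h = ℤ.+ 1 , sym ι1
integral-∏ (suc n) h = integral-* (integral-∏ n h) (h n)

integral-↑ : ∀ {x} n → Integral x → Integral (x ↑ n)
integral-↑ zero h = ℤ.+ 1 , sym ι1
integral-↑ (suc n) h = integral-* h (integral-↑ n h)

ι-∏ : ∀ n (f : ℕ → ℕ) → ιℕ (∏ n f) ≡ ∏ℚ n (λ i → ιℕ (f i))
ι-∏ zero f = ι1
ι-∏ (suc n) f = trans (ιℕ-* (∏ n f) (f n)) (cong (_* ιℕ (f n)) (ι-∏ n f))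

ι-^ : ∀ p k → ι (p ℤ.^ k) ≡ ι p ↑ k
ι-^ p zero = ι1
ι-^ p (suc k) = trans (ι-* p (p ℤ.^ k)) (cong (ι p *_) (ι-^ p k))

ι-U : ∀ p k → ι (U p k) ≡ ι p ↑ k - 1ℚ
ι-U p k = trans (ι-+ (p ℤ.^ k) (ℤ.- ℤ.+ 1)) (cong₂ _+_ (ι-^ p k) (trans (ι-neg (ℤ.+ 1)) (cong -_ ι1)))

abs-^ : ∀ p k → ℤ.∣ p ℤ.^ k ∣ ≡ ℤ.∣ p ∣ ℕ.^ k
abs-^ p zero = refl
abs-^ p (suc k) = trans (ℤP.abs-* p (p ℤ.^ k)) (cong (ℤ.∣ p ∣ ℕ.*_) (abs-^ p k))

u≢0 : ∀ p → 2 ℕ.≤ ℤ.∣ p ∣ → ∀ k → u p (suc k) ≢ 0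
u≢0 p 2≤p k e = ℕP.<⇒≢ (ℕP.<-≤-trans (s≤s (s≤s z≤n)) 2≤) (sym abs1)
  where
  abs1 : ℤ.∣ p ∣ ℕ.^ suc k ≡ 1
  abs1 = trans (sym (abs-^ p (suc k))) (cong ℤ.∣_∣ (ℤP.i-j≡0⇒i≡j (p ℤ.^ suc k) (ℤ.+ 1) (ℤP.∣i∣≡0⇒i≡0 e)))
  2≤ : 2 ℕ.≤ ℤ.∣ p ∣ ℕ.^ suc k
  2≤ = ℕP.≤-trans 2≤p (subst (ℕ._≤ ℤ.∣ p ∣ ℕ.^ suc k) (ℕP.^-identityʳ ℤ.∣ p ∣) (ℕP.^-monoʳ-≤ ℤ.∣ p ∣ {{ℕ.>-nonZero (ℕP.<-≤-trans (s≤s z≤n) 2≤p)}} (s≤s (z≤n {k}))))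

-- Factorisations are available for absolute values only; the sign is an integral unit that can be
-- moved into a cofactor.
sign-abs : ∀ z → ∃ λ s → Integral s × s * s ≡ 1ℚ × ι z ≡ s * ιℕ ℤ.∣ z ∣
sign-abs (ℤ.+ n) = 1ℚ , (ℤ.+ 1 , sym ι1) , refl , sym (*-identityˡ _)
sign-abs -[1+ n ] = - 1ℚ , integral-neg (ℤ.+ 1 , sym ι1) , refl , trans (ι-neg (ℤ.+ suc n)) (r (ιℕ (suc n)))
  where
  r : ∀ x → - x ≡ - 1ℚ * x
  r = solve-∀ ℚring

-- Exponent functions: index 0 stands for p, index l ≥ 1 for the l-th cyclotomic factor.

0̂ : ℕ → ℕ
0̂ _ = 0

at0 : ℕ → ℕ → ℕ
at0 k zero = k
at0 k (suc _) = 0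

δ : ℕ → ℕ → ℕ
δ k zero = 0
δ k (suc l) = ind (suc l) k

_⊞_ : (ℕ → ℕ) → (ℕ → ℕ) → ℕ → ℕ
(f ⊞ g) l = f l ℕ.+ g l
infixl 6 _⊞_

-- Fractional ideals generated by p and the cyclotomic factors.

module Arith (p : ℤ) (2≤p : 2 ℕ.≤ ℤ.∣ p ∣) (q : ℚ) (qP : q * ι p ≡ 1ℚ) (n : ℕ) where

  open StrongDivisibility (u p) (u≢0 p 2≤p) (u-mono p) (u-gcd p) using (Φ; u-factors; Φ≢0)

  P : ℚ
  P = ι p

  Φℚ : ℕ → ℚ
  Φℚ i = ιℕ (Φ (suc i))

  Φℚ≢0 : ∀ i → Φℚ i ≢ 0ℚ
  Φℚ≢0 i e = Φ≢0 i (ℤP.+-injective (ι-injective (trans e (sym ι0))))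

  P≢0 : P ≢ 0ℚ
  P≢0 e = 1≢0 (trans (sym qP) (trans (cong (q *_) e) (*-zeroʳ q)))

  q≢0 : q ≢ 0ℚ
  q≢0 = *≡1⇒≢0 qP

  opaque
    Φpow : (ℕ → ℕ) → ℚ
    Φpow f = P ↑ f 0 * ∏ℚ n (λ i → Φℚ i ↑ f (suc i))

    Φpow-cong : ∀ {f g} → (∀ l → l ℕ.≤ n → f l ≡ g l) → Φpow f ≡ Φpow g
    Φpow-cong h = cong₂ _*_ (cong (P ↑_) (h 0 z≤n)) (∏ℚ-cong n (λ i i<n → cong (Φℚ i ↑_) (h (suc i) i<n)))

    Φpow-⊞ : ∀ f g → Φpow (f ⊞ g) ≡ Φpow f * Φpow g
    Φpow-⊞ f g = trans (cong₂ _*_ (↑-+ P (f 0) (g 0))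
        (trans (∏ℚ-cong n (λ i _ → ↑-+ (Φℚ i) (f (suc i)) (g (suc i)))) (∏ℚ-* n _ _)))
      (*-swap-middle (P ↑ f 0) (P ↑ g 0) _ _)

    Φpow≢0 : ∀ f → Φpow f ≢ 0ℚ
    Φpow≢0 f = *-≢0 (↑-≢0 (f 0) P≢0) (∏ℚ-≢0 n (λ i → ↑-≢0 (f (suc i)) (Φℚ≢0 i)))

    Φpow-integral : ∀ f → Integral (Φpow f)
    Φpow-integral f = integral-* (integral-↑ (f 0) (integral-ι p)) (integral-∏ n (λ i → integral-↑ (f (suc i)) (integral-ι _)))

    Φpow-0̂ : Φpow 0̂ ≡ 1ℚ
    Φpow-0̂ = trans (*-identityˡ _) (one n)
      where
      one : ∀ n → ∏ℚ n (λ _ → 1ℚ) ≡ 1ℚ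
      one zero = refl
      one (suc n) = trans (*-identityʳ _) (one n)

    Φpow-at0 : ∀ k → Φpow (at0 k) ≡ P ↑ k
    Φpow-at0 k = trans (cong (P ↑ k *_) (trans (sym (*-identityˡ _)) Φpow-0̂)) (*-identityʳ _)

    Φpow-δ : ∀ k → Φpow (δ k) ≡ ∏ℚ n (λ i → Φℚ i ↑ ind (suc i) k)
    Φpow-δ k = *-identityˡ _

  -- x ∈ M f g means that x lies in the fractional ideal generated by Φ^g / Φ^f.
  record M (f g : ℕ → ℕ) (x : ℚ) : Set where
    constructor mem
    field
      {cof} : ℚ
      cof-integral : Integral cof
      mem-eq : x * Φpow f ≡ Φpow g * cof

  M-* : ∀ {f g f′ g′ x y} → M f g x → M f′ g′ y → M (f ⊞ f′) (g ⊞ g′) (x * y)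
  M-* {f} {g} {f′} {g′} {x} {y} (mem {c} i e) (mem {c′} i′ e′) = mem (integral-* i i′)
    (trans (cong (x * y *_) (Φpow-⊞ f f′)) (trans (*-swap-middle x y _ _) (trans (cong₂ _*_ e e′)
      (trans (*-swap-middle (Φpow g) c _ _) (cong (_* (c * c′)) (sym (Φpow-⊞ g g′)))))))

  M-+ : ∀ {f g x y} → M f g x → M f g y → M f g (x + y)
  M-+ {f} {g} {x} {y} (mem {c} i e) (mem {c′} i′ e′) = mem (integral-+ i i′)
    (trans (*-distribʳ-+ (Φpow f) x y) (trans (cong₂ _+_ e e′) (sym (*-distribˡ-+ (Φpow g) c c′))))

  M-neg : ∀ {f g x} → M f g x → M f g (- x)
  M-neg {f} {g} {x} (mem {c} i e) = mem (integral-neg i)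
    (trans (sym (neg-distribˡ-* x (Φpow f))) (trans (cong -_ e) (neg-distribʳ-* (Φpow g) c)))

  M-0 : ∀ {f g} → M f g 0ℚ
  M-0 {f} {g} = mem (ℤ.+ 0 , refl) (trans (*-zeroˡ (Φpow f)) (trans (sym (*-zeroʳ (Φpow g))) (cong (Φpow g *_) (sym ι0))))

  -- Only the difference g - f matters: the ideal grows when it decreases, and the surplus d goes
  -- into the integral cofactor.
  M-weaken : ∀ {f g f′ g′ x} → (∀ l → l ℕ.≤ n → f l ℕ.+ g′ l ℕ.≤ f′ l ℕ.+ g l) → M f g x → M f′ g′ x
  M-weaken {f} {g} {f′} {g′} {x} h (mem {c} i e) = mem (integral-* i (Φpow-integral d))
    (*-cancelˡ-≢0 (Φpow≢0 g) (begin
      Φpow g * (x * Φpow f′)              ≡⟨ r₁ (Φpow g) x (Φpow f′) ⟩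
      x * (Φpow f′ * Φpow g)              ≡⟨ cong (x *_) (sym (Φpow-⊞ f′ g)) ⟩
      x * Φpow (f′ ⊞ g)                   ≡⟨ cong (x *_) (Φpow-cong (λ l l≤n → sym (ℕP.m+[n∸m]≡n (h l l≤n)))) ⟩
      x * Φpow (f ⊞ g′ ⊞ d)               ≡⟨ cong (x *_) (trans (Φpow-⊞ (f ⊞ g′) d) (cong (_* Φpow d) (Φpow-⊞ f g′))) ⟩
      x * (Φpow f * Φpow g′ * Φpow d)     ≡⟨ r₂ x (Φpow f) (Φpow g′) (Φpow d) ⟩
      x * Φpow f * (Φpow g′ * Φpow d)     ≡⟨ cong (_* (Φpow g′ * Φpow d)) e ⟩
      Φpow g * c * (Φpow g′ * Φpow d)     ≡⟨ r₃ (Φpow g) c (Φpow g′) (Φpow d) ⟩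
      Φpow g * (Φpow g′ * (c * Φpow d))   ∎))
    where
    open ≡-Reasoning
    d : ℕ → ℕ
    d l = (f′ l ℕ.+ g l) ℕ.∸ (f l ℕ.+ g′ l)
    r₁ : ∀ a b c → a * (b * c) ≡ b * (c * a)
    r₁ = solve-∀ ℚring
    r₂ : ∀ a b c d → a * (b * c * d) ≡ a * b * (c * d)
    r₂ = solve-∀ ℚring
    r₃ : ∀ a b c d → a * b * (c * d) ≡ a * (c * (b * d))
    r₃ = solve-∀ ℚring

  M-integral : ∀ {x} → Integral x → M 0̂ 0̂ x
  M-integral {x} i = mem i (*-comm x (Φpow 0̂))

  integral-M : ∀ {f g x} → (∀ l → l ℕ.≤ n → f l ℕ.≤ g l) → M f g x → Integral x
  integral-M {f} {g} {x} h m = go (M-weaken {f} {g} {0̂} {0̂} (λ l l≤n → subst (ℕ._≤ g l) (sym (ℕP.+-identityʳ (f l))) (h l l≤n)) m)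
    where
    go : M 0̂ 0̂ x → Integral x
    go (mem {c} i e) = subst Integral (sym (trans (sym (*-identityʳ x)) (trans (cong (x *_) (sym Φpow-0̂)) (trans e
          (trans (cong (_* c) Φpow-0̂) (*-identityˡ c)))))) i

  M-1 : M 0̂ 0̂ 1ℚ
  M-1 = M-integral (ℤ.+ 1 , sym ι1)

  qP^ : ∀ k → q ↑ k * P ↑ k ≡ 1ℚ
  qP^ k = trans (sym (↑-*ˡ q P k)) (trans (cong (_↑ k) qP) (1↑ k))

  M-P^ : ∀ k → M 0̂ (at0 k) (P ↑ k)
  M-P^ k = mem (ℤ.+ 1 , sym ι1) (trans (cong (P ↑ k *_) Φpow-0̂) (cong (_* 1ℚ) (sym (Φpow-at0 k))))

  M-q^ : ∀ k → M (at0 k) 0̂ (q ↑ k)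
  M-q^ k = mem (ℤ.+ 1 , sym ι1) (trans (cong (q ↑ k *_) (Φpow-at0 k)) (trans (qP^ k) (sym (trans (*-identityʳ (Φpow 0̂)) Φpow-0̂))))

  private
    u-Φ : ∀ k N → suc k ℕ.≤ N → ιℕ (u p (suc k)) ≡ ∏ℚ N (λ i → Φℚ i ↑ ind (suc i) (suc k))
    u-Φ k N h = trans (cong ιℕ (u-factors k N h)) (trans (ι-∏ N _) (∏ℚ-cong N (λ i _ → ιℕ-^ (Φ (suc i)) (ind (suc i) (suc k)))))

    P^-1 : ∀ k → ∃ λ s → Integral s × s * s ≡ 1ℚ × P ↑ k - 1ℚ ≡ s * ιℕ (u p k)
    P^-1 k with sign-abs (U p k)
    ... | s , i , ss , e = s , i , ss , trans (sym (ι-U p k)) e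

  -- Cyclotomic factors of index above n are collected in the integral cofactor.
  M-U : ∀ k → M 0̂ (δ (suc k)) (P ↑ suc k - 1ℚ)
  M-U k with P^-1 (suc k)
  ... | s , i , ss , e = mem {cof = s * rest} (integral-* i (integral-∏ (suc k) (λ i → integral-↑ (ind (suc (n ℕ.+ i)) (suc k)) (integral-ι _))))
    (trans (cong ((P ↑ suc k - 1ℚ) *_) Φpow-0̂) (trans (*-identityʳ (P ↑ suc k - 1ℚ)) (trans e (trans (cong (s *_)
      (trans (u-Φ k (n ℕ.+ suc k) (ℕP.m≤n+m (suc k) n)) (∏ℚ-split n (suc k) _)))
      (trans (r s (∏ℚ n (λ i → Φℚ i ↑ ind (suc i) (suc k))) rest) (cong (_* (s * rest)) (sym (Φpow-δ (suc k)))))))))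
    where
    rest = ∏ℚ (suc k) (λ i → Φℚ (n ℕ.+ i) ↑ ind (suc (n ℕ.+ i)) (suc k))
    r : ∀ s a b → s * (a * b) ≡ a * (s * b)
    r = solve-∀ ℚring

  U≢0 : ∀ k → P ↑ suc k - 1ℚ ≢ 0ℚ
  U≢0 k e = u≢0 p 2≤p k (cong ℤ.∣_∣ (ι-injective {U p (suc k)} {ℤ.+ 0} (trans (ι-U p (suc k)) (trans e (sym ι0)))))

  -- An integral cofactor could not be inverted, so all factors of p^(k+1) - 1 must be among those
  -- that `Φpow` records.
  M-U⁻¹ : ∀ k → suc k ℕ.≤ n → M (δ (suc k)) 0̂ (inv (P ↑ suc k - 1ℚ))
  M-U⁻¹ k k<n with P^-1 (suc k)
  ... | s , i , ss , e = mem i (trans (cong (inv V *_) (trans (Φpow-δ (suc k)) (sym (u-Φ k n k<n))))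
      (trans (cong (inv V *_) uu) (trans (r (inv V) s V) (trans (cong (_* s) (*-inv (U≢0 k))) (cong (_* s) (sym Φpow-0̂))))))
    where
    V = P ↑ suc k - 1ℚ
    r : ∀ x s v → x * (s * v) ≡ v * x * s
    r = solve-∀ ℚring
    r₂ : ∀ s x → s * s * x ≡ s * (s * x)
    r₂ = solve-∀ ℚring
    uu : ιℕ (u p (suc k)) ≡ s * V
    uu = trans (sym (*-identityˡ _)) (trans (cong (_* ιℕ (u p (suc k))) (sym ss)) (trans (r₂ s _) (cong (s *_) (sym e))))

-- Formal power series

PS : Set
PS = ℕ → ℚ

infix 4 _≈_
_≈_ : PS → PS → Set
f ≈ g = ∀ t → f t ≡ g t

infixl 7 _⊛_
infixl 6 _⊕_

tail : PS → PS
tail f t = f (suc t)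

_⊕_ : PS → PS → PS
(f ⊕ g) t = f t + g t

⊝_ : PS → PS
(⊝ f) t = - f t

_⊛_ : PS → PS → PS
(f ⊛ g) zero = f 0 * g 0
(f ⊛ g) (suc t) = f 0 * g (suc t) + (tail f ⊛ g) t

C : ℚ → PS
C c zero = c
C c (suc t) = 0ℚ

-- The variable of the series. At the pole of index j it will stand for 1 - x q^j.
𝕎 : PS
𝕎 zero = 0ℚ
𝕎 (suc t) = C 1ℚ t

≈-sym : ∀ {f g} → f ≈ g → g ≈ f
≈-sym e t = sym (e t)

≈-trans : ∀ {f g h} → f ≈ g → g ≈ h → f ≈ h
≈-trans e e′ t = trans (e t) (e′ t)

⊛-cong : ∀ {f f′ g g′} → f ≈ f′ → g ≈ g′ → f ⊛ g ≈ f′ ⊛ g′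
⊛-cong e e′ zero = cong₂ _*_ (e 0) (e′ 0)
⊛-cong e e′ (suc t) = cong₂ _+_ (cong₂ _*_ (e 0) (e′ (suc t))) (⊛-cong (λ s → e (suc s)) e′ t)

⊕-cong : ∀ {f f′ g g′} → f ≈ f′ → g ≈ g′ → f ⊕ g ≈ f′ ⊕ g′
⊕-cong e e′ t = cong₂ _+_ (e t) (e′ t)

⊛-distribʳ : ∀ h f g → (f ⊕ g) ⊛ h ≈ (f ⊛ h) ⊕ (g ⊛ h)
⊛-distribʳ h f g zero = *-distribʳ-+ (h 0) (f 0) (g 0)
⊛-distribʳ h f g (suc t) = trans (cong ((f 0 + g 0) * h (suc t) +_) (⊛-distribʳ h (tail f) (tail g) t))
  (r (f 0) (g 0) (h (suc t)) ((tail f ⊛ h) t) ((tail g ⊛ h) t))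
  where
  r : ∀ a b c x y → (a + b) * c + (x + y) ≡ a * c + x + (b * c + y)
  r = solve-∀ ℚring

⊛-scale : ∀ c f g t → ((λ s → c * f s) ⊛ g) t ≡ c * (f ⊛ g) t
⊛-scale c f g zero = *-assoc c (f 0) (g 0)
⊛-scale c f g (suc t) = trans (cong (c * f 0 * g (suc t) +_) (⊛-scale c (tail f) g t))
  (r c (f 0) (g (suc t)) ((tail f ⊛ g) t))
  where
  r : ∀ c a b x → c * a * b + c * x ≡ c * (a * b + x)
  r = solve-∀ ℚring

⊛-last : ∀ f g t → (f ⊛ g) (suc t) ≡ (f ⊛ tail g) t + f (suc t) * g 0
⊛-last f g zero = refl
⊛-last f g (suc t) = trans (cong (f 0 * g (suc (suc t)) +_) (⊛-last (tail f) g t))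
  (sym (+-assoc (f 0 * g (suc (suc t))) ((tail f ⊛ tail g) t) _))

⊛-comm : ∀ f g → f ⊛ g ≈ g ⊛ f
⊛-comm f g zero = *-comm (f 0) (g 0)
⊛-comm f g (suc t) = trans (cong₂ _+_ (*-comm (f 0) (g (suc t))) (⊛-comm (tail f) g t))
  (trans (+-comm (g (suc t) * f 0) _) (sym (⊛-last g f t)))

⊛-assoc : ∀ f g h → (f ⊛ g) ⊛ h ≈ f ⊛ (g ⊛ h)
⊛-assoc f g h zero = *-assoc (f 0) (g 0) (h 0)
⊛-assoc f g h (suc t) = trans (cong (f 0 * g 0 * h (suc t) +_)
    (trans (⊛-distribʳ h (λ s → f 0 * g (suc s)) (tail f ⊛ g) t)
      (cong₂ _+_ (⊛-scale (f 0) (tail g) h t) (⊛-assoc (tail f) g h t))))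
  (r (f 0) (g 0) (h (suc t)) ((tail g ⊛ h) t) ((tail f ⊛ (g ⊛ h)) t))
  where
  r : ∀ a b c x y → a * b * c + (a * x + y) ≡ a * (b * c + x) + y
  r = solve-∀ ℚring

0⊛ : ∀ {f} → (∀ t → f t ≡ 0ℚ) → ∀ g t → (f ⊛ g) t ≡ 0ℚ
0⊛ {f} z g zero = trans (cong (_* g 0) (z 0)) (*-zeroˡ (g 0))
0⊛ {f} z g (suc t) = trans (cong₂ _+_ (trans (cong (_* g (suc t)) (z 0)) (*-zeroˡ (g (suc t)))) (0⊛ (λ s → z (suc s)) g t)) (+-identityˡ 0ℚ)

C⊛ : ∀ c f t → (C c ⊛ f) t ≡ c * f t
C⊛ c f zero = refl
C⊛ c f (suc t) = trans (cong (c * f (suc t) +_) (0⊛ (λ _ → refl) f t)) (+-identityʳ _)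

𝕎⊛0 : ∀ f → (𝕎 ⊛ f) 0 ≡ 0ℚ
𝕎⊛0 f = *-zeroˡ (f 0)

𝕎⊛suc : ∀ f t → (𝕎 ⊛ f) (suc t) ≡ f t
𝕎⊛suc f t = trans (cong₂ _+_ (*-zeroˡ (f (suc t))) (trans (⊛-cong (λ s → refl) (λ s → refl) t) (C⊛ 1ℚ f t)))
  (trans (+-identityˡ _) (*-identityˡ (f t)))

PS-ring : CommutativeRing 0ℓ 0ℓ
PS-ring = record
  { Carrier = PS
  ; _≈_ = _≈_
  ; _+_ = _⊕_
  ; _*_ = _⊛_
  ; -_ = ⊝_
  ; 0# = C 0ℚ
  ; 1# = C 1ℚ
  ; isCommutativeRing = record
    { isRing = record
      { +-isAbelianGroup = record
        { isGroup = record
          { isMonoid = record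
            { isSemigroup = record
              { isMagma = record
                { isEquivalence = record { refl = λ _ → refl ; sym = λ {f} {g} → ≈-sym {f} {g} ; trans = λ {f} {g} {h} → ≈-trans {f} {g} {h} }
                ; ∙-cong = λ {f} {f′} {g} {g′} → ⊕-cong {f} {f′} {g} {g′} }
              ; assoc = λ f g h t → +-assoc (f t) (g t) (h t) }
            ; identity = (λ f t → trans (cong (_+ f t) (C0 t)) (+-identityˡ (f t))) , (λ f t → trans (cong (f t +_) (C0 t)) (+-identityʳ (f t))) }
          ; inverse = (λ f t → trans (+-inverseˡ (f t)) (sym (C0 t))) , (λ f t → trans (+-inverseʳ (f t)) (sym (C0 t)))
          ; ⁻¹-cong = λ e t → cong -_ (e t) }
        ; comm = λ f g t → +-comm (f t) (g t) }
      ; *-cong = λ {f} {f′} {g} {g′} → ⊛-cong {f} {f′} {g} {g′}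
      ; *-assoc = ⊛-assoc
      ; *-identity = 1⊛ , (λ f → ≈-trans {f ⊛ C 1ℚ} {C 1ℚ ⊛ f} {f} (⊛-comm f (C 1ℚ)) (1⊛ f))
      ; distrib = (λ f g h → ≈-trans {f ⊛ (g ⊕ h)} {(g ⊕ h) ⊛ f} {f ⊛ g ⊕ f ⊛ h} (⊛-comm f (g ⊕ h))
          (≈-trans {(g ⊕ h) ⊛ f} {g ⊛ f ⊕ h ⊛ f} {f ⊛ g ⊕ f ⊛ h} (⊛-distribʳ f g h)
            (⊕-cong {g ⊛ f} {f ⊛ g} {h ⊛ f} {f ⊛ h} (⊛-comm g f) (⊛-comm h f)))) , ⊛-distribʳ }
    ; *-comm = ⊛-comm } }
  where
  C0 : ∀ t → C 0ℚ t ≡ 0ℚ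
  C0 zero = refl
  C0 (suc t) = refl
  1⊛ : ∀ f → C 1ℚ ⊛ f ≈ f
  1⊛ f t = trans (C⊛ 1ℚ f t) (*-identityˡ (f t))

infixr 8 _⇑_
_⇑_ : PS → ℕ → PS
f ⇑ zero = C 1ℚ
f ⇑ suc n = f ⊛ (f ⇑ n)

open import Algebra.Solver.Ring.NaturalCoefficients.Default (CommutativeRing.commutativeSemiring PS-ring) using () renaming (solve to PS-solve; _:*_ to _:⊛_; _:+_ to _:⊕_; _:=_ to _:≈_)

open CommutativeRing PS-ring using () renaming (setoid to PS-setoid; *-identityʳ to PS-*-identityʳ)

⊛-congˡ : ∀ f {g g′} → g ≈ g′ → f ⊛ g ≈ f ⊛ g′
⊛-congˡ f {g} {g′} e = ⊛-cong {f} {f} {g} {g′} (λ _ → refl) e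

⊛-congʳ : ∀ {f f′} g → f ≈ f′ → f ⊛ g ≈ f′ ⊛ g
⊛-congʳ {f} {f′} g e = ⊛-cong {f} {f′} {g} {g} e (λ _ → refl)

-- Partial fractions

⊛-∑ : ∀ Y n (F : ℕ → PS) → Y ⊛ (λ t → ∑ n (λ i → F i t)) ≈ (λ t → ∑ n (λ i → (Y ⊛ F i) t))
⊛-∑ Y zero F t = trans (⊛-comm Y (λ _ → 0ℚ) t) (0⊛ (λ _ → refl) Y t)
⊛-∑ Y (suc n) F t = trans (r Y (λ t → ∑ n (λ i → F i t)) (F n) t) (cong (_+ (Y ⊛ F n) t) (⊛-∑ Y n F t))
  where
  r : ∀ a b c → a ⊛ (b ⊕ c) ≈ a ⊛ b ⊕ a ⊛ c
  r = PS-solve 3 (λ a b c → a :⊛ (b :⊕ c) :≈ a :⊛ b :⊕ a :⊛ c) (λ _ → refl)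

⊛-*ˡ : ∀ Y c f t → (Y ⊛ (λ s → c * f s)) t ≡ c * (Y ⊛ f) t
⊛-*ˡ Y c f t = trans (⊛-comm Y (λ s → c * f s) t) (trans (⊛-scale c f Y t) (cong (c *_) (⊛-comm f Y t)))

-- The factor (a₀ + a₁ x) / (1 - x a k)
record Factor : Set where
  constructor factor
  field
    a₀ a₁ : ℚ
    pole : ℕ
open Factor public

module PartialFractions
  (n : ℕ) (a a⁻ : ℕ → ℚ)
  (a-distinct : (i k : ℕ) → i ≢ k → a i - a k ≢ 0ℚ)
  (a-inverse : (k : ℕ) → a k * a⁻ k ≡ 1ℚ)
  where

  -- For η i = 1 / (1 - x a i) one has η i η k = lam i k * η i + mu i k * η k when i and k differ.
  lam mu : ℕ → ℕ → ℚ
  lam i k = a i * inv (a i - a k)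
  mu i k = - (a k * inv (a i - a k))

  -- A homogenised version of the relations between the functions η i = 1 / (1 - x a i).
  record Model : Set where
    field
      h : PS
      η : ℕ → PS
      rel : ∀ i k → i ℕ.≤ n → k ℕ.≤ n → i ≢ k → η i ⊛ η k ≈ h ⊛ (C (lam i k) ⊛ η i ⊕ C (mu i k) ⊛ η k)
  open Model public

  basis : Model → ℕ → ℕ → ℕ → PS
  basis M T j s = h M ⇑ (T ℕ.∸ s) ⊛ η M j ⇑ s

  ev : Model → ℕ → (ℕ → ℕ → ℚ) → PS
  ev M T g t = ∑ (suc n) (λ j → ∑ (suc T) (λ s → g j s * basis M T j s t))

  -- The coefficients are chosen before the model, so one array serves for local expansions, at
  -- infinity and at numerical x. Facts about the coefficients are then read off by choosing a
  -- model; no independence of the basis functions is proved.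
  record PF (T : ℕ) (X : Model → PS) : Set where
    constructor pf
    field
      coeff : ℕ → ℕ → ℚ
      expansion : ∀ M → X M ≈ ev M T coeff

  pf-cong : ∀ {T} {X Y : Model → PS} → (∀ M → Y M ≈ X M) → PF T X → PF T Y
  pf-cong e (pf g p) = pf g λ M t → trans (e M t) (p M t)

  pf-+ : ∀ {T X Y} → PF T X → PF T Y → PF T (λ M → X M ⊕ Y M)
  pf-+ {T} (pf g p) (pf g′ p′) = pf (λ j s → g j s + g′ j s) λ M t → trans (cong₂ _+_ (p M t) (p′ M t))
    (sym (trans (∑-cong (suc n) (λ j _ → trans
      (∑-cong (suc T) (λ s _ → *-distribʳ-+ (basis M T j s t) (g j s) (g′ j s)))
      (∑-+ (suc T) (λ s → g j s * basis M T j s t) (λ s → g′ j s * basis M T j s t))))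
      (∑-+ (suc n) (λ j → ∑ (suc T) (λ s → g j s * basis M T j s t)) (λ j → ∑ (suc T) (λ s → g′ j s * basis M T j s t)))))

  pf-scale : ∀ {T X} c → PF T X → PF T (λ M t → c * X M t)
  pf-scale {T} c (pf g p) = pf (λ j s → c * g j s) λ M t → trans (cong (c *_) (p M t))
    (sym (trans (∑-cong (suc n) (λ j _ → trans
      (∑-cong (suc T) (λ s _ → *-assoc c (g j s) (basis M T j s t)))
      (∑-*ˡ (suc T) c (λ s → g j s * basis M T j s t))))
      (∑-*ˡ (suc n) c (λ j → ∑ (suc T) (λ s → g j s * basis M T j s t)))))

  pf-0 : ∀ {T} → PF T (λ M t → 0ℚ)
  pf-0 {T} = pf (λ _ _ → 0ℚ) λ M t → sym (∑-0 (suc n) (λ j _ → ∑-0 (suc T) (λ s _ → *-zeroˡ (basis M T j s t))))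

  pf-∑ : ∀ {T} N (X : ℕ → Model → PS) → (∀ i → i ℕ.< N → PF T (X i)) → PF T (λ M t → ∑ N (λ i → X i M t))
  pf-∑ zero X h = pf-0
  pf-∑ (suc N) X h = pf-+ (pf-∑ N X (λ i i<N → h i (ℕP.m<n⇒m<1+n i<N))) (h N ℕP.≤-refl)

  pf-basis : ∀ {T} j s → j ℕ.≤ n → s ℕ.≤ T → PF T (λ M → basis M T j s)
  pf-basis {T} j s j≤n s≤T = pf δ′ λ M t → sym (trans
      (∑-single (suc n) j (λ j′ → ∑ (suc T) (λ s′ → δ′ j′ s′ * basis M T j′ s′ t)) (s≤s j≤n)
        (λ i i≢j → ∑-0 (suc T) (λ s′ _ → trans (cong (_* basis M T i s′ t) (δ′-j i s′ i≢j)) (*-zeroˡ (basis M T i s′ t)))))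
      (trans (∑-single (suc T) s (λ s′ → δ′ j s′ * basis M T j s′ t) (s≤s s≤T)
        (λ i i≢s → trans (cong (_* basis M T j i t) (δ′-s j i i≢s)) (*-zeroˡ (basis M T j i t))))
      (trans (cong (_* basis M T j s t) δ′-1) (*-identityˡ _))))
    where
    δ′ : ℕ → ℕ → ℚ
    δ′ j′ s′ with j′ ℕP.≟ j | s′ ℕP.≟ s
    ... | yes _ | yes _ = 1ℚ
    ... | yes _ | no _ = 0ℚ
    ... | no _ | _ = 0ℚ
    δ′-j : ∀ i s′ → i ≢ j → δ′ i s′ ≡ 0ℚ
    δ′-j i s′ i≢j with i ℕP.≟ j | s′ ℕP.≟ s
    ... | yes e | _ = ⊥-elim (i≢j e)
    ... | no _ | _ = refl
    δ′-s : ∀ i s′ → s′ ≢ s → δ′ i s′ ≡ 0ℚ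
    δ′-s i s′ s′≢s with i ℕP.≟ j | s′ ℕP.≟ s
    ... | yes _ | yes e = ⊥-elim (s′≢s e)
    ... | yes _ | no _ = refl
    ... | no _ | _ = refl
    δ′-1 : δ′ j s ≡ 1ℚ
    δ′-1 with j ℕP.≟ j | s ℕP.≟ s
    ... | yes _ | yes _ = refl
    ... | yes _ | no ¬e = ⊥-elim (¬e refl)
    ... | no ¬e | _ = ⊥-elim (¬e refl)

  private
    -- For j = k the exponent of η rises by one. Otherwise the relation of the model splits off one
    -- factor η j and lowers s, down to s = 0, where η k alone remains.
    pf-η-basis : ∀ {T} k j s → k ℕ.≤ n → j ℕ.≤ n → s ℕ.≤ T → PF (suc T) (λ M → η M k ⊛ basis M T j s)
    pf-η-basis {T} k j s k≤n j≤n s≤T with j ℕP.≟ k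
    ... | yes refl = pf-cong (λ M → r (η M k) (h M ⇑ (T ℕ.∸ s)) (η M k ⇑ s)) (pf-basis k (suc s) k≤n (s≤s s≤T))
      where
      r : ∀ a b c → a ⊛ (b ⊛ c) ≈ b ⊛ (a ⊛ c)
      r = PS-solve 3 (λ a b c → a :⊛ (b :⊛ c) :≈ b :⊛ (a :⊛ c)) (λ _ → refl)
    ... | no j≢k = go s s≤T
      where
      go : ∀ s → s ℕ.≤ T → PF (suc T) (λ M → η M k ⊛ basis M T j s)
      go zero _ = pf-cong (λ M → r (η M k) (h M ⇑ T) (C 1ℚ)) (pf-basis k 1 k≤n (s≤s z≤n))
        where
        r : ∀ a b c → a ⊛ (b ⊛ c) ≈ b ⊛ (a ⊛ c)
        r = PS-solve 3 (λ a b c → a :⊛ (b :⊛ c) :≈ b :⊛ (a :⊛ c)) (λ _ → refl)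
      go (suc s) s<T = pf-cong step
        (pf-+ (pf-scale (lam j k) (pf-basis j (suc s) j≤n (ℕP.m≤n⇒m≤1+n s<T)))
              (pf-scale (mu j k) (go s (ℕP.<⇒≤ s<T))))
        where
        step : ∀ M → η M k ⊛ basis M T j (suc s) ≈ (λ t → lam j k * basis M (suc T) j (suc s) t) ⊕ (λ t → mu j k * (η M k ⊛ basis M T j s) t)
        step M = begin
          ηk ⊛ (hh ⊛ (ηj ⊛ ηs))
            ≈⟨ r₁ ηk hh ηj ηs ⟩
          (ηj ⊛ ηk) ⊛ (hh ⊛ ηs)
            ≈⟨ ⊛-congʳ (hh ⊛ ηs) (rel M j k j≤n k≤n j≢k) ⟩
          (h M ⊛ (C (lam j k) ⊛ ηj ⊕ C (mu j k) ⊛ ηk)) ⊛ (hh ⊛ ηs)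
            ≈⟨ r₂ (h M) (C (lam j k)) ηj (C (mu j k)) ηk hh ηs ⟩
          C (lam j k) ⊛ ((h M ⊛ hh) ⊛ (ηj ⊛ ηs)) ⊕ C (mu j k) ⊛ (ηk ⊛ ((h M ⊛ hh) ⊛ ηs))
            ≈⟨ (λ t → cong₂ _+_ (trans (C⊛ (lam j k) _ t) (cong (λ d → lam j k * (h M ⇑ d ⊛ (ηj ⊛ ηs)) t) hh≡))
                                (trans (C⊛ (mu j k) _ t) (cong (λ d → mu j k * (ηk ⊛ (h M ⇑ d ⊛ ηs)) t) hh≡))) ⟩
          (λ t → lam j k * basis M (suc T) j (suc s) t) ⊕ (λ t → mu j k * (ηk ⊛ basis M T j s) t) ∎
          where
          open Relation.Binary.Reasoning.Setoid PS-setoid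
          ηk = η M k
          ηj = η M j
          ηs = η M j ⇑ s
          hh = h M ⇑ (T ℕ.∸ suc s)
          hh≡ : suc (T ℕ.∸ suc s) ≡ T ℕ.∸ s
          hh≡ = sym (ℕP.+-∸-assoc 1 s<T)
          r₁ : ∀ a b c d → a ⊛ (b ⊛ (c ⊛ d)) ≈ (c ⊛ a) ⊛ (b ⊛ d)
          r₁ = PS-solve 4 (λ a b c d → a :⊛ (b :⊛ (c :⊛ d)) :≈ (c :⊛ a) :⊛ (b :⊛ d)) (λ _ → refl)
          r₂ : ∀ x l e u k y z → (x ⊛ (l ⊛ e ⊕ u ⊛ k)) ⊛ (y ⊛ z) ≈ l ⊛ ((x ⊛ y) ⊛ (e ⊛ z)) ⊕ u ⊛ (k ⊛ ((x ⊛ y) ⊛ z))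
          r₂ = PS-solve 7 (λ x l e u k y z → (x :⊛ (l :⊛ e :⊕ u :⊛ k)) :⊛ (y :⊛ z) :≈ l :⊛ ((x :⊛ y) :⊛ (e :⊛ z)) :⊕ u :⊛ (k :⊛ ((x :⊛ y) :⊛ z))) (λ _ → refl)

    pf-h-basis : ∀ {T} j s → j ℕ.≤ n → s ℕ.≤ T → PF (suc T) (λ M → h M ⊛ basis M T j s)
    pf-h-basis {T} j s j≤n s≤T = pf-cong (λ M t → trans (sym (⊛-assoc (h M) (h M ⇑ (T ℕ.∸ s)) (η M j ⇑ s) t))
        (cong (λ d → (h M ⇑ d ⊛ η M j ⇑ s) t) (sym (ℕP.+-∸-assoc 1 s≤T))))
      (pf-basis j s j≤n (ℕP.m≤n⇒m≤1+n s≤T))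

    pf-⊛ : ∀ {T X} (Y : Model → PS) → (∀ j s → j ℕ.≤ n → s ℕ.≤ T → PF (suc T) (λ M → Y M ⊛ basis M T j s)) →
           PF T X → PF (suc T) (λ M → Y M ⊛ X M)
    pf-⊛ {T} {X} Y H (pf g p) = pf-cong
      (λ M t → trans (⊛-congˡ (Y M) (p M) t) (trans (⊛-∑ (Y M) (suc n) (λ j t → ∑ (suc T) (λ s → g j s * basis M T j s t)) t)
        (∑-cong (suc n) (λ j _ → trans (⊛-∑ (Y M) (suc T) (λ s t → g j s * basis M T j s t) t)
          (∑-cong (suc T) (λ s _ → ⊛-*ˡ (Y M) (g j s) (basis M T j s) t))))))
      (pf-∑ (suc n) (λ j M t → ∑ (suc T) (λ s → g j s * (Y M ⊛ basis M T j s) t)) (λ j j<n →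
        pf-∑ (suc T) (λ s M t → g j s * (Y M ⊛ basis M T j s) t) (λ s s<T → pf-scale (g j s) (H j s (ℕP.≤-pred j<n) (ℕP.≤-pred s<T)))))

  -- Division with remainder: (a₀ + a₁ x) / (1 - x a k) = α + β η k, with a⁻ k = 1 / a k.
  α β : Factor → ℚ
  α f = - (a₁ f * a⁻ (pole f))
  β f = a₀ f + a₁ f * a⁻ (pole f)

  facPS : Model → Factor → PS
  facPS M f = C (α f) ⊛ h M ⊕ C (β f) ⊛ η M (pole f)

  prodPS : Model → List Factor → PS
  prodPS M [] = C 1ℚ
  prodPS M (f ∷ fs) = facPS M f ⊛ prodPS M fs

  partial-fractions : ∀ fs → All (λ f → pole f ℕ.≤ n) fs → PF (length fs) (λ M → prodPS M fs)
  partial-fractions [] [] = pf-cong (λ M t → sym (PS-*-identityʳ (C 1ℚ) t)) (pf-basis 0 0 z≤n z≤n)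
  partial-fractions (f ∷ fs) (k≤n ∷ ks) = pf-cong
    (λ M t → trans (r (C (α f)) (h M) (C (β f)) (η M (pole f)) (prodPS M fs) t)
       (cong₂ _+_ (C⊛ (α f) (h M ⊛ prodPS M fs) t) (C⊛ (β f) (η M (pole f) ⊛ prodPS M fs) t)))
    (pf-+ (pf-scale (α f) (pf-⊛ h pf-h-basis ih)) (pf-scale (β f) (pf-⊛ (λ M → η M (pole f)) (λ j s → pf-η-basis (pole f) j s k≤n) ih)))
    where
    ih = partial-fractions fs ks
    r : ∀ x y z w p → (x ⊛ y ⊕ z ⊛ w) ⊛ p ≈ x ⊛ (y ⊛ p) ⊕ z ⊛ (w ⊛ p)
    r = PS-solve 5 (λ x y z w p → (x :⊛ y :⊕ z :⊛ w) :⊛ p :≈ x :⊛ (y :⊛ p) :⊕ z :⊛ (w :⊛ p)) (λ _ → refl)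

  -- The combination lam i k * (1 - a k X) + mu i k * (1 - a i X) is 1; multiplying η i η k by it
  -- and cancelling with the hypothesis gives the relation.
  mkModel : (X hh : PS) (ηη : ℕ → PS) → (∀ i → i ℕ.≤ n → ηη i ⊛ (C 1ℚ ⊕ C (- a i) ⊛ X) ≈ hh) → Model
  mkModel X hh ηη eq = record { h = hh ; η = ηη ; rel = rl }
    where
    rl : ∀ i k → i ℕ.≤ n → k ℕ.≤ n → i ≢ k → ηη i ⊛ ηη k ≈ hh ⊛ (C (lam i k) ⊛ ηη i ⊕ C (mu i k) ⊛ ηη k)
    rl i k i≤n k≤n i≢k = begin
      ηi ⊛ ηk                                                   ≈⟨ (λ t → sym (PS-*-identityʳ (ηi ⊛ ηk) t)) ⟩
      (ηi ⊛ ηk) ⊛ C 1ℚ                                         ≈⟨ ⊛-congˡ (ηi ⊛ ηk) one ⟩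
      (ηi ⊛ ηk) ⊛ (C l ⊛ ℓ k ⊕ C κ ⊛ ℓ i)                      ≈⟨ r₁ ηi ηk (C l) (ℓ k) (C κ) (ℓ i) ⟩
      (ηk ⊛ ℓ k) ⊛ (C l ⊛ ηi) ⊕ (ηi ⊛ ℓ i) ⊛ (C κ ⊛ ηk)        ≈⟨ (λ t → cong₂ _+_ (⊛-congʳ (C l ⊛ ηi) (eq k k≤n) t) (⊛-congʳ (C κ ⊛ ηk) (eq i i≤n) t)) ⟩
      hh ⊛ (C l ⊛ ηi) ⊕ hh ⊛ (C κ ⊛ ηk)                        ≈⟨ r₂ hh (C l ⊛ ηi) (C κ ⊛ ηk) ⟩
      hh ⊛ (C l ⊛ ηi ⊕ C κ ⊛ ηk) ∎
      where
      open Relation.Binary.Reasoning.Setoid PS-setoid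
      ηi = ηη i
      ηk = ηη k
      l = lam i k
      κ = mu i k
      ℓ : ℕ → PS
      ℓ i = C 1ℚ ⊕ C (- a i) ⊛ X
      r₁ : ∀ a b c d e f → (a ⊛ b) ⊛ (c ⊛ d ⊕ e ⊛ f) ≈ (b ⊛ d) ⊛ (c ⊛ a) ⊕ (a ⊛ f) ⊛ (e ⊛ b)
      r₁ = PS-solve 6 (λ a b c d e f → (a :⊛ b) :⊛ (c :⊛ d :⊕ e :⊛ f) :≈ (b :⊛ d) :⊛ (c :⊛ a) :⊕ (a :⊛ f) :⊛ (e :⊛ b)) (λ _ → refl)
      r₂ : ∀ a b c → a ⊛ b ⊕ a ⊛ c ≈ a ⊛ (b ⊕ c)
      r₂ = PS-solve 3 (λ a b c → a :⊛ b :⊕ a :⊛ c :≈ a :⊛ (b :⊕ c)) (λ _ → refl)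
      D = inv (a i - a k)
      q₂ : ∀ x y d k z → x * d * (k + - y * z) + - (y * d) * (k + - x * z) ≡ (x - y) * d * k
      q₂ = solve-∀ ℚring
      one : C 1ℚ ≈ C l ⊛ ℓ k ⊕ C κ ⊛ ℓ i
      one t = sym (trans (cong₂ _+_ (trans (C⊛ l (ℓ k) t) (cong (λ z → l * (C 1ℚ t + z)) (C⊛ (- a k) X t)))
                                   (trans (C⊛ κ (ℓ i) t) (cong (λ z → κ * (C 1ℚ t + z)) (C⊛ (- a i) X t))))
        (trans (q₂ (a i) (a k) D (C 1ℚ t) (X t)) (trans (cong (_* C 1ℚ t) (*-inv (a-distinct i k i≢k))) (*-identityˡ _))))

  -- All functions 1 / (1 - x a i) vanish at x = ∞.
  atInfinity : Model
  atInfinity = record { h = C 1ℚ ; η = λ _ → C 0ℚ ; rel = λ i k _ _ _ t → trans (zero⊛ (C 0ℚ) t) (sym (trans (C⊛ 1ℚ _ t)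
    (trans (*-identityˡ _) (cong₂ _+_ (⊛zero (C (lam i k)) t) (⊛zero (C (mu i k)) t))))) }
    where
    C0 : ∀ t → C 0ℚ t ≡ 0ℚ
    C0 zero = refl
    C0 (suc t) = refl
    zero⊛ : ∀ f t → (C 0ℚ ⊛ f) t ≡ 0ℚ
    zero⊛ f = 0⊛ C0 f
    ⊛zero : ∀ f t → (f ⊛ C 0ℚ) t ≡ 0ℚ
    ⊛zero f t = trans (⊛-comm f (C 0ℚ) t) (zero⊛ f t)

-- Local expansions at a pole and the coefficients they determine.

aff : ℚ → ℚ → PS
aff a b zero = a
aff a b (suc t) = C b t

aff⊛suc : ∀ a b f t → (aff a b ⊛ f) (suc t) ≡ a * f (suc t) + b * f t
aff⊛suc a b f t = cong (a * f (suc t) +_) (C⊛ b f t)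

𝕎⇑-low : ∀ k f t → t ℕ.< k → (𝕎 ⇑ k ⊛ f) t ≡ 0ℚ
𝕎⇑-low (suc k) f zero _ = trans (⊛-assoc 𝕎 (𝕎 ⇑ k) f 0) (𝕎⊛0 (𝕎 ⇑ k ⊛ f))
𝕎⇑-low (suc k) f (suc t) (s≤s t<k) = trans (⊛-assoc 𝕎 (𝕎 ⇑ k) f (suc t)) (trans (𝕎⊛suc (𝕎 ⇑ k ⊛ f) t) (𝕎⇑-low k f t t<k))

𝕎⇑-high : ∀ k f t → (𝕎 ⇑ k ⊛ f) (k ℕ.+ t) ≡ f t
𝕎⇑-high zero f t = trans (C⊛ 1ℚ f t) (*-identityˡ (f t))
𝕎⇑-high (suc k) f t = trans (⊛-assoc 𝕎 (𝕎 ⇑ k) f (suc (k ℕ.+ t))) (trans (𝕎⊛suc (𝕎 ⇑ k ⊛ f) (k ℕ.+ t)) (𝕎⇑-high k f t))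

⇑-+ : ∀ f a b → f ⇑ (a ℕ.+ b) ≈ f ⇑ a ⊛ f ⇑ b
⇑-+ f zero b t = sym (trans (C⊛ 1ℚ (f ⇑ b) t) (*-identityˡ _))
⇑-+ f (suc a) b t = trans (⊛-congˡ f (⇑-+ f a b) t) (sym (⊛-assoc f (f ⇑ a) (f ⇑ b) t))

⇑-⊛ : ∀ f g k → (f ⊛ g) ⇑ k ≈ f ⇑ k ⊛ g ⇑ k
⇑-⊛ f g zero t = sym (trans (C⊛ 1ℚ (C 1ℚ) t) (*-identityˡ _))
⇑-⊛ f g (suc k) t = trans (⊛-congˡ (f ⊛ g) (⇑-⊛ f g k) t) (r f g (f ⇑ k) (g ⇑ k) t)
  where
  r : ∀ a b c d → (a ⊛ b) ⊛ (c ⊛ d) ≈ (a ⊛ c) ⊛ (b ⊛ d)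
  r = PS-solve 4 (λ a b c d → (a :⊛ b) :⊛ (c :⊛ d) :≈ (a :⊛ c) :⊛ (b :⊛ d)) (λ _ → refl)

1⇑ : ∀ k → C 1ℚ ⇑ k ≈ C 1ℚ
1⇑ zero t = refl
1⇑ (suc k) t = trans (C⊛ 1ℚ (C 1ℚ ⇑ k) t) (trans (*-identityˡ _) (1⇑ k t))

C1-pos : ∀ {t} → t ≢ 0 → C 1ℚ t ≡ 0ℚ
C1-pos {zero} h = ⊥-elim (h refl)
C1-pos {suc t} h = refl

-- The linear numerators 1, x, 1 - x q^(-k), 1 - x q^i, and 1 ∓ x q^i. `high` and `minus` denote the
-- same polynomial; cyclotomic divisibility at a pole is claimed only for `high`.
data Num : Set where
  one var : Num
  low high minus plus : ℕ → Num

module Expansion (p : ℤ) (2≤p : 2 ℕ.≤ ℤ.∣ p ∣) (q : ℚ) (qP : q * ι p ≡ 1ℚ) (n : ℕ) where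

  open Arith p 2≤p q qP n public

  qP′ : ∀ a b → q ↑ (a ℕ.+ b) * P ↑ a ≡ q ↑ b
  qP′ a b = trans (cong (_* P ↑ a) (↑-+ q a b)) (trans (r (q ↑ a) (q ↑ b) (P ↑ a)) (trans (cong (_* q ↑ b) (qP^ a)) (*-identityˡ _)))
    where
    r : ∀ a b c → a * b * c ≡ a * c * b
    r = solve-∀ ℚring

  qP″ : ∀ a b → q ↑ a * P ↑ (a ℕ.+ b) ≡ P ↑ b
  qP″ a b = trans (cong (q ↑ a *_) (↑-+ P a b)) (trans (sym (*-assoc (q ↑ a) (P ↑ a) (P ↑ b))) (trans (cong (_* P ↑ b) (qP^ a)) (*-identityˡ _)))

  1-qP : ∀ d → P ↑ d * (1ℚ - q ↑ d) ≡ P ↑ d - 1ℚ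
  1-qP d = trans (r (P ↑ d) (q ↑ d)) (cong (λ z → P ↑ d - z) (qP^ d))
    where
    r : ∀ a b → a * (1ℚ - b) ≡ a - b * a
    r = solve-∀ ℚring

  1-q^≢0 : ∀ d → 1ℚ - q ↑ suc d ≢ 0ℚ
  1-q^≢0 d e = U≢0 d (trans (sym (1-qP (suc d))) (trans (cong (P ↑ suc d *_) e) (*-zeroʳ (P ↑ suc d))))

  q-distinct< : ∀ i d → q ↑ i - q ↑ (i ℕ.+ suc d) ≢ 0ℚ
  q-distinct< i d e = *-≢0 (↑-≢0 i q≢0) (1-q^≢0 d) (trans (sym (trans (cong (λ z → q ↑ i - z) (↑-+ q i (suc d))) (r (q ↑ i) (q ↑ suc d)))) e)
    where
    r : ∀ a b → a - a * b ≡ a * (1ℚ - b)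
    r = solve-∀ ℚring

  q-distinct : ∀ i k → i ≢ k → q ↑ i - q ↑ k ≢ 0ℚ
  q-distinct i k i≢k e = go (ℕP.<-cmp i k)
    where
    r : ∀ a b → a - b ≡ - (b - a)
    r = solve-∀ ℚring
    lemma : ∀ i k → i ℕ.< k → q ↑ i - q ↑ k ≢ 0ℚ
    lemma i k i<k = subst (λ k → q ↑ i - q ↑ k ≢ 0ℚ) (trans (ℕP.+-suc i _) (ℕP.m+[n∸m]≡n i<k)) (q-distinct< i (k ℕ.∸ suc i))
    go : _ → _
    go (tri< i<k _ _) = lemma i k i<k e
    go (tri≈ _ i≡k _) = i≢k i≡k
    go (tri> _ _ k<i) = lemma k i k<i (trans (r (q ↑ k) (q ↑ i)) (cong -_ e))

  open PartialFractions n (q ↑_) (P ↑_) q-distinct qP^ public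

  num₀ num₁ : Num → ℚ
  num₀ one = 1ℚ
  num₀ var = 0ℚ
  num₀ (low _) = 1ℚ
  num₀ (high _) = 1ℚ
  num₀ (minus _) = 1ℚ
  num₀ (plus _) = 1ℚ
  num₁ one = 0ℚ
  num₁ var = 1ℚ
  num₁ (low k) = - P ↑ k
  num₁ (high i) = - q ↑ i
  num₁ (minus i) = - q ↑ i
  num₁ (plus i) = q ↑ i

  mkFactor : Num → ℕ → Factor
  mkFactor N k = factor (num₀ N) (num₁ N) k

  module Local (j : ℕ) where

    -- The value of q^k x at x = q^(-j). Near that point x = q^(-j) (1 - 𝕎), the series `X`, and `ω`
    -- k is the geometric expansion of 1 / (1 - q^k x), whose denominator is `ℓ` k.
    cst : ℕ → ℚ
    cst k = q ↑ k * P ↑ j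

    ω : ℕ → PS
    ω k t = inv (1ℚ - cst k) * (- (cst k * inv (1ℚ - cst k))) ↑ t

    ℓ : ℕ → PS
    ℓ k = aff (1ℚ - cst k) (cst k)

    cst-j : cst j ≡ 1ℚ
    cst-j = qP^ j

    cst≢1 : ∀ k → k ≢ j → 1ℚ - cst k ≢ 0ℚ
    cst≢1 k k≢j e = *-≢0 (q-distinct j k (λ x → k≢j (sym x))) (↑-≢0 j P≢0)
      (trans (r (q ↑ j) (q ↑ k) (P ↑ j)) (trans (cong (λ z → z - cst k) cst-j) e))
      where
      r : ∀ a b c → (a - b) * c ≡ a * c - b * c
      r = solve-∀ ℚring

    ℓω : ∀ k → k ≢ j → ℓ k ⊛ ω k ≈ C 1ℚ
    ℓω k k≢j zero = trans (cong ((1ℚ - cst k) *_) (*-identityʳ _)) (*-inv (cst≢1 k k≢j))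
    ℓω k k≢j (suc t) = trans (aff⊛suc (1ℚ - cst k) (cst k) (ω k) t)
      (trans (r (1ℚ - cst k) (cst k) (inv (1ℚ - cst k)) ((- (cst k * inv (1ℚ - cst k))) ↑ t))
        (trans (cong (λ z → (1ℚ - z) * (cst k * (inv (1ℚ - cst k) * (- (cst k * inv (1ℚ - cst k))) ↑ t))) (*-inv (cst≢1 k k≢j)))
          (r₂ (cst k * (inv (1ℚ - cst k) * (- (cst k * inv (1ℚ - cst k))) ↑ t)))))
      where
      r : ∀ x c y z → x * (y * (- (c * y) * z)) + c * (y * z) ≡ (1ℚ - x * y) * (c * (y * z))
      r = solve-∀ ℚring
      r₂ : ∀ z → (1ℚ - 1ℚ) * z ≡ 0ℚ
      r₂ = solve-∀ ℚring

    X : PS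
    X = aff (P ↑ j) (- P ↑ j)

    lin≈ℓ : ∀ k → C 1ℚ ⊕ C (- q ↑ k) ⊛ X ≈ ℓ k
    lin≈ℓ k zero = r (q ↑ k) (P ↑ j)
      where
      r : ∀ a b → 1ℚ + - a * b ≡ 1ℚ - a * b
      r = solve-∀ ℚring
    lin≈ℓ k (suc zero) = trans (cong (0ℚ +_) (C⊛ (- q ↑ k) X 1)) (r (q ↑ k) (P ↑ j))
      where
      r : ∀ a b → 0ℚ + - a * - b ≡ a * b
      r = solve-∀ ℚring
    lin≈ℓ k (suc (suc t)) = trans (cong (0ℚ +_) (C⊛ (- q ↑ k) X (suc (suc t)))) (r (q ↑ k))
      where
      r : ∀ a → 0ℚ + - a * 0ℚ ≡ 0ℚ
      r = solve-∀ ℚring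

    -- All functions are multiplied by h = 𝕎 to stay among power series: the singular one becomes 1
    -- and the others 𝕎 ω k.
    ηd : ∀ k → Dec (k ≡ j) → PS
    ηd k (yes _) = C 1ℚ
    ηd k (no _) = 𝕎 ⊛ ω k

    ηd-eq : ∀ k d → ηd k d ⊛ ℓ k ≈ 𝕎
    ηd-eq k (yes refl) t = trans (C⊛ 1ℚ (ℓ j) t) (trans (*-identityˡ _) (lem t))
      where
      lem : ℓ j ≈ 𝕎
      lem zero = trans (cong (λ z → 1ℚ - z) cst-j) (+-inverseʳ 1ℚ)
      lem (suc t) = cong (λ z → C z t) cst-j
    ηd-eq k (no k≢j) t = trans (r 𝕎 (ω k) (ℓ k) t) (trans (⊛-congˡ 𝕎 (ℓω k k≢j) t) (trans (⊛-comm 𝕎 (C 1ℚ) t) (trans (C⊛ 1ℚ 𝕎 t) (*-identityˡ _))))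
      where
      r : ∀ a b c → (a ⊛ b) ⊛ c ≈ a ⊛ (c ⊛ b)
      r = PS-solve 3 (λ a b c → (a :⊛ b) :⊛ c :≈ a :⊛ (c :⊛ b)) (λ _ → refl)

    local : Model
    local = mkModel X 𝕎 (λ k → ηd k (k ℕP.≟ j)) (λ k _ t → trans (⊛-congˡ (ηd k (k ℕP.≟ j)) (lin≈ℓ k) t) (ηd-eq k (k ℕP.≟ j) t))

    numPS : Factor → PS
    numPS f = aff (a₀ f + a₁ f * P ↑ j) (- (a₁ f * P ↑ j))

    facd : ∀ f → Dec (pole f ≡ j) → PS
    facd f (yes _) = numPS f
    facd f (no _) = numPS f ⊛ ω (pole f)

    shiftd : ∀ {k} → Dec (k ≡ j) → ℕ
    shiftd (yes _) = 0
    shiftd (no _) = 1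

    multd : ∀ {k} → Dec (k ≡ j) → ℕ
    multd (yes _) = 1
    multd (no _) = 0

    cnt mult : List Factor → ℕ
    cnt [] = 0
    cnt (f ∷ fs) = shiftd (pole f ℕP.≟ j) ℕ.+ cnt fs
    mult [] = 0
    mult (f ∷ fs) = multd (pole f ℕP.≟ j) ℕ.+ mult fs

    cnt+mult : ∀ fs → cnt fs ℕ.+ mult fs ≡ length fs
    cnt+mult [] = refl
    cnt+mult (f ∷ fs) = go (pole f ℕP.≟ j)
      where
      go : (d : Dec (pole f ≡ j)) → (shiftd d ℕ.+ cnt fs) ℕ.+ (multd d ℕ.+ mult fs) ≡ suc (length fs)
      go (yes _) = trans (ℕP.+-suc (cnt fs) (mult fs)) (cong suc (cnt+mult fs))
      go (no _) = cong suc (cnt+mult fs)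

    -- The product of the factors with its pole at j removed, that is, multiplied by 𝕎 to the power
    -- `mult`.
    𝕌 : List Factor → PS
    𝕌 [] = C 1ℚ
    𝕌 (f ∷ fs) = facd f (pole f ℕP.≟ j) ⊛ 𝕌 fs

    facPS-local : ∀ f (d : Dec (pole f ≡ j)) → C (α f) ⊛ 𝕎 ⊕ C (β f) ⊛ ηd (pole f) d ≈ 𝕎 ⇑ shiftd d ⊛ facd f d
    facPS-local f (yes e) t = trans (cong₂ _+_ (C⊛ (α f) 𝕎 t) (C⊛ (β f) (C 1ℚ) t)) (trans (lem t) (sym (trans (C⊛ 1ℚ (numPS f) t) (*-identityˡ _))))
      where
      r₀ : ∀ a b → a * 0ℚ + b * 1ℚ ≡ b
      r₀ = solve-∀ ℚring
      r₁ : ∀ a b → a * 1ℚ + b * 0ℚ ≡ a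
      r₁ = solve-∀ ℚring
      r₂ : ∀ a b → a * 0ℚ + b * 0ℚ ≡ 0ℚ
      r₂ = solve-∀ ℚring
      lem : ∀ t → α f * 𝕎 t + β f * C 1ℚ t ≡ numPS f t
      lem zero = trans (r₀ (α f) (β f)) (cong (λ k → a₀ f + a₁ f * P ↑ k) e)
      lem (suc zero) = trans (r₁ (α f) (β f)) (cong (λ k → - (a₁ f * P ↑ k)) e)
      lem (suc (suc t)) = r₂ (α f) (β f)
    facPS-local f (no k≢j) t = trans (r (C (α f)) 𝕎 (C (β f)) (ω k) t)
      (trans (⊛-congˡ 𝕎 step t) (⊛-congʳ (numPS f ⊛ ω k) (λ t → sym (trans (⊛-comm 𝕎 (C 1ℚ) t) (trans (C⊛ 1ℚ 𝕎 t) (*-identityˡ _)))) t))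
      where
      k = pole f
      r : ∀ a w b o → a ⊛ w ⊕ b ⊛ (w ⊛ o) ≈ w ⊛ (a ⊕ b ⊛ o)
      r = PS-solve 4 (λ a w b o → a :⊛ w :⊕ b :⊛ (w :⊛ o) :≈ w :⊛ (a :⊕ b :⊛ o)) (λ _ → refl)
      r₂ : ∀ a l b o → (a ⊛ l ⊕ b) ⊛ o ≈ a ⊛ (l ⊛ o) ⊕ b ⊛ o
      r₂ = PS-solve 4 (λ a l b o → (a :⊛ l :⊕ b) :⊛ o :≈ a :⊛ (l :⊛ o) :⊕ b :⊛ o) (λ _ → refl)
      Pc : P ↑ k * cst k ≡ P ↑ j
      Pc = trans (r₃ (P ↑ k) (q ↑ k) (P ↑ j)) (trans (cong (_* P ↑ j) (qP^ k)) (*-identityˡ _))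
        where
        r₃ : ∀ a b c → a * (b * c) ≡ b * a * c
        r₃ = solve-∀ ℚring
      num≈ : numPS f ≈ C (α f) ⊛ ℓ k ⊕ C (β f)
      num≈ zero = trans (cong (λ z → a₀ f + a₁ f * z) (sym Pc)) (r₄ (a₀ f) (a₁ f) (P ↑ k) (cst k))
        where
        r₄ : ∀ a b p c → a + b * (p * c) ≡ - (b * p) * (1ℚ - c) + (a + b * p)
        r₄ = solve-∀ ℚring
      num≈ (suc zero) = trans (cong (λ z → - (a₁ f * z)) (sym Pc)) (trans (r₅ (a₁ f) (P ↑ k) (cst k)) (cong (_+ 0ℚ) (sym (C⊛ (α f) (ℓ k) 1))))
        where
        r₅ : ∀ b p c → - (b * (p * c)) ≡ - (b * p) * c + 0ℚ
        r₅ = solve-∀ ℚring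
      num≈ (suc (suc t)) = trans (r₆ (α f)) (cong (_+ 0ℚ) (sym (C⊛ (α f) (ℓ k) (suc (suc t)))))
        where
        r₆ : ∀ a → 0ℚ ≡ a * 0ℚ + 0ℚ
        r₆ = solve-∀ ℚring
      step : C (α f) ⊕ C (β f) ⊛ ω k ≈ numPS f ⊛ ω k
      step t = sym (trans (⊛-congʳ (ω k) num≈ t) (trans (r₂ (C (α f)) (ℓ k) (C (β f)) (ω k) t)
        (cong (_+ (C (β f) ⊛ ω k) t) (trans (⊛-congˡ (C (α f)) (ℓω k k≢j) t) (trans (⊛-comm (C (α f)) (C 1ℚ) t) (trans (C⊛ 1ℚ (C (α f)) t) (*-identityˡ (C (α f) t))))))))

    prodPS-local : ∀ fs → prodPS local fs ≈ 𝕎 ⇑ cnt fs ⊛ 𝕌 fs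
    prodPS-local [] t = sym (trans (C⊛ 1ℚ (C 1ℚ) t) (*-identityˡ _))
    prodPS-local (f ∷ fs) t = trans (⊛-cong (facPS-local f (pole f ℕP.≟ j)) (prodPS-local fs) t)
      (trans (r (𝕎 ⇑ shiftd (pole f ℕP.≟ j)) (facd f (pole f ℕP.≟ j)) (𝕎 ⇑ cnt fs) (𝕌 fs) t)
        (⊛-congʳ (facd f (pole f ℕP.≟ j) ⊛ 𝕌 fs) (λ t → sym (⇑-+ 𝕎 (shiftd (pole f ℕP.≟ j)) (cnt fs) t)) t))
      where
      r : ∀ a b c d → (a ⊛ b) ⊛ (c ⊛ d) ≈ (a ⊛ c) ⊛ (b ⊛ d)
      r = PS-solve 4 (λ a b c d → (a :⊛ b) :⊛ (c :⊛ d) :≈ (a :⊛ c) :⊛ (b :⊛ d)) (λ _ → refl)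

    basis-other : ∀ T i s t (d : Dec (i ≡ j)) → i ≢ j → s ℕ.≤ T → t ℕ.< T → (𝕎 ⇑ (T ℕ.∸ s) ⊛ ηd i d ⇑ s) t ≡ 0ℚ
    basis-other T i s t (yes e) i≢j _ _ = ⊥-elim (i≢j e)
    basis-other T i s t (no _) _ s≤T t<T = trans (⊛-congˡ (𝕎 ⇑ (T ℕ.∸ s)) (⇑-⊛ 𝕎 (ω i) s) t)
      (trans (sym (⊛-assoc (𝕎 ⇑ (T ℕ.∸ s)) (𝕎 ⇑ s) (ω i ⇑ s) t))
        (trans (⊛-congʳ (ω i ⇑ s) (λ t → sym (⇑-+ 𝕎 (T ℕ.∸ s) s t)) t)
          (𝕎⇑-low ((T ℕ.∸ s) ℕ.+ s) (ω i ⇑ s) t (subst (t ℕ.<_) (sym (ℕP.m∸n+n≡m s≤T)) t<T))))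

    basis-j : ∀ T s (d : Dec (j ≡ j)) → 𝕎 ⇑ (T ℕ.∸ s) ⊛ ηd j d ⇑ s ≈ 𝕎 ⇑ (T ℕ.∸ s) ⊛ C 1ℚ
    basis-j T s (yes _) = ⊛-congˡ (𝕎 ⇑ (T ℕ.∸ s)) (1⇑ s)
    basis-j T s (no ¬e) = ⊥-elim (¬e refl)

    -- The basis element of order s at j is 𝕎^(T - s), while those at other poles are divisible by
    -- 𝕎^T. Below order T the series is thus the list of coefficients at j in reverse.
    ev-local : ∀ T g t → j ℕ.≤ n → t ℕ.< T → ev local T g t ≡ g j (T ℕ.∸ t)
    ev-local T g t j≤n t<T = trans
      (∑-single (suc n) j (λ i → ∑ (suc T) (λ s → g i s * basis local T i s t)) (s≤s j≤n)
        (λ i i≢j → ∑-0 (suc T) (λ s s<T → trans (cong (g i s *_) (basis-other T i s t (i ℕP.≟ j) i≢j (ℕP.≤-pred s<T) t<T)) (*-zeroʳ (g i s)))))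
      (trans (∑-single′ (suc T) (T ℕ.∸ t) (λ s → g j s * basis local T j s t) (s≤s (ℕP.m∸n≤m T t))
        (λ s s≤T s≢ → trans (cong (g j s *_) (trans (basis-j T s (j ℕP.≟ j) t) (off s (ℕP.≤-pred s≤T) s≢))) (*-zeroʳ (g j s))))
      (trans (cong (g j (T ℕ.∸ t) *_) (trans (basis-j T (T ℕ.∸ t) (j ℕP.≟ j) t) on)) (*-identityʳ _)))
      where
      ∑-single′ : ∀ n k (f : ℕ → ℚ) → k ℕ.< n → (∀ i → i ℕ.< n → i ≢ k → f i ≡ 0ℚ) → ∑ n f ≡ f k
      ∑-single′ (suc n) k f k<n h = go (k ℕP.≟ n)
        where
        go : Dec (k ≡ n) → ∑ (suc n) f ≡ f k
        go (yes refl) = trans (cong (_+ f n) (∑-0 n (λ i i<n → h i (ℕP.m<n⇒m<1+n i<n) (ℕP.<⇒≢ i<n)))) (+-identityˡ _)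
        go (no k≢n) = trans (cong₂ _+_ (∑-single′ n k f (ℕP.≤∧≢⇒< (ℕP.≤-pred k<n) k≢n) (λ i i<n → h i (ℕP.m<n⇒m<1+n i<n))) (h n ℕP.≤-refl (λ e → k≢n (sym e)))) (+-identityʳ _)
      T∸ : T ℕ.∸ (T ℕ.∸ t) ≡ t
      T∸ = ℕP.m∸[m∸n]≡n (ℕP.<⇒≤ t<T)
      on : (𝕎 ⇑ (T ℕ.∸ (T ℕ.∸ t)) ⊛ C 1ℚ) t ≡ 1ℚ
      on = trans (cong (λ k → (𝕎 ⇑ k ⊛ C 1ℚ) t) T∸) (trans (cong (𝕎 ⇑ t ⊛ C 1ℚ) (sym (ℕP.+-identityʳ t))) (𝕎⇑-high t (C 1ℚ) 0))
      off : ∀ s → s ℕ.≤ T → s ≢ T ℕ.∸ t → (𝕎 ⇑ (T ℕ.∸ s) ⊛ C 1ℚ) t ≡ 0ℚ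
      off s s≤T s≢ = go (ℕP.<-cmp t (T ℕ.∸ s))
        where
        go : _ → _
        go (tri< t< _ _) = 𝕎⇑-low (T ℕ.∸ s) (C 1ℚ) t t<
        go (tri≈ _ e _) = ⊥-elim (s≢ (sym (trans (cong (T ℕ.∸_) e) (ℕP.m∸[m∸n]≡n s≤T))))
        go (tri> _ ¬e >t) = trans (cong (𝕎 ⇑ (T ℕ.∸ s) ⊛ C 1ℚ) (sym (ℕP.m+[n∸m]≡n (ℕP.<⇒≤ >t))))
          (trans (𝕎⇑-high (T ℕ.∸ s) (C 1ℚ) (t ℕ.∸ (T ℕ.∸ s))) (C1-pos (λ z → ¬e (ℕP.≤-antisym (ℕP.m∸n≡0⇒m≤n z) (ℕP.<⇒≤ >t)))))

    module Coefficients (fs : List Factor) (j≤n : j ℕ.≤ n) (r : PF (length fs) (λ M → prodPS M fs)) where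
      open PF r

      private
        T = length fs

        at : ∀ s → 1 ℕ.≤ s → s ℕ.≤ T → coeff j s ≡ (𝕎 ⇑ cnt fs ⊛ 𝕌 fs) (T ℕ.∸ s)
        at s 1≤s s≤T = sym (trans (sym (prodPS-local fs (T ℕ.∸ s))) (trans (expansion local (T ℕ.∸ s))
          (trans (ev-local T coeff (T ℕ.∸ s) j≤n (ℕP.∸-monoʳ-< 1≤s s≤T)) (cong (coeff j) (ℕP.m∸[m∸n]≡n s≤T)))))

      coeff-𝕌 : ∀ s → 1 ℕ.≤ s → s ℕ.≤ mult fs → coeff j s ≡ 𝕌 fs (mult fs ℕ.∸ s)
      coeff-𝕌 s 1≤s s≤m = trans (at s 1≤s (ℕP.≤-trans s≤m (subst (mult fs ℕ.≤_) (cnt+mult fs) (ℕP.m≤n+m (mult fs) (cnt fs)))))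
        (trans (cong (𝕎 ⇑ cnt fs ⊛ 𝕌 fs) (trans (cong (ℕ._∸ s) (sym (cnt+mult fs))) (ℕP.+-∸-assoc (cnt fs) s≤m)))
          (𝕎⇑-high (cnt fs) (𝕌 fs) (mult fs ℕ.∸ s)))

      coeff-0 : ∀ s → mult fs ℕ.< s → s ℕ.≤ T → coeff j s ≡ 0ℚ
      coeff-0 s m<s s≤T = trans (at s (ℕP.≤-trans (s≤s z≤n) m<s) s≤T)
        (𝕎⇑-low (cnt fs) (𝕌 fs) (T ℕ.∸ s) (subst (T ℕ.∸ s ℕ.<_) (trans (cong (ℕ._∸ mult fs) (sym (cnt+mult fs))) (ℕP.m+n∸n≡m (cnt fs) (mult fs))) (ℕP.∸-monoʳ-< m<s s≤T)))

-- Denominators of the local expansions.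

module Membership (p : ℤ) (2≤p : 2 ℕ.≤ ℤ.∣ p ∣) (q : ℚ) (qP : q * ι p ≡ 1ℚ) (n c : ℕ) where

  open Expansion p 2≤p q qP n public

  module AtPole (j : ℕ) (j≤n : j ℕ.≤ n) where
    open Local j public

    -- The largest distance from j to an index in [0, n]. It bounds the cyclotomic indices in the
    -- pole differences, and also the indices of the ω_i in the finite sums that the reindexing of
    -- the series will leave at j.
    reach : ℕ
    reach = j ℕ.⊔ (n ℕ.∸ j)

    χd : ∀ {l} → Dec (l ℕ.≤ reach) → ℕ
    χd (yes _) = 1
    χd (no _) = 0

    χ : ℕ → ℕ
    χ zero = 0
    χ (suc l) = χd (suc l ℕP.≤? reach)

    χ≤1 : ∀ l → χ l ℕ.≤ 1
    χ≤1 zero = z≤n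
    χ≤1 (suc l) = go (suc l ℕP.≤? reach)
      where
      go : ∀ d → χd d ℕ.≤ 1
      go (yes _) = ℕP.≤-refl
      go (no _) = z≤n

    χ-yes : ∀ {l} → suc l ℕ.≤ reach → χ (suc l) ≡ 1
    χ-yes {l} h = go (suc l ℕP.≤? reach)
      where
      go : ∀ d → χd d ≡ 1
      go (yes _) = refl
      go (no ¬h) = ⊥-elim (¬h h)

    χ-no : ∀ {l} → reach ℕ.< l → χ l ≡ 0
    χ-no {suc l} h = go (suc l ℕP.≤? reach)
      where
      go : ∀ d → χd d ≡ 0
      go (yes h′) = ⊥-elim (ℕP.<⇒≱ h h′)
      go (no _) = refl

    δ≤χ : ∀ d → suc d ℕ.≤ reach → ∀ l → δ (suc d) l ℕ.≤ χ l
    δ≤χ d d≤ zero = z≤n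
    δ≤χ d d≤ (suc l) = go (suc l ℕP.≤? reach)
      where
      go : ∀ x → ind (suc l) (suc d) ℕ.≤ χd x
      go (yes _) = ind≤1 (suc l) (suc d)
      go (no ¬h) = ℕP.≤-reflexive (ind-0 (suc l) (s≤s (ℕP.≤-trans d≤ (ℕP.≤-pred (ℕP.≰⇒> ¬h)))) (s≤s z≤n))

    -- Each further power of the local parameter costs at most one cyclotomic factor Φ l with l ≤ reach.
    Ser : (ℕ → ℕ) → (ℕ → ℕ) → PS → Set
    Ser f g φ = ∀ t → M (λ l → f l ℕ.+ t ℕ.* χ l) g (φ t)

    Ser-weaken : ∀ {f g f′ g′ φ} → (∀ l → l ℕ.≤ n → f l ℕ.+ g′ l ℕ.≤ f′ l ℕ.+ g l) → Ser f g φ → Ser f′ g′ φ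
    Ser-weaken {f} {g} {f′} {g′} {φ} h s t = M-weaken (λ l l≤n → subst₂ ℕ._≤_ (r (f l) (g′ l) (t ℕ.* χ l)) (r (f′ l) (g l) (t ℕ.* χ l))
        (ℕP.+-monoˡ-≤ (t ℕ.* χ l) (h l l≤n))) (s t)
      where
      r : ∀ a b c → a ℕ.+ b ℕ.+ c ≡ a ℕ.+ c ℕ.+ b
      r = ℕ-solve-∀

    Ser-⊛ : ∀ {f g f′ g′} φ ψ → Ser f g φ → Ser f′ g′ ψ → Ser (f ⊞ f′) (g ⊞ g′) (φ ⊛ ψ)
    Ser-⊛ {f} {g} {f′} {g′} φ ψ s s′ zero = M-weaken (λ l _ → ℕP.≤-reflexive (r (f l) (f′ l) (g l ℕ.+ g′ l))) (M-* (s 0) (s′ 0))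
      where
      r : ∀ a b c → (a ℕ.+ 0) ℕ.+ (b ℕ.+ 0) ℕ.+ c ≡ a ℕ.+ b ℕ.+ 0 ℕ.+ c
      r = ℕ-solve-∀
    Ser-⊛ {f} {g} {f′} {g′} φ ψ s s′ (suc t) = M-+
      (M-weaken (λ l _ → ℕP.≤-reflexive (r (f l) (f′ l) (t ℕ.* χ l) (χ l) (g l ℕ.+ g′ l))) (M-* (s 0) (s′ (suc t))))
      (M-weaken (λ l _ → ℕP.≤-reflexive (r₂ (f l) (f′ l) (t ℕ.* χ l) (χ l) (g l ℕ.+ g′ l)))
        (Ser-⊛ {f ⊞ χ} {g} {f′} {g′} (tail φ) ψ (λ t → M-weaken (λ l _ → ℕP.≤-reflexive (r₃ (f l) (t ℕ.* χ l) (χ l) (g l))) (s (suc t))) s′ t))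
      where
      r : ∀ a b t x g → (a ℕ.+ 0) ℕ.+ (b ℕ.+ (x ℕ.+ t)) ℕ.+ g ≡ a ℕ.+ b ℕ.+ (x ℕ.+ t) ℕ.+ g
      r = ℕ-solve-∀
      r₂ : ∀ a b t x g → a ℕ.+ x ℕ.+ b ℕ.+ t ℕ.+ g ≡ a ℕ.+ b ℕ.+ (x ℕ.+ t) ℕ.+ g
      r₂ = ℕ-solve-∀
      r₃ : ∀ a t x g → a ℕ.+ (x ℕ.+ t) ℕ.+ g ≡ a ℕ.+ x ℕ.+ t ℕ.+ g
      r₃ = ℕ-solve-∀

    M⇒0 : ∀ {f g x} → M f g x → M (λ l → f l ℕ.+ 0 ℕ.* χ l) g x
    M⇒0 {f} {g} = M-weaken (λ l _ → ℕP.≤-reflexive (cong (ℕ._+ g l) (sym (ℕP.+-identityʳ (f l)))))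

    Ser-1 : Ser 0̂ 0̂ (C 1ℚ)
    Ser-1 zero = M⇒0 M-1
    Ser-1 (suc t) = M-0

    Ser-aff : ∀ {f g a b} → M f g a → M (f ⊞ χ) g b → Ser f g (aff a b)
    Ser-aff m m′ zero = M⇒0 m
    Ser-aff {f} {g} m m′ (suc zero) = M-weaken (λ l _ → ℕP.≤-reflexive (cong (λ z → f l ℕ.+ z ℕ.+ g l) (sym (ℕP.+-identityʳ (χ l))))) m′
    Ser-aff m m′ (suc (suc t)) = M-0

    Ser-geometric : ∀ {f g b r} → M f g b → M χ 0̂ r → Ser f g (λ t → b * r ↑ t)
    Ser-geometric {f} {g} {b} {r} mb mr t = M-weaken (λ l _ → ℕP.≤-reflexive (cong (f l ℕ.+ t ℕ.* χ l ℕ.+_) (sym (ℕP.+-identityʳ (g l))))) (M-* mb (pow t))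
      where
      pow : ∀ t → M (λ l → t ℕ.* χ l) 0̂ (r ↑ t)
      pow zero = M-1
      pow (suc t) = M-* mr (pow t)

    -- In a linear factor only the constant coefficient is divisible by cyclotomic factors; the
    -- coefficient of 𝕎 is a power of p. The divisibility may be claimed for the whole series only
    -- as far as one power of 𝕎 pays for it, hence the restriction to `χ`.
    trunc : ℕ → ℕ → ℕ
    trunc d l = δ d l ℕ.* χ l

    trunc≤δ : ∀ d l → trunc d l ℕ.≤ δ d l
    trunc≤δ d l = subst (trunc d l ℕ.≤_) (ℕP.*-identityʳ (δ d l)) (ℕP.*-monoʳ-≤ (δ d l) (χ≤1 l))

    trunc≤χ : ∀ d l → trunc d l ℕ.≤ χ l
    trunc≤χ d zero = ℕP.≤-reflexive refl
    trunc≤χ d (suc l) = subst (trunc d (suc l) ℕ.≤_) (ℕP.*-identityˡ (χ (suc l))) (ℕP.*-monoˡ-≤ (χ (suc l)) (ind≤1 (suc l) d))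

    M-U-trunc : ∀ d → M 0̂ (trunc (suc d)) (P ↑ suc d - 1ℚ)
    M-U-trunc d = M-weaken (λ l _ → trunc≤δ (suc d) l) (M-U d)

    -- At the pole j, `high` i has the value 1 - q^(i-j) = q^(i-j) (p^(i-j) - 1). Its exponent - (i
    -- - j) of p is stored as i in the denominator and j in the numerator, so that totals are linear
    -- in j.
    numF numG : Num → ℕ → ℕ
    numF one = 0̂
    numF var = 0̂
    numF (low k) = 0̂
    numF (high i) = at0 i
    numF (minus i) = at0 i
    numF (plus i) = at0 i
    numG one = 0̂
    numG var = at0 j
    numG (low k) = trunc (k ℕ.+ j)
    numG (high i) = at0 j ⊞ trunc (i ℕ.∸ j)
    numG (minus i) = 0̂
    numG (plus i) = 0̂

    Valid : Num → Set
    Valid (low k) = 1 ℕ.≤ k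
    Valid (high i) = j ℕ.< i
    Valid _ = ⊤

    M-≡ : ∀ {f g x y} → x ≡ y → M f g x → M f g y
    M-≡ {f} {g} e = subst (M f g) e

    M-cst : ∀ i → M (at0 i) 0̂ (q ↑ i * P ↑ j)
    M-cst i = M-weaken (λ l _ → w l) (M-* (M-q^ i) (M-P^ j))
      where
      w : ∀ l → at0 i l ℕ.+ 0 ℕ.+ 0 ℕ.≤ at0 i l ℕ.+ (0 ℕ.+ at0 j l)
      w l = ℕP.≤-trans (ℕP.≤-reflexive (trans (ℕP.+-identityʳ _) (ℕP.+-identityʳ _))) (ℕP.m≤m+n _ _)

    numPS-Ser : ∀ N k → Valid N → Ser (numF N) (numG N) (numPS (mkFactor N k))
    numPS-Ser one k _ = Ser-aff (M-≡ (sym (r (P ↑ j))) M-1) (M-≡ (sym (r₂ (P ↑ j))) M-0)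
      where
      r : ∀ x → 1ℚ + 0ℚ * x ≡ 1ℚ
      r = solve-∀ ℚring
      r₂ : ∀ x → - (0ℚ * x) ≡ 0ℚ
      r₂ = solve-∀ ℚring
    numPS-Ser var k _ = Ser-aff (M-≡ (sym (r (P ↑ j))) (M-P^ j)) (M-≡ (cong -_ (sym (*-identityˡ (P ↑ j)))) (M-weaken (λ l _ → ℕP.+-monoˡ-≤ (at0 j l) z≤n) (M-neg (M-P^ j))))
      where
      r : ∀ x → 0ℚ + 1ℚ * x ≡ x
      r = solve-∀ ℚring
    numPS-Ser (low (suc k)) _ _ = Ser-aff
      (M-≡ (trans (r (P ↑ suc (k ℕ.+ j))) (trans (cong (λ z → 1ℚ - z) (↑-+ P (suc k) j)) (r₂ (P ↑ suc k) (P ↑ j)))) (M-neg (M-U-trunc (k ℕ.+ j))))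
      (M-≡ (trans (↑-+ P (suc k) j) (r₃ (P ↑ suc k) (P ↑ j))) (M-weaken (λ l _ → ℕP.≤-trans (trunc≤χ (suc (k ℕ.+ j)) l) (ℕP.m≤m+n _ _)) (M-integral (integral-↑ (suc (k ℕ.+ j)) (integral-ι p)))))
      where
      r : ∀ x → - (x - 1ℚ) ≡ 1ℚ - x
      r = solve-∀ ℚring
      r₂ : ∀ a b → 1ℚ - a * b ≡ 1ℚ + - a * b
      r₂ = solve-∀ ℚring
      r₃ : ∀ a b → a * b ≡ - (- a * b)
      r₃ = solve-∀ ℚring
    numPS-Ser (high i) k j<i = subst (λ i′ → Ser (at0 i′) (at0 j ⊞ trunc (i′ ℕ.∸ j)) (numPS (mkFactor (high i′) k))) (trans (ℕP.+-suc j d) (ℕP.m+[n∸m]≡n j<i)) (go d)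
      where
      d = i ℕ.∸ suc j
      go : ∀ d → Ser (at0 (j ℕ.+ suc d)) (at0 j ⊞ trunc ((j ℕ.+ suc d) ℕ.∸ j)) (numPS (mkFactor (high (j ℕ.+ suc d)) k))
      go d = Ser-aff (M-≡ e₀ (M-weaken w₀ (M-* (M-q^ (suc d)) (M-U-trunc d)))) (M-≡ e₁ (M-weaken w₁ (M-q^ (suc d))))
        where
        jd : (j ℕ.+ suc d) ℕ.∸ j ≡ suc d
        jd = ℕP.m+n∸m≡n j (suc d)
        e₀ : q ↑ suc d * (P ↑ suc d - 1ℚ) ≡ 1ℚ + - q ↑ (j ℕ.+ suc d) * P ↑ j
        e₀ = trans (r (q ↑ suc d) (P ↑ suc d)) (trans (cong₂ (λ x y → x - y) (qP^ (suc d)) (sym (qP′ j (suc d)))) (r₂ (q ↑ (j ℕ.+ suc d)) (P ↑ j)))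
          where
          r : ∀ a b → a * (b - 1ℚ) ≡ a * b - a
          r = solve-∀ ℚring
          r₂ : ∀ a b → 1ℚ - a * b ≡ 1ℚ + - a * b
          r₂ = solve-∀ ℚring
        e₁ : q ↑ suc d ≡ - (- q ↑ (j ℕ.+ suc d) * P ↑ j)
        e₁ = trans (sym (qP′ j (suc d))) (r (q ↑ (j ℕ.+ suc d)) (P ↑ j))
          where
          r : ∀ a b → a * b ≡ - (- a * b)
          r = solve-∀ ℚring
        w₀ : ∀ l → l ℕ.≤ n → (at0 (suc d) ⊞ 0̂) l ℕ.+ (at0 j ⊞ trunc ((j ℕ.+ suc d) ℕ.∸ j)) l ℕ.≤ at0 (j ℕ.+ suc d) l ℕ.+ (0̂ ⊞ trunc (suc d)) l
        w₀ zero _ = ℕP.≤-reflexive (r j d)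
          where
          r : ∀ j d → suc d ℕ.+ 0 ℕ.+ (j ℕ.+ 0) ≡ j ℕ.+ suc d ℕ.+ (0 ℕ.+ 0)
          r = ℕ-solve-∀
        w₀ (suc l) _ = ℕP.≤-reflexive (cong (λ z → trunc z (suc l)) jd)
        w₁ : ∀ l → l ℕ.≤ n → at0 (suc d) l ℕ.+ (at0 j ⊞ trunc ((j ℕ.+ suc d) ℕ.∸ j)) l ℕ.≤ (at0 (j ℕ.+ suc d) ⊞ χ) l ℕ.+ 0
        w₁ zero _ = ℕP.≤-reflexive (r j d)
          where
          r : ∀ j d → suc d ℕ.+ (j ℕ.+ 0) ≡ j ℕ.+ suc d ℕ.+ 0 ℕ.+ 0
          r = ℕ-solve-∀
        w₁ (suc l) _ = ℕP.≤-trans (trunc≤χ ((j ℕ.+ suc d) ℕ.∸ j) (suc l)) (ℕP.≤-reflexive (sym (ℕP.+-identityʳ _)))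
    numPS-Ser (minus i) k _ = Ser-aff (M-≡ (r (q ↑ i) (P ↑ j)) (M-+ (M-weaken (λ l _ → z≤n) M-1) (M-neg (M-cst i))))
      (M-≡ (r₂ (q ↑ i) (P ↑ j)) (M-weaken (λ l _ → ℕP.+-monoˡ-≤ 0 (ℕP.m≤m+n (at0 i l) (χ l))) (M-cst i)))
      where
      r : ∀ a b → 1ℚ + - (a * b) ≡ 1ℚ + - a * b
      r = solve-∀ ℚring
      r₂ : ∀ a b → a * b ≡ - (- a * b)
      r₂ = solve-∀ ℚring
    numPS-Ser (plus i) k _ = Ser-aff (M-+ (M-weaken (λ l _ → z≤n) M-1) (M-cst i))
      (M-weaken (λ l _ → ℕP.+-monoˡ-≤ 0 (ℕP.m≤m+n (at0 i l) (χ l))) (M-neg (M-cst i)))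

    -- Exponents of p are only claimed for the poles beyond the centre c.
    beyond : ∀ {k} → Dec (c ℕ.< k) → ℕ → ℕ → ℕ
    beyond (yes _) x = at0 x
    beyond (no _) x = 0̂

    poled : ∀ k → Dec (k ≡ j) → ℕ → ℕ
    poled k (yes _) = 0̂
    poled k (no _) = δ ℕ.∣ k - j ∣

    -- The true exponent of p contributed by index k is the maximum of k - j and 0. Claiming k - j
    -- beyond the centre and 0 elsewhere is a lower bound for every j and keeps the total linear in
    -- j.
    poleF poleG : ℕ → ℕ → ℕ
    poleF k = poled k (k ℕP.≟ j) ⊞ beyond (c ℕP.<? k) j
    poleG k = beyond (c ℕP.<? k) k

    ∣-∣-cases : ∀ k → k ≢ j → (∃ λ d → k ≡ j ℕ.+ suc d × ℕ.∣ k - j ∣ ≡ suc d) ⊎ (∃ λ d → j ≡ k ℕ.+ suc d × ℕ.∣ k - j ∣ ≡ suc d)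
    ∣-∣-cases k k≢j = go (ℕP.<-cmp k j)
      where
      go : _ → _
      go (tri< k<j _ _) = inj₂ (j ℕ.∸ suc k , je , trans (cong (λ z → ℕ.∣ k - z ∣) je) (ℕP.∣m-m+n∣≡n k _))
        where
        je = sym (trans (ℕP.+-suc k _) (ℕP.m+[n∸m]≡n k<j))
      go (tri≈ _ e _) = ⊥-elim (k≢j e)
      go (tri> _ _ j<k) = inj₁ (k ℕ.∸ suc j , ke , trans (cong (λ z → ℕ.∣ z - j ∣) ke) (trans (ℕP.∣-∣-comm (j ℕ.+ suc _) j) (ℕP.∣m-m+n∣≡n j _)))
        where
        ke = sym (trans (ℕP.+-suc j _) (ℕP.m+[n∸m]≡n j<k))

    w-beyond-hi : ∀ {f d} x → f ≡ j ℕ.+ suc d → (b : Dec (c ℕ.< f)) → ∀ l → (δ x l ℕ.+ 0) ℕ.+ beyond b f l ℕ.≤ δ x l ℕ.+ beyond b j l ℕ.+ at0 (suc d) l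
    w-beyond-hi {f} {d} x e (yes _) zero = ℕP.≤-reflexive e
    w-beyond-hi x e (yes _) (suc l) = ℕP.≤-refl
    w-beyond-hi x e (no _) l = ℕP.≤-trans (ℕP.≤-reflexive (ℕP.+-identityʳ _)) (ℕP.m≤m+n _ _)

    w-beyond-lo : ∀ {k d} x → j ≡ k ℕ.+ suc d → (b : Dec (c ℕ.< k)) → ∀ l → δ x l ℕ.+ beyond b k l ℕ.≤ δ x l ℕ.+ beyond b j l ℕ.+ 0
    w-beyond-lo {k} {d} x e (yes _) zero = subst (k ℕ.≤_) (trans (sym e) (sym (ℕP.+-identityʳ j))) (ℕP.m≤m+n k (suc d))
    w-beyond-lo x e (yes _) (suc l) = ℕP.≤-reflexive (sym (ℕP.+-identityʳ _))
    w-beyond-lo x e (no _) l = ℕP.≤-reflexive (sym (ℕP.+-identityʳ _))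

    -- With d = |k - j|, the geometric series has first term p^d / (p^d - 1) and ratio - 1 / (p^d -
    -- 1) for k > j, and first term - 1 / (p^d - 1) and ratio p^d / (p^d - 1) for k < j. As d ≤
    -- `reach`, each ratio costs at most `χ`.
    ω-Ser : ∀ k → k ℕ.≤ n → k ≢ j → Ser (δ ℕ.∣ k - j ∣ ⊞ beyond (c ℕP.<? k) j) (poleG k) (ω k)
    ω-Ser k k≤n k≢j = go (∣-∣-cases k k≢j)
      where
      go : _ → _
      go (inj₁ (d , ke , de)) = Ser-geometric
          (M-≡ e₀ (M-weaken (λ l _ → subst (λ z → δ (suc d) l ℕ.+ 0 ℕ.+ poleG k l ℕ.≤ δ z l ℕ.+ beyond (c ℕP.<? k) j l ℕ.+ at0 (suc d) l) (sym de) (w-beyond-hi (suc d) ke (c ℕP.<? k) l)) (M-* (M-U⁻¹ d d<n) (M-P^ (suc d)))))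
          (M-≡ e₁ (M-weaken (λ l _ → ℕP.+-monoˡ-≤ 0 (δ≤χ d (ℕP.≤-trans d≤ (ℕP.m≤n⊔m j (n ℕ.∸ j))) l)) (M-neg (M-U⁻¹ d d<n))))
        where
        d≤ : suc d ℕ.≤ n ℕ.∸ j
        d≤ = subst (ℕ._≤ n ℕ.∸ j) (trans (cong (ℕ._∸ j) ke) (ℕP.m+n∸m≡n j (suc d))) (ℕP.∸-monoˡ-≤ j k≤n)
        d<n : suc d ℕ.≤ n
        d<n = ℕP.≤-trans d≤ (ℕP.m∸n≤m n j)
        V = P ↑ suc d - 1ℚ
        ck : cst k ≡ q ↑ suc d
        ck = trans (cong (λ z → q ↑ z * P ↑ j) ke) (qP′ j (suc d))
        invc : inv (1ℚ - cst k) ≡ inv V * P ↑ suc d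
        invc = trans (cong (λ z → inv (1ℚ - z)) ck) (inv-unique {1ℚ - q ↑ suc d} {inv V * P ↑ suc d} (trans (r₂ (1ℚ - q ↑ suc d) (inv V) (P ↑ suc d)) (trans (cong (_* inv V) (1-qP (suc d))) (*-inv (U≢0 d)))))
          where
          r₂ : ∀ a b c → a * (b * c) ≡ c * a * b
          r₂ = solve-∀ ℚring
        e₀ : inv V * P ↑ suc d ≡ inv (1ℚ - cst k)
        e₀ = sym invc
        e₁ : - inv V ≡ - (cst k * inv (1ℚ - cst k))
        e₁ = cong -_ (sym (trans (cong₂ _*_ ck invc) (trans (r₃ (q ↑ suc d) (inv V) (P ↑ suc d)) (trans (cong (_* inv V) (qP^ (suc d))) (*-identityˡ _)))))
          where
          r₃ : ∀ a b c → a * (b * c) ≡ a * c * b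
          r₃ = solve-∀ ℚring
      go (inj₂ (d , je , de)) = Ser-geometric
          (M-≡ e₀ (M-weaken (λ l _ → subst (λ z → δ (suc d) l ℕ.+ poleG k l ℕ.≤ δ z l ℕ.+ beyond (c ℕP.<? k) j l ℕ.+ 0) (sym de) (w-beyond-lo (suc d) je (c ℕP.<? k) l)) (M-neg (M-U⁻¹ d d<n))))
          (M-≡ e₁ (M-weaken (λ l _ → ℕP.+-mono-≤ (subst (ℕ._≤ χ l) (sym (ℕP.+-identityʳ _)) (δ≤χ d (ℕP.≤-trans d≤ (ℕP.m≤m⊔n j (n ℕ.∸ j))) l)) z≤n) (M-* (M-U⁻¹ d d<n) (M-integral (integral-↑ (suc d) (integral-ι p))))))
        where
        d≤ : suc d ℕ.≤ j
        d≤ = subst (suc d ℕ.≤_) (sym je) (ℕP.m≤n+m (suc d) k)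
        d<n : suc d ℕ.≤ n
        d<n = ℕP.≤-trans d≤ j≤n
        V = P ↑ suc d - 1ℚ
        ck : cst k ≡ P ↑ suc d
        ck = trans (cong (λ z → q ↑ k * P ↑ z) je) (qP″ k (suc d))
        invc : inv (1ℚ - cst k) ≡ - inv V
        invc = trans (cong (λ z → inv (1ℚ - z)) ck) (inv-unique {1ℚ - P ↑ suc d} { - inv V} (trans (r₂ (P ↑ suc d) (inv V)) (*-inv (U≢0 d))))
          where
          r₂ : ∀ a b → (1ℚ - a) * - b ≡ (a - 1ℚ) * b
          r₂ = solve-∀ ℚring
        e₀ : - inv V ≡ inv (1ℚ - cst k)
        e₀ = sym invc
        e₁ : inv V * P ↑ suc d ≡ - (cst k * inv (1ℚ - cst k))
        e₁ = sym (trans (cong₂ (λ x y → - (x * y)) ck invc) (r₃ (P ↑ suc d) (inv V)))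
          where
          r₃ : ∀ a b → - (a * - b) ≡ b * a
          r₃ = solve-∀ ℚring

    facd-Ser : ∀ N k → Valid N → k ℕ.≤ n → (d : Dec (k ≡ j)) →
      Ser (numF N ⊞ (poled k d ⊞ beyond (c ℕP.<? k) j)) (numG N ⊞ poleG k) (facd (mkFactor N k) d)
    facd-Ser N k v k≤n (yes e) = Ser-weaken (λ l _ → w (c ℕP.<? k) l) (numPS-Ser N k v)
      where
      r : ∀ a b x → a ℕ.+ (b ℕ.+ x) ≡ a ℕ.+ x ℕ.+ b
      r = ℕ-solve-∀
      w : ∀ b l → numF N l ℕ.+ (numG N l ℕ.+ beyond b k l) ℕ.≤ numF N l ℕ.+ (0 ℕ.+ beyond b j l) ℕ.+ numG N l
      w b l = ℕP.≤-reflexive (trans (r (numF N l) (numG N l) (beyond b k l)) (cong (λ z → numF N l ℕ.+ beyond b z l ℕ.+ numG N l) e))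
    facd-Ser N k v k≤n (no k≢j) = Ser-⊛ (numPS (mkFactor N k)) (ω k) (numPS-Ser N k v) (ω-Ser k k≤n k≢j)

    totF totG : List (Num × ℕ) → ℕ → ℕ
    totF [] = 0̂
    totF ((N , k) ∷ xs) = numF N ⊞ poleF k ⊞ totF xs
    totG [] = 0̂
    totG ((N , k) ∷ xs) = numG N ⊞ poleG k ⊞ totG xs

    mkFactors : List (Num × ℕ) → List Factor
    mkFactors = map (λ x → mkFactor (proj₁ x) (proj₂ x))

    𝕌-Ser : ∀ xs → All (λ x → Valid (proj₁ x) × proj₂ x ℕ.≤ n) xs → Ser (totF xs) (totG xs) (𝕌 (mkFactors xs))
    𝕌-Ser [] [] = Ser-1
    𝕌-Ser ((N , k) ∷ xs) ((v , k≤n) ∷ vs) = Ser-⊛ (facd (mkFactor N k) (k ℕP.≟ j)) (𝕌 (mkFactors xs)) (facd-Ser N k v k≤n (k ℕP.≟ j)) (𝕌-Ser xs vs)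

-- The rational function R

highLow : ℕ → ℕ → List Num
highLow n zero = []
highLow n (suc k) = high (n ℕ.+ suc k) ∷ low (suc k) ∷ highLow n k

-- The factors 1 pad the list to the number 110m + 10 of poles. The exponent 35m + 4 is half of 110m
-- + 10 - 40m - 2: x and 1 occur equally often, as the reflection requires. The factors `minus` and
-- `plus` give 1 - x² q^(16m).
numerators : ℕ → List Num
numerators m = replicate (35 ℕ.* m ℕ.+ 4) var ++ minus (8 ℕ.* m) ∷ plus (8 ℕ.* m) ∷ highLow (16 ℕ.* m) (20 ℕ.* m) ++ replicate (35 ℕ.* m ℕ.+ 4) one

∑N : List Num → (Num → ℕ) → ℕ
∑N [] f = 0
∑N (x ∷ xs) f = f x ℕ.+ ∑N xs f

∑N-++ : ∀ xs ys f → ∑N (xs ++ ys) f ≡ ∑N xs f ℕ.+ ∑N ys f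
∑N-++ [] ys f = refl
∑N-++ (x ∷ xs) ys f = trans (cong (f x ℕ.+_) (∑N-++ xs ys f)) (sym (ℕP.+-assoc (f x) _ _))

∑N-replicate : ∀ k x f → ∑N (replicate k x) f ≡ k ℕ.* f x
∑N-replicate zero x f = refl
∑N-replicate (suc k) x f = cong (f x ℕ.+_) (∑N-replicate k x f)

∑N-highLow : ∀ n k f → ∑N (highLow n k) f ≡ ∑ℕ k (λ i → f (high (n ℕ.+ suc i)) ℕ.+ f (low (suc i)))
∑N-highLow n zero f = refl
∑N-highLow n (suc k) f = trans (cong (λ z → f (high (n ℕ.+ suc k)) ℕ.+ (f (low (suc k)) ℕ.+ z)) (∑N-highLow n k f))
  (r (f (high (n ℕ.+ suc k))) (f (low (suc k))) _)
  where
  r : ∀ a b c → a ℕ.+ (b ℕ.+ c) ≡ c ℕ.+ (a ℕ.+ b)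
  r = ℕ-solve-∀

∑N-numerators : ∀ m f → ∑N (numerators m) f ≡ (35 ℕ.* m ℕ.+ 4) ℕ.* f var ℕ.+ (f (minus (8 ℕ.* m)) ℕ.+ (f (plus (8 ℕ.* m)) ℕ.+
  (∑ℕ (20 ℕ.* m) (λ i → f (high (16 ℕ.* m ℕ.+ suc i)) ℕ.+ f (low (suc i))) ℕ.+ (35 ℕ.* m ℕ.+ 4) ℕ.* f one)))
∑N-numerators m f = trans (∑N-++ (replicate e var) _ f) (cong₂ ℕ._+_ (∑N-replicate e var f)
  (cong (λ z → f (minus (8 ℕ.* m)) ℕ.+ (f (plus (8 ℕ.* m)) ℕ.+ z)) (trans (∑N-++ (highLow (16 ℕ.* m) (20 ℕ.* m)) _ f)
    (cong₂ ℕ._+_ (∑N-highLow (16 ℕ.* m) (20 ℕ.* m) f) (∑N-replicate e one f)))))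
  where
  e = 35 ℕ.* m ℕ.+ 4

∑N-length : ∀ xs → ∑N xs (λ _ → 1) ≡ length xs
∑N-length [] = refl
∑N-length (x ∷ xs) = cong suc (∑N-length xs)

∑ℕ-const : ∀ n c → ∑ℕ n (λ _ → c) ≡ n ℕ.* c
∑ℕ-const zero c = refl
∑ℕ-const (suc n) c = trans (ℕP.+-comm (∑ℕ n (λ _ → c)) c) (cong (c ℕ.+_) (∑ℕ-const n c))

length-numerators : ∀ m → length (numerators m) ≡ 110 ℕ.* m ℕ.+ 10
length-numerators m = trans (sym (∑N-length (numerators m))) (trans (∑N-numerators m (λ _ → 1))
  (trans (cong (λ z → (35 ℕ.* m ℕ.+ 4) ℕ.* 1 ℕ.+ (1 ℕ.+ (1 ℕ.+ (z ℕ.+ (35 ℕ.* m ℕ.+ 4) ℕ.* 1)))) (∑ℕ-const (20 ℕ.* m) 2)) (r m)))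
  where
  r : ∀ m → (35 ℕ.* m ℕ.+ 4) ℕ.* 1 ℕ.+ (1 ℕ.+ (1 ℕ.+ (20 ℕ.* m ℕ.* 2 ℕ.+ (35 ℕ.* m ℕ.+ 4) ℕ.* 1))) ≡ 110 ℕ.* m ℕ.+ 10
  r = ℕ-solve-∀

length-block : ∀ c L → length (block c L) ≡ L ℕ.* 2
length-block c zero = refl
length-block c (suc L) = cong (λ z → suc (suc z)) (length-block c L)

length-intervals : ∀ m hs → length (intervals m hs) ≡ ∑L hs (λ h → suc ((8 ℕ.∸ h) ℕ.* m ℕ.* 2))
length-intervals m [] = refl
length-intervals m (h ∷ hs) = trans (length-++ (8 ℕ.* m ∷ block (8 ℕ.* m) ((8 ℕ.∸ h) ℕ.* m)))
  (cong₂ ℕ._+_ (cong suc (length-block (8 ℕ.* m) ((8 ℕ.∸ h) ℕ.* m))) (length-intervals m hs))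

length-poles : ∀ m → length (poles m) ≡ 110 ℕ.* m ℕ.+ 10
length-poles m = trans (length-intervals m heights) (r m)
  where
  r : ∀ m → suc (8 ℕ.* m ℕ.* 2) ℕ.+ (suc (7 ℕ.* m ℕ.* 2) ℕ.+ (suc (7 ℕ.* m ℕ.* 2) ℕ.+ (suc (6 ℕ.* m ℕ.* 2) ℕ.+ (suc (6 ℕ.* m ℕ.* 2) ℕ.+
    (suc (5 ℕ.* m ℕ.* 2) ℕ.+ (suc (5 ℕ.* m ℕ.* 2) ℕ.+ (suc (4 ℕ.* m ℕ.* 2) ℕ.+ (suc (4 ℕ.* m ℕ.* 2) ℕ.+ (suc (3 ℕ.* m ℕ.* 2) ℕ.+ 0))))))))) ≡ 110 ℕ.* m ℕ.+ 10
  r = ℕ-solve-∀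

All-++ : ∀ {A : Set} {Q : A → Set} {xs ys} → All Q xs → All Q ys → All Q (xs ++ ys)
All-++ [] ys = ys
All-++ (x ∷ xs) ys = x ∷ All-++ xs ys

All-replicate : ∀ {A : Set} {Q : A → Set} k {x} → Q x → All Q (replicate k x)
All-replicate zero _ = []
All-replicate (suc k) q = q ∷ All-replicate k q

All-zip : ∀ {A B : Set} {Q : A → Set} {R : B → Set} {xs ys} → All Q xs → All R ys → All (λ z → Q (proj₁ z) × R (proj₂ z)) (zip xs ys)
All-zip [] _ = []
All-zip (_ ∷ _) [] = []
All-zip (x ∷ xs) (y ∷ ys) = (x , y) ∷ All-zip xs ys

block-bounded : ∀ c L n → L ℕ.≤ c → c ℕ.+ L ℕ.≤ n → All (ℕ._≤ n) (c ∷ block c L)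
block-bounded c L n L≤c h = ℕP.≤-trans (ℕP.m≤m+n c L) h ∷ go L h
  where
  go : ∀ L → c ℕ.+ L ℕ.≤ n → All (ℕ._≤ n) (block c L)
  go zero h = []
  go (suc L) h = ℕP.≤-trans (ℕP.m∸n≤m c (suc L)) (ℕP.≤-trans (ℕP.m≤m+n c (suc L)) h) ∷ h ∷ go L (ℕP.≤-trans (ℕP.+-monoʳ-≤ c (ℕP.n≤1+n L)) h)

intervals-bounded : ∀ m hs → All (ℕ._≤ 16 ℕ.* m) (intervals m hs)
intervals-bounded m [] = []
intervals-bounded m (h ∷ hs) = All-++ (block-bounded (8 ℕ.* m) ((8 ℕ.∸ h) ℕ.* m) (16 ℕ.* m) w≤
    (ℕP.≤-trans (ℕP.+-monoʳ-≤ (8 ℕ.* m) w≤) (ℕP.≤-reflexive (sym (ℕP.*-distribʳ-+ m 8 8))))) (intervals-bounded m hs)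
  where
  w≤ : (8 ℕ.∸ h) ℕ.* m ℕ.≤ 8 ℕ.* m
  w≤ = ℕP.*-monoˡ-≤ m (ℕP.m∸n≤m 8 h)

-- The modulus 16m + 1 exceeds every |k - j|, so divisibility means k = j. No interval is longer
-- than one period, so each of the ten counts at most once.
pole-order : ∀ m j → j ℕ.≤ 16 ℕ.* m → ∑L (poles m) (λ k → ind (suc (16 ℕ.* m)) ℕ.∣ k - j ∣) ℕ.≤ 10
pole-order m j j≤n = go heights
  where
  open Count (16 ℕ.* m) (16 ℕ.* m ℕ.∸ j) j 1 (trans (cong suc (ℕP.m∸n+n≡m j≤n)) (sym (ℕP.*-identityˡ (suc (16 ℕ.* m))))) hiding (l)
  l = suc (16 ℕ.* m)
  f : ℕ → ℕ
  f k = ind l ℕ.∣ k - j ∣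
  one-each : ∀ h → ∑L (8 ℕ.* m ∷ block (8 ℕ.* m) ((8 ℕ.∸ h) ℕ.* m)) f ℕ.≤ 1
  one-each h = ℕP.+-cancelʳ-≤ (N (8 ℕ.* m ℕ.∸ w)) _ 1 (ℕP.≤-trans (ℕP.≤-reflexive (count-block (8 ℕ.* m) w w≤))
      (ℕP.≤-trans (ℕD./-monoˡ-≤ l le) (ℕP.≤-reflexive (trans (div-+* (8 ℕ.* m ℕ.∸ w ℕ.+ (16 ℕ.* m ℕ.∸ j)) 1 l) (ℕP.+-comm _ 1)))))
    where
    w = (8 ℕ.∸ h) ℕ.* m
    w≤ : w ℕ.≤ 8 ℕ.* m
    w≤ = ℕP.*-monoˡ-≤ m (ℕP.m∸n≤m 8 h)
    le : 8 ℕ.* m ℕ.+ suc w ℕ.+ (16 ℕ.* m ℕ.∸ j) ℕ.≤ 8 ℕ.* m ℕ.∸ w ℕ.+ (16 ℕ.* m ℕ.∸ j) ℕ.+ 1 ℕ.* l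
    le = ℕP.≤-trans (ℕP.≤-reflexive (r (8 ℕ.* m) w (16 ℕ.* m ℕ.∸ j))) (ℕP.≤-trans (ℕP.+-monoˡ-≤ (suc (8 ℕ.* m) ℕ.+ (16 ℕ.* m ℕ.∸ j)) w≤′) (ℕP.≤-reflexive (r₂ (8 ℕ.* m ℕ.∸ w) m (16 ℕ.* m ℕ.∸ j))))
      where
      w≤′ : w ℕ.≤ 8 ℕ.* m ℕ.∸ w ℕ.+ 8 ℕ.* m
      w≤′ = ℕP.≤-trans w≤ (ℕP.m≤n+m (8 ℕ.* m) (8 ℕ.* m ℕ.∸ w))
      r : ∀ a b c → a ℕ.+ suc b ℕ.+ c ≡ b ℕ.+ (suc a ℕ.+ c)
      r = ℕ-solve-∀
      r₂ : ∀ a m c → a ℕ.+ 8 ℕ.* m ℕ.+ (suc (8 ℕ.* m) ℕ.+ c) ≡ a ℕ.+ c ℕ.+ 1 ℕ.* suc (16 ℕ.* m)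
      r₂ = ℕ-solve-∀
  go : ∀ hs → ∑L (intervals m hs) f ℕ.≤ ∑L hs (λ _ → 1)
  go [] = z≤n
  go (h ∷ hs) = ℕP.≤-trans (ℕP.≤-reflexive (∑L-++ (8 ℕ.* m ∷ block (8 ℕ.* m) ((8 ℕ.∸ h) ℕ.* m)) (intervals m hs) f)) (ℕP.+-mono-≤ (one-each h) (go hs))

-- The common denominator and the integrality of the coefficients.

module Construction (p : ℤ) (2≤p : 2 ℕ.≤ ℤ.∣ p ∣) (q : ℚ) (qP : q * ι p ≡ 1ℚ) (m : ℕ) where

  n : ℕ
  n = 16 ℕ.* m

  open Membership p 2≤p q qP n (8 ℕ.* m) public

  pairs : List (Num × ℕ)
  pairs = zip (numerators m) (poles m)

  toFactors : List (Num × ℕ) → List Factor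
  toFactors = map (λ x → mkFactor (proj₁ x) (proj₂ x))

  factors : List Factor
  factors = toFactors pairs

  factors-bounded : All (λ f → pole f ℕ.≤ n) factors
  factors-bounded = go (numerators m) (intervals-bounded m heights)
    where
    go : ∀ Ns {ks} → All (ℕ._≤ n) ks → All (λ f → pole f ℕ.≤ n) (toFactors (zip Ns ks))
    go [] _ = []
    go (N ∷ Ns) [] = []
    go (N ∷ Ns) (h ∷ hs) = h ∷ go Ns hs

  opaque
    expansionPF : PF (length factors) (λ M → prodPS M factors)
    expansionPF = partial-fractions factors factors-bounded

  open PF expansionPF public

  qfact : ℕ → ℚ
  qfact x = ∏ℚ x (λ i → P ↑ suc i - 1ℚ)

  qfact⁻¹ : ℕ → ℚ
  qfact⁻¹ x = ∏ℚ x (λ i → inv (P ↑ suc i - 1ℚ))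

  -- The exponent of the l-th cyclotomic factor in the product of p^i - 1 for i ≤ x is the number of
  -- multiples of l up to x.
  factE : ℕ → ℕ → ℕ
  factE x zero = 0
  factE x (suc l) = x ℕ./ suc l

  factE-suc : ∀ x l → factE (suc x) l ≡ factE x l ℕ.+ δ (suc x) l
  factE-suc x zero = refl
  factE-suc x (suc l) = div-suc x (suc l)

  factE-0 : ∀ l → factE 0 l ≡ 0
  factE-0 zero = refl
  factE-0 (suc l) = ℕD.m<n⇒m/n≡0 {0} {suc l} (s≤s z≤n)

  M-qfact : ∀ x → M 0̂ (factE x) (qfact x)
  M-qfact zero = M-weaken (λ l _ → ℕP.≤-reflexive (factE-0 l)) M-1
  M-qfact (suc x) = M-weaken (λ l _ → ℕP.≤-reflexive (factE-suc x l)) (M-* (M-qfact x) (M-U x))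

  M-qfact⁻¹ : ∀ x → x ℕ.≤ n → M (factE x) 0̂ (qfact⁻¹ x)
  M-qfact⁻¹ zero _ = M-weaken (λ l _ → z≤n) M-1
  M-qfact⁻¹ (suc x) h = M-weaken (λ l _ → ℕP.≤-reflexive (trans (ℕP.+-identityʳ _) (sym (trans (ℕP.+-identityʳ _) (factE-suc x l))))) (M-* (M-qfact⁻¹ x (ℕP.≤-trans (ℕP.n≤1+n x) h)) (M-U⁻¹ x h))

  ∏L : List ℕ → (ℕ → ℚ) → ℚ
  ∏L [] f = 1ℚ
  ∏L (x ∷ xs) f = f x * ∏L xs f

  ∑E : List ℕ → ℕ → ℕ
  ∑E xs l = ∑L xs (λ i → factE (i ℕ.* m) l)

  M-∏L : ∀ xs → M 0̂ (∑E xs) (∏L xs (λ i → qfact (i ℕ.* m)))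
  M-∏L [] = M-1
  M-∏L (x ∷ xs) = M-weaken (λ l _ → ℕP.≤-refl) (M-* (M-qfact (x ℕ.* m)) (M-∏L xs))

  M-∏L⁻¹ : ∀ {xs} → All (ℕ._≤ 16) xs → M (∑E xs) 0̂ (∏L xs (λ i → qfact⁻¹ (i ℕ.* m)))
  M-∏L⁻¹ [] = M-1
  M-∏L⁻¹ (h ∷ hs) = M-* (M-qfact⁻¹ _ (ℕP.*-monoˡ-≤ m h)) (M-∏L⁻¹ hs)

  -- A power of p that divides all numerators and is taken out of `Δ`. The available exponent is
  -- (165 m² + 3m + 8j) / 2, and 82 is the integer part of 165 / 2.
  gain : ℕ
  gain = 82 ℕ.* (m ℕ.* m)

  opaque
    Δ : ℚ
    Δ = ∏L up (λ i → qfact (i ℕ.* m)) * ∏L down (λ i → qfact⁻¹ (i ℕ.* m)) * q ↑ gain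

    Δ-def : Δ ≡ ∏L up (λ i → qfact (i ℕ.* m)) * ∏L down (λ i → qfact⁻¹ (i ℕ.* m)) * q ↑ gain
    Δ-def = refl

    M-Δ : M (∑E down ⊞ at0 gain) (∑E up) Δ
    M-Δ = M-weaken (λ l _ → ℕP.≤-reflexive (r (∑E down l) (at0 gain l) (∑E up l))) (M-* (M-* (M-∏L up) (M-∏L⁻¹ down-small)) (M-q^ gain))
      where
      r : ∀ d g u → 0 ℕ.+ d ℕ.+ g ℕ.+ u ≡ d ℕ.+ g ℕ.+ (u ℕ.+ 0 ℕ.+ 0)
      r = ℕ-solve-∀

  module Pole (j : ℕ) (j≤n : j ℕ.≤ n) where
    open AtPole j j≤n public

    private
      totF-zip : ∀ Ns ks → length Ns ≡ length ks → ∀ l → totF (zip Ns ks) l ≡ ∑N Ns (λ N → numF N l) ℕ.+ ∑L ks (λ k → poleF k l)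
      totF-zip [] [] _ l = refl
      totF-zip (N ∷ Ns) (k ∷ ks) e l = trans (cong (numF N l ℕ.+ poleF k l ℕ.+_) (totF-zip Ns ks (ℕP.suc-injective e) l)) (r (numF N l) (poleF k l) _ _)
        where
        r : ∀ a b c d → a ℕ.+ b ℕ.+ (c ℕ.+ d) ≡ a ℕ.+ c ℕ.+ (b ℕ.+ d)
        r = ℕ-solve-∀

      totG-zip : ∀ Ns ks → length Ns ≡ length ks → ∀ l → totG (zip Ns ks) l ≡ ∑N Ns (λ N → numG N l) ℕ.+ ∑L ks (λ k → poleG k l)
      totG-zip [] [] _ l = refl
      totG-zip (N ∷ Ns) (k ∷ ks) e l = trans (cong (numG N l ℕ.+ poleG k l ℕ.+_) (totG-zip Ns ks (ℕP.suc-injective e) l)) (r (numG N l) (poleG k l) _ _)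
        where
        r : ∀ a b c d → a ℕ.+ b ℕ.+ (c ℕ.+ d) ≡ a ℕ.+ c ℕ.+ (b ℕ.+ d)
        r = ℕ-solve-∀

      mult-zip : ∀ Ns ks → length Ns ≡ length ks → mult (mkFactors (zip Ns ks)) ≡ ∑L ks (λ k → multd (k ℕP.≟ j))
      mult-zip [] [] _ = refl
      mult-zip (N ∷ Ns) (k ∷ ks) e = cong (multd (k ℕP.≟ j) ℕ.+_) (mult-zip Ns ks (ℕP.suc-injective e))

      lengths : length (numerators m) ≡ length (poles m)
      lengths = trans (length-numerators m) (sym (length-poles m))

      μ : ℕ
      μ = mult factors

      μ≡ : μ ≡ ∑L (poles m) (λ k → multd (k ℕP.≟ j))
      μ≡ = mult-zip (numerators m) (poles m) lengths

    multd≤ : ∀ l k (d : Dec (k ≡ j)) → multd d ℕ.≤ ind l ℕ.∣ k - j ∣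
    multd≤ l k (yes refl) = ℕP.≤-reflexive (sym (trans (cong (ind l) (ℕP.∣n-n∣≡0 k)) (ind-yes (0-div l))))
      where
      0-div : ∀ l → l ∣ℕ 0
      0-div l = divides 0 refl
    multd≤ l k (no _) = z≤n

    mult≤10 : mult factors ℕ.≤ 10
    mult≤10 = ℕP.≤-trans (ℕP.≤-reflexive μ≡) (ℕP.≤-trans (∑L-mono (allTrue (poles m))) (pole-order m j j≤n))
      where
      allTrue : ∀ ks → All (λ k → multd (k ℕP.≟ j) ℕ.≤ ind (suc n) ℕ.∣ k - j ∣) ks
      allTrue [] = []
      allTrue (k ∷ ks) = multd≤ (suc n) k (k ℕP.≟ j) ∷ allTrue ks

    private
      nums-valid : All Valid (numerators m)
      nums-valid = All-++ (All-replicate (35 ℕ.* m ℕ.+ 4) tt) (tt ∷ tt ∷ All-++ (hl (20 ℕ.* m)) (All-replicate (35 ℕ.* m ℕ.+ 4) tt))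
        where
        hl : ∀ k → All Valid (highLow n k)
        hl zero = []
        hl (suc k) = ℕP.≤-trans (s≤s j≤n) (ℕP.≤-trans (s≤s (ℕP.m≤m+n n k)) (ℕP.≤-reflexive (sym (ℕP.+-suc n k)))) ∷ s≤s z≤n ∷ hl k

      series : Ser (totF pairs) (totG pairs) (𝕌 factors)
      series = 𝕌-Ser pairs (All-zip nums-valid (intervals-bounded m heights))

      beyond-yes : ∀ {k} x → 8 ℕ.* m ℕ.< k → (d : Dec (8 ℕ.* m ℕ.< k)) → beyond d x 0 ≡ x
      beyond-yes x h (yes _) = refl
      beyond-yes x h (no ¬h) = ⊥-elim (¬h h)

      beyond-no : ∀ {k} x → k ℕ.≤ 8 ℕ.* m → (d : Dec (8 ℕ.* m ℕ.< k)) → beyond d x 0 ≡ 0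
      beyond-no x h (yes h′) = ⊥-elim (ℕP.<⇒≱ h′ h)
      beyond-no x h (no _) = refl

      beyond-suc : ∀ {k} x (d : Dec (8 ℕ.* m ℕ.< k)) l → beyond d x (suc l) ≡ 0
      beyond-suc x (yes _) l = refl
      beyond-suc x (no _) l = refl

      C′ : ℕ
      C′ = 8 ℕ.* m

      beyond-block : ∀ (X : ℕ → ℕ) L → ∑L (block C′ L) (λ k → beyond (C′ ℕP.<? k) (X k) 0) ≡ ∑ℕ L (λ i → X (C′ ℕ.+ suc i))
      beyond-block X zero = refl
      beyond-block X (suc L) = trans (cong₂ ℕ._+_ (beyond-no (X (C′ ℕ.∸ suc L)) (ℕP.m∸n≤m C′ (suc L)) (C′ ℕP.<? (C′ ℕ.∸ suc L)))
        (cong₂ ℕ._+_ (beyond-yes (X (C′ ℕ.+ suc L)) (ℕP.m<m+n C′ (s≤s z≤n)) (C′ ℕP.<? (C′ ℕ.+ suc L))) (beyond-block X L)))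
        (ℕP.+-comm (X (C′ ℕ.+ suc L)) _)

      beyond-intervals : ∀ (X : ℕ → ℕ) hs → ∑L (intervals m hs) (λ k → beyond (C′ ℕP.<? k) (X k) 0) ≡ ∑L hs (λ h → ∑ℕ ((8 ℕ.∸ h) ℕ.* m) (λ i → X (C′ ℕ.+ suc i)))
      beyond-intervals X [] = refl
      beyond-intervals X (h ∷ hs) = trans (∑L-++ (C′ ∷ block C′ ((8 ℕ.∸ h) ℕ.* m)) (intervals m hs) _)
        (cong₂ ℕ._+_ (trans (cong (ℕ._+ ∑L (block C′ ((8 ℕ.∸ h) ℕ.* m)) (λ k → beyond (C′ ℕP.<? k) (X k) 0)) (beyond-no (X C′) ℕP.≤-refl (C′ ℕP.<? C′))) (beyond-block X ((8 ℕ.∸ h) ℕ.* m))) (beyond-intervals X hs))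

      poled-0 : ∀ k (d : Dec (k ≡ j)) → poled k d 0 ≡ 0
      poled-0 k (yes _) = refl
      poled-0 k (no _) = refl

      ∑-arith : ∀ c L → 2 ℕ.* ∑ℕ L (λ i → c ℕ.+ suc i) ≡ 2 ℕ.* (c ℕ.* L) ℕ.+ L ℕ.* L ℕ.+ L
      ∑-arith c zero = cong (λ z → 2 ℕ.* z ℕ.+ 0 ℕ.+ 0) (sym (ℕP.*-zeroʳ c))
      ∑-arith c (suc L) = trans (ℕP.*-distribˡ-+ 2 (∑ℕ L (λ i → c ℕ.+ suc i)) (c ℕ.+ suc L)) (trans (cong (ℕ._+ 2 ℕ.* (c ℕ.+ suc L)) (∑-arith c L)) (r c L))
        where
        r : ∀ c L → 2 ℕ.* (c ℕ.* L) ℕ.+ L ℕ.* L ℕ.+ L ℕ.+ 2 ℕ.* (c ℕ.+ suc L) ≡ 2 ℕ.* (c ℕ.* suc L) ℕ.+ suc L ℕ.* suc L ℕ.+ suc L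
        r = ℕ-solve-∀

      F0 : totF pairs 0 ≡ 8 ℕ.* m ℕ.+ 8 ℕ.* m ℕ.+ ∑ℕ (20 ℕ.* m) (λ i → 16 ℕ.* m ℕ.+ suc i) ℕ.+ 55 ℕ.* m ℕ.* j
      F0 = trans (totF-zip (numerators m) (poles m) lengths 0) (cong₂ ℕ._+_
        (trans (∑N-numerators m (λ N → numF N 0)) (trans (cong (λ z → (35 ℕ.* m ℕ.+ 4) ℕ.* 0 ℕ.+ (8 ℕ.* m ℕ.+ (8 ℕ.* m ℕ.+ (z ℕ.+ (35 ℕ.* m ℕ.+ 4) ℕ.* 0)))) (∑ℕ-cong (20 ℕ.* m) (λ i _ → ℕP.+-identityʳ _))) (r (35 ℕ.* m ℕ.+ 4) (8 ℕ.* m) _)))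
        (trans (∑L-cong′ (poles m) (λ k → cong (ℕ._+ beyond (C′ ℕP.<? k) j 0) (poled-0 k (k ℕP.≟ j)))) (trans (beyond-intervals (λ _ → j) heights)
          (trans (∑L-cong′ heights (λ h → ∑ℕ-const ((8 ℕ.∸ h) ℕ.* m) j)) (r₂ m j)))))
        where
        r : ∀ e c s → e ℕ.* 0 ℕ.+ (c ℕ.+ (c ℕ.+ (s ℕ.+ e ℕ.* 0))) ≡ c ℕ.+ c ℕ.+ s
        r = ℕ-solve-∀
        r₂ : ∀ m j → 8 ℕ.* m ℕ.* j ℕ.+ (7 ℕ.* m ℕ.* j ℕ.+ (7 ℕ.* m ℕ.* j ℕ.+ (6 ℕ.* m ℕ.* j ℕ.+ (6 ℕ.* m ℕ.* j ℕ.+ (5 ℕ.* m ℕ.* j ℕ.+ (5 ℕ.* m ℕ.* j ℕ.+ (4 ℕ.* m ℕ.* j ℕ.+ (4 ℕ.* m ℕ.* j ℕ.+ (3 ℕ.* m ℕ.* j ℕ.+ 0))))))))) ≡ 55 ℕ.* m ℕ.* j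
        r₂ = ℕ-solve-∀

      S : ℕ → ℕ
      S w = ∑ℕ (w ℕ.* m) (λ i → 8 ℕ.* m ℕ.+ suc i)

      G0 : totG pairs 0 ≡ (35 ℕ.* m ℕ.+ 4) ℕ.* j ℕ.+ 20 ℕ.* m ℕ.* j ℕ.+ (S 8 ℕ.+ (S 7 ℕ.+ (S 7 ℕ.+ (S 6 ℕ.+ (S 6 ℕ.+ (S 5 ℕ.+ (S 5 ℕ.+ (S 4 ℕ.+ (S 4 ℕ.+ (S 3 ℕ.+ 0))))))))))
      G0 = trans (totG-zip (numerators m) (poles m) lengths 0) (cong₂ ℕ._+_
        (trans (∑N-numerators m (λ N → numG N 0)) (trans (cong (λ z → (35 ℕ.* m ℕ.+ 4) ℕ.* j ℕ.+ (0 ℕ.+ (0 ℕ.+ (z ℕ.+ (35 ℕ.* m ℕ.+ 4) ℕ.* 0)))) (trans (∑ℕ-cong (20 ℕ.* m) (λ i _ → trans (ℕP.+-identityʳ _) (ℕP.+-identityʳ j))) (∑ℕ-const (20 ℕ.* m) j))) (r (35 ℕ.* m ℕ.+ 4) j _)))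
        (beyond-intervals (λ k → k) heights))
        where
        r : ∀ e j s → e ℕ.* j ℕ.+ (0 ℕ.+ (0 ℕ.+ (s ℕ.+ e ℕ.* 0))) ≡ e ℕ.* j ℕ.+ s
        r = ℕ-solve-∀

      -- The dependence on j cancels up to 4j ≥ 0: the numerators give (35m + 4) j + 20m j, and the
      -- poles beyond the centre cost 55m j, since 8 + 7 + 7 + 6 + 6 + 5 + 5 + 4 + 4 + 3 = 55.
      slot-0 : gain ℕ.+ totF pairs 0 ℕ.≤ totG pairs 0
      slot-0 = ℕP.*-cancelˡ-≤ 2 (subst₂ ℕ._≤_ (sym eqF) (sym eqG) (ℕP.m≤m+n _ (m ℕ.* m ℕ.+ 3 ℕ.* m ℕ.+ 8 ℕ.* j)))
        where
        eqF : 2 ℕ.* (gain ℕ.+ totF pairs 0) ≡ 1204 ℕ.* (m ℕ.* m) ℕ.+ 52 ℕ.* m ℕ.+ 110 ℕ.* m ℕ.* j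
        eqF = trans (cong (λ z → 2 ℕ.* (gain ℕ.+ z)) F0) (trans (r₁ m j (∑ℕ (20 ℕ.* m) (λ i → 16 ℕ.* m ℕ.+ suc i))) (trans (cong (λ z → z ℕ.+ 164 ℕ.* (m ℕ.* m) ℕ.+ 32 ℕ.* m ℕ.+ 110 ℕ.* m ℕ.* j) (∑-arith (16 ℕ.* m) (20 ℕ.* m))) (r₂ m j)))
          where
          r₁ : ∀ m j s → 2 ℕ.* (82 ℕ.* (m ℕ.* m) ℕ.+ (8 ℕ.* m ℕ.+ 8 ℕ.* m ℕ.+ s ℕ.+ 55 ℕ.* m ℕ.* j)) ≡ 2 ℕ.* s ℕ.+ 164 ℕ.* (m ℕ.* m) ℕ.+ 32 ℕ.* m ℕ.+ 110 ℕ.* m ℕ.* j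
          r₁ = ℕ-solve-∀
          r₂ : ∀ m j → 2 ℕ.* (16 ℕ.* m ℕ.* (20 ℕ.* m)) ℕ.+ 20 ℕ.* m ℕ.* (20 ℕ.* m) ℕ.+ 20 ℕ.* m ℕ.+ 164 ℕ.* (m ℕ.* m) ℕ.+ 32 ℕ.* m ℕ.+ 110 ℕ.* m ℕ.* j ≡ 1204 ℕ.* (m ℕ.* m) ℕ.+ 52 ℕ.* m ℕ.+ 110 ℕ.* m ℕ.* j
          r₂ = ℕ-solve-∀
        2S : ∀ w → 2 ℕ.* S w ≡ 16 ℕ.* w ℕ.* (m ℕ.* m) ℕ.+ w ℕ.* w ℕ.* (m ℕ.* m) ℕ.+ w ℕ.* m
        2S w = trans (∑-arith (8 ℕ.* m) (w ℕ.* m)) (r m w)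
          where
          r : ∀ m w → 2 ℕ.* (8 ℕ.* m ℕ.* (w ℕ.* m)) ℕ.+ w ℕ.* m ℕ.* (w ℕ.* m) ℕ.+ w ℕ.* m ≡ 16 ℕ.* w ℕ.* (m ℕ.* m) ℕ.+ w ℕ.* w ℕ.* (m ℕ.* m) ℕ.+ w ℕ.* m
          r = ℕ-solve-∀
        eqG : 2 ℕ.* totG pairs 0 ≡ 1204 ℕ.* (m ℕ.* m) ℕ.+ 52 ℕ.* m ℕ.+ 110 ℕ.* m ℕ.* j ℕ.+ (m ℕ.* m ℕ.+ 3 ℕ.* m ℕ.+ 8 ℕ.* j)
        eqG = trans (cong (2 ℕ.*_) G0) (trans (r₁ ((35 ℕ.* m ℕ.+ 4) ℕ.* j ℕ.+ 20 ℕ.* m ℕ.* j) (S 8) (S 7) (S 6) (S 5) (S 4) (S 3))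
            (trans (cong₂ (λ a b → 2 ℕ.* ((35 ℕ.* m ℕ.+ 4) ℕ.* j ℕ.+ 20 ℕ.* m ℕ.* j) ℕ.+ a ℕ.+ b) (cong₂ (λ x y → x ℕ.+ 2 ℕ.* y) (2S 8) (cong₂ ℕ._+_ (2S 7) (2S 6))) (cong₂ (λ x y → 2 ℕ.* x ℕ.+ y) (cong₂ ℕ._+_ (2S 5) (2S 4)) (2S 3))) (r₂ (m ℕ.* m) m j)))
          where
          r₁ : ∀ e a b c d x y → 2 ℕ.* (e ℕ.+ (a ℕ.+ (b ℕ.+ (b ℕ.+ (c ℕ.+ (c ℕ.+ (d ℕ.+ (d ℕ.+ (x ℕ.+ (x ℕ.+ (y ℕ.+ 0))))))))))) ≡ 2 ℕ.* e ℕ.+ (2 ℕ.* a ℕ.+ 2 ℕ.* (2 ℕ.* b ℕ.+ 2 ℕ.* c)) ℕ.+ (2 ℕ.* (2 ℕ.* d ℕ.+ 2 ℕ.* x) ℕ.+ 2 ℕ.* y)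
          r₁ = ℕ-solve-∀
          r₂ : ∀ M m j → 2 ℕ.* ((35 ℕ.* m ℕ.+ 4) ℕ.* j ℕ.+ 20 ℕ.* m ℕ.* j) ℕ.+ (16 ℕ.* 8 ℕ.* M ℕ.+ 8 ℕ.* 8 ℕ.* M ℕ.+ 8 ℕ.* m ℕ.+ 2 ℕ.* (16 ℕ.* 7 ℕ.* M ℕ.+ 7 ℕ.* 7 ℕ.* M ℕ.+ 7 ℕ.* m ℕ.+ (16 ℕ.* 6 ℕ.* M ℕ.+ 6 ℕ.* 6 ℕ.* M ℕ.+ 6 ℕ.* m)))
              ℕ.+ (2 ℕ.* (16 ℕ.* 5 ℕ.* M ℕ.+ 5 ℕ.* 5 ℕ.* M ℕ.+ 5 ℕ.* m ℕ.+ (16 ℕ.* 4 ℕ.* M ℕ.+ 4 ℕ.* 4 ℕ.* M ℕ.+ 4 ℕ.* m)) ℕ.+ (16 ℕ.* 3 ℕ.* M ℕ.+ 3 ℕ.* 3 ℕ.* M ℕ.+ 3 ℕ.* m))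
            ≡ 1204 ℕ.* M ℕ.+ 52 ℕ.* m ℕ.+ 110 ℕ.* m ℕ.* j ℕ.+ (M ℕ.+ 3 ℕ.* m ℕ.+ 8 ℕ.* j)
          r₂ = ℕ-solve-∀

      Fsuc : ∀ l → totF pairs (suc l) ≡ ∑L (poles m) (λ k → poled k (k ℕP.≟ j) (suc l))
      Fsuc l = trans (totF-zip (numerators m) (poles m) lengths (suc l)) (cong₂ ℕ._+_
        (trans (∑N-numerators m (λ N → numF N (suc l))) (trans (cong (λ z → (35 ℕ.* m ℕ.+ 4) ℕ.* 0 ℕ.+ (z ℕ.+ (35 ℕ.* m ℕ.+ 4) ℕ.* 0)) (trans (∑ℕ-const (20 ℕ.* m) 0) (ℕP.*-zeroʳ (20 ℕ.* m)))) (r (35 ℕ.* m ℕ.+ 4))))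
        (∑L-cong′ (poles m) (λ k → trans (cong (poled k (k ℕP.≟ j) (suc l) ℕ.+_) (beyond-suc j (C′ ℕP.<? k) l)) (ℕP.+-identityʳ _))))
        where
        r : ∀ e → e ℕ.* 0 ℕ.+ (0 ℕ.+ e ℕ.* 0) ≡ 0
        r = ℕ-solve-∀

      Gsuc : ∀ l → totG pairs (suc l) ≡ ∑ℕ (20 ℕ.* m) (λ i → trunc (16 ℕ.* m ℕ.+ suc i ℕ.∸ j) (suc l) ℕ.+ trunc (suc i ℕ.+ j) (suc l))
      Gsuc l = trans (totG-zip (numerators m) (poles m) lengths (suc l)) (trans (cong₂ ℕ._+_
        (trans (∑N-numerators m (λ N → numG N (suc l))) (r (35 ℕ.* m ℕ.+ 4) _))
        (trans (∑L-cong′ (poles m) (λ k → beyond-suc k (C′ ℕP.<? k) l)) (∑L-const (poles m) 0 )))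
        (trans (cong (T′ ℕ.+_) (ℕP.*-zeroʳ (∑L (poles m) (λ _ → 1)))) (ℕP.+-identityʳ _)))
        where
        T′ = ∑ℕ (20 ℕ.* m) (λ i → trunc (16 ℕ.* m ℕ.+ suc i ℕ.∸ j) (suc l) ℕ.+ trunc (suc i ℕ.+ j) (suc l))
        r : ∀ e s → e ℕ.* 0 ℕ.+ (s ℕ.+ e ℕ.* 0) ≡ s
        r = ℕ-solve-∀

      poled+mult : ∀ l k (d : Dec (k ≡ j)) → poled k d (suc l) ℕ.+ multd d ≡ ind (suc l) ℕ.∣ k - j ∣
      poled+mult l k (yes e) = ℕP.≤-antisym (multd≤ (suc l) k (yes e)) (ind≤1 (suc l) ℕ.∣ k - j ∣)
      poled+mult l k (no _) = ℕP.+-identityʳ _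

      poled-far : ∀ l → reach ℕ.< suc l → ∀ k → k ℕ.≤ n → (d : Dec (k ≡ j)) → poled k d (suc l) ≡ 0
      poled-far l h k k≤n (yes _) = refl
      poled-far l h k k≤n (no k≢j) = ind-0 (suc l) (ℕP.≤-<-trans dist h) (ℕP.n≢0⇒n>0 (λ z → k≢j (ℕP.∣m-n∣≡0⇒m≡n z)))
        where
        dist : ℕ.∣ k - j ∣ ℕ.≤ reach
        dist with ℕP.≤-total k j
        ... | inj₁ k≤j = ℕP.≤-trans (ℕP.≤-reflexive (ℕP.m≤n⇒∣m-n∣≡n∸m k≤j)) (ℕP.≤-trans (ℕP.m∸n≤m j k) (ℕP.m≤m⊔n j (n ℕ.∸ j)))
        ... | inj₂ j≤k = ℕP.≤-trans (ℕP.≤-reflexive (ℕP.m≤n⇒∣n-m∣≡n∸m j≤k)) (ℕP.≤-trans (ℕP.∸-monoˡ-≤ j k≤n) (ℕP.m≤n⊔m j (n ℕ.∸ j)))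

      -- For 1 ≤ l ≤ `reach` the μ poles equal to j are charged one factor each, so that all poles
      -- are counted as in `poles-count`. For larger l no nonzero pole difference is divisible by l,
      -- and only the factorials in `Δ` remain. Index 0 is `slot-0`.
      exponents : ∀ l → l ℕ.≤ n → ∑E down l ℕ.+ at0 gain l ℕ.+ (totF pairs l ℕ.+ μ ℕ.* χ l) ℕ.≤ ∑E up l ℕ.+ totG pairs l
      exponents zero _ = ℕP.≤-trans (ℕP.≤-reflexive (trans (cong (λ z → z ℕ.+ gain ℕ.+ (totF pairs 0 ℕ.+ μ ℕ.* 0)) z≡) (trans (cong (λ z → gain ℕ.+ (totF pairs 0 ℕ.+ z)) (ℕP.*-zeroʳ μ)) (cong (gain ℕ.+_) (ℕP.+-identityʳ _)))))
          (ℕP.≤-trans slot-0 (ℕP.m≤n+m (totG pairs 0) (∑E up 0)))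
        where
        z≡ : ∑E down 0 ≡ 0
        z≡ = refl
      exponents (suc l) l<n = go (suc l ℕP.≤? reach)
        where
        open PoleCount m l j j≤n hiding (l)
        d = ∑E down (suc l)
        r : ∀ a b c → a ℕ.+ 0 ℕ.+ (b ℕ.+ c) ≡ b ℕ.+ c ℕ.+ a
        r = ℕ-solve-∀
        go : Dec (suc l ℕ.≤ reach) → d ℕ.+ 0 ℕ.+ (totF pairs (suc l) ℕ.+ μ ℕ.* χ (suc l)) ℕ.≤ ∑E up (suc l) ℕ.+ totG pairs (suc l)
        go (yes h) = ℕP.≤-trans (ℕP.≤-reflexive (trans (r d (totF pairs (suc l)) (μ ℕ.* χ (suc l))) (cong (ℕ._+ d) tot)))
            (ℕP.≤-trans (poles-count h) (ℕP.≤-reflexive (cong (∑E up (suc l) ℕ.+_) (sym (trans (Gsuc l) (∑ℕ-cong (20 ℕ.* m) (λ i _ →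
              trans (cong₂ ℕ._+_ (tr (16 ℕ.* m ℕ.+ suc i ℕ.∸ j)) (tr (suc i ℕ.+ j))) (ℕP.+-comm (ind (suc l) (16 ℕ.* m ℕ.+ suc i ℕ.∸ j)) _))))))))
          where
          tr : ∀ x → trunc x (suc l) ≡ ind (suc l) x
          tr x = trans (cong (ind (suc l) x ℕ.*_) (χ-yes h)) (ℕP.*-identityʳ _)
          tot : totF pairs (suc l) ℕ.+ μ ℕ.* χ (suc l) ≡ ∑L (poles m) (λ k → ind (suc l) ℕ.∣ k - j ∣)
          tot = trans (cong₂ ℕ._+_ (Fsuc l) (trans (cong (μ ℕ.*_) (χ-yes h)) (trans (ℕP.*-identityʳ μ) μ≡)))
            (trans (sym (∑L-+ (poles m) (λ k → poled k (k ℕP.≟ j) (suc l)) (λ k → multd (k ℕP.≟ j)))) (∑L-cong′ (poles m) (λ k → poled+mult l k (k ℕP.≟ j))))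
        go (no ¬h) = ℕP.≤-trans (ℕP.≤-reflexive (trans (cong (d ℕ.+ 0 ℕ.+_) zeros) (trans (ℕP.+-identityʳ _) (ℕP.+-identityʳ _)))) (ℕP.≤-trans down≤up′ (ℕP.m≤m+n _ _))
          where
          far = ℕP.≰⇒> ¬h
          zeros : totF pairs (suc l) ℕ.+ μ ℕ.* χ (suc l) ≡ 0
          zeros = cong₂ ℕ._+_ (trans (Fsuc l) (trans (∑L-cong (mapAll (λ k k≤n → poled-far l far k k≤n (k ℕP.≟ j)) (intervals-bounded m heights))) (trans (∑L-const (poles m) 0) (ℕP.*-zeroʳ (∑L (poles m) (λ _ → 1))))))
            (trans (cong (μ ℕ.*_) (χ-no far)) (ℕP.*-zeroʳ μ))

    private
      module Co = Coefficients factors j≤n expansionPF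

    coeff-vanish : ∀ s → 10 ℕ.< s → s ℕ.≤ length factors → coeff j s ≡ 0ℚ
    coeff-vanish s h h′ = Co.coeff-0 s (ℕP.≤-<-trans mult≤10 h) h′

    -- The coefficient of order s is the term of order μ - s of `𝕌` and costs μ - s factors `χ`; a
    -- cofactor y of cost s brings the total to μ, whatever s is. This is the charge that
    -- `exponents` allows.
    integrality : ∀ s y → 1 ℕ.≤ s → s ℕ.≤ length factors → M (λ l → s ℕ.* χ l) 0̂ y → Integral (Δ * (coeff j s * y))
    integrality s y 1≤s s≤T my = go (ℕP.≤-total s μ)
      where
      small : s ℕ.≤ μ → Integral (Δ * (coeff j s * y))
      small s≤μ = integral-M ex (M-* M-Δ (M-* (M-≡ (sym (Co.coeff-𝕌 s 1≤s s≤μ)) (series (μ ℕ.∸ s))) my))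
        where
        r : ∀ a b c d e x → a ℕ.+ b ℕ.+ (c ℕ.+ d ℕ.* x ℕ.+ e ℕ.* x) ≡ a ℕ.+ b ℕ.+ (c ℕ.+ (d ℕ.+ e) ℕ.* x)
        r = ℕ-solve-∀
        ex : ∀ l → l ℕ.≤ n → ∑E down l ℕ.+ at0 gain l ℕ.+ (totF pairs l ℕ.+ (μ ℕ.∸ s) ℕ.* χ l ℕ.+ s ℕ.* χ l) ℕ.≤ ∑E up l ℕ.+ (totG pairs l ℕ.+ 0)
        ex l l≤n = subst₂ ℕ._≤_ (sym (trans (r (∑E down l) (at0 gain l) (totF pairs l) (μ ℕ.∸ s) s (χ l)) (cong (λ z → ∑E down l ℕ.+ at0 gain l ℕ.+ (totF pairs l ℕ.+ z ℕ.* χ l)) (ℕP.m∸n+n≡m s≤μ))))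
          (cong (∑E up l ℕ.+_) (sym (ℕP.+-identityʳ _))) (exponents l l≤n)
      go : s ℕ.≤ μ ⊎ μ ℕ.≤ s → Integral (Δ * (coeff j s * y))
      go (inj₁ h) = small h
      go (inj₂ h) = go′ (μ ℕP.≟ s)
        where
        go′ : Dec (μ ≡ s) → Integral (Δ * (coeff j s * y))
        go′ (yes e) = small (ℕP.≤-reflexive (sym e))
        go′ (no ne) = ℤ.+ 0 , trans (cong (λ z → Δ * (z * y)) (Co.coeff-0 s (ℕP.≤∧≢⇒< h ne) s≤T)) (trans (r Δ y) (sym ι0))
          where
          r : ∀ a b → a * (0ℚ * b) ≡ 0ℚ
          r = solve-∀ ℚring

-- Numerical evaluation of the partial fractions.

∏N : List Num → (Num → ℚ) → ℚ
∏N [] f = 1ℚ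
∏N (x ∷ xs) f = f x * ∏N xs f

∏N-++ : ∀ xs ys f → ∏N (xs ++ ys) f ≡ ∏N xs f * ∏N ys f
∏N-++ [] ys f = sym (*-identityˡ _)
∏N-++ (x ∷ xs) ys f = trans (cong (f x *_) (∏N-++ xs ys f)) (sym (*-assoc (f x) _ _))

∏N-replicate : ∀ k x f → ∏N (replicate k x) f ≡ f x ↑ k
∏N-replicate zero x f = refl
∏N-replicate (suc k) x f = cong (f x *_) (∏N-replicate k x f)

∏N-highLow : ∀ n k f → ∏N (highLow n k) f ≡ ∏ℚ k (λ i → f (high (n ℕ.+ suc i)) * f (low (suc i)))
∏N-highLow n zero f = refl
∏N-highLow n (suc k) f = trans (cong (λ z → f (high (n ℕ.+ suc k)) * (f (low (suc k)) * z)) (∏N-highLow n k f))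
  (r (f (high (n ℕ.+ suc k))) (f (low (suc k))) (∏ℚ k (λ i → f (high (n ℕ.+ suc i)) * f (low (suc i)))))
  where
  r : ∀ a b c → a * (b * c) ≡ c * (a * b)
  r = solve-∀ ℚring

∏N-numerators : ∀ m f → ∏N (numerators m) f ≡ f var ↑ (35 ℕ.* m ℕ.+ 4) * (f (minus (8 ℕ.* m)) * (f (plus (8 ℕ.* m)) *
  (∏ℚ (20 ℕ.* m) (λ i → f (high (16 ℕ.* m ℕ.+ suc i)) * f (low (suc i))) * f one ↑ (35 ℕ.* m ℕ.+ 4))))
∏N-numerators m f = trans (∏N-++ (replicate e var) _ f) (cong₂ _*_ (∏N-replicate e var f)
  (cong (λ z → f (minus (8 ℕ.* m)) * (f (plus (8 ℕ.* m)) * z)) (trans (∏N-++ (highLow (16 ℕ.* m) (20 ℕ.* m)) _ f)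
    (cong₂ _*_ (∏N-highLow (16 ℕ.* m) (20 ℕ.* m) f) (∏N-replicate e one f)))))
  where
  e = 35 ℕ.* m ℕ.+ 4

∏K : List ℕ → (ℕ → ℚ) → ℚ
∏K [] f = 1ℚ
∏K (x ∷ xs) f = f x * ∏K xs f

∏K-++ : ∀ xs ys f → ∏K (xs ++ ys) f ≡ ∏K xs f * ∏K ys f
∏K-++ [] ys f = sym (*-identityˡ _)
∏K-++ (x ∷ xs) ys f = trans (cong (f x *_) (∏K-++ xs ys f)) (sym (*-assoc (f x) _ _))

∏K-block : ∀ c L f → ∏K (block c L) f ≡ ∏ℚ L (λ i → f (c ℕ.∸ suc i) * f (c ℕ.+ suc i))
∏K-block c zero f = refl
∏K-block c (suc L) f = trans (cong (λ z → f (c ℕ.∸ suc L) * (f (c ℕ.+ suc L) * z)) (∏K-block c L f))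
  (r (f (c ℕ.∸ suc L)) (f (c ℕ.+ suc L)) (∏ℚ L (λ i → f (c ℕ.∸ suc i) * f (c ℕ.+ suc i))))
  where
  r : ∀ a b c → a * (b * c) ≡ c * (a * b)
  r = solve-∀ ℚring

∏zip : List (Num × ℕ) → (Num → ℚ) → (ℕ → ℚ) → ℚ
∏zip [] f g = 1ℚ
∏zip ((N , k) ∷ xs) f g = f N * g k * ∏zip xs f g

∏zip-split : ∀ Ns ks f g → length Ns ≡ length ks → ∏zip (zip Ns ks) f g ≡ ∏N Ns f * ∏K ks g
∏zip-split [] [] f g _ = refl
∏zip-split (N ∷ Ns) (k ∷ ks) f g e = trans (cong (f N * g k *_) (∏zip-split Ns ks f g (ℕP.suc-injective e))) (*-swap-middle (f N) (g k) _ _)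

∏ℚ-0 : ∀ n (f : ℕ → ℚ) k → k ℕ.< n → f k ≡ 0ℚ → ∏ℚ n f ≡ 0ℚ
∏ℚ-0 (suc n) f k k<n e = go (k ℕP.≟ n)
  where
  go : Dec (k ≡ n) → ∏ℚ n f * f n ≡ 0ℚ
  go (yes refl) = trans (cong (∏ℚ n f *_) e) (*-zeroʳ (∏ℚ n f))
  go (no k≢n) = trans (cong (_* f n) (∏ℚ-0 n f k (ℕP.≤∧≢⇒< (ℕP.≤-pred k<n) k≢n) e)) (*-zeroˡ (f n))

0↑ : ∀ n → 0ℚ ↑ suc n ≡ 0ℚ
0↑ n = *-zeroˡ (0ℚ ↑ n)

∏ℚ-const : ∀ n c → ∏ℚ n (λ _ → c) ≡ c ↑ n
∏ℚ-const zero c = refl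
∏ℚ-const (suc n) c = trans (cong (_* c) (∏ℚ-const n c)) (*-comm (c ↑ n) c)

C⇑0 : ∀ a k → (C a ⇑ k) 0 ≡ a ↑ k
C⇑0 a zero = refl
C⇑0 a (suc k) = cong (a *_) (C⇑0 a k)

shift-sum : ∀ K j (f : ℕ → ℚ) → ∑ K (λ k → f (k ℕ.+ j)) ≡ ∑ K f + ∑ j (λ i → f (K ℕ.+ i)) - ∑ j f
shift-sum K j f = trans (∑-cong K (λ k _ → cong f (ℕP.+-comm k j))) (r (∑ K (λ k → f (j ℕ.+ k))) (∑ j f) (∑ K f + ∑ j (λ i → f (K ℕ.+ i)))
  (trans (sym (∑-split j K f)) (trans (cong (λ z → ∑ z f) (ℕP.+-comm j K)) (∑-split K j f))))
  where
  r : ∀ x y z → y + x ≡ z → x ≡ z - y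
  r x y z e = trans (r₁ x y) (cong (_- y) e)
    where
    r₁ : ∀ x y → x ≡ y + x - y
    r₁ = solve-∀ ℚring

module Evaluation (p : ℤ) (2≤p : 2 ℕ.≤ ℤ.∣ p ∣) (q : ℚ) (qP : q * ι p ≡ 1ℚ) (m : ℕ) where

  open Construction p 2≤p q qP m public

  T : ℕ
  T = length factors

  lengths : length (numerators m) ≡ length (poles m)
  lengths = trans (length-numerators m) (sym (length-poles m))

  T≡ : T ≡ 110 ℕ.* m ℕ.+ 10
  T≡ = trans (length-map _ pairs) (trans (go (numerators m) (poles m) lengths) (length-numerators m))
    where
    go : ∀ (Ns : List Num) (ks : List ℕ) → length Ns ≡ length ks → length (zip Ns ks) ≡ length Ns
    go [] [] _ = refl
    go (N ∷ Ns) (k ∷ ks) e = cong suc (go Ns ks (ℕP.suc-injective e))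

  10≤T : 10 ℕ.≤ T
  10≤T = ℕP.≤-trans (ℕP.m≤n+m 10 (110 ℕ.* m)) (ℕP.≤-reflexive (sym T≡))

  nv : ℚ → Num → ℚ
  nv x N = num₀ N + num₁ N * x

  prod-const : ∀ (M : Model) (g : Num → ℚ) (w : ℕ → ℚ) → (∀ N k → k ℕ.≤ n → facPS M (mkFactor N k) 0 ≡ g N * w k) →
    prodPS M factors 0 ≡ ∏N (numerators m) g * ∏K (poles m) w
  prod-const M g w h = trans (go (numerators m) (intervals-bounded m heights)) (∏zip-split (numerators m) (poles m) g w lengths)
    where
    go : ∀ Ns {ks} → All (ℕ._≤ n) ks → prodPS M (toFactors (zip Ns ks)) 0 ≡ ∏zip (zip Ns ks) g w
    go [] _ = refl
    go (N ∷ Ns) [] = refl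
    go (N ∷ Ns) {k ∷ ks} (k≤n ∷ hs) = cong₂ _*_ (h N k k≤n) (go Ns hs)

  trim : (g : ℕ → ℚ) → (∀ s → 10 ℕ.< s → s ℕ.≤ T → g s ≡ 0ℚ) → ∑ (suc T) g ≡ g 0 + ∑ 10 (λ s → g (suc s))
  trim g h = trans (cong (λ z → ∑ (suc z) g) (sym (ℕP.m+[n∸m]≡n 10≤T))) (trans (∑-split 11 (T ℕ.∸ 10) g)
    (trans (cong (∑ 11 g +_) (∑-0 (T ℕ.∸ 10) (λ i i< → h (11 ℕ.+ i) (s≤s (ℕP.m≤m+n 10 i)) (subst (11 ℕ.+ i ℕ.≤_) (ℕP.m+[n∸m]≡n 10≤T) (ℕP.+-monoʳ-≤ 10 i<)))))
      (trans (+-identityʳ _) (∑-head 10 g))))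

  ev-const : ∀ (M : Model) (w : ℕ → ℚ) → (∀ i → (h M ⇑ i) 0 ≡ 1ℚ) → (∀ k → k ℕ.≤ n → ∀ s → (η M k ⇑ s) 0 ≡ w k ↑ s) →
    ev M T coeff 0 ≡ ∑ (suc n) (λ j → coeff j 0) + ∑ (suc n) (λ j → ∑ 10 (λ s → coeff j (suc s) * w j ↑ suc s))
  ev-const M w e₁ e₂ = trans (∑-cong (suc n) (λ j j< → trans
      (∑-cong (suc T) (λ s _ → cong (coeff j s *_) (trans (cong₂ _*_ (e₁ (T ℕ.∸ s)) (e₂ j (ℕP.≤-pred j<) s)) (*-identityˡ _))))
      (trans (trim (λ s → coeff j s * w j ↑ s) (λ s h h′ → trans (cong (_* w j ↑ s) (Pole.coeff-vanish j (ℕP.≤-pred j<) s h h′)) (*-zeroˡ (w j ↑ s))))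
        (cong (_+ ∑ 10 (λ s → coeff j (suc s) * w j ↑ suc s)) (*-identityʳ (coeff j 0))))))
    (∑-+ (suc n) (λ j → coeff j 0) (λ j → ∑ 10 (λ s → coeff j (suc s) * w j ↑ suc s)))

  1⇑0 : ∀ i → (C 1ℚ ⇑ i) 0 ≡ 1ℚ
  1⇑0 i = trans (C⇑0 1ℚ i) (1↑ i)

  -- At infinity only the constant coefficients survive, while each padding factor 1 contributes the
  -- value 0.
  const-vanish : ∑ (suc n) (λ j → coeff j 0) ≡ 0ℚ
  const-vanish = trans (sym (trans (cong (∑ (suc n) (λ j → coeff j 0) +_) (∑-0 (suc n) (λ j _ → ∑-0 10 (λ s _ → trans (cong (coeff j (suc s) *_) (0↑ s)) (*-zeroʳ (coeff j (suc s))))))) (+-identityʳ _)))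
    (trans (sym (ev-const atInfinity (λ _ → 0ℚ) 1⇑0 (λ k _ s → C⇑0 0ℚ s))) (trans (sym (expansion atInfinity 0))
      (trans (prod-const atInfinity (λ N → - num₁ N) (λ k → P ↑ k) (λ N k _ → r (num₀ N) (num₁ N) (P ↑ k)))
        (trans (cong (_* ∏K (poles m) (P ↑_)) (trans (∏N-numerators m (λ N → - num₁ N)) zeroN)) (*-zeroˡ (∏K (poles m) (P ↑_)))))))
    where
    r : ∀ a b p → - (b * p) * 1ℚ + (a + b * p) * 0ℚ ≡ - b * p
    r = solve-∀ ℚring
    r₂ : ∀ a b c d → a * (b * (c * (d * 0ℚ))) ≡ 0ℚ
    r₂ = solve-∀ ℚring
    zeroN : (- num₁ var) ↑ (35 ℕ.* m ℕ.+ 4) * (- num₁ (minus (8 ℕ.* m)) * (- num₁ (plus (8 ℕ.* m)) *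
      (∏ℚ (20 ℕ.* m) (λ i → - num₁ (high (16 ℕ.* m ℕ.+ suc i)) * - num₁ (low (suc i))) * (- 0ℚ) ↑ (35 ℕ.* m ℕ.+ 4)))) ≡ 0ℚ
    zeroN = trans (cong (λ z → (- num₁ var) ↑ (35 ℕ.* m ℕ.+ 4) * (- num₁ (minus (8 ℕ.* m)) * (- num₁ (plus (8 ℕ.* m)) *
      (∏ℚ (20 ℕ.* m) (λ i → - num₁ (high (16 ℕ.* m ℕ.+ suc i)) * - num₁ (low (suc i))) * z)))) (trans (cong ((- 0ℚ) ↑_) (ℕP.+-suc (35 ℕ.* m) 3)) (0↑ (35 ℕ.* m ℕ.+ 3))))
      (r₂ ((- num₁ var) ↑ (35 ℕ.* m ℕ.+ 4)) (- num₁ (minus (8 ℕ.* m))) (- num₁ (plus (8 ℕ.* m))) (∏ℚ (20 ℕ.* m) (λ i → - num₁ (high (16 ℕ.* m ℕ.+ suc i)) * - num₁ (low (suc i)))))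

  -- To be used with w k = 1 / (1 - q ^ k x).
  R : ℚ → (ℕ → ℚ) → ℚ
  R x w = ∏N (numerators m) (nv x) * ∏K (poles m) w

  -- The model of constant series with h = 1 and η k = 1 / (1 - q^k x). Orders above 10 vanish by
  -- `coeff-vanish`, order 0 by `const-vanish`.
  R-expand : ∀ x w → (∀ k → k ℕ.≤ n → w k * (1ℚ - q ↑ k * x) ≡ 1ℚ) →
    R x w ≡ ∑ (suc n) (λ j → ∑ 10 (λ s → coeff j (suc s) * w j ↑ suc s))
  R-expand x w hw = trans (sym (prod-const 𝔐 (nv x) w fac)) (trans (expansion 𝔐 0) (trans (ev-const 𝔐 w 1⇑0 (λ k _ s → C⇑0 (w k) s))
    (trans (cong (_+ ∑ (suc n) (λ j → ∑ 10 (λ s → coeff j (suc s) * w j ↑ suc s))) const-vanish) (+-identityˡ _))))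
    where
    𝔐 : Model
    𝔐 = mkModel (C x) (C 1ℚ) (λ k → C (w k)) eq
      where
      eq : ∀ i → i ℕ.≤ n → C (w i) ⊛ (C 1ℚ ⊕ C (- q ↑ i) ⊛ C x) ≈ C 1ℚ
      eq i i≤n zero = trans (r (w i) (q ↑ i) x) (hw i i≤n)
        where
        r : ∀ a b c → a * (1ℚ + - b * c) ≡ a * (1ℚ - b * c)
        r = solve-∀ ℚring
      eq i i≤n (suc t) = trans (C⊛ (w i) _ (suc t)) (trans (cong (λ z → w i * (0ℚ + z)) (C⊛ (- q ↑ i) (C x) (suc t))) (r (w i) (- q ↑ i)))
        where
        r : ∀ a b → a * (0ℚ + b * 0ℚ) ≡ 0ℚ
        r = solve-∀ ℚring
    fac : ∀ N k → k ℕ.≤ n → facPS 𝔐 (mkFactor N k) 0 ≡ nv x N * w k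
    fac N k k≤n = trans (r (num₀ N) (num₁ N) (P ↑ k) (w k)) (trans (cong₂ (λ y z → num₀ N * w k + num₁ N * (P ↑ k * w k - P ↑ k * y) + num₁ N * z) (sym (hw k k≤n)) refl)
      (trans (r₂ (num₀ N) (num₁ N) (P ↑ k) (w k) (q ↑ k) x) (trans (cong (λ z → (num₀ N + num₁ N * (z * x)) * w k) (qP^ k)) (r₃ (num₀ N) (num₁ N) x (w k)))))
      where
      r : ∀ a b p w → - (b * p) * 1ℚ + (a + b * p) * w ≡ a * w + b * (p * w - p * 1ℚ) + b * 0ℚ
      r = solve-∀ ℚring
      r₂ : ∀ a b p w c x → a * w + b * (p * w - p * (w * (1ℚ - c * x))) + b * 0ℚ ≡ (a + b * (c * p * x)) * w
      r₂ = solve-∀ ℚring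
      r₃ : ∀ a b x w → (a + b * (1ℚ * x)) * w ≡ (a + b * x) * w
      r₃ = solve-∀ ℚring

  -- At x = 0 every 1 / (1 - q^k x) is 1, and R is 0 there because of its factor x^(35m+4).
  sum-vanish : ∑ (suc n) (λ j → ∑ 10 (λ s → coeff j (suc s))) ≡ 0ℚ
  sum-vanish = trans (∑-cong (suc n) (λ j _ → ∑-cong 10 (λ s _ → sym (trans (cong (coeff j (suc s) *_) (1↑ (suc s))) (*-identityʳ (coeff j (suc s)))))))
    (trans (sym (R-expand 0ℚ (λ _ → 1ℚ) (λ k _ → r (q ↑ k)))) (trans (cong (_* ∏K (poles m) (λ _ → 1ℚ)) (trans (∏N-numerators m (nv 0ℚ)) (trans (cong (_* Z) (trans (cong ((0ℚ + 1ℚ * 0ℚ) ↑_) (ℕP.+-suc (35 ℕ.* m) 3)) (0↑ (35 ℕ.* m ℕ.+ 3)))) (*-zeroˡ Z)))) (*-zeroˡ (∏K (poles m) (λ _ → 1ℚ)))))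
    where
    r : ∀ a → 1ℚ * (1ℚ - a * 0ℚ) ≡ 1ℚ
    r = solve-∀ ℚring
    Z = nv 0ℚ (minus (8 ℕ.* m)) * (nv 0ℚ (plus (8 ℕ.* m)) * (∏ℚ (20 ℕ.* m) (λ i → nv 0ℚ (high (16 ℕ.* m ℕ.+ suc i)) * nv 0ℚ (low (suc i))) * nv 0ℚ one ↑ (35 ℕ.* m ℕ.+ 4)))

-- H s = ω ^ (s + 1) - (1 - ω) ^ (s + 1), normalised to vanish for s = 0.
Hd : ℕ → ℚ → ℚ
Hd s ω = (ω ↑ suc s - (1ℚ - ω) ↑ suc s) - (ω - (1ℚ - ω))

-- The linear form

module LinearForm (p : ℤ) (2≤p : 2 ℕ.≤ ℤ.∣ p ∣) (q : ℚ) (qP : q * ι p ≡ 1ℚ) (m : ℕ) where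

  open Evaluation p 2≤p q qP m public

  -- The index is shifted by one: `W` i is ω_(i+1).
  W : ℕ → ℚ
  W i = inv (1ℚ - q ↑ suc i)

  W-inv : ∀ i → W i * (1ℚ - q ↑ suc i) ≡ 1ℚ
  W-inv i = trans (*-comm (W i) _) (*-inv (1-q^≢0 i))

  1-W : ∀ i → 1ℚ - W i ≡ - (q ↑ suc i * W i)
  1-W i = trans (cong (_- W i) (sym (W-inv i))) (r (W i) (q ↑ suc i))
    where
    r : ∀ w y → w * (1ℚ - y) - w ≡ - (y * w)
    r = solve-∀ ℚring

  module Reflection (k : ℕ) where
    -- The reflected point x̃ is q^(-16m) / x. With θ = q^(8m) x and τ = 1 / θ one has x̃ = τ² x.
    x x̃ θ τ : ℚ
    x = q ↑ suc k
    x̃ = P ↑ (n ℕ.+ suc k)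
    θ = q ↑ (8 ℕ.* m ℕ.+ suc k)
    τ = P ↑ (8 ℕ.* m ℕ.+ suc k)

    -- From 1 / (1 - 1/y) = 1 - 1 / (1 - y) with y = q^(k + 1 + n - j): reflection exchanges the
    -- indices j and n - j and turns ω into 1 - ω.
    w w̃ : ℕ → ℚ
    w j = W (k ℕ.+ j)
    w̃ j = 1ℚ - W (k ℕ.+ (n ℕ.∸ j))

    qx : ∀ j → q ↑ j * x ≡ q ↑ suc (k ℕ.+ j)
    qx j = trans (sym (↑-+ q j (suc k))) (cong (q ↑_) (trans (ℕP.+-suc j k) (cong suc (ℕP.+-comm j k))))

    w-inv : ∀ j → j ℕ.≤ n → w j * (1ℚ - q ↑ j * x) ≡ 1ℚ
    w-inv j _ = trans (cong (λ z → w j * (1ℚ - z)) (qx j)) (W-inv (k ℕ.+ j))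

    qx̃ : ∀ j → j ℕ.≤ n → q ↑ j * x̃ ≡ P ↑ suc (k ℕ.+ (n ℕ.∸ j))
    qx̃ j j≤n = trans (cong (λ z → q ↑ j * P ↑ z) eq) (qP″ j (suc (k ℕ.+ (n ℕ.∸ j))))
      where
      r : ∀ j d k → j ℕ.+ d ℕ.+ suc k ≡ j ℕ.+ suc (k ℕ.+ d)
      r = ℕ-solve-∀
      eq : n ℕ.+ suc k ≡ j ℕ.+ suc (k ℕ.+ (n ℕ.∸ j))
      eq = trans (cong (ℕ._+ suc k) (sym (ℕP.m+[n∸m]≡n j≤n))) (r j (n ℕ.∸ j) k)

    w̃-inv : ∀ j → j ℕ.≤ n → w̃ j * (1ℚ - q ↑ j * x̃) ≡ 1ℚ
    w̃-inv j j≤n = trans (cong₂ (λ a b → a * (1ℚ - b)) (1-W i) (qx̃ j j≤n)) (trans (r (q ↑ suc i) (W i) (P ↑ suc i)) (trans (cong (λ z → W i * (z - q ↑ suc i)) (qP^ (suc i))) (W-inv i)))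
      where
      i = k ℕ.+ (n ℕ.∸ j)
      r : ∀ y w z → - (y * w) * (1ℚ - z) ≡ w * (y * z - y)
      r = solve-∀ ℚring

    θτ : θ * τ ≡ 1ℚ
    θτ = qP^ (8 ℕ.* m ℕ.+ suc k)

    n≡ : 8 ℕ.* m ℕ.+ 8 ℕ.* m ≡ n
    n≡ = sym (ℕP.*-distribʳ-+ m 8 8)

    w̃-pair : ∀ d → d ℕ.≤ 8 ℕ.* m → w̃ (8 ℕ.* m ℕ.∸ d) * w̃ (8 ℕ.* m ℕ.+ d) ≡ θ * θ * (w (8 ℕ.* m ℕ.∸ d) * w (8 ℕ.* m ℕ.+ d))
    w̃-pair d d≤ = trans (cong₂ (λ a b → (1ℚ - W (k ℕ.+ a)) * (1ℚ - W (k ℕ.+ b))) e₁ e₂)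
      (trans (cong₂ _*_ (1-W (k ℕ.+ hi)) (1-W (k ℕ.+ lo))) (trans (r (q ↑ suc (k ℕ.+ hi)) (W (k ℕ.+ hi)) (q ↑ suc (k ℕ.+ lo)) (W (k ℕ.+ lo))) (cong (_* (W (k ℕ.+ lo) * W (k ℕ.+ hi))) pw)))
      where
      c = 8 ℕ.* m
      lo = c ℕ.∸ d
      hi = c ℕ.+ d
      lo+d : lo ℕ.+ d ≡ c
      lo+d = ℕP.m∸n+n≡m d≤
      e₁ : n ℕ.∸ lo ≡ hi
      e₁ = trans (cong (ℕ._∸ lo) (trans (sym n≡) (trans (cong (c ℕ.+_) (sym lo+d)) (r₁ c lo d)))) (ℕP.m+n∸m≡n lo hi)
        where
        r₁ : ∀ c l d → c ℕ.+ (l ℕ.+ d) ≡ l ℕ.+ (c ℕ.+ d)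
        r₁ = ℕ-solve-∀
      e₂ : n ℕ.∸ hi ≡ lo
      e₂ = trans (cong (ℕ._∸ hi) (trans (sym n≡) (trans (cong (c ℕ.+_) (sym lo+d)) (r₁ c lo d)))) (ℕP.m+n∸m≡n hi lo)
        where
        r₁ : ∀ c l d → c ℕ.+ (l ℕ.+ d) ≡ c ℕ.+ d ℕ.+ l
        r₁ = ℕ-solve-∀
      r : ∀ a b c d → - (a * b) * - (c * d) ≡ a * c * (d * b)
      r = solve-∀ ℚring
      pw : q ↑ suc (k ℕ.+ hi) * q ↑ suc (k ℕ.+ lo) ≡ θ * θ
      pw = trans (sym (↑-+ q (suc (k ℕ.+ hi)) (suc (k ℕ.+ lo)))) (trans (cong (q ↑_) (trans (r₁ k c d lo) (cong (λ z → c ℕ.+ suc k ℕ.+ (z ℕ.+ suc k)) lo+d))) (↑-+ q (c ℕ.+ suc k) (c ℕ.+ suc k)))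
        where
        r₁ : ∀ k c d l → suc (k ℕ.+ (c ℕ.+ d)) ℕ.+ suc (k ℕ.+ l) ≡ c ℕ.+ suc k ℕ.+ (l ℕ.+ d ℕ.+ suc k)
        r₁ = ℕ-solve-∀

    w̃-centre : w̃ (8 ℕ.* m) ≡ - θ * w (8 ℕ.* m)
    w̃-centre = trans (cong (λ z → 1ℚ - W (k ℕ.+ z)) (trans (cong (ℕ._∸ 8 ℕ.* m) (sym n≡)) (ℕP.m+n∸m≡n (8 ℕ.* m) (8 ℕ.* m))))
      (trans (1-W (k ℕ.+ 8 ℕ.* m)) (trans (cong (λ z → - (q ↑ z * W (k ℕ.+ 8 ℕ.* m))) (trans (cong suc (ℕP.+-comm k (8 ℕ.* m))) (sym (ℕP.+-suc (8 ℕ.* m) k)))) (neg-distribˡ-* θ _)))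

    poles-reflect : ∏K (poles m) w̃ ≡ θ ↑ (110 ℕ.* m ℕ.+ 10) * ∏K (poles m) w
    poles-reflect = trans (go heights) (cong (_* ∏K (poles m) w) (trans (cong₂ _*_ (r₁₀ θ) (trans (cong ((θ * θ) ↑_) (r₅₅ m)) (trans (cong (_↑ (55 ℕ.* m)) (sym (cong (θ *_) (*-identityʳ θ)))) (sym (↑-* θ (55 ℕ.* m) 2)))))
        (trans (sym (↑-+ θ 10 (55 ℕ.* m ℕ.* 2))) (cong (θ ↑_) (r₁₁₀ m)))))
      where
      pairprod : ∀ L → L ℕ.≤ 8 ℕ.* m → ∏ℚ L (λ i → w̃ (8 ℕ.* m ℕ.∸ suc i) * w̃ (8 ℕ.* m ℕ.+ suc i)) ≡ (θ * θ) ↑ L * ∏ℚ L (λ i → w (8 ℕ.* m ℕ.∸ suc i) * w (8 ℕ.* m ℕ.+ suc i))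
      pairprod L L≤ = trans (∏ℚ-cong L (λ i i<L → w̃-pair (suc i) (ℕP.≤-trans i<L L≤))) (trans (∏ℚ-* L (λ _ → θ * θ) wp) (cong (_* ∏ℚ L wp) (∏ℚ-const L (θ * θ))))
        where
        wp : ℕ → ℚ
        wp i = w (8 ℕ.* m ℕ.∸ suc i) * w (8 ℕ.* m ℕ.+ suc i)
      go : ∀ hs → ∏K (intervals m hs) w̃ ≡ (- θ) ↑ (∑L hs (λ _ → 1)) * (θ * θ) ↑ (∑L hs (λ h → (8 ℕ.∸ h) ℕ.* m)) * ∏K (intervals m hs) w
      go [] = refl
      go (h ∷ hs) = trans (∏K-++ (8 ℕ.* m ∷ block (8 ℕ.* m) L) (intervals m hs) w̃)
        (trans (cong₂ _*_ (cong₂ _*_ w̃-centre (trans (∏K-block (8 ℕ.* m) L w̃) (trans (pairprod L (ℕP.*-monoˡ-≤ m (ℕP.m∸n≤m 8 h))) (cong ((θ * θ) ↑ L *_) (sym (∏K-block (8 ℕ.* m) L w)))))) (go hs))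
        (trans (r (- θ) (w (8 ℕ.* m)) ((θ * θ) ↑ L) (∏K (block (8 ℕ.* m) L) w) ((- θ) ↑ (∑L hs (λ _ → 1))) ((θ * θ) ↑ (∑L hs (λ h → (8 ℕ.∸ h) ℕ.* m))) (∏K (intervals m hs) w))
          (cong₂ (λ a b → - θ * (- θ) ↑ (∑L hs (λ _ → 1)) * a * b) (sym (↑-+ (θ * θ) L (∑L hs (λ h → (8 ℕ.∸ h) ℕ.* m)))) (sym (∏K-++ (8 ℕ.* m ∷ block (8 ℕ.* m) L) (intervals m hs) w)))))
        where
        L = (8 ℕ.∸ h) ℕ.* m
        r : ∀ t c a b u v z → t * c * (a * b) * (u * v * z) ≡ t * u * (a * v) * (c * b * z)
        r = solve-∀ ℚring
      r₁₀ : ∀ t → (- t) ↑ 10 ≡ t ↑ 10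
      r₁₀ t = trans (lem (- t)) (trans (rr t) (sym (lem t)))
        where
        lem : ∀ t → t ↑ 10 ≡ t * (t * (t * (t * (t * (t * (t * (t * (t * (t * 1ℚ)))))))))
        lem t = refl
        rr : ∀ t → - t * (- t * (- t * (- t * (- t * (- t * (- t * (- t * (- t * (- t * 1ℚ))))))))) ≡ t * (t * (t * (t * (t * (t * (t * (t * (t * (t * 1ℚ)))))))))
        rr = solve-∀ ℚring
      r₅₅ : ∀ m → 8 ℕ.* m ℕ.+ (7 ℕ.* m ℕ.+ (7 ℕ.* m ℕ.+ (6 ℕ.* m ℕ.+ (6 ℕ.* m ℕ.+ (5 ℕ.* m ℕ.+ (5 ℕ.* m ℕ.+ (4 ℕ.* m ℕ.+ (4 ℕ.* m ℕ.+ (3 ℕ.* m ℕ.+ 0))))))))) ≡ 55 ℕ.* m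
      r₅₅ = ℕ-solve-∀
      r₁₁₀ : ∀ m → 10 ℕ.+ 55 ℕ.* m ℕ.* 2 ≡ 110 ℕ.* m ℕ.+ 10
      r₁₁₀ = ℕ-solve-∀

    x̃≡ : x̃ ≡ τ * τ * x
    x̃≡ = sym (trans (cong (_* x) (trans (sym (↑-+ P (8 ℕ.* m ℕ.+ suc k) (8 ℕ.* m ℕ.+ suc k))) (cong (P ↑_) (r (8 ℕ.* m) (suc k))))) (trans (*-comm _ x) (trans (qP″ (suc k) (8 ℕ.* m ℕ.+ 8 ℕ.* m ℕ.+ suc k)) (cong (λ z → P ↑ (z ℕ.+ suc k)) n≡))))
      where
      r : ∀ c k → c ℕ.+ k ℕ.+ (c ℕ.+ k) ≡ k ℕ.+ (c ℕ.+ c ℕ.+ k)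
      r = ℕ-solve-∀

    num-pair : ∀ s → nv x̃ (high (n ℕ.+ s)) * nv x̃ (low s) ≡ τ * τ * (nv x (high (n ℕ.+ s)) * nv x (low s))
    num-pair s = trans (cong₂ (λ a b → (1ℚ + a) * (1ℚ + b)) h̃ l̃)
        (trans (r₀ a A y Y v V e₁ e₂ e₃) (cong₂ (λ z v → z * ((1ℚ + v) * (1ℚ + - P ↑ s * x))) pw (sym hx)))
      where
      a = q ↑ s
      A = P ↑ s
      y = q ↑ suc k
      Y = P ↑ suc k
      v = q ↑ n
      V = P ↑ n
      e₁ : a * A ≡ 1ℚ
      e₁ = qP^ s
      e₂ : y * Y ≡ 1ℚ
      e₂ = qP^ (suc k)
      e₃ : v * V ≡ 1ℚ
      e₃ = qP^ n
      x̃s : x̃ ≡ V * Y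
      x̃s = ↑-+ P n (suc k)
      h̃ : - q ↑ (n ℕ.+ s) * x̃ ≡ - (a * Y)
      h̃ = trans (cong₂ (λ b c → - b * c) (↑-+ q n s) x̃s) (trans (r v a V Y) (trans (cong (λ z → - (z * (a * Y))) e₃) (cong -_ (*-identityˡ (a * Y)))))
        where
        r : ∀ u a U Y → - (u * a) * (U * Y) ≡ - (u * U * (a * Y))
        r = solve-∀ ℚring
      l̃ : - A * x̃ ≡ - (A * (V * Y))
      l̃ = trans (cong (- A *_) x̃s) (sym (neg-distribˡ-* A (V * Y)))
      hx : - q ↑ (n ℕ.+ s) * x ≡ - (v * a * y)
      hx = trans (cong (λ b → - b * x) (↑-+ q n s)) (sym (neg-distribˡ-* (v * a) y))
      pw : V * Y * Y ≡ τ * τ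
      pw = trans (trans (cong (_* Y) (sym x̃s)) (trans (sym (↑-+ P (n ℕ.+ suc k) (suc k))) (cong (P ↑_) (trans (cong (λ z → z ℕ.+ suc k ℕ.+ suc k) (sym n≡)) (r (8 ℕ.* m) (suc k)))))) (↑-+ P (8 ℕ.* m ℕ.+ suc k) (8 ℕ.* m ℕ.+ suc k))
        where
        r : ∀ c k → c ℕ.+ c ℕ.+ k ℕ.+ k ≡ c ℕ.+ k ℕ.+ (c ℕ.+ k)
        r = ℕ-solve-∀
      r₀ : ∀ a A y Y u U → a * A ≡ 1ℚ → y * Y ≡ 1ℚ → u * U ≡ 1ℚ → (1ℚ - a * Y) * (1ℚ - A * (U * Y)) ≡ U * Y * Y * ((1ℚ - u * a * y) * (1ℚ + - A * y))
      r₀ a A y Y u U e₁ e₂ e₃ = trans (s₁ a A Y U) (trans (cong (λ z → 1ℚ - a * Y - A * (U * Y) + z * (U * Y * Y)) e₁)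
        (sym (trans (trans (s₂ a A y Y u U) (cong₂ (λ f g → f + g) (trans (cong₂ (λ α β → U * Y * Y - α * (β * (a * Y)) - A * (U * Y) * β) e₃ e₂) refl) (trans (cong₂ (λ α β → α * (β * β) * (a * A)) e₃ e₂) (cong (1ℚ * (1ℚ * 1ℚ) *_) e₁)))) (s₃ a A Y U))))
        where
        s₁ : ∀ a A Y U → (1ℚ - a * Y) * (1ℚ - A * (U * Y)) ≡ 1ℚ - a * Y - A * (U * Y) + a * A * (U * Y * Y)
        s₁ = solve-∀ ℚring
        s₂ : ∀ a A y Y u U → U * Y * Y * ((1ℚ - u * a * y) * (1ℚ + - A * y)) ≡ (U * Y * Y - (u * U) * ((y * Y) * (a * Y)) - A * (U * Y) * (y * Y)) + (u * U) * ((y * Y) * (y * Y)) * (a * A)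
        s₂ = solve-∀ ℚring
        s₃ : ∀ a A Y U → U * Y * Y - 1ℚ * (1ℚ * (a * Y)) - A * (U * Y) * 1ℚ + 1ℚ * (1ℚ * 1ℚ) * 1ℚ ≡ 1ℚ - a * Y - A * (U * Y) + 1ℚ * (U * Y * Y)
        s₃ = solve-∀ ℚring

    -- All factors reproduce themselves up to powers of τ, except that 1 - τ² = - τ² (1 - θ²). The
    -- sign from this one factor makes R antisymmetric.
    nums-reflect : ∏N (numerators m) (nv x̃) ≡ - (τ ↑ (110 ℕ.* m ℕ.+ 10) * ∏N (numerators m) (nv x))
    nums-reflect = begin
      ∏N (numerators m) (nv x̃)
        ≡⟨ ∏N-numerators m (nv x̃) ⟩
      nv x̃ var ↑ e * (nv x̃ (minus c) * (nv x̃ (plus c) * (∏ℚ (20 ℕ.* m) (pr x̃) * nv x̃ one ↑ e)))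
        ≡⟨ cong₂ _*_ (trans (cong (_↑ e) vx) (↑-*ˡ (τ * τ) (nv x var) e)) (sym (*-assoc (nv x̃ (minus c)) (nv x̃ (plus c)) _)) ⟩
      (τ * τ) ↑ e * nv x var ↑ e * (nv x̃ (minus c) * nv x̃ (plus c) * (∏ℚ (20 ℕ.* m) (pr x̃) * nv x̃ one ↑ e))
        ≡⟨ cong₂ (λ a b → (τ * τ) ↑ e * nv x var ↑ e * (a * b)) vwp (cong₂ _*_ prs (cong (_↑ e) (one≡ x̃ x))) ⟩
      (τ * τ) ↑ e * nv x var ↑ e * (- (τ * τ * (nv x (minus c) * nv x (plus c))) * ((τ * τ) ↑ (20 ℕ.* m) * ∏ℚ (20 ℕ.* m) (pr x) * nv x one ↑ e))
        ≡⟨ r ((τ * τ) ↑ e) (nv x var ↑ e) (τ * τ) (nv x (minus c)) (nv x (plus c)) ((τ * τ) ↑ (20 ℕ.* m)) (∏ℚ (20 ℕ.* m) (pr x)) (nv x one ↑ e) ⟩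
      - ((τ * τ) ↑ e * ((τ * τ) * (τ * τ) ↑ (20 ℕ.* m)) * (nv x var ↑ e * (nv x (minus c) * (nv x (plus c) * (∏ℚ (20 ℕ.* m) (pr x) * nv x one ↑ e)))))
        ≡⟨ cong₂ (λ a b → - (a * b)) pows (sym (∏N-numerators m (nv x))) ⟩
      - (τ ↑ (110 ℕ.* m ℕ.+ 10) * ∏N (numerators m) (nv x)) ∎
      where
      open ≡-Reasoning
      e = 35 ℕ.* m ℕ.+ 4
      c = 8 ℕ.* m
      pr : ℚ → ℕ → ℚ
      pr x i = nv x (high (16 ℕ.* m ℕ.+ suc i)) * nv x (low (suc i))
      vx : nv x̃ var ≡ τ * τ * nv x var
      vx = trans (r₁ x̃) (trans x̃≡ (cong (τ * τ *_) (sym (r₁ x))))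
        where
        r₁ : ∀ x → 0ℚ + 1ℚ * x ≡ x
        r₁ = solve-∀ ℚring
      one≡ : ∀ x y → 1ℚ + 0ℚ * x ≡ 1ℚ + 0ℚ * y
      one≡ = solve-∀ ℚring
      cx̃ : q ↑ c * x̃ ≡ τ
      cx̃ = trans (cong (λ z → q ↑ c * P ↑ z) (trans (cong (ℕ._+ suc k) (sym n≡)) (ℕP.+-assoc c c (suc k)))) (qP″ c (c ℕ.+ suc k))
      cx : q ↑ c * x ≡ θ
      cx = sym (↑-+ q c (suc k))
      vwp : nv x̃ (minus c) * nv x̃ (plus c) ≡ - (τ * τ * (nv x (minus c) * nv x (plus c)))
      vwp = trans (r₁ (q ↑ c) x̃) (trans (cong (λ z → 1ℚ - z * z) cx̃) (sym (trans (r₂ (q ↑ c) x τ) (trans (cong (λ z → (z * τ) * (z * τ) - τ * τ) cx) (cong (λ z → z * z - τ * τ) θτ)))))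
        where
        r₁ : ∀ a x → (1ℚ + - a * x) * (1ℚ + a * x) ≡ 1ℚ - a * x * (a * x)
        r₁ = solve-∀ ℚring
        r₂ : ∀ a x t → - (t * t * ((1ℚ + - a * x) * (1ℚ + a * x))) ≡ a * x * t * (a * x * t) - t * t
        r₂ = solve-∀ ℚring
      prs : ∏ℚ (20 ℕ.* m) (pr x̃) ≡ (τ * τ) ↑ (20 ℕ.* m) * ∏ℚ (20 ℕ.* m) (pr x)
      prs = trans (∏ℚ-cong (20 ℕ.* m) (λ i _ → num-pair (suc i))) (trans (∏ℚ-* (20 ℕ.* m) (λ _ → τ * τ) (pr x)) (cong (_* ∏ℚ (20 ℕ.* m) (pr x)) (∏ℚ-const (20 ℕ.* m) (τ * τ))))
      r : ∀ a b t u v s z o → a * b * (- (t * (u * v)) * (s * z * o)) ≡ - (a * (t * s) * (b * (u * (v * (z * o)))))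
      r = solve-∀ ℚring
      pows : (τ * τ) ↑ e * ((τ * τ) * (τ * τ) ↑ (20 ℕ.* m)) ≡ τ ↑ (110 ℕ.* m ℕ.+ 10)
      pows = trans (sym (↑-+ (τ * τ) e (suc (20 ℕ.* m)))) (trans (cong (_↑ (e ℕ.+ suc (20 ℕ.* m))) (cong (τ *_) (sym (*-identityʳ τ)))) (trans (sym (↑-* τ (e ℕ.+ suc (20 ℕ.* m)) 2)) (cong (τ ↑_) (rr m))))
        where
        rr : ∀ m → (35 ℕ.* m ℕ.+ 4 ℕ.+ suc (20 ℕ.* m)) ℕ.* 2 ≡ 110 ℕ.* m ℕ.+ 10
        rr = ℕ-solve-∀

    -- The power τ^(110m+10) from the numerators cancels θ^(110m+10) from the poles.
    R-reflect : R x̃ w̃ ≡ - R x w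
    R-reflect = trans (cong₂ _*_ nums-reflect poles-reflect) (trans (r (τ ↑ T′) (∏N (numerators m) (nv x)) (θ ↑ T′) (∏K (poles m) w))
      (trans (cong (λ z → - (z * R x w)) (trans (sym (↑-*ˡ θ τ T′)) (trans (cong (_↑ T′) θτ) (1↑ T′)))) (cong -_ (*-identityˡ (R x w)))))
      where
      T′ = 110 ℕ.* m ℕ.+ 10
      r : ∀ a b c d → - (a * b) * (c * d) ≡ - (c * a * (b * d))
      r = solve-∀ ℚring

  term : ℕ → ℚ
  term k = R (q ↑ suc k) (λ j → W (k ℕ.+ j))

  -- Subtracting 1 from each power is free by `sum-vanish`. Both functions now vanish at ω = 1, the
  -- limit of the ω_i, so the boundary terms of the reindexed sums tend to 0.
  AA BB : ℕ → ℚ → ℚ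
  AA j ω = ∑ 10 (λ s → coeff j (suc s) * (ω ↑ suc s - 1ℚ))
  BB j ω = ∑ 10 (λ s → coeff j (suc s) * (1ℚ - ω) ↑ suc s)

  two-terms : ∀ k → term k + term k ≡ ∑ (suc n) (λ j → AA j (W (k ℕ.+ j))) - ∑ (suc n) (λ j → BB j (W (k ℕ.+ (n ℕ.∸ j))))
  two-terms k = trans (cong (term k +_) (trans (r (term k)) (cong -_ (sym R-reflect)))) (cong₂ _-_ eqA (R-expand x̃ w̃ w̃-inv))
    where
    open Reflection k
    r : ∀ a → a ≡ - (- a)
    r = solve-∀ ℚring
    r₂ : ∀ a b → a * b ≡ a * (b - 1ℚ) + a
    r₂ = solve-∀ ℚring
    eqA : term k ≡ ∑ (suc n) (λ j → AA j (W (k ℕ.+ j)))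
    eqA = trans (R-expand x w w-inv) (trans (∑-cong (suc n) (λ j _ → trans (∑-cong 10 (λ s _ → r₂ (coeff j (suc s)) (w j ↑ suc s))) (∑-+ 10 (λ s → coeff j (suc s) * (w j ↑ suc s - 1ℚ)) (λ s → coeff j (suc s)))))
      (trans (∑-+ (suc n) (λ j → AA j (w j)) (λ j → ∑ 10 (λ s → coeff j (suc s)))) (trans (cong (∑ (suc n) (λ j → AA j (w j)) +_) sum-vanish) (+-identityʳ _))))

  γ : ℕ → ℚ
  γ s = ∑ (suc n) (λ j → coeff j (suc s))

  -- Reindexing by i = k + j and i = k + n - j drops initial segments of lengths j and n - j,
  -- collected here; `tailSum` is the overshoot at the upper end.
  constant : ℚ
  constant = ∑ (suc n) (λ j → ∑ j (λ i → AA j (W i))) - ∑ (suc n) (λ j → ∑ (n ℕ.∸ j) (λ i → BB j (W i)))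

  tailSum : ℕ → ℚ
  tailSum K = ∑ (suc n) (λ j → ∑ j (λ i → AA j (W (K ℕ.+ i)))) - ∑ (suc n) (λ j → ∑ (n ℕ.∸ j) (λ i → BB j (W (K ℕ.+ i))))

  -- The normalisation in `Hd` changes each summand by a multiple of 2ω - 2, and these multiples
  -- cancel by `sum-vanish`.
  AB-sum : ∀ ω → ∑ (suc n) (λ j → AA j ω) - ∑ (suc n) (λ j → BB j ω) ≡ ∑ 10 (λ s → γ s * Hd s ω)
  AB-sum ω = trans (sym (∑-- (suc n) (λ j → AA j ω) (λ j → BB j ω))) (trans (∑-cong (suc n) (λ j _ → trans (sym (∑-- 10 (λ s → coeff j (suc s) * (ω ↑ suc s - 1ℚ)) (λ s → coeff j (suc s) * (1ℚ - ω) ↑ suc s)))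
      (trans (∑-cong 10 (λ s _ → r (coeff j (suc s)) (ω ↑ suc s) ((1ℚ - ω) ↑ suc s) ω)) (trans (∑-+ 10 (λ s → coeff j (suc s) * Hd s ω) (λ s → coeff j (suc s) * (ω + ω - 1ℚ - 1ℚ))) (cong (∑ 10 (λ s → coeff j (suc s) * Hd s ω) +_) (∑-*ʳ 10 (ω + ω - 1ℚ - 1ℚ) (λ s → coeff j (suc s))))))))
    (trans (∑-+ (suc n) (λ j → ∑ 10 (λ s → coeff j (suc s) * Hd s ω)) (λ j → ∑ 10 (λ s → coeff j (suc s)) * (ω + ω - 1ℚ - 1ℚ)))
    (trans (cong₂ _+_ (trans (∑-swap (suc n) 10 (λ j s → coeff j (suc s) * Hd s ω)) (∑-cong 10 (λ s _ → ∑-*ʳ (suc n) (Hd s ω) (λ j → coeff j (suc s)))))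
      (trans (∑-*ʳ (suc n) (ω + ω - 1ℚ - 1ℚ) (λ j → ∑ 10 (λ s → coeff j (suc s)))) (trans (cong (_* (ω + ω - 1ℚ - 1ℚ)) sum-vanish) (*-zeroˡ (ω + ω - 1ℚ - 1ℚ))))) (+-identityʳ _))))
    where
    r : ∀ g a b w → g * (a - 1ℚ) - g * b ≡ g * ((a - b) - (w - (1ℚ - w))) + g * (w + w - 1ℚ - 1ℚ)
    r = solve-∀ ℚring

  form : ∀ K → ∑ K (λ k → term k + term k) ≡ ∑ K (λ i → ∑ 10 (λ s → γ s * Hd s (W i))) + tailSum K - constant
  form K = begin
    ∑ K (λ k → term k + term k)
      ≡⟨ trans (∑-cong K (λ k _ → two-terms k)) (∑-- K _ _) ⟩
    ∑ K (λ k → ∑ (suc n) (λ j → AA j (W (k ℕ.+ j)))) - ∑ K (λ k → ∑ (suc n) (λ j → BB j (W (k ℕ.+ (n ℕ.∸ j)))))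
      ≡⟨ cong₂ _-_ (sumA AA (λ j → j)) (sumA BB (λ j → n ℕ.∸ j)) ⟩
    (a′₁ + a′₂ - a′₃) - (b′₁ + b′₂ - b′₃)
      ≡⟨ r a′₁ a′₂ a′₃ b′₁ b′₂ b′₃ ⟩
    (a′₁ - b′₁) + (a′₂ - b′₂) - (a′₃ - b′₃)
      ≡⟨ cong (λ z → z + tailSum K - constant) (trans (cong₂ _-_ (∑-swap (suc n) K (λ j i → AA j (W i))) (∑-swap (suc n) K (λ j i → BB j (W i)))) (trans (sym (∑-- K _ _)) (∑-cong K (λ i _ → AB-sum (W i))))) ⟩
    ∑ K (λ i → ∑ 10 (λ s → γ s * Hd s (W i))) + tailSum K - constant ∎
    where
    open ≡-Reasoning
    a′₁ = ∑ (suc n) (λ j → ∑ K (λ i → AA j (W i)))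
    a′₂ = ∑ (suc n) (λ j → ∑ j (λ i → AA j (W (K ℕ.+ i))))
    a′₃ = ∑ (suc n) (λ j → ∑ j (λ i → AA j (W i)))
    b′₁ = ∑ (suc n) (λ j → ∑ K (λ i → BB j (W i)))
    b′₂ = ∑ (suc n) (λ j → ∑ (n ℕ.∸ j) (λ i → BB j (W (K ℕ.+ i))))
    b′₃ = ∑ (suc n) (λ j → ∑ (n ℕ.∸ j) (λ i → BB j (W i)))
    r : ∀ a b c x y z → (a + b - c) - (x + y - z) ≡ (a - x) + (b - y) - (c - z)
    r = solve-∀ ℚring
    sumA : ∀ (F : ℕ → ℚ → ℚ) (sh : ℕ → ℕ) → ∑ K (λ k → ∑ (suc n) (λ j → F j (W (k ℕ.+ sh j)))) ≡
      ∑ (suc n) (λ j → ∑ K (λ i → F j (W i))) + ∑ (suc n) (λ j → ∑ (sh j) (λ i → F j (W (K ℕ.+ i)))) - ∑ (suc n) (λ j → ∑ (sh j) (λ i → F j (W i)))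
    sumA F sh = trans (∑-swap K (suc n) (λ k j → F j (W (k ℕ.+ sh j)))) (trans (∑-cong (suc n) (λ j _ → shift-sum K (sh j) (λ i → F j (W i))))
      (trans (∑-- (suc n) (λ j → ∑ K (λ i → F j (W i)) + ∑ (sh j) (λ i → F j (W (K ℕ.+ i)))) (λ j → ∑ (sh j) (λ i → F j (W i))))
        (cong (_- ∑ (suc n) (λ j → ∑ (sh j) (λ i → F j (W i)))) (∑-+ (suc n) (λ j → ∑ K (λ i → F j (W i))) (λ j → ∑ (sh j) (λ i → F j (W (K ℕ.+ i))))))))

  Δ∑ : ∀ N {f : ℕ → ℚ} → (∀ i → i ℕ.< N → Integral (Δ * f i)) → Integral (Δ * ∑ N f)
  Δ∑ N {f} h = subst Integral (∑-*ˡ N Δ f) (integral-∑ N h)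

  module _ (j : ℕ) (j≤n : j ℕ.≤ n) where
    open Pole j j≤n

    M-pow : ∀ {y} → M χ 0̂ y → ∀ s → M (λ l → s ℕ.* χ l) 0̂ (y ↑ s)
    M-pow h zero = M-1
    M-pow h (suc s) = M-* h (M-pow h s)

    coeff-pow : ∀ {y} s → s ℕ.< 10 → M χ 0̂ y → Integral (Δ * (coeff j (suc s) * y ↑ suc s))
    coeff-pow s s<10 h = integrality (suc s) _ (s≤s z≤n) (ℕP.≤-trans s<10 10≤T) (M-pow h (suc s))

    coeff-1 : ∀ s → s ℕ.< 10 → Integral (Δ * coeff j (suc s))
    coeff-1 s s<10 = subst Integral (cong (Δ *_) (trans (cong (coeff j (suc s) *_) (1↑ (suc s))) (*-identityʳ (coeff j (suc s)))))
      (coeff-pow s s<10 (M-weaken (λ l _ → z≤n) M-1))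

    M-W⁻ : ∀ i → suc i ℕ.≤ reach → M χ 0̂ (inv (P ↑ suc i - 1ℚ))
    M-W⁻ i h = M-weaken (λ l _ → ℕP.+-monoˡ-≤ 0 (δ≤χ i h l)) (M-U⁻¹ i (ℕP.≤-trans h (ℕP.⊔-lub j≤n (ℕP.m∸n≤m n j))))

    W≡ : ∀ i → W i ≡ inv (P ↑ suc i - 1ℚ) * P ↑ suc i
    W≡ i = inv-unique {1ℚ - q ↑ suc i} {inv (P ↑ suc i - 1ℚ) * P ↑ suc i} (trans (r (1ℚ - q ↑ suc i) (inv (P ↑ suc i - 1ℚ)) (P ↑ suc i)) (trans (cong (_* inv (P ↑ suc i - 1ℚ)) (1-qP (suc i))) (*-inv (U≢0 i))))
      where
      r : ∀ a b c → a * (b * c) ≡ c * a * b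
      r = solve-∀ ℚring

    M-W : ∀ i → suc i ℕ.≤ reach → M χ 0̂ (W i)
    M-W i h = subst (M χ 0̂) (sym (W≡ i)) (M-weaken (λ l _ → ℕP.≤-reflexive (cong (ℕ._+ 0) (ℕP.+-identityʳ (χ l)))) (M-* (M-W⁻ i h) (M-integral (integral-↑ (suc i) (integral-ι p)))))

    M-1-W : ∀ i → suc i ℕ.≤ reach → M χ 0̂ (1ℚ - W i)
    M-1-W i h = M-+ (M-weaken (λ l _ → z≤n) M-1) (M-neg (M-W i h))

    -- A power s of ω_(i+1) with i + 1 ≤ `reach` costs s factors `χ`, just what `integrality`
    -- admits. The segments in `constant` satisfy the bound, as j and n - j are at most `reach`.
    AA-integral : ∀ i → suc i ℕ.≤ reach → Integral (Δ * AA j (W i))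
    AA-integral i h = Δ∑ 10 (λ s s<10 → subst Integral (r Δ (coeff j (suc s)) (W i ↑ suc s)) (integral-+ (coeff-pow s s<10 (M-W i h)) (integral-neg (coeff-1 s s<10))))
      where
      r : ∀ d c w → d * (c * w) + - (d * c) ≡ d * (c * (w - 1ℚ))
      r = solve-∀ ℚring

    BB-integral : ∀ i → suc i ℕ.≤ reach → Integral (Δ * BB j (W i))
    BB-integral i h = Δ∑ 10 (λ s s<10 → coeff-pow s s<10 (M-1-W i h))

    rowA-integral : Integral (Δ * ∑ j (λ i → AA j (W i)))
    rowA-integral = Δ∑ j (λ i i<j → AA-integral i (ℕP.≤-trans i<j (ℕP.m≤m⊔n j (n ℕ.∸ j))))

    rowB-integral : Integral (Δ * ∑ (n ℕ.∸ j) (λ i → BB j (W i)))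
    rowB-integral = Δ∑ (n ℕ.∸ j) (λ i i< → BB-integral i (ℕP.≤-trans i< (ℕP.m≤n⊔m j (n ℕ.∸ j))))

  γ-integral : ∀ s → s ℕ.< 10 → Integral (Δ * γ s)
  γ-integral s s<10 = Δ∑ (suc n) (λ j j< → coeff-1 j (ℕP.≤-pred j<) s s<10)

  constant-integral : Integral (Δ * constant)
  constant-integral = subst Integral (r Δ _ _) (integral-+ (Δ∑ (suc n) (λ j j< → rowA-integral j (ℕP.≤-pred j<))) (integral-neg (Δ∑ (suc n) (λ j j< → rowB-integral j (ℕP.≤-pred j<)))))
    where
    r : ∀ d a b → d * a + - (d * b) ≡ d * (a - b)
    r = solve-∀ ℚring

-- Size estimates

2ℚ : ℚ
2ℚ = 1ℚ + 1ℚ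

0≤1 : 0ℚ ≤ 1ℚ
0≤1 = <⇒≤ (positive⁻¹ 1ℚ)

1≤2 : 1ℚ ≤ 2ℚ
1≤2 = subst (_≤ 2ℚ) (+-identityʳ 1ℚ) (+-monoʳ-≤ 1ℚ 0≤1)

0≤2 : 0ℚ ≤ 2ℚ
0≤2 = ≤-trans 0≤1 1≤2

-- Two-sided: |x| lies between 2^(-b) and 2^b, a condition stable under products and inverses.
record Bd (b : ℕ) (x : ℚ) : Set where
  constructor bd
  field
    upper : ∣ x ∣ ≤ 2ℚ ↑ b
    lower : 1ℚ ≤ ∣ x ∣ * 2ℚ ↑ b
open Bd

Bd-* : ∀ {b c x y} → Bd b x → Bd c y → Bd (b ℕ.+ c) (x * y)
Bd-* {b} {c} {x} {y} (bd u l) (bd u′ l′) = bd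
  (subst₂ _≤_ (sym (∣p*q∣≡∣p∣*∣q∣ x y)) (sym (↑-+ 2ℚ b c)) (*-mono-nonNeg (0≤∣p∣ x) u (0≤∣p∣ y) u′))
  (subst (1ℚ ≤_) (trans (*-swap-middle (∣ x ∣) (2ℚ ↑ b) (∣ y ∣) (2ℚ ↑ c)) (cong₂ _*_ (sym (∣p*q∣≡∣p∣*∣q∣ x y)) (sym (↑-+ 2ℚ b c))))
    (subst (_≤ ∣ x ∣ * 2ℚ ↑ b * (∣ y ∣ * 2ℚ ↑ c)) (*-identityʳ 1ℚ) (*-mono-nonNeg 0≤1 l 0≤1 l′)))

Bd-inv : ∀ {b x y} → x * y ≡ 1ℚ → Bd b x → Bd b y
Bd-inv {b} {x} {y} e (bd u l) = bd
  (subst₂ _≤_ (*-identityʳ ∣ y ∣) (trans (r (∣ y ∣) (∣ x ∣) (2ℚ ↑ b)) (trans (cong (_* 2ℚ ↑ b) e′) (*-identityˡ _))) (*-monoˡ (0≤∣p∣ y) l))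
  (subst (_≤ ∣ y ∣ * 2ℚ ↑ b) (trans (*-comm (∣ y ∣) (∣ x ∣)) e′) (*-monoˡ (0≤∣p∣ y) u))
  where
  e′ : ∣ x ∣ * ∣ y ∣ ≡ 1ℚ
  e′ = trans (sym (∣p*q∣≡∣p∣*∣q∣ x y)) (cong ∣_∣ e)
  r : ∀ a b c → a * (b * c) ≡ b * a * c
  r = solve-∀ ℚring

Bd-1 : Bd 0 1ℚ
Bd-1 = bd ≤-refl ≤-refl

Bd-mono : ∀ {b c x} → b ℕ.≤ c → Bd b x → Bd c x
Bd-mono {b} {c} {x} h (bd u l) = bd (≤-trans u (↑-mono-exp 1≤2 h)) (≤-trans l (*-monoˡ (0≤∣p∣ x) (↑-mono-exp 1≤2 h)))

module Sizes (q : ℚ) (q≤½ : ∣ q ∣ * 2ℚ ≤ 1ℚ) where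

  Q : ℚ
  Q = ∣ q ∣

  0≤Q : 0ℚ ≤ Q
  0≤Q = 0≤∣p∣ q

  Q≤1 : Q ≤ 1ℚ
  Q≤1 = ≤-trans (subst (_≤ Q * 2ℚ) (*-identityʳ Q) (*-monoˡ 0≤Q 1≤2)) q≤½

  Q2 : ∀ a → Q ↑ suc a + Q ↑ suc a ≤ Q ↑ a
  Q2 a = subst₂ _≤_ (r (Q ↑ a) Q) (*-identityʳ _) (*-monoˡ (0≤↑ a 0≤Q) q≤½)
    where
    r : ∀ x y → x * (y * (1ℚ + 1ℚ)) ≡ y * x + y * x
    r = solve-∀ ℚring

  rising : ℕ → ℕ → ℚ
  rising a L = ∏ℚ L (λ i → 1ℚ - q ↑ (a ℕ.+ suc i))

  private
    S : ℕ → ℕ → ℚ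
    S a L = ∑ L (λ i → Q ↑ (a ℕ.+ suc i))

    S≤ : ∀ a L → S a L ≤ Q ↑ a
    S≤ a zero = 0≤↑ a 0≤Q
    S≤ a (suc L) = ≤-trans (≤-reflexive (trans (∑-head L (λ i → Q ↑ (a ℕ.+ suc i))) (cong₂ _+_ (cong (Q ↑_) (ℕP.+-comm a 1)) (∑-cong L (λ i _ → cong (Q ↑_) (ℕP.+-suc a (suc i)))))))
      (≤-trans (+-monoʳ-≤ (Q ↑ suc a) (S≤ (suc a) L)) (Q2 a))

    0≤S : ∀ a L → 0ℚ ≤ S a L
    0≤S a zero = ≤-refl
    0≤S a (suc L) = 0≤+ (0≤S a L) (0≤↑ (a ℕ.+ suc L) 0≤Q)

    1-S : ∀ a L → 2ℚ * (1ℚ - S (suc a) L) ≥ 1ℚ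
    1-S a L = subst (_≤ 2ℚ * (1ℚ - S (suc a) L)) (r₁ 1ℚ) (≤-trans (+-monoʳ-≤ 2ℚ (neg-antimono-≤ (≤-trans (*-monoˡ 0≤2 (≤-trans (S≤ (suc a) L) (≤-trans (↑-anti {b = suc a} 0≤Q Q≤1 (s≤s (z≤n {a}))) (≤-reflexive (*-identityʳ Q))))) (≤-trans (≤-reflexive (*-comm 2ℚ Q)) q≤½)))) (≤-reflexive (r₂ (S (suc a) L))))
      where
      r₁ : ∀ x → x + x - x ≡ x
      r₁ = solve-∀ ℚring
      r₂ : ∀ s → (1ℚ + 1ℚ) - (1ℚ + 1ℚ) * s ≡ (1ℚ + 1ℚ) * (1ℚ - s)
      r₂ = solve-∀ ℚring

    abs-hi : ∀ y → ∣ 1ℚ - y ∣ ≤ 1ℚ + ∣ y ∣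
    abs-hi y = ∣x-y∣≤ 1ℚ y

    abs-lo : ∀ y → 1ℚ - ∣ y ∣ ≤ ∣ 1ℚ - y ∣
    abs-lo y = ≤-trans (+-monoʳ-≤ 1ℚ (neg-antimono-≤ (x≤abs y))) (x≤abs (1ℚ - y))

    -- Weierstrass's inequality: a product of numbers 1 - y_i is at least 1 minus the sum of the
    -- |y_i| in absolute value.
    lowerB : ∀ a L → 1ℚ - S (suc a) L ≤ ∣ rising (suc a) L ∣
    lowerB a zero = ≤-reflexive refl
    lowerB a (suc L) = ≤-trans (≤-trans (≤-reflexive (r s y)) (≤-trans (+-monoʳ-≤ ((1ℚ - s) - (1ℚ - s) * y) (neg-antimono-≤ (0≤* (0≤S (suc a) L) 0≤y))) (≤-reflexive (r₂ s y))))
        (≤-trans (*-mono-nonNeg 0≤1-s (lowerB a L) 0≤1-y (≤-trans (≤-reflexive (cong (λ z → 1ℚ - z) (sym (↑-abs q (suc a ℕ.+ suc L))))) (abs-lo (q ↑ (suc a ℕ.+ suc L)))))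
          (≤-reflexive (sym (∣p*q∣≡∣p∣*∣q∣ (rising (suc a) L) _))))
      where
      s = S (suc a) L
      y = Q ↑ (suc a ℕ.+ suc L)
      0≤y : 0ℚ ≤ y
      0≤y = 0≤↑ (suc a ℕ.+ suc L) 0≤Q
      r : ∀ s y → 1ℚ - (s + y) ≡ ((1ℚ - s) - (1ℚ - s) * y) - s * y
      r = solve-∀ ℚring
      r₂ : ∀ s y → ((1ℚ - s) - (1ℚ - s) * y) - 0ℚ ≡ (1ℚ - s) * (1ℚ - y)
      r₂ = solve-∀ ℚring
      0≤1-s : 0ℚ ≤ 1ℚ - s
      0≤1-s = subst (_≤ 1ℚ - s) (+-inverseʳ s) (+-monoˡ-≤ (- s) (≤-trans (S≤ (suc a) L) (↑≤1 (suc a) 0≤Q Q≤1)))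
      0≤1-y : 0ℚ ≤ 1ℚ - y
      0≤1-y = subst (_≤ 1ℚ - y) (+-inverseʳ y) (+-monoˡ-≤ (- y) (↑≤1 (suc a ℕ.+ suc L) 0≤Q Q≤1))

    -- The companion of `lowerB`, from (1 + y)(1 - s - y) ≤ 1 - s for nonnegative s and y.
    upperB : ∀ a L → ∣ rising (suc a) L ∣ * (1ℚ - S (suc a) L) ≤ 1ℚ
    upperB a zero = ≤-reflexive refl
    upperB a (suc L) = ≤-trans (≤-trans (≤-reflexive (cong (_* (1ℚ - (s + y))) (∣p*q∣≡∣p∣*∣q∣ A (1ℚ - q ↑ (suc a ℕ.+ suc L)))))
        (*-monoʳ 0≤1-s-y (*-monoˡ (0≤∣p∣ A) (≤-trans (abs-hi (q ↑ (suc a ℕ.+ suc L))) (≤-reflexive (cong (1ℚ +_) (↑-abs q (suc a ℕ.+ suc L))))))))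
        (≤-trans (≤-trans (≤-reflexive (r ∣ A ∣ s y)) (≤-trans (+-monoʳ-≤ (∣ A ∣ * (1ℚ - s)) (neg-antimono-≤ (0≤* (0≤∣p∣ A) (0≤+ (0≤* (0≤S (suc a) L) 0≤y) (0≤* 0≤y 0≤y))))) (≤-reflexive (r₂ (∣ A ∣ * (1ℚ - s)))))) (upperB a L))
      where
      A = rising (suc a) L
      s = S (suc a) L
      y = Q ↑ (suc a ℕ.+ suc L)
      0≤y : 0ℚ ≤ y
      0≤y = 0≤↑ (suc a ℕ.+ suc L) 0≤Q
      r : ∀ A s y → A * (1ℚ + y) * (1ℚ - (s + y)) ≡ A * (1ℚ - s) - A * (s * y + y * y)
      r = solve-∀ ℚring
      r₂ : ∀ z → z - 0ℚ ≡ z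
      r₂ = solve-∀ ℚring
      0≤1-s-y : 0ℚ ≤ 1ℚ - (s + y)
      0≤1-s-y = subst (_≤ 1ℚ - (s + y)) (+-inverseʳ (s + y)) (+-monoˡ-≤ (- (s + y)) (≤-trans (S≤ (suc a) (suc L)) (↑≤1 (suc a) 0≤Q Q≤1)))

  rising-Bd′ : ∀ a L → Bd 1 (rising (suc a) L)
  rising-Bd′ a L = bd
      (subst₂ _≤_ (*-identityʳ ∣ A ∣) refl (≤-trans (*-monoˡ (0≤∣p∣ A) (1-S a L)) (≤-trans (≤-reflexive (r ∣ A ∣ (1ℚ - S (suc a) L))) (≤-trans (*-monoˡ 0≤2 (upperB a L)) (≤-reflexive refl)))))
      (≤-trans (1-S a L) (≤-trans (*-monoˡ 0≤2 (lowerB a L)) (≤-reflexive (r₂ ∣ A ∣))))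
    where
    A = rising (suc a) L
    r : ∀ a b → a * ((1ℚ + 1ℚ) * b) ≡ (1ℚ + 1ℚ) * (a * b)
    r = solve-∀ ℚring
    r₂ : ∀ a → (1ℚ + 1ℚ) * a ≡ a * ((1ℚ + 1ℚ) * 1ℚ)
    r₂ = solve-∀ ℚring

  1±-Bd : ∀ y → ∣ y ∣ ≤ Q → Bd 1 (1ℚ - y)
  1±-Bd y h = bd (≤-trans (abs-hi y) (≤-trans (+-monoʳ-≤ 1ℚ (≤-trans h Q≤1)) (≤-reflexive refl)))
      (≤-trans (≤-trans (≤-reflexive (r₁ 1ℚ)) (≤-trans (+-monoʳ-≤ 2ℚ (neg-antimono-≤ (≤-trans (*-monoʳ 0≤2 h) q≤½))) (≤-reflexive (r ∣ y ∣)))) (*-monoʳ (≤-trans 0≤2 (≤-reflexive (sym (*-identityʳ 2ℚ)))) (abs-lo y)))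
    where
    r₁ : ∀ x → x ≡ x + x - x
    r₁ = solve-∀ ℚring
    r : ∀ y → (1ℚ + 1ℚ) - y * (1ℚ + 1ℚ) ≡ (1ℚ - y) * ((1ℚ + 1ℚ) * 1ℚ)
    r = solve-∀ ℚring

  Q^≤Q : ∀ k → ∣ q ↑ suc k ∣ ≤ Q
  Q^≤Q k = ≤-trans (≤-reflexive (↑-abs q (suc k))) (≤-trans (*-monoˡ 0≤Q (↑≤1 k 0≤Q Q≤1)) (≤-reflexive (*-identityʳ Q)))

  rising-Bd : ∀ a L → Bd 2 (rising a L)
  rising-Bd (suc a) L = Bd-mono (s≤s z≤n) (rising-Bd′ a L)
  rising-Bd zero zero = Bd-mono z≤n Bd-1
  -- For |q| = 1/2 the sum of |q|^i over i ≥ 1 is 1 and the lower bound degenerates, so the factor 1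
  -- - q is estimated separately.
  rising-Bd zero (suc L) = subst (Bd 2) (sym (∏ℚ-split 1 L (λ i → 1ℚ - q ↑ suc i))) (Bd-* (subst (Bd 1) (sym (*-identityˡ _)) (1±-Bd (q ↑ 1) (Q^≤Q 0))) (rising-Bd′ 0 L))

  falling-Bd : ∀ a L → L ℕ.≤ a → Bd 2 (∏ℚ L (λ i → 1ℚ - q ↑ (a ℕ.∸ i)))
  falling-Bd a L L≤a = subst (Bd 2) (trans (rev L (λ i → 1ℚ - q ↑ (a ℕ.∸ L ℕ.+ suc i))) (∏ℚ-cong L (λ i i<L → cong (λ z → 1ℚ - q ↑ z) (idx i i<L)))) (rising-Bd (a ℕ.∸ L) L)
    where
    rev : ∀ L (f : ℕ → ℚ) → ∏ℚ L f ≡ ∏ℚ L (λ i → f (L ℕ.∸ suc i))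
    rev zero f = refl
    rev (suc L) f = trans (cong (_* f L) (rev L f)) (trans (*-comm _ (f L)) (sym (trans (∏ℚ-split 1 L (λ i → f (suc L ℕ.∸ suc i))) (cong (_* ∏ℚ L (λ i → f (L ℕ.∸ suc i))) (*-identityˡ (f L))))))
    idx : ∀ i → i ℕ.< L → a ℕ.∸ L ℕ.+ suc (L ℕ.∸ suc i) ≡ a ℕ.∸ i
    idx i i<L = trans (cong (a ℕ.∸ L ℕ.+_) (sym (ℕP.+-∸-assoc 1 i<L))) (trans (sym (ℕP.+-∸-assoc (a ℕ.∸ L) (ℕP.<⇒≤ i<L))) (cong (ℕ._∸ i) (ℕP.m∸n+n≡m L≤a)))

module TermSizes (p : ℤ) (2≤p : 2 ℕ.≤ ℤ.∣ p ∣) (q : ℚ) (qP : q * ι p ≡ 1ℚ) (m : ℕ) (q≤½ : ∣ q ∣ * 2ℚ ≤ 1ℚ) where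

  open LinearForm p 2≤p q qP m public
  open Sizes q q≤½ public

  e : ℕ
  e = 35 ℕ.* m ℕ.+ 4

  private
    inv-Bd : ∀ {b x} → x ≢ 0ℚ → Bd b x → Bd b (inv x)
    inv-Bd h = Bd-inv (*-inv h)

    ∏inv : ∀ L (f : ℕ → ℕ) → ∏ℚ L (λ i → 1ℚ - q ↑ suc (f i)) * ∏ℚ L (λ i → W (f i)) ≡ 1ℚ
    ∏inv L f = trans (sym (∏ℚ-* L _ _)) (trans (∏ℚ-cong L (λ i _ → *-inv (1-q^≢0 (f i)))) (trans (∏ℚ-const L 1ℚ) (1↑ L)))

  interval-Bd : ∀ k c L → L ℕ.≤ c → Bd 5 (∏K (c ∷ block c L) (λ j → W (k ℕ.+ j)))
  interval-Bd k c L L≤c = Bd-* {1} {4} (inv-Bd (1-q^≢0 (k ℕ.+ c)) (1±-Bd (q ↑ suc (k ℕ.+ c)) (Q^≤Q (k ℕ.+ c))))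
    (subst (Bd 4) (sym (trans (∏K-block c L (λ j → W (k ℕ.+ j))) (∏ℚ-* L _ _))) (Bd-* {2} {2} lo hi))
    where
    lo : Bd 2 (∏ℚ L (λ i → W (k ℕ.+ (c ℕ.∸ suc i))))
    lo = Bd-inv (∏inv L (λ i → k ℕ.+ (c ℕ.∸ suc i))) (subst (Bd 2) (∏ℚ-cong L (λ i i<L → cong (λ z → 1ℚ - q ↑ z) (idx i i<L))) (falling-Bd (k ℕ.+ c) L (ℕP.≤-trans L≤c (ℕP.m≤n+m c k))))
      where
      idx : ∀ i → i ℕ.< L → k ℕ.+ c ℕ.∸ i ≡ suc (k ℕ.+ (c ℕ.∸ suc i))
      idx i i<L = trans (ℕP.+-∸-assoc k (ℕP.≤-trans (ℕP.<⇒≤ i<L) L≤c)) (trans (cong (k ℕ.+_) (ℕP.+-∸-assoc 1 (ℕP.≤-trans i<L L≤c))) (ℕP.+-suc k _))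
    hi : Bd 2 (∏ℚ L (λ i → W (k ℕ.+ (c ℕ.+ suc i))))
    hi = Bd-inv (∏inv L (λ i → k ℕ.+ (c ℕ.+ suc i))) (subst (Bd 2) (∏ℚ-cong L (λ i _ → cong (λ z → 1ℚ - q ↑ suc z) (ℕP.+-assoc k c (suc i)))) (rising-Bd (suc (k ℕ.+ c)) L))

  poles-Bd : ∀ k → Bd 50 (∏K (poles m) (λ j → W (k ℕ.+ j)))
  poles-Bd k = go heights
    where
    go : ∀ hs → Bd (∑L hs (λ _ → 5)) (∏K (intervals m hs) (λ j → W (k ℕ.+ j)))
    go [] = Bd-1
    go (h ∷ hs) = subst (Bd (5 ℕ.+ ∑L hs (λ _ → 5))) (sym (∏K-++ (8 ℕ.* m ∷ block (8 ℕ.* m) ((8 ℕ.∸ h) ℕ.* m)) (intervals m hs) (λ j → W (k ℕ.+ j))))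
      (Bd-* (interval-Bd k (8 ℕ.* m) ((8 ℕ.∸ h) ℕ.* m) (ℕP.*-monoˡ-≤ m (ℕP.m∸n≤m 8 h))) (go hs))

  rest : ℕ → ℚ
  rest k = nv x (minus (8 ℕ.* m)) * (nv x (plus (8 ℕ.* m)) * (∏ℚ (20 ℕ.* m) (λ i → nv x (high (16 ℕ.* m ℕ.+ suc i)) * nv x (low (suc i))) * nv x one ↑ e)) * ∏K (poles m) (λ j → W (k ℕ.+ j))
    where x = q ↑ suc k

  term≡ : ∀ k → term k ≡ (q ↑ suc k) ↑ e * rest k
  term≡ k = trans (cong (_* ∏K (poles m) (λ j → W (k ℕ.+ j))) (trans (∏N-numerators m (nv x)) (cong (λ z → z ↑ e * Z) (r x)))) (*-assoc (x ↑ e) Z _)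
    where
    x = q ↑ suc k
    Z = nv x (minus (8 ℕ.* m)) * (nv x (plus (8 ℕ.* m)) * (∏ℚ (20 ℕ.* m) (λ i → nv x (high (16 ℕ.* m ℕ.+ suc i)) * nv x (low (suc i))) * nv x one ↑ e))
    r : ∀ x → 0ℚ + 1ℚ * x ≡ x
    r = solve-∀ ℚring

  -- The factor 1 - x q^(-(k+1)) of the numerator vanishes at x = q^(k+1).
  term-0 : ∀ k → k ℕ.< 20 ℕ.* m → term k ≡ 0ℚ
  term-0 k k< = trans (term≡ k) (trans (cong (λ z → (q ↑ suc k) ↑ e * (nv x (minus (8 ℕ.* m)) * (nv x (plus (8 ℕ.* m)) * (z * nv x one ↑ e)) * ∏K (poles m) (λ j → W (k ℕ.+ j))))
      (∏ℚ-0 (20 ℕ.* m) (λ i → nv x (high (16 ℕ.* m ℕ.+ suc i)) * nv x (low (suc i))) k k< (trans (cong (nv x (high (16 ℕ.* m ℕ.+ suc k)) *_) lowz) (*-zeroʳ (nv x (high (16 ℕ.* m ℕ.+ suc k)))))))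
      (r ((q ↑ suc k) ↑ e) (nv x (minus (8 ℕ.* m))) (nv x (plus (8 ℕ.* m))) (nv x one ↑ e) (∏K (poles m) (λ j → W (k ℕ.+ j)))))
    where
    x = q ↑ suc k
    lowz : 1ℚ + - P ↑ suc k * x ≡ 0ℚ
    lowz = trans (cong (1ℚ +_) (trans (sym (neg-distribˡ-* (P ↑ suc k) x)) (cong -_ (trans (*-comm (P ↑ suc k) x) (qP^ (suc k)))))) (+-inverseʳ 1ℚ)
    r : ∀ a b c d f → a * (b * (c * (0ℚ * d)) * f) ≡ 0ℚ
    r = solve-∀ ℚring

  -- 56 = 1 + 1 + 2 + 2 + 50: two single factors, two products of length 20m, and ten pole intervals
  -- at 5 each.
  rest-Bd : ∀ k → 20 ℕ.* m ℕ.≤ k → Bd 56 (rest k)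
  rest-Bd k h = Bd-* {6} {50} (Bd-* {1} {5} mB (Bd-* {1} {4} pB (subst (Bd 4) (sym (trans (cong (∏ℚ (20 ℕ.* m) (λ i → nv x (high (16 ℕ.* m ℕ.+ suc i)) * nv x (low (suc i))) *_) (trans (cong (_↑ e) (r₁ x)) (1↑ e))) (trans (*-identityʳ _) (∏ℚ-* (20 ℕ.* m) _ _)))) (Bd-* {2} {2} hB lB)))) (poles-Bd k)
    where
    x = q ↑ suc k
    c = 8 ℕ.* m
    r₁ : ∀ x → 1ℚ + 0ℚ * x ≡ 1ℚ
    r₁ = solve-∀ ℚring
    cx : q ↑ c * x ≡ q ↑ suc (c ℕ.+ k)
    cx = trans (sym (↑-+ q c (suc k))) (cong (q ↑_) (ℕP.+-suc c k))
    mB : Bd 1 (nv x (minus c))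
    mB = subst (Bd 1) (trans (cong (λ z → 1ℚ - z) (sym cx)) (r (q ↑ c) x)) (1±-Bd (q ↑ suc (c ℕ.+ k)) (Q^≤Q (c ℕ.+ k)))
      where
      r : ∀ a b → 1ℚ - a * b ≡ 1ℚ + - a * b
      r = solve-∀ ℚring
    pB : Bd 1 (nv x (plus c))
    pB = subst (Bd 1) (trans (cong (λ z → 1ℚ - - z) (sym cx)) (r (q ↑ c) x)) (1±-Bd (- q ↑ suc (c ℕ.+ k)) (≤-trans (≤-reflexive (∣-p∣≡∣p∣ (q ↑ suc (c ℕ.+ k)))) (Q^≤Q (c ℕ.+ k))))
      where
      r : ∀ a b → 1ℚ - - (a * b) ≡ 1ℚ + a * b
      r = solve-∀ ℚring
    hB : Bd 2 (∏ℚ (20 ℕ.* m) (λ i → nv x (high (16 ℕ.* m ℕ.+ suc i))))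
    hB = subst (Bd 2) (∏ℚ-cong (20 ℕ.* m) (λ i _ → sym (trans (r (q ↑ (16 ℕ.* m ℕ.+ suc i)) x) (cong (λ z → 1ℚ - z) (trans (sym (↑-+ q (16 ℕ.* m ℕ.+ suc i) (suc k))) (cong (q ↑_) (rr (16 ℕ.* m) (suc i) (suc k)))))))) (rising-Bd (16 ℕ.* m ℕ.+ suc k) (20 ℕ.* m))
      where
      r : ∀ a b → 1ℚ + - a * b ≡ 1ℚ - a * b
      r = solve-∀ ℚring
      rr : ∀ a b c → a ℕ.+ b ℕ.+ c ≡ a ℕ.+ c ℕ.+ b
      rr = ℕ-solve-∀
    lB : Bd 2 (∏ℚ (20 ℕ.* m) (λ i → nv x (low (suc i))))
    lB = subst (Bd 2) (∏ℚ-cong (20 ℕ.* m) (λ i i< → sym (trans (r (P ↑ suc i) x) (cong (λ z → 1ℚ - z) (eq i i<))))) (falling-Bd k (20 ℕ.* m) h)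
      where
      r : ∀ a b → 1ℚ + - a * b ≡ 1ℚ - b * a
      r = solve-∀ ℚring
      eq : ∀ i → i ℕ.< 20 ℕ.* m → x * P ↑ suc i ≡ q ↑ (k ℕ.∸ i)
      eq i i< = trans (cong (λ z → q ↑ suc z * P ↑ suc i) (sym (ℕP.m+[n∸m]≡n (ℕP.≤-trans (ℕP.<⇒≤ i<) h)))) (qP′ (suc i) (k ℕ.∸ i))

  term-upper : ∀ k → ∣ term k ∣ ≤ Q ↑ (e ℕ.* suc k) * 2ℚ ↑ 56
  term-upper k = go (ℕP.≤-<-connex (20 ℕ.* m) k)
    where
    abs-x : ∣ (q ↑ suc k) ↑ e ∣ ≡ Q ↑ (e ℕ.* suc k)
    abs-x = trans (↑-abs (q ↑ suc k) e) (trans (cong (_↑ e) (↑-abs q (suc k))) (sym (↑-* Q e (suc k))))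
    go : 20 ℕ.* m ℕ.≤ k ⊎ k ℕ.< 20 ℕ.* m → ∣ term k ∣ ≤ Q ↑ (e ℕ.* suc k) * 2ℚ ↑ 56
    go (inj₁ h) = ≤-trans (≤-reflexive (trans (cong ∣_∣ (term≡ k)) (trans (∣p*q∣≡∣p∣*∣q∣ ((q ↑ suc k) ↑ e) (rest k)) (cong (_* ∣ rest k ∣) abs-x)))) (*-monoˡ (0≤↑ (e ℕ.* suc k) 0≤Q) (upper (rest-Bd k h)))
    go (inj₂ h) = ≤-trans (≤-reflexive (cong ∣_∣ (term-0 k h))) (0≤* (0≤↑ (e ℕ.* suc k) 0≤Q) (0≤↑ 56 0≤2))

  term-lower : Q ↑ (e ℕ.* suc (20 ℕ.* m)) ≤ ∣ term (20 ℕ.* m) ∣ * 2ℚ ↑ 56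
  term-lower = ≤-trans (≤-reflexive (sym (*-identityʳ _))) (≤-trans (*-monoˡ (0≤↑ (e ℕ.* suc k) 0≤Q) (lower (rest-Bd k ℕP.≤-refl)))
      (≤-reflexive (trans (sym (*-assoc (Q ↑ (e ℕ.* suc k)) ∣ rest k ∣ (2ℚ ↑ 56))) (cong (_* 2ℚ ↑ 56) (sym (trans (cong ∣_∣ (term≡ k)) (trans (∣p*q∣≡∣p∣*∣q∣ ((q ↑ suc k) ↑ e) (rest k)) (cong (_* ∣ rest k ∣) abs-x))))))))
    where
    k = 20 ℕ.* m
    abs-x : ∣ (q ↑ suc k) ↑ e ∣ ≡ Q ↑ (e ℕ.* suc k)
    abs-x = trans (↑-abs (q ↑ suc k) e) (trans (cong (_↑ e) (↑-abs q (suc k))) (sym (↑-* Q e (suc k))))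

-- Sizes of the common denominator and of the partial sums.

tri : ℕ → ℕ
tri x = ∑ℕ x suc

2tri : ∀ x → 2 ℕ.* tri x ≡ x ℕ.* x ℕ.+ x
2tri zero = refl
2tri (suc x) = trans (ℕP.*-distribˡ-+ 2 (tri x) (suc x)) (trans (cong (ℕ._+ 2 ℕ.* suc x) (2tri x)) (r x))
  where
  r : ∀ x → x ℕ.* x ℕ.+ x ℕ.+ 2 ℕ.* suc x ≡ suc x ℕ.* suc x ℕ.+ suc x
  r = ℕ-solve-∀

∏-pow : ∀ x L → ∏ℚ L (λ i → x ↑ suc i) ≡ x ↑ tri L
∏-pow x zero = refl
∏-pow x (suc L) = trans (cong (_* x ↑ suc L) (∏-pow x L)) (sym (↑-+ x (tri L) (suc L)))

geometric : ∀ y → 0ℚ ≤ y → y * 2ℚ ≤ 1ℚ → ∀ a L → ∑ L (λ i → y ↑ (a ℕ.+ suc i)) ≤ y ↑ a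
geometric y 0≤y h a zero = 0≤↑ a 0≤y
geometric y 0≤y h a (suc L) = ≤-trans (≤-reflexive (trans (∑-head L (λ i → y ↑ (a ℕ.+ suc i))) (cong₂ _+_ (cong (y ↑_) (ℕP.+-comm a 1)) (∑-cong L (λ i _ → cong (y ↑_) (ℕP.+-suc a (suc i)))))))
  (≤-trans (+-monoʳ-≤ (y ↑ suc a) (geometric y 0≤y h (suc a) L)) (subst₂ _≤_ (r (y ↑ a) y) (*-identityʳ _) (*-monoˡ (0≤↑ a 0≤y) h)))
  where
  r : ∀ x y → x * (y * (1ℚ + 1ℚ)) ≡ y * x + y * x
  r = solve-∀ ℚring

module FormSizes (p : ℤ) (2≤p : 2 ℕ.≤ ℤ.∣ p ∣) (q : ℚ) (qP : q * ι p ≡ 1ℚ) (m : ℕ) (q≤½ : ∣ q ∣ * 2ℚ ≤ 1ℚ) (4≤m : 4 ℕ.≤ m) where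

  open TermSizes p 2≤p q qP m q≤½ public

  Pa : ℚ
  Pa = ∣ P ∣

  QPa : Q * Pa ≡ 1ℚ
  QPa = trans (sym (∣p*q∣≡∣p∣*∣q∣ q P)) (cong ∣_∣ qP)

  QPa^ : ∀ k → Q ↑ k * Pa ↑ k ≡ 1ℚ
  QPa^ k = trans (sym (↑-*ˡ Q Pa k)) (trans (cong (_↑ k) QPa) (1↑ k))

  0≤Pa : 0ℚ ≤ Pa
  0≤Pa = 0≤∣p∣ P

  qfact-abs : ∀ x → ∣ qfact x ∣ ≤ Pa ↑ tri x * 2ℚ ↑ 2
  qfact-abs x = ≤-trans (≤-reflexive (trans (cong ∣_∣ (trans (∏ℚ-cong x (λ i _ → sym (1-qP (suc i)))) (trans (∏ℚ-* x (λ i → P ↑ suc i) (λ i → 1ℚ - q ↑ suc i)) (cong (_* rising 0 x) (∏-pow P x)))))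
      (trans (∣p*q∣≡∣p∣*∣q∣ (P ↑ tri x) (rising 0 x)) (cong (_* ∣ rising 0 x ∣) (↑-abs P (tri x))))))
    (*-monoˡ (0≤↑ (tri x) 0≤Pa) (Bd.upper (rising-Bd 0 x)))

  qfact⁻¹-abs : ∀ x → ∣ qfact⁻¹ x ∣ ≤ Q ↑ tri x * 2ℚ ↑ 2
  qfact⁻¹-abs x = ≤-trans (≤-reflexive (trans (cong ∣_∣ (trans (∏ℚ-cong x (λ i _ → iv i)) (trans (∏ℚ-* x (λ i → q ↑ suc i) W) (cong (_* ∏ℚ x W) (∏-pow q x)))))
      (trans (∣p*q∣≡∣p∣*∣q∣ (q ↑ tri x) (∏ℚ x W)) (cong (_* ∣ ∏ℚ x W ∣) (↑-abs q (tri x))))))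
    (*-monoˡ (0≤↑ (tri x) 0≤Q) (Bd.upper (Bd-inv invs (rising-Bd 0 x))))
    where
    invs : rising 0 x * ∏ℚ x W ≡ 1ℚ
    invs = trans (sym (∏ℚ-* x _ _)) (trans (∏ℚ-cong x (λ i _ → *-inv (1-q^≢0 i))) (trans (∏ℚ-const x 1ℚ) (1↑ x)))
    iv : ∀ i → inv (P ↑ suc i - 1ℚ) ≡ q ↑ suc i * W i
    iv i = inv-unique {P ↑ suc i - 1ℚ} {q ↑ suc i * W i} (trans (r (P ↑ suc i) (q ↑ suc i) (W i)) (trans (cong (λ z → W i * (z - q ↑ suc i)) (qP^ (suc i))) (W-inv i)))
      where
      r : ∀ a b w → (a - 1ℚ) * (b * w) ≡ w * (b * a - b)
      r = solve-∀ ℚring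

  ∏L-abs : ∀ xs (f : ℕ → ℚ) (g : ℕ → ℕ) y → 0ℚ ≤ y → (∀ x → ∣ f x ∣ ≤ y ↑ g x * 2ℚ ↑ 2) → ∣ ∏L xs f ∣ ≤ y ↑ ∑L xs g * 2ℚ ↑ (∑L xs (λ _ → 2))
  ∏L-abs [] f g y 0≤y h = ≤-refl
  ∏L-abs (x ∷ xs) f g y 0≤y h = ≤-trans (≤-reflexive (∣p*q∣≡∣p∣*∣q∣ (f x) (∏L xs f))) (≤-trans (*-mono-nonNeg (0≤∣p∣ (f x)) (h x) (0≤∣p∣ (∏L xs f)) (∏L-abs xs f g y 0≤y h))
    (≤-reflexive (trans (*-swap-middle (y ↑ g x) (2ℚ ↑ 2) _ _) (cong₂ _*_ (sym (↑-+ y (g x) (∑L xs g))) (sym (↑-+ 2ℚ 2 (∑L xs (λ _ → 2))))))))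

  upT downT : ℕ
  upT = ∑L up (λ i → tri (i ℕ.* m))
  downT = ∑L down (λ i → tri (i ℕ.* m))

  -- Each of the 13 + 14 factorials is a power of p up to a factor 4, whence 2^54.
  Δ-abs : ∣ Δ ∣ ≤ Pa ↑ upT * Q ↑ (downT ℕ.+ gain) * 2ℚ ↑ 54
  Δ-abs = ≤-trans (≤-reflexive (trans (cong ∣_∣ Δ-def) (trans (∣p*q∣≡∣p∣*∣q∣ (a * b) (q ↑ gain)) (cong₂ _*_ (∣p*q∣≡∣p∣*∣q∣ a b) (↑-abs q gain)))))
    (≤-trans (*-monoʳ (0≤↑ gain 0≤Q) (*-mono-nonNeg (0≤∣p∣ a) (∏L-abs up (λ i → qfact (i ℕ.* m)) (λ i → tri (i ℕ.* m)) Pa 0≤Pa (λ x → qfact-abs (x ℕ.* m))) (0≤∣p∣ b) (∏L-abs down (λ i → qfact⁻¹ (i ℕ.* m)) (λ i → tri (i ℕ.* m)) Q 0≤Q (λ x → qfact⁻¹-abs (x ℕ.* m)))))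
      (≤-reflexive (trans (r (Pa ↑ upT) (2ℚ ↑ 26) (Q ↑ downT) (2ℚ ↑ 28) (Q ↑ gain)) (cong₂ (λ x y → Pa ↑ upT * x * y) (sym (↑-+ Q downT gain)) (sym (↑-+ 2ℚ 26 28))))))
    where
    a = ∏L up (λ i → qfact (i ℕ.* m))
    b = ∏L down (λ i → qfact⁻¹ (i ℕ.* m))
    r : ∀ a b c d e → a * b * (c * d) * e ≡ a * (c * e) * (b * d)
    r = solve-∀ ℚring

  E₀ : ℕ
  E₀ = e ℕ.* suc (20 ℕ.* m)

  -- After doubling, the coefficients of m² are 1931, the sum of squares of `up`, against 384 + 164
  -- + 1400 = 1948 from the squares of `down`, from `gain` and from 35 · 20 in `E₀`. The surplus 17
  -- makes the method work.
  exponent-gap : upT ℕ.+ m ℕ.≤ downT ℕ.+ gain ℕ.+ E₀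
  exponent-gap = ℕP.*-cancelˡ-≤ 2 (subst₂ ℕ._≤_ (sym eqU) (sym eqD) (ℕP.m≤m+n _ (17 ℕ.* (m ℕ.* m) ℕ.+ 147 ℕ.* m ℕ.+ 8)))
    where
    2∑ : ∀ xs → 2 ℕ.* ∑L xs (λ i → tri (i ℕ.* m)) ≡ ∑L xs (λ i → i ℕ.* i) ℕ.* (m ℕ.* m) ℕ.+ ∑L xs (λ i → i) ℕ.* m
    2∑ [] = refl
    2∑ (x ∷ xs) = trans (ℕP.*-distribˡ-+ 2 (tri (x ℕ.* m)) _) (trans (cong₂ ℕ._+_ (2tri (x ℕ.* m)) (2∑ xs)) (r x m (∑L xs (λ i → i ℕ.* i)) (∑L xs (λ i → i))))
      where
      r : ∀ x m a b → x ℕ.* m ℕ.* (x ℕ.* m) ℕ.+ x ℕ.* m ℕ.+ (a ℕ.* (m ℕ.* m) ℕ.+ b ℕ.* m) ≡ (x ℕ.* x ℕ.+ a) ℕ.* (m ℕ.* m) ℕ.+ (x ℕ.+ b) ℕ.* m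
      r = ℕ-solve-∀
    eqU : 2 ℕ.* (upT ℕ.+ m) ≡ 1931 ℕ.* (m ℕ.* m) ℕ.+ 153 ℕ.* m
    eqU = trans (ℕP.*-distribˡ-+ 2 upT m) (trans (cong (ℕ._+ 2 ℕ.* m) (2∑ up)) (r (m ℕ.* m) m))
      where
      r : ∀ M m → 1931 ℕ.* M ℕ.+ 151 ℕ.* m ℕ.+ 2 ℕ.* m ≡ 1931 ℕ.* M ℕ.+ 153 ℕ.* m
      r = ℕ-solve-∀
    eqD : 2 ℕ.* (downT ℕ.+ gain ℕ.+ E₀) ≡ 1931 ℕ.* (m ℕ.* m) ℕ.+ 153 ℕ.* m ℕ.+ (17 ℕ.* (m ℕ.* m) ℕ.+ 147 ℕ.* m ℕ.+ 8)
    eqD = trans (r₁ downT gain E₀) (trans (cong (λ z → z ℕ.+ 2 ℕ.* gain ℕ.+ 2 ℕ.* E₀) (2∑ down)) (r₂ m))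
      where
      r₁ : ∀ a b c → 2 ℕ.* (a ℕ.+ b ℕ.+ c) ≡ 2 ℕ.* a ℕ.+ 2 ℕ.* b ℕ.+ 2 ℕ.* c
      r₁ = ℕ-solve-∀
      r₂ : ∀ m → 384 ℕ.* (m ℕ.* m) ℕ.+ 70 ℕ.* m ℕ.+ 2 ℕ.* (82 ℕ.* (m ℕ.* m)) ℕ.+ 2 ℕ.* ((35 ℕ.* m ℕ.+ 4) ℕ.* suc (20 ℕ.* m)) ≡ 1931 ℕ.* (m ℕ.* m) ℕ.+ 153 ℕ.* m ℕ.+ (17 ℕ.* (m ℕ.* m) ℕ.+ 147 ℕ.* m ℕ.+ 8)
      r₂ = ℕ-solve-∀

  k₀ : ℕ
  k₀ = 20 ℕ.* m

  t₀ : ℚ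
  t₀ = term k₀

  0≤2^ : ∀ k → 0ℚ ≤ 2ℚ ↑ k
  0≤2^ k = 0≤↑ k 0≤2

  partialSum : ℕ → ℚ
  partialSum K = ∑ K (λ k → term k + term k)

  private
    y : ℚ
    y = Q ↑ e

    0≤y : 0ℚ ≤ y
    0≤y = 0≤↑ e 0≤Q

    -- 114 = 57 + 56 + 1 collects the upper bound of a doubled term, the lower bound of `t₀` and the
    -- geometric tail. Here m ≥ 4 enters.
    114≤e : 114 ℕ.≤ e
    114≤e = ℕP.≤-trans (ℕP.m≤m+n 114 30) (ℕP.+-monoˡ-≤ 4 (ℕP.*-monoʳ-≤ 35 4≤m))

    Q2^ : ∀ k → Q ↑ k * 2ℚ ↑ k ≤ 1ℚ
    Q2^ k = subst (_≤ 1ℚ) (↑-*ˡ Q 2ℚ k) (↑≤1 k (0≤* 0≤Q 0≤2) q≤½)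

    y2^114 : y * 2ℚ ↑ 114 ≤ 1ℚ
    y2^114 = ≤-trans (*-monoʳ (0≤2^ 114) (↑-anti {a = 114} 0≤Q Q≤1 114≤e)) (Q2^ 114)

    y2 : y * 2ℚ ≤ 1ℚ
    y2 = ≤-trans (*-monoˡ 0≤y (≤-trans (≤-reflexive (sym (*-identityʳ 2ℚ))) (↑-mono-exp {a = 1} {b = 114} 1≤2 (s≤s z≤n)))) y2^114

    later : ℕ → ℚ
    later L = ∑ L (λ i → term (suc k₀ ℕ.+ i) + term (suc k₀ ℕ.+ i))

    -- The bounds of consecutive terms shrink by y = |q|^e, and y 2^114 ≤ 1 absorbs all constants.
    later-abs : ∀ L → ∣ later L ∣ ≤ ∣ t₀ ∣
    later-abs L = ≤-trans (∑-abs L _) (≤-trans (∑-mono L (λ i _ → ≤-trans (∣p+q∣≤∣p∣+∣q∣ (term (suc k₀ ℕ.+ i)) (term (suc k₀ ℕ.+ i))) (≤-trans (+-mono-≤ (b i) (b i)) (≤-reflexive (r₁ (y ↑ (suc k₀ ℕ.+ suc i)) (2ℚ ↑ 56))))))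
        (≤-trans (≤-reflexive (∑-*ʳ L (2ℚ ↑ 57) (λ i → y ↑ (suc k₀ ℕ.+ suc i)))) (fin L)))
      where
      b : ∀ i → ∣ term (suc k₀ ℕ.+ i) ∣ ≤ y ↑ (suc k₀ ℕ.+ suc i) * 2ℚ ↑ 56
      b i = ≤-trans (term-upper (suc k₀ ℕ.+ i)) (≤-reflexive (cong (_* 2ℚ ↑ 56) (trans (cong (Q ↑_) (ℕP.*-comm e (suc (suc k₀ ℕ.+ i)))) (trans (↑-* Q (suc (suc k₀ ℕ.+ i)) e) (cong (y ↑_) (sym (ℕP.+-suc (suc k₀) i)))))))
      r₁ : ∀ a b → a * b + a * b ≡ a * ((1ℚ + 1ℚ) * b)
      r₁ = solve-∀ ℚring
      t≥ : y ↑ suc k₀ ≤ ∣ t₀ ∣ * 2ℚ ↑ 56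
      t≥ = ≤-trans (≤-reflexive (sym (trans (cong (Q ↑_) (ℕP.*-comm e (suc k₀))) (↑-* Q (suc k₀) e)))) term-lower
      sumB : ∀ L → ∑ L (λ i → y ↑ (suc k₀ ℕ.+ suc i)) ≤ 2ℚ * (y * y ↑ suc k₀)
      sumB zero = 0≤* 0≤2 (0≤* 0≤y (0≤↑ (suc k₀) 0≤y))
      sumB (suc L) = ≤-trans (≤-reflexive (trans (∑-head L (λ i → y ↑ (suc k₀ ℕ.+ suc i))) (cong₂ _+_ (cong (y ↑_) (ℕP.+-comm (suc k₀) 1)) (∑-cong L (λ i _ → cong (y ↑_) (ℕP.+-suc (suc k₀) (suc i)))))))
        (≤-trans (+-monoʳ-≤ (y ↑ suc (suc k₀)) (geometric y 0≤y y2 (suc (suc k₀)) L)) (≤-reflexive (r₂ (y * y ↑ suc k₀))))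
        where
        r₂ : ∀ a → a + a ≡ (1ℚ + 1ℚ) * a
        r₂ = solve-∀ ℚring
      fin : ∀ L → ∑ L (λ i → y ↑ (suc k₀ ℕ.+ suc i)) * 2ℚ ↑ 57 ≤ ∣ t₀ ∣
      fin L = ≤-trans (*-monoʳ (0≤2^ 57) (sumB L)) (≤-trans (*-monoʳ (0≤2^ 57) (*-monoˡ 0≤2 (*-monoˡ 0≤y t≥)))
        (≤-trans (≤-reflexive (trans (r₃ 2ℚ y ∣ t₀ ∣ (2ℚ ↑ 56) (2ℚ ↑ 57)) (cong (λ z → y * (2ℚ * z) * ∣ t₀ ∣) (sym (↑-+ 2ℚ 56 57))))) (≤-trans (*-monoʳ (0≤∣p∣ t₀) y2^114) (≤-reflexive (*-identityˡ _)))))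
        where
        r₃ : ∀ a b c d f → a * (b * (c * d)) * f ≡ b * (a * (d * f)) * c
        r₃ = solve-∀ ℚring

    split : ∀ L → partialSum (suc k₀ ℕ.+ L) ≡ (t₀ + t₀) + later L
    split L = trans (∑-split (suc k₀) L (λ k → term k + term k)) (cong (_+ later L) (trans (cong (_+ (t₀ + t₀)) (∑-0 k₀ (λ k k< → cong (λ z → z + z) (term-0 k k<)))) (+-identityˡ (t₀ + t₀))))

  -- The sum is 2 t₀ plus a remainder of absolute value at most |t₀|.
  partial-lower : ∀ K → suc k₀ ℕ.≤ K → ∣ t₀ ∣ ≤ ∣ partialSum K ∣
  partial-lower K h = subst (λ k → ∣ t₀ ∣ ≤ ∣ partialSum k ∣) (ℕP.m+[n∸m]≡n h) (go (K ℕ.∸ suc k₀))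
    where
    r : ∀ a l → a + a ≡ (a + a + l) - l
    r = solve-∀ ℚring
    go : ∀ L → ∣ t₀ ∣ ≤ ∣ partialSum (suc k₀ ℕ.+ L) ∣
    go L = ≤-trans (≤-trans (≤-reflexive (r′ ∣ t₀ ∣)) (-≤ two≤)) (≤-reflexive (cong ∣_∣ (sym (split L))))
      where
      r′ : ∀ a → a ≡ a + a - a
      r′ = solve-∀ ℚring
      r₂ : ∀ a → a + a ≡ (1ℚ + 1ℚ) * a
      r₂ = solve-∀ ℚring
      two≤ : ∣ t₀ ∣ + ∣ t₀ ∣ ≤ ∣ t₀ + t₀ + later L ∣ + ∣ t₀ ∣
      two≤ = ≤-trans (≤-reflexive (trans (r₂ ∣ t₀ ∣) (trans (cong (_* ∣ t₀ ∣) (sym (abs≡ 0≤2))) (trans (sym (∣p*q∣≡∣p∣*∣q∣ 2ℚ t₀)) (cong ∣_∣ (trans (sym (r₂ t₀)) (r t₀ (later L)))))))) (≤-trans (∣x-y∣≤ (t₀ + t₀ + later L) (later L)) (+-monoʳ-≤ ∣ t₀ + t₀ + later L ∣ (later-abs L)))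

  partial-upper : ∀ K → suc k₀ ℕ.≤ K → ∣ partialSum K ∣ ≤ ∣ t₀ ∣ + ∣ t₀ ∣ + ∣ t₀ ∣
  partial-upper K h = subst (λ k → ∣ partialSum k ∣ ≤ ∣ t₀ ∣ + ∣ t₀ ∣ + ∣ t₀ ∣) (ℕP.m+[n∸m]≡n h) (≤-trans (≤-reflexive (cong ∣_∣ (split (K ℕ.∸ suc k₀))))
    (≤-trans (∣p+q∣≤∣p∣+∣q∣ (t₀ + t₀) (later (K ℕ.∸ suc k₀))) (+-mono-≤ (∣p+q∣≤∣p∣+∣q∣ t₀ t₀) (later-abs (K ℕ.∸ suc k₀)))))

  t₀≢0 : 0ℚ < ∣ t₀ ∣
  t₀≢0 = abs>0 (λ z → <⇒≢ (<-≤-trans (0<↑ E₀ (abs>0 q≢0)) (≤-trans term-lower (≤-reflexive (trans (cong (λ w → ∣ w ∣ * 2ℚ ↑ 56) z) (*-zeroˡ (2ℚ ↑ 56)))))) refl)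

  Δt₀-small : ∣ Δ ∣ * ∣ t₀ ∣ ≤ Q ↑ m * 2ℚ ↑ 110
  Δt₀-small = ≤-trans (*-mono-nonNeg (0≤∣p∣ Δ) Δ-abs (0≤∣p∣ t₀) (term-upper k₀)) (≤-trans (≤-reflexive (trans (r (Pa ↑ upT) (Q ↑ (downT ℕ.+ gain)) (2ℚ ↑ 54) (Q ↑ E₀) (2ℚ ↑ 56)) (cong₂ (λ a b → Pa ↑ upT * a * b) (sym (↑-+ Q (downT ℕ.+ gain) E₀)) (sym (↑-+ 2ℚ 54 56)))))
    (*-monoʳ (0≤2^ 110) (≤-trans (*-monoˡ (0≤↑ upT 0≤Pa) (↑-anti {b = downT ℕ.+ gain ℕ.+ E₀} 0≤Q Q≤1 exponent-gap)) (≤-reflexive (trans (cong (Pa ↑ upT *_) (↑-+ Q upT m)) (trans (r₂ (Pa ↑ upT) (Q ↑ upT) (Q ↑ m)) (trans (cong (_* Q ↑ m) (QPa^ upT)) (*-identityˡ (Q ↑ m)))))))))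
    where
    r : ∀ a b c d f → a * b * c * (d * f) ≡ a * (b * d) * (c * f)
    r = solve-∀ ℚring
    r₂ : ∀ a b c → a * (b * c) ≡ b * a * c
    r₂ = solve-∀ ℚring

-- Limits

abs-numerator : ∀ x → ∃ λ N → x ≤ ιℕ N
abs-numerator x@(mkℚ n d c) = ℤ.∣ n ∣ , toℚᵘ-cancel-≤ (ℚᵘP.≤-respʳ-≃ (ℚᵘP.≃-sym (toιᵘ (ℤ.+ ℤ.∣ n ∣))) (ℚᵘ.*≤* le))
  where
  le : n ℤ.* ℤ.+ 1 ℤ.≤ ℤ.+ ℤ.∣ n ∣ ℤ.* ℤ.+ suc d
  le = ℤP.≤-trans (ℤP.≤-reflexive (ℤP.*-identityʳ n)) (ℤP.≤-trans (n≤∣n∣ n) (ℤP.≤-trans (ℤ.+≤+ (ℕP.m≤m*n ℤ.∣ n ∣ (suc d))) (ℤP.≤-reflexive (ℤP.pos-* ℤ.∣ n ∣ (suc d)))))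
    where
    n≤∣n∣ : ∀ n → n ℤ.≤ ℤ.+ ℤ.∣ n ∣
    n≤∣n∣ (ℤ.+ n) = ℤP.≤-refl
    n≤∣n∣ (ℤ.-[1+ n ]) = ℤ.-≤+

archimedean : ∀ C ε → 0ℚ < ε → ∃ λ N → C < ε * ιℕ (suc N)
archimedean C ε 0<ε = proj₁ ab , subst₂ _<_ eq (*-comm (ιℕ (suc (proj₁ ab))) ε) (*-monoˡ-<-pos ε {{positive 0<ε}} (≤-<-trans (proj₂ ab) lt))
  where
  ab = abs-numerator (C * inv ε)
  lt : ιℕ (proj₁ ab) < ιℕ (suc (proj₁ ab))
  lt = subst₂ _<_ (+-identityˡ _) (sym (ιℕ-suc (proj₁ ab))) (+-monoˡ-< (ιℕ (proj₁ ab)) (positive⁻¹ 1ℚ))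
  r : ∀ a b c → a * b * c ≡ a * (c * b)
  r = solve-∀ ℚring
  eq : C * inv ε * ε ≡ C
  eq = trans (r C (inv ε) ε) (trans (cong (C *_) (*-inv (0<⇒≢0 0<ε))) (*-identityʳ C))

record Null (a : ℕ → ℚ) : Set where
  constructor null
  field
    vanishes : ∀ ε → 0ℚ < ε → ∃ λ N → ∀ n → N ℕ.≤ n → ∣ a n ∣ < ε
open Null

null-crit : ∀ {a} C → (∀ K → ∣ a K ∣ * ιℕ (suc K) ≤ C) → Null a
null-crit {a} C h = null go
  where
  go : ∀ ε → 0ℚ < ε → ∃ λ N → ∀ n → N ℕ.≤ n → ∣ a n ∣ < ε
  go ε 0<ε = proj₁ ar , λ n N≤n → *-cancelʳ-<-nonNeg (ιℕ (suc n)) {{nonNegative (0≤ιℕ (suc n))}}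
      (≤-<-trans (h n) (<-≤-trans (proj₂ ar) (*-monoˡ (<⇒≤ 0<ε) (ιℕ-mono (s≤s N≤n)))))
    where ar = archimedean C ε 0<ε

null-cong : ∀ {a b} → (∀ n → a n ≡ b n) → Null a → Null b
null-cong e h = null λ ε 0<ε → proj₁ (vanishes h ε 0<ε) , λ n N≤n → subst (λ z → ∣ z ∣ < ε) (e n) (proj₂ (vanishes h ε 0<ε) n N≤n)

½ε : ∀ {ε} → 0ℚ < ε → 0ℚ < ε * ½
½ε h = 0<* h (positive⁻¹ ½)

half+half : ∀ ε → ε * ½ + ε * ½ ≡ ε
half+half ε = trans (sym (*-distribˡ-+ ε ½ ½)) (*-identityʳ ε)

null-+ : ∀ {a b} → Null a → Null b → Null (λ n → a n + b n)
null-+ {a} {b} ha hb = null λ ε 0<ε → go ε (vanishes ha (ε * ½) (½ε 0<ε)) (vanishes hb (ε * ½) (½ε 0<ε))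
  where
  go : ∀ ε → (∃ λ N → ∀ n → N ℕ.≤ n → ∣ a n ∣ < ε * ½) → (∃ λ N → ∀ n → N ℕ.≤ n → ∣ b n ∣ < ε * ½) → ∃ λ N → ∀ n → N ℕ.≤ n → ∣ a n + b n ∣ < ε
  go ε (N , f) (N′ , f′) = N ℕ.⊔ N′ , λ n h → ≤-<-trans (∣p+q∣≤∣p∣+∣q∣ (a n) (b n)) (subst (∣ a n ∣ + ∣ b n ∣ <_) (half+half ε)
    (+-mono-< (f n (ℕP.≤-trans (ℕP.m≤m⊔n N N′) h)) (f′ n (ℕP.≤-trans (ℕP.m≤n⊔m N N′) h))))

null-bounded : ∀ {a b : ℕ → ℚ} C → 0ℚ < C → (∀ n → ∣ b n ∣ ≤ C) → Null a → Null (λ n → b n * a n)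
null-bounded {a} {b} C 0<C hb ha = null λ ε 0<ε → proj₁ (N ε 0<ε) , λ n h → ≤-<-trans (≤-trans (≤-reflexive (∣p*q∣≡∣p∣*∣q∣ (b n) (a n))) (*-monoʳ (0≤∣p∣ (a n)) (hb n)))
    (subst (C * ∣ a n ∣ <_) (eq ε) (*-monoʳ-<-pos C {{positive 0<C}} (proj₂ (N ε 0<ε) n h)))
  where
  0<inv : 0ℚ < inv C
  0<inv = ≰⇒> (λ h → <⇒≱ (positive⁻¹ 1ℚ) (subst₂ _≤_ (*-inv (0<⇒≢0 0<C)) (*-zeroʳ C) (*-monoˡ (<⇒≤ 0<C) h)))
    where
    <⇒≱ : ∀ {a b} → a < b → ¬ (b ≤ a)
    <⇒≱ h h′ = <⇒≢ (<-≤-trans h h′) refl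
  N : ∀ ε → 0ℚ < ε → ∃ λ N → ∀ n → N ℕ.≤ n → ∣ a n ∣ < ε * inv C
  N ε 0<ε = vanishes ha (ε * inv C) (0<* 0<ε 0<inv)
  r : ∀ a b c → a * (b * c) ≡ b * (a * c)
  r = solve-∀ ℚring
  eq : ∀ ε → C * (ε * inv C) ≡ ε
  eq ε = trans (r C ε (inv C)) (trans (cong (ε *_) (*-inv (0<⇒≢0 0<C))) (*-identityʳ ε))

null-0 : Null (λ _ → 0ℚ)
null-0 = null λ ε 0<ε → 0 , λ _ _ → 0<ε

null-∑ : ∀ N (f : ℕ → ℕ → ℚ) → (∀ i → Null (f i)) → Null (λ K → ∑ N (λ i → f i K))
null-∑ zero f h = null-0
null-∑ (suc N) f h = null-+ (null-∑ N f h) (h N)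

null-shift : ∀ {a} i → Null a → Null (λ K → a (K ℕ.+ i))
null-shift i h = null λ ε 0<ε → proj₁ (vanishes h ε 0<ε) , λ n N≤n → proj₂ (vanishes h ε 0<ε) (n ℕ.+ i) (ℕP.≤-trans N≤n (ℕP.m≤m+n n i))

null-*ˡ : ∀ {a} c → Null a → Null (λ K → c * a K)
null-*ˡ {a} c h = null-bounded {a} {λ _ → c} (∣ c ∣ + 1ℚ) (<-≤-trans (positive⁻¹ 1ℚ) (≤-trans (≤-reflexive (sym (+-identityˡ 1ℚ))) (+-monoˡ-≤ 1ℚ (0≤∣p∣ c)))) (λ _ → ≤-trans (≤-reflexive (sym (+-identityʳ (∣ c ∣)))) (+-monoʳ-≤ (∣ c ∣) 0≤1)) h

null-neg : ∀ {a} → Null a → Null (λ K → - a K)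
null-neg {a} h = null λ ε 0<ε → proj₁ (vanishes h ε 0<ε) , λ n N≤n → subst (_< ε) (sym (∣-p∣≡∣p∣ (a n))) (proj₂ (vanishes h ε 0<ε) n N≤n)

record Lim (a : ℕ → ℚ) (L : ℚ) : Set where
  constructor lim
  field
    difference : Null (λ n → a n - L)
open Lim

lim-cong : ∀ {a b L} → (∀ n → a n ≡ b n) → Lim a L → Lim b L
lim-cong {L = L} e h = lim (null-cong (λ n → cong (_- L) (e n)) (difference h))

lim-+ : ∀ {a b L L′} → Lim a L → Lim b L′ → Lim (λ n → a n + b n) (L + L′)
lim-+ {a} {b} {L} {L′} h h′ = lim (null-cong (λ n → r (a n) (b n) L L′) (null-+ (difference h) (difference h′)))
  where
  r : ∀ a b c d → (a - c) + (b - d) ≡ a + b - (c + d)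
  r = solve-∀ ℚring

lim-*ˡ : ∀ {a L} c → Lim a L → Lim (λ n → c * a n) (c * L)
lim-*ˡ {a} {L} c h = lim (null-cong (λ n → r c (a n) L) (null-*ˡ c (difference h)))
  where
  r : ∀ c a b → c * (a - b) ≡ c * a - c * b
  r = solve-∀ ℚring

lim-null : ∀ {a b L} → Null (λ n → a n - b n) → Lim b L → Lim a L
lim-null {a} {b} {L} h h′ = lim (null-cong (λ n → r (a n) (b n) L) (null-+ h (difference h′)))
  where
  r : ∀ a b c → (a - b) + (b - c) ≡ a - c
  r = solve-∀ ℚring

lim-∑ : ∀ N (f : ℕ → ℕ → ℚ) (L : ℕ → ℚ) → (∀ i → i ℕ.< N → Lim (f i) (L i)) → Lim (λ K → ∑ N (λ i → f i K)) (∑ N L)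
lim-∑ zero f L h = lim null-0
lim-∑ (suc N) f L h = lim-+ (lim-∑ N f L (λ i i<N → h i (ℕP.m<n⇒m<1+n i<N))) (h N ℕP.≤-refl)

lim-lower : ∀ {a L c} N → Lim a L → (∀ n → N ℕ.≤ n → c ≤ ∣ a n ∣) → c ≤ ∣ L ∣
lim-lower {a} {L} {c} N h hc = ≮⇒≥′ (λ lt → contra lt)
  where
  ≮⇒≥′ : ¬ (∣ L ∣ < c) → c ≤ ∣ L ∣
  ≮⇒≥′ n with ≤-total c (∣ L ∣)
  ... | inj₁ h = h
  ... | inj₂ h with ∣ L ∣ ≟ c
  ...   | yes e = ≤-reflexive (sym e)
  ...   | no ne = ⊥-elim (n (≤∧≢⇒<′ h ne))
    where
    ≤∧≢⇒<′ : ∀ {x y} → x ≤ y → x ≢ y → x < y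
    ≤∧≢⇒<′ {x} {y} h ne = ≰⇒> (λ h′ → ne (≤-antisym h h′))
  contra : ¬ (∣ L ∣ < c)
  contra lt with vanishes (difference h) (c - ∣ L ∣) (subst (_< c - ∣ L ∣) (+-inverseʳ (∣ L ∣)) (+-monoˡ-< (- ∣ L ∣) lt))
  ... | M , f = <⇒≢ (≤-<-trans (hc k (ℕP.m≤m⊔n N M)) (≤-<-trans (≤-trans (≤-reflexive (cong ∣_∣ (r (a k) L))) (∣p+q∣≤∣p∣+∣q∣ (a k - L) L))
      (subst (∣ a k - L ∣ + ∣ L ∣ <_) (r₂ c (∣ L ∣)) (+-monoˡ-< (∣ L ∣) (f k (ℕP.m≤n⊔m N M)))))) refl
    where
    k = N ℕ.⊔ M
    r : ∀ a l → a ≡ (a - l) + l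
    r = solve-∀ ℚring
    r₂ : ∀ c l → c - l + l ≡ c
    r₂ = solve-∀ ℚring

lim-upper : ∀ {a L c} N → Lim a L → (∀ n → N ℕ.≤ n → ∣ a n ∣ ≤ c) → ∣ L ∣ ≤ c
lim-upper {a} {L} {c} N h hc with ≤-total (∣ L ∣) c
... | inj₁ ok = ok
... | inj₂ c≤L with ∣ L ∣ ≟ c
...   | yes e = ≤-reflexive e
...   | no ne = ⊥-elim (contra (≰⇒> (λ h′ → ne (≤-antisym h′ c≤L))))
  where
  contra : ¬ (c < ∣ L ∣)
  contra lt with vanishes (difference h) (∣ L ∣ - c) (subst (_< ∣ L ∣ - c) (+-inverseʳ c) (+-monoˡ-< (- c) lt))
  ... | M , f = <⇒≢ (≤-<-trans (≤-trans (≤-reflexive (cong ∣_∣ (r (a k) L))) (∣x-y∣≤ (a k) (a k - L)))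
      (<-≤-trans (+-monoʳ-< (∣ a k ∣) (f k (ℕP.m≤n⊔m N M))) (≤-trans (+-monoˡ-≤ (∣ L ∣ - c) (hc k (ℕP.m≤m⊔n N M))) (≤-reflexive (r₂ c (∣ L ∣)))))) refl
    where
    k = N ℕ.⊔ M
    r : ∀ a l → l ≡ a - (a - l)
    r = solve-∀ ℚring
    r₂ : ∀ c l → c + (l - c) ≡ l
    r₂ = solve-∀ ℚring

suc≤2^ : ∀ k → suc k ℕ.≤ 2 ℕ.^ k
suc≤2^ zero = ℕP.≤-refl
suc≤2^ (suc k) = ℕP.≤-trans (ℕP.+-mono-≤ (ℕP.≤-trans (s≤s z≤n) (suc≤2^ k)) (suc≤2^ k)) (ℕP.≤-reflexive (cong (2 ℕ.^ k ℕ.+_) (sym (ℕP.+-identityʳ _))))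

-- With k the quotient of n by d + 1 one has n + 1 ≤ (d + 1)(k + 1) and k + 1 ≤ 2^k; raising to the
-- power d + 1 costs at most 2^n.
poly≤exp : ∀ d n → suc n ℕ.^ suc d ℕ.≤ suc d ℕ.^ suc d ℕ.* 2 ℕ.^ n
poly≤exp d n = ℕP.≤-trans (ℕP.^-monoˡ-≤ (suc d) n≤) (ℕP.≤-trans (ℕP.≤-reflexive (dist (suc d) (suc d) (suc k)))
    (ℕP.*-monoʳ-≤ (suc d ℕ.^ suc d) (ℕP.≤-trans (ℕP.^-monoˡ-≤ (suc d) (suc≤2^ k)) (ℕP.≤-trans (ℕP.≤-reflexive (ℕP.^-*-assoc 2 k (suc d))) (ℕP.^-monoʳ-≤ 2 (ℕD.m/n*n≤m n (suc d)))))))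
  where
  k = n ℕ./ suc d
  n≤ : suc n ℕ.≤ suc d ℕ.* suc k
  n≤ = ℕP.≤-trans (s≤s (ℕP.≤-reflexive (ℕD.m≡m%n+[m/n]*n n (suc d)))) (ℕP.≤-trans (ℕP.+-monoˡ-≤ (k ℕ.* suc d) (ℕD.m%n<n n (suc d))) (ℕP.≤-reflexive (ℕP.*-comm (suc k) (suc d))))
  dist : ∀ e a b → (a ℕ.* b) ℕ.^ e ≡ a ℕ.^ e ℕ.* b ℕ.^ e
  dist zero a b = refl
  dist (suc e) a b = trans (cong (a ℕ.* b ℕ.*_) (dist e a b)) (r a b (a ℕ.^ e) (b ℕ.^ e))
    where
    r : ∀ a b c d → a ℕ.* b ℕ.* (c ℕ.* d) ≡ a ℕ.* c ℕ.* (b ℕ.* d)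
    r = ℕ-solve-∀

ι2 : ιℕ 2 ≡ 2ℚ
ι2 = trans (ιℕ-suc 1) (cong (1ℚ +_) ι1)

poly-geometric : ∀ Q → 0ℚ ≤ Q → Q * 2ℚ ≤ 1ℚ → ∀ d n → ιℕ (suc n) ↑ suc d * Q ↑ n ≤ ιℕ (suc d) ↑ suc d
poly-geometric Q 0≤Q h d n = ≤-trans (*-monoʳ (0≤↑ n 0≤Q) (subst₂ _≤_ (ιℕ-^ (suc n) (suc d)) (trans (ιℕ-* (suc d ℕ.^ suc d) (2 ℕ.^ n)) (cong₂ _*_ (ιℕ-^ (suc d) (suc d)) (trans (ιℕ-^ 2 n) (cong (_↑ n) ι2)))) (ιℕ-mono (poly≤exp d n))))
  (≤-trans (≤-reflexive (trans (r (ιℕ (suc d) ↑ suc d) (2ℚ ↑ n) (Q ↑ n)) (cong (ιℕ (suc d) ↑ suc d *_) (sym (↑-*ˡ Q 2ℚ n))))) (≤-trans (*-monoˡ (0≤↑ (suc d) (0≤ιℕ (suc d))) (↑≤1 n (0≤* 0≤Q 0≤2) h)) (≤-reflexive (*-identityʳ _))))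
  where
  r : ∀ a b c → a * b * c ≡ a * (c * b)
  r = solve-∀ ℚring

null-geometric : ∀ Q → 0ℚ ≤ Q → Q * 2ℚ ≤ 1ℚ → ∀ {a : ℕ → ℚ} d C → 0ℚ ≤ C → (∀ K → ∣ a K ∣ ≤ C * (ιℕ (suc K) ↑ d * Q ↑ K)) → Null a
null-geometric Q 0≤Q h {a} d C 0≤C b = null-crit (C * ιℕ (suc d) ↑ suc d) (λ K → ≤-trans (*-monoʳ (0≤ιℕ (suc K)) (b K))
  (≤-trans (≤-reflexive (r C (ιℕ (suc K) ↑ d) (Q ↑ K) (ιℕ (suc K)))) (*-monoˡ 0≤C (poly-geometric Q 0≤Q h d K))))
  where
  r : ∀ c a q n → c * (a * q) * n ≡ c * (n * a * q)
  r = solve-∀ ℚring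

-- Lambert series

divisorTerm : ℕ → ℕ → ℕ → ℕ
divisorTerm t k d = if does (suc d ∣? k) then suc d ℕ.^ t else 0

divisorSum : ℕ → ℕ → ℕ → ℕ
divisorSum t k zero = 0
divisorSum t k (suc d) = divisorTerm t k d ℕ.+ divisorSum t k d

-- The local function in the definition of σ has no name in scope; it is found by unification,
-- after abstracting suc k so that its parameter and its argument become independent.
mutual
  σ-local : ∀ t w d → _ ≡ divisorSum t w d
  σ-local t w zero = refl
  σ-local t w (suc d) = cong (divisorTerm t w d ℕ.+_) (σ-local t w d)

  σ-rest : ℕ → ℕ → ℕ
  σ-rest t k = _

  σ-peel : ∀ t k → σ t (suc k) ≡ divisorTerm t (suc k) k ℕ.+ σ-rest t k
  σ-peel t k = refl

  σ-rest≡ : ∀ t k → σ-rest t k ≡ divisorSum t (suc k) k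
  σ-rest≡ t k with suc k
  ... | w = σ-local t w k

σ≡ : ∀ t k → σ t (suc k) ≡ divisorSum t (suc k) (suc k)
σ≡ t k = trans (σ-peel t k) (cong (divisorTerm t (suc k) k ℕ.+_) (σ-rest≡ t k))

divisorTerm-ℚ : ∀ t k d → ιℕ (divisorTerm t k d) ≡ ιℕ (ind (suc d) k) * ιℕ (suc d) ↑ t
divisorTerm-ℚ t k d = go (suc d ∣? k)
  where
  go : (dd : Dec (suc d ∣ℕ k)) → ιℕ (if does dd then suc d ℕ.^ t else 0) ≡ ιℕ (ind (suc d) k) * ιℕ (suc d) ↑ t
  go (yes h) = trans (ιℕ-^ (suc d) t) (trans (sym (*-identityˡ _)) (cong (_* ιℕ (suc d) ↑ t) (sym (trans (cong ιℕ (ind-yes h)) ι1))))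
  go (no h) = trans ι0 (trans (sym (*-zeroˡ (ιℕ (suc d) ↑ t))) (cong (_* ιℕ (suc d) ↑ t) (sym (trans (cong ιℕ (ind-no h)) ι0))))

divisorSum-ℚ : ∀ t k n → ιℕ (divisorSum t k n) ≡ ∑ n (λ d → ιℕ (ind (suc d) k) * ιℕ (suc d) ↑ t)
divisorSum-ℚ t k zero = ι0
divisorSum-ℚ t k (suc n) = trans (ιℕ-+ (divisorTerm t k n) (divisorSum t k n)) (trans (cong₂ _+_ (divisorTerm-ℚ t k n) (divisorSum-ℚ t k n)) (+-comm (ιℕ (ind (suc n) k) * ιℕ (suc n) ↑ t) _))

Ind : ∀ {A : Set} → Dec A → ℚ
Ind (yes _) = 1ℚ
Ind (no _) = 0ℚ

Ind-yes : ∀ {A : Set} (d : Dec A) → A → Ind d ≡ 1ℚ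
Ind-yes (yes _) _ = refl
Ind-yes (no ¬a) a = ⊥-elim (¬a a)

Ind-no : ∀ {A : Set} (d : Dec A) → ¬ A → Ind d ≡ 0ℚ
Ind-no (yes a) ¬a = ⊥-elim (¬a a)
Ind-no (no _) _ = refl

multiples : ∀ (g : ℕ → ℚ) d K → ∑ K (λ N → ιℕ (ind (suc d) (suc N)) * g (suc N)) ≡ ∑ K (λ i → Ind (suc i ℕ.* suc d ℕP.≤? K) * g (suc i ℕ.* suc d))
multiples g d zero = refl
multiples g d (suc K) = sym (trans (∑-cong (suc K) (λ i _ → trans (cong (_* g (suc i ℕ.* D)) (Ind-suc i)) (*-distribʳ-+ (g (suc i ℕ.* D)) (Ind (suc i ℕ.* D ℕP.≤? K)) (Ind (suc i ℕ.* D ℕP.≟ suc K)))))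
    (trans (∑-+ (suc K) (λ i → Ind (suc i ℕ.* D ℕP.≤? K) * g (suc i ℕ.* D)) (λ i → Ind (suc i ℕ.* D ℕP.≟ suc K) * g (suc i ℕ.* D)))
      (cong₂ _+_ (trans (cong (∑ K (λ i → Ind (suc i ℕ.* D ℕP.≤? K) * g (suc i ℕ.* D)) +_) (trans (cong (_* g (suc K ℕ.* D)) (Ind-no (suc K ℕ.* D ℕP.≤? K) (λ h → ℕP.<⇒≱ (ℕP.m≤m*n (suc K) D) h))) (*-zeroˡ (g (suc K ℕ.* D)))))
          (trans (+-identityʳ _) (sym (multiples g d K)))) last)))
  where
  D = suc d
  Ind-suc : ∀ i → Ind (suc i ℕ.* D ℕP.≤? suc K) ≡ Ind (suc i ℕ.* D ℕP.≤? K) + Ind (suc i ℕ.* D ℕP.≟ suc K)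
  Ind-suc i = go (suc i ℕ.* D) (suc i ℕ.* D ℕP.≤? suc K) (suc i ℕ.* D ℕP.≤? K) (suc i ℕ.* D ℕP.≟ suc K)
    where
    go : ∀ x (a : Dec (x ℕ.≤ suc K)) (b : Dec (x ℕ.≤ K)) (c : Dec (x ≡ suc K)) → Ind a ≡ Ind b + Ind c
    go x (yes _) (yes h) (yes e) = ⊥-elim (ℕP.<⇒≱ (ℕP.≤-reflexive (sym e)) h)
    go x (yes _) (yes _) (no _) = sym (+-identityʳ 1ℚ)
    go x (yes _) (no _) (yes _) = sym (+-identityˡ 1ℚ)
    go x (yes h) (no ¬h) (no ne) = ⊥-elim (¬h (ℕP.≤-pred (ℕP.≤∧≢⇒< h ne)))
    go x (no ¬h) (yes h) _ = ⊥-elim (¬h (ℕP.m≤n⇒m≤1+n h))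
    go x (no ¬h) (no _) (yes e) = ⊥-elim (¬h (ℕP.≤-reflexive e))
    go x (no _) (no _) (no _) = sym (+-identityˡ 0ℚ)
  last : ∑ (suc K) (λ i → Ind (suc i ℕ.* D ℕP.≟ suc K) * g (suc i ℕ.* D)) ≡ ιℕ (ind D (suc K)) * g (suc K)
  last = go (D ∣? suc K)
    where
    go : Dec (D ∣ℕ suc K) → ∑ (suc K) (λ i → Ind (suc i ℕ.* D ℕP.≟ suc K) * g (suc i ℕ.* D)) ≡ ιℕ (ind D (suc K)) * g (suc K)
    go (yes (divides (suc c) e)) = trans (∑-single (suc K) c (λ i → Ind (suc i ℕ.* D ℕP.≟ suc K) * g (suc i ℕ.* D)) (ℕP.≤-trans (ℕP.m≤m*n (suc c) D) (ℕP.≤-reflexive (sym e)))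
        (λ i i≢c → trans (cong (_* g (suc i ℕ.* D)) (Ind-no (suc i ℕ.* D ℕP.≟ suc K) (λ e′ → i≢c (ℕP.suc-injective (ℕP.*-cancelʳ-≡ (suc i) (suc c) D (trans e′ e)))))) (*-zeroˡ (g (suc i ℕ.* D)))))
      (cong₂ _*_ (trans (Ind-yes (suc c ℕ.* D ℕP.≟ suc K) (sym e)) (sym (trans (cong ιℕ (ind-yes {D} {suc K} (divides (suc c) e))) ι1))) (cong g (sym e)))
    go (no ¬d) = trans (∑-0 (suc K) (λ i _ → trans (cong (_* g (suc i ℕ.* D)) (Ind-no (suc i ℕ.* D ℕP.≟ suc K) (λ e → ¬d (divides (suc i) (sym e))))) (*-zeroˡ (g (suc i ℕ.* D)))))
      (sym (trans (cong (λ z → ιℕ z * g (suc K)) (ind-no ¬d)) (trans (cong (_* g (suc K)) ι0) (*-zeroˡ (g (suc K))))))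

-- The double series of ζ_q(s + 1) over a rectangle instead of the region below a hyperbola; its
-- rows are truncated series in x = q^(i+1).
rect : ℚ → ℕ → ℕ → ℚ
rect q s K = ∑ K (λ i → ∑ (suc K) (λ d → ιℕ (suc d) ↑ s * q ↑ (suc i ℕ.* suc d)))

ζ-rect : ∀ q s K → ζpartial q (suc s) K ≡ ∑ (suc K) (λ d → ιℕ (suc d) ↑ s * ∑ K (λ i → Ind (suc i ℕ.* suc d ℕP.≤? K) * q ↑ (suc i ℕ.* suc d)))
ζ-rect q s K = trans (unfold K) (trans (∑-cong K (λ N N<K → trans (cong (q ↑ suc N *_) (trans (cong ιℕ (σ≡ s N)) (trans (divisorSum-ℚ s (suc N) (suc N)) (extend N N<K)))) (sym (∑-*ˡ (suc K) (q ↑ suc N) _))))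
    (trans (∑-swap K (suc K) (λ N d → q ↑ suc N * (ιℕ (ind (suc d) (suc N)) * ιℕ (suc d) ↑ s)))
      (∑-cong (suc K) (λ d _ → trans (∑-cong K (λ N _ → r (q ↑ suc N) (ιℕ (ind (suc d) (suc N))) (ιℕ (suc d) ↑ s))) (trans (∑-*ˡ K (ιℕ (suc d) ↑ s) _) (cong (ιℕ (suc d) ↑ s *_) (multiples (q ↑_) d K)))))))
  where
  r : ∀ a b c → a * (b * c) ≡ c * (b * a)
  r = solve-∀ ℚring
  unfold : ∀ K → ζpartial q (suc s) K ≡ ∑ K (λ N → q ↑ suc N * ιℕ (σ s (suc N)))
  unfold zero = refl
  unfold (suc K) = cong₂ _+_ (unfold K) (cong (q ↑ suc K *_) (sym (ι≡/1 (ℤ.+ σ s (suc K)))))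
  extend : ∀ N → N ℕ.< K → ∑ (suc N) (λ d → ιℕ (ind (suc d) (suc N)) * ιℕ (suc d) ↑ s) ≡ ∑ (suc K) (λ d → ιℕ (ind (suc d) (suc N)) * ιℕ (suc d) ↑ s)
  extend N N<K = sym (trans (cong (λ z → ∑ z f) (sym (ℕP.m+[n∸m]≡n (ℕP.m≤n⇒m≤1+n N<K)))) (trans (∑-split (suc N) (suc K ℕ.∸ suc N) f)
    (trans (cong (∑ (suc N) f +_) (∑-0 (suc K ℕ.∸ suc N) (λ i _ → trans (cong (λ z → ιℕ z * ιℕ (suc (suc N ℕ.+ i)) ↑ s) (ind-0 (suc (suc N ℕ.+ i)) (s≤s (ℕP.m≤m+n (suc N) i)) (s≤s z≤n))) (trans (cong (_* ιℕ (suc (suc N ℕ.+ i)) ↑ s) ι0) (*-zeroˡ (ιℕ (suc (suc N ℕ.+ i)) ↑ s)))))) (+-identityʳ _))))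
    where
    f : ℕ → ℚ
    f d = ιℕ (ind (suc d) (suc N)) * ιℕ (suc d) ↑ s

null-dom : ∀ {a b : ℕ → ℚ} → (∀ n → ∣ a n ∣ ≤ ∣ b n ∣) → Null b → Null a
null-dom h nb = null λ ε 0<ε → proj₁ (Null.vanishes nb ε 0<ε) , λ n N≤n → ≤-<-trans (h n) (proj₂ (Null.vanishes nb ε 0<ε) n N≤n)

lim-unshift : ∀ {a : ℕ → ℚ} {L} k → Lim (λ K → a (k ℕ.+ K)) L → Lim a L
lim-unshift {a} {L} k h = lim (null λ ε 0<ε → k ℕ.+ proj₁ (V ε 0<ε) , λ n N≤n → subst (λ z → ∣ a z - L ∣ < ε) (ℕP.m+[n∸m]≡n (ℕP.≤-trans (ℕP.m≤m+n k _) N≤n))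
    (proj₂ (V ε 0<ε) (n ℕ.∸ k) (subst (ℕ._≤ n ℕ.∸ k) (ℕP.m+n∸m≡n k (proj₁ (V ε 0<ε))) (ℕP.∸-monoˡ-≤ k N≤n))))
  where V = Null.vanishes (Lim.difference h)

lim-shift : ∀ {a : ℕ → ℚ} {L} k → Lim a L → Lim (λ K → a (k ℕ.+ K)) L
lim-shift {a} {L} k h = lim (null-cong (λ n → cong (λ z → a z - L) (ℕP.+-comm n k)) (null-shift k (Lim.difference h)))

-- Sums over the ω_i as combinations of zeta values.

module ZetaSums (q : ℚ) (q≤½ : ∣ q ∣ * 2ℚ ≤ 1ℚ) (1-q≢0 : (i : ℕ) → 1ℚ - q ↑ suc i ≢ 0ℚ) where

  open Sizes q q≤½ using (Q; 0≤Q; Q≤1; 1±-Bd; Q^≤Q)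

  W : ℕ → ℚ
  W i = inv (1ℚ - q ↑ suc i)

  W-abs : ∀ i → ∣ W i ∣ ≤ 2ℚ
  W-abs i = ≤-trans (Bd.upper (Bd-inv (*-inv (1-q≢0 i)) (1±-Bd (q ↑ suc i) (Q^≤Q i)))) (≤-reflexive (*-identityʳ 2ℚ))

  -- The two partial sums differ by the terms with (i + 1)(d + 1) > K: at most K (K + 1) terms, each
  -- at most (K + 1)^s |q|^K.
  rect-lim : ∀ s r → ConvergesTo (ζpartial q (suc s)) r → Lim (rect q s) r
  rect-lim s r h = lim-null (null-geometric Q 0≤Q q≤½ (suc (suc s)) 1ℚ 0≤1 bound) (lim (null h))
    where
    diff : ∀ K → rect q s K - ζpartial q (suc s) K ≡ ∑ (suc K) (λ d → ∑ K (λ i → ιℕ (suc d) ↑ s * ((1ℚ - Ind (suc i ℕ.* suc d ℕP.≤? K)) * q ↑ (suc i ℕ.* suc d))))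
    diff K = trans (cong₂ _-_ (∑-swap K (suc K) (λ i d → ιℕ (suc d) ↑ s * q ↑ (suc i ℕ.* suc d))) (trans (ζ-rect q s K) (∑-cong (suc K) (λ d _ → sym (∑-*ˡ K (ιℕ (suc d) ↑ s) _)))))
      (trans (sym (∑-- (suc K) _ _)) (∑-cong (suc K) (λ d _ → trans (sym (∑-- K _ _)) (∑-cong K (λ i _ → r′ (ιℕ (suc d) ↑ s) (q ↑ (suc i ℕ.* suc d)) (Ind (suc i ℕ.* suc d ℕP.≤? K)))))))
      where
      r′ : ∀ a b j → a * b - a * (j * b) ≡ a * ((1ℚ - j) * b)
      r′ = solve-∀ ℚring
    small : ∀ K e (dd : Dec (e ℕ.≤ K)) → ∣ (1ℚ - Ind dd) * q ↑ e ∣ ≤ Q ↑ K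
    small K e (yes _) = ≤-trans (≤-reflexive (trans (cong ∣_∣ (r₁ (q ↑ e))) refl)) (0≤↑ K 0≤Q)
      where
      r₁ : ∀ x → (1ℚ - 1ℚ) * x ≡ 0ℚ
      r₁ = solve-∀ ℚring
    small K e (no ¬h) = ≤-trans (≤-reflexive (trans (cong ∣_∣ (r₁ (q ↑ e))) (↑-abs q e))) (↑-anti {b = e} 0≤Q Q≤1 (ℕP.<⇒≤ (ℕP.≰⇒> ¬h)))
      where
      r₁ : ∀ x → (1ℚ - 0ℚ) * x ≡ x
      r₁ = solve-∀ ℚring
    bound : ∀ K → ∣ rect q s K - ζpartial q (suc s) K ∣ ≤ 1ℚ * (ιℕ (suc K) ↑ suc (suc s) * Q ↑ K)
    bound K = ≤-trans (≤-reflexive (cong ∣_∣ (diff K))) (≤-trans (∑-abs (suc K) _) (≤-trans (∑-mono (suc K) (λ d d< → ≤-trans (∑-abs K _) (∑-mono K (λ i _ →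
        ≤-trans (≤-reflexive (∣p*q∣≡∣p∣*∣q∣ (ιℕ (suc d) ↑ s) ((1ℚ - Ind (suc i ℕ.* suc d ℕP.≤? K)) * q ↑ (suc i ℕ.* suc d)))) (*-mono-nonNeg (0≤∣p∣ _) (≤-trans (≤-reflexive (abs≡ (0≤↑ s (0≤ιℕ (suc d))))) (↑-mono s (0≤ιℕ (suc d)) (ιℕ-mono d<))) (0≤∣p∣ _) (small K (suc i ℕ.* suc d) (suc i ℕ.* suc d ℕP.≤? K)))))))
      (≤-trans (≤-reflexive (trans (∑-cong (suc K) (λ _ _ → ∑-const K (ιℕ (suc K) ↑ s * Q ↑ K))) (∑-const (suc K) (ιℕ K * (ιℕ (suc K) ↑ s * Q ↑ K)))))
        (≤-trans (*-monoˡ (0≤ιℕ (suc K)) (*-monoʳ (0≤* (0≤↑ s (0≤ιℕ (suc K))) (0≤↑ K 0≤Q)) (ιℕ-mono (ℕP.n≤1+n K)))) (≤-reflexive (r₁ (ιℕ (suc K)) (ιℕ (suc K) ↑ s) (Q ↑ K)))))))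
      where
      r₁ : ∀ a b c → a * (a * (b * c)) ≡ 1ℚ * (a * (a * b) * c)
      r₁ = solve-∀ ℚring

  -- Generating functions: Σ a j x ^ j = y, with an explicit error bound.
  GF : (x : ℚ) → ℕ → (ℕ → ℚ) → ℚ → ℚ → Set
  GF x k a y C = ∀ N → k ℕ.≤ N → ∣ ∑ N (λ j → a j * x ↑ j) - y ∣ ≤ C * (∣ x ∣ ↑ N * ιℕ N ↑ 8)

  -- The coefficients of (1 + x) / (1 - x) = 2ω - 1.
  κ₀ : ℕ → ℚ
  κ₀ zero = 1ℚ
  κ₀ (suc _) = 2ℚ

  GF-base : ∀ i → GF (q ↑ suc i) 1 κ₀ (W i + W i - 1ℚ) (2ℚ * 2ℚ)
  GF-base i (suc M) (s≤s _) = ≤-trans (≤-reflexive (trans (cong ∣_∣ (err M)) (trans (cong ∣_∣ (r₂ (W i) (x ↑ suc M))) (trans (∣p*q∣≡∣p∣*∣q∣ (- (2ℚ * W i)) (x ↑ suc M)) (cong₂ _*_ (trans (∣-p∣≡∣p∣ (2ℚ * W i)) (trans (∣p*q∣≡∣p∣*∣q∣ 2ℚ (W i)) (cong (_* ∣ W i ∣) (abs≡ 0≤2)))) (↑-abs x (suc M)))))))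
      (≤-trans (*-monoʳ (0≤↑ (suc M) (0≤∣p∣ x)) (*-monoˡ 0≤2 (W-abs i))) (*-monoˡ (0≤* 0≤2 0≤2) (≤-trans (≤-reflexive (sym (*-identityʳ (∣ x ∣ ↑ suc M)))) (*-monoˡ (0≤↑ (suc M) (0≤∣p∣ x)) (1≤↑ 8 (≤-trans (≤-reflexive (sym ι1)) (ιℕ-mono (s≤s z≤n))))))))
    where
    x = q ↑ suc i
    w = W i
    wx : w * (1ℚ - x) ≡ 1ℚ
    wx = trans (*-comm w (1ℚ - x)) (*-inv (1-q≢0 i))
    r₂ : ∀ w z → - (2ℚ * (w * z)) ≡ - (2ℚ * w) * z
    r₂ w z = trans (cong -_ (sym (*-assoc 2ℚ w z))) (neg-distribˡ-* (2ℚ * w) z)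
    err : ∀ M → ∑ (suc M) (λ j → κ₀ j * x ↑ j) - (w + w - 1ℚ) ≡ - (2ℚ * (w * x ↑ suc M))
    err zero = trans (r w) (trans (cong (λ z → 2ℚ * z - 2ℚ * w) (sym wx)) (r₁ w x))
      where
      r : ∀ w → 0ℚ + 1ℚ * 1ℚ - (w + w - 1ℚ) ≡ (1ℚ + 1ℚ) * 1ℚ - (1ℚ + 1ℚ) * w
      r = solve-∀ ℚring
      r₁ : ∀ w x → (1ℚ + 1ℚ) * (w * (1ℚ - x)) - (1ℚ + 1ℚ) * w ≡ - ((1ℚ + 1ℚ) * (w * (x * 1ℚ)))
      r₁ = solve-∀ ℚring
    err (suc M) = trans (r (∑ (suc M) (λ j → κ₀ j * x ↑ j)) (2ℚ * x ↑ suc M) (w + w - 1ℚ)) (trans (cong (_+ 2ℚ * x ↑ suc M) (err M)) (trans (cong (λ z → - (2ℚ * (w * x ↑ suc M)) + 2ℚ * z) (trans (sym (*-identityˡ (x ↑ suc M))) (cong (_* x ↑ suc M) (sym wx)))) (r₁ w x (x ↑ suc M))))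
      where
      r : ∀ a b c → a + b - c ≡ a - c + b
      r = solve-∀ ℚring
      r₁ : ∀ w x z → - ((1ℚ + 1ℚ) * (w * z)) + (1ℚ + 1ℚ) * (w * (1ℚ - x) * z) ≡ - ((1ℚ + 1ℚ) * (w * (x * z)))
      r₁ = solve-∀ ℚring

  v : ℚ → ℚ
  v ω = ω * ω - ω

  -- Multiplication by v = x / (1 - x) ^ 2 inverts the second difference of the coefficients.
  GF-step : ∀ i k (a b : ℕ → ℚ) y A B → 0ℚ ≤ A → 0ℚ ≤ B → b 0 ≡ 0ℚ → b 1 ≡ a 0 → (∀ j → b (suc (suc j)) ≡ b (suc j) + b (suc j) - b j + a (suc j)) →
    (∀ j → ∣ b j ∣ ≤ B * ιℕ (suc j) ↑ 8) → GF (q ↑ suc i) (suc k) a y A → GF (q ↑ suc i) (suc (suc k)) b (v (W i) * y) (2ℚ * 2ℚ * (A + 2ℚ * 2ℚ * B))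
  GF-step i k a b y A B 0≤A 0≤B b0 b1 rec bb ha (suc (suc M)) (s≤s k≤) =
    ≤-trans (≤-reflexive (cong ∣_∣ (err M))) (≤-trans (∣p+q∣≤∣p∣+∣q∣ (v w * (SA (suc M) - y)) (w * w * (x ↑ suc (suc M) * (b M - (b (suc M) + b (suc M)) + x * b (suc M)))))
      (≤-trans (+-mono-≤ first second) (≤-reflexive (r (X * X ↑ suc M) n8 A B))))
    where
    x = q ↑ suc i
    X = ∣ x ∣
    w = W i
    n8 = ιℕ (suc (suc M)) ↑ 8
    SA SB : ℕ → ℚ
    SA n = ∑ n (λ j → a j * x ↑ j)
    SB n = ∑ n (λ j → b j * x ↑ j)
    r : ∀ X n A B → (1ℚ + 1ℚ) * (1ℚ + 1ℚ) * (A * (X * n)) + (1ℚ + 1ℚ) * (1ℚ + 1ℚ) * (X * ((1ℚ + 1ℚ) * (1ℚ + 1ℚ) * (B * n))) ≡ (1ℚ + 1ℚ) * (1ℚ + 1ℚ) * (A + (1ℚ + 1ℚ) * (1ℚ + 1ℚ) * B) * (X * n)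
    r = solve-∀ ℚring
    wx : w * (1ℚ - x) ≡ 1ℚ
    wx = trans (*-comm w (1ℚ - x)) (*-inv (1-q≢0 i))
    0≤X : 0ℚ ≤ X
    0≤X = 0≤∣p∣ x
    ww : ∣ w * w ∣ ≤ 2ℚ * 2ℚ
    ww = ≤-trans (≤-reflexive (∣p*q∣≡∣p∣*∣q∣ w w)) (*-mono-nonNeg (0≤∣p∣ w) (W-abs i) (0≤∣p∣ w) (W-abs i))
    v≡ : v w ≡ w * w * x
    v≡ = sym (trans (r₁ w x) (trans (cong (λ z → w * w - w * z) wx) (cong (λ z → w * w - z) (*-identityʳ w))))
      where
      r₁ : ∀ w x → w * w * x ≡ w * w - w * (w * (1ℚ - x))
      r₁ = solve-∀ ℚring
    -- Multiplication by (1 - x)² turns the inner coefficients into second differences, which are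
    -- those of the series of a; only boundary terms of order x^(M+2) remain.
    identity : ∀ M → (1ℚ - x) * (1ℚ - x) * SB (suc (suc M)) ≡ x * SA (suc M) + x ↑ suc (suc M) * (b M - (b (suc M) + b (suc M)) + x * b (suc M))
    identity zero = trans (cong₂ (λ s t → (1ℚ - x) * (1ℚ - x) * (0ℚ + s * 1ℚ + t * (x * 1ℚ))) b0 b1) (trans (r₁ x (a 0)) (cong₂ (λ s t → x * (0ℚ + a 0 * 1ℚ) + x * (x * 1ℚ) * (s - (t + t) + x * t)) (sym b0) (sym b1)))
      where
      r₁ : ∀ x a → (1ℚ - x) * (1ℚ - x) * (0ℚ + 0ℚ * 1ℚ + a * (x * 1ℚ)) ≡ x * (0ℚ + a * 1ℚ) + x * (x * 1ℚ) * (0ℚ - (a + a) + x * a)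
      r₁ = solve-∀ ℚring
    identity (suc M) = trans (*-distribˡ-+ ((1ℚ - x) * (1ℚ - x)) (SB (suc (suc M))) (b (suc (suc M)) * x ↑ suc (suc M)))
      (trans (cong₂ _+_ (identity M) (cong (λ z → (1ℚ - x) * (1ℚ - x) * (z * x ↑ suc (suc M))) (rec M)))
        (trans (r₁ x (x ↑ suc M) (SA (suc M)) (a (suc M)) (b M) (b (suc M))) (cong (λ z → x * SA (suc (suc M)) + x * (x * x ↑ suc M) * (b (suc M) - (z + z) + x * z)) (sym (rec M)))))
      where
      r₁ : ∀ x z s a b b′ → x * s + x * z * (b - (b′ + b′) + x * b′) + (1ℚ - x) * (1ℚ - x) * ((b′ + b′ - b + a) * (x * z)) ≡
        x * (s + a * z) + x * (x * z) * (b′ - ((b′ + b′ - b + a) + (b′ + b′ - b + a)) + x * (b′ + b′ - b + a))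
      r₁ = solve-∀ ℚring
    err : ∀ M → SB (suc (suc M)) - v w * y ≡ v w * (SA (suc M) - y) + w * w * (x ↑ suc (suc M) * (b M - (b (suc M) + b (suc M)) + x * b (suc M)))
    err M = trans (cong (_- v w * y) (trans (sym (trans (cong₂ (λ s t → s * t * SB (suc (suc M))) wx wx) (r₁ (SB (suc (suc M)))))) (trans (r₂ w x (SB (suc (suc M)))) (cong (w * w *_) (identity M)))))
      (trans (r₃ (w * w) x (SA (suc M)) T (v w) y) (trans (cong (λ z → z * SA (suc M) + w * w * T - v w * y) (sym v≡)) (r₄ (v w) (SA (suc M)) (w * w * T) y)))
      where
      T = x ↑ suc (suc M) * (b M - (b (suc M) + b (suc M)) + x * b (suc M))
      r₁ : ∀ s → 1ℚ * 1ℚ * s ≡ s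
      r₁ = solve-∀ ℚring
      r₂ : ∀ w x s → w * (1ℚ - x) * (w * (1ℚ - x)) * s ≡ w * w * ((1ℚ - x) * (1ℚ - x) * s)
      r₂ = solve-∀ ℚring
      r₃ : ∀ ω x s t v y → ω * (x * s + t) - v * y ≡ ω * x * s + ω * t - v * y
      r₃ = solve-∀ ℚring
      r₄ : ∀ v s t y → v * s + t - v * y ≡ v * (s - y) + t
      r₄ = solve-∀ ℚring
    step≤ : ∀ {m n} → m ℕ.≤ n → ιℕ m ↑ 8 ≤ ιℕ n ↑ 8
    step≤ h = ↑-mono 8 (0≤ιℕ _) (ιℕ-mono h)
    first : ∣ v w * (SA (suc M) - y) ∣ ≤ 2ℚ * 2ℚ * (A * (X * X ↑ suc M * n8))
    first = ≤-trans (≤-reflexive (trans (∣p*q∣≡∣p∣*∣q∣ (v w) (SA (suc M) - y)) (cong (_* ∣ SA (suc M) - y ∣) (trans (cong ∣_∣ v≡) (∣p*q∣≡∣p∣*∣q∣ (w * w) x)))))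
      (≤-trans (*-mono-nonNeg (0≤* (0≤∣p∣ (w * w)) 0≤X) (*-monoʳ 0≤X ww) (0≤∣p∣ (SA (suc M) - y)) (≤-trans (ha (suc M) k≤) (*-monoˡ 0≤A (*-monoˡ (0≤↑ (suc M) 0≤X) (step≤ (ℕP.n≤1+n (suc M))))))) (≤-reflexive (r₁ (2ℚ * 2ℚ) X A (X ↑ suc M) n8)))
      where
      r₁ : ∀ c x a z n → c * x * (a * (z * n)) ≡ c * (a * (x * z * n))
      r₁ = solve-∀ ℚring
    b≤ : ∀ j → suc j ℕ.≤ suc (suc M) → ∣ b j ∣ ≤ B * n8
    b≤ j h = ≤-trans (bb j) (*-monoˡ 0≤B (step≤ h))
    second : ∣ w * w * (x ↑ suc (suc M) * (b M - (b (suc M) + b (suc M)) + x * b (suc M))) ∣ ≤ 2ℚ * 2ℚ * (X * X ↑ suc M * (2ℚ * 2ℚ * (B * n8)))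
    second = ≤-trans (≤-reflexive (trans (∣p*q∣≡∣p∣*∣q∣ (w * w) (x ↑ suc (suc M) * (b M - (b (suc M) + b (suc M)) + x * b (suc M)))) (cong (∣ w * w ∣ *_) (trans (∣p*q∣≡∣p∣*∣q∣ (x ↑ suc (suc M)) (b M - (b (suc M) + b (suc M)) + x * b (suc M))) (cong (_* ∣ b M - (b (suc M) + b (suc M)) + x * b (suc M) ∣) (↑-abs x (suc (suc M))))))))
      (*-mono-nonNeg (0≤∣p∣ (w * w)) ww (0≤* (0≤↑ (suc (suc M)) 0≤X) (0≤∣p∣ (b M - (b (suc M) + b (suc M)) + x * b (suc M)))) (*-monoˡ (0≤↑ (suc (suc M)) 0≤X) bound))
      where
      r₁ : ∀ z → z + (z + z) + z ≡ (1ℚ + 1ℚ) * (1ℚ + 1ℚ) * z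
      r₁ = solve-∀ ℚring
      b′ = b≤ (suc M) ℕP.≤-refl
      bound : ∣ b M - (b (suc M) + b (suc M)) + x * b (suc M) ∣ ≤ 2ℚ * 2ℚ * (B * n8)
      bound = ≤-trans (∣p+q∣≤∣p∣+∣q∣ (b M - (b (suc M) + b (suc M))) (x * b (suc M)))
        (≤-trans (+-mono-≤ (≤-trans (∣x-y∣≤ (b M) (b (suc M) + b (suc M))) (+-mono-≤ (b≤ M (ℕP.n≤1+n (suc M))) (≤-trans (∣p+q∣≤∣p∣+∣q∣ (b (suc M)) (b (suc M))) (+-mono-≤ b′ b′))))
          (≤-trans (≤-reflexive (∣p*q∣≡∣p∣*∣q∣ x (b (suc M)))) (≤-trans (*-mono-nonNeg 0≤X (≤-trans (Q^≤Q i) Q≤1) (0≤∣p∣ (b (suc M))) b′) (≤-reflexive (*-identityˡ (B * n8)))))) (≤-reflexive (r₁ (B * n8))))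

  evenPoly : (ℕ → ℚ) → ℕ → ℚ
  evenPoly e j = ∑ 4 (λ s → e s * ιℕ j ↑ (2 ℕ.* s ℕ.+ 2))

  evenPoly-0 : ∀ e → evenPoly e 0 ≡ 0ℚ
  evenPoly-0 e = ∑-0 4 (λ s _ → trans (cong (λ z → e s * ιℕ 0 ↑ z) (ℕP.+-comm (2 ℕ.* s) 2)) (trans (cong (λ z → e s * (z * ιℕ 0 ↑ suc (2 ℕ.* s))) ι0) (r (e s) (ιℕ 0 ↑ suc (2 ℕ.* s)))))
    where
    r : ∀ a b → a * (0ℚ * b) ≡ 0ℚ
    r = solve-∀ ℚring

  evenPoly-abs : ∀ e j → ∣ evenPoly e j ∣ ≤ ∑ 4 (λ s → ∣ e s ∣) * ιℕ (suc j) ↑ 8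
  evenPoly-abs e j = ≤-trans (∑-abs 4 (λ s → e s * ιℕ j ↑ (2 ℕ.* s ℕ.+ 2))) (≤-trans (∑-mono 4 {λ s → ∣ e s * ιℕ j ↑ (2 ℕ.* s ℕ.+ 2) ∣} {λ s → ∣ e s ∣ * ιℕ (suc j) ↑ 8} (λ s s<4 → ≤-trans (≤-reflexive (∣p*q∣≡∣p∣*∣q∣ (e s) (ιℕ j ↑ (2 ℕ.* s ℕ.+ 2)))) (*-monoˡ (0≤∣p∣ (e s)) (≤-trans (≤-reflexive (abs≡ (0≤↑ (2 ℕ.* s ℕ.+ 2) (0≤ιℕ j))))
      (≤-trans (↑-mono (2 ℕ.* s ℕ.+ 2) (0≤ιℕ j) (ιℕ-mono (ℕP.n≤1+n j))) (↑-mono-exp (≤-trans (≤-reflexive (sym ι1)) (ιℕ-mono {1} {suc j} (s≤s z≤n))) (ℕP.+-monoˡ-≤ 2 (ℕP.*-monoʳ-≤ 2 (ℕP.≤-pred s<4)))))))))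
    (≤-reflexive (∑-*ʳ 4 (ιℕ (suc j) ↑ 8) (λ s → ∣ e s ∣))))

  at : (ℕ → ℚ) → ℚ → ℚ
  at e z = ∑ 4 (λ s → e s * z ↑ (2 ℕ.* s ℕ.+ 2))

  -- The polynomials 2 j²(j² - 1) ⋯ (j² - (t - 1)²) / (2t)!, the coefficients of x ^ j in
  -- (2ω - 1)(ω² - ω) ^ t for ω = 1 / (1 - x).
  e₁ : ℕ → ℚ
  e₁ 0 = 1ℚ
  e₁ 1 = 0ℚ
  e₁ 2 = 0ℚ
  e₁ _ = 0ℚ

  e₂ : ℕ → ℚ
  e₂ 0 = (ℤ.- (ℤ.+ 1) / 12)
  e₂ 1 = (ℤ.+ 1 / 12)
  e₂ 2 = 0ℚ
  e₂ _ = 0ℚ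

  e₃ : ℕ → ℚ
  e₃ 0 = (ℤ.+ 1 / 90)
  e₃ 1 = (ℤ.- (ℤ.+ 1) / 72)
  e₃ 2 = (ℤ.+ 1 / 360)
  e₃ _ = 0ℚ

  e₄ : ℕ → ℚ
  e₄ 0 = (ℤ.- (ℤ.+ 1) / 560)
  e₄ 1 = (ℤ.+ 7 / 2880)
  e₄ 2 = (ℤ.- (ℤ.+ 1) / 1440)
  e₄ _ = (ℤ.+ 1 / 20160)

  -- The second difference of j² is 2, the general coefficient of `κ₀`. Likewise each further
  -- polynomial has the preceding one as its second difference. Sums and powers are written out for
  -- the ring solver.
  e₁-rec : ∀ j → evenPoly e₁ (suc (suc j)) ≡ evenPoly e₁ (suc j) + evenPoly e₁ (suc j) - evenPoly e₁ j + 2ℚ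
  e₁-rec j = trans (cong (at e₁) (trans (ιℕ-suc (suc j)) (cong (1ℚ +_) (ιℕ-suc j)))) (trans (r (ιℕ j)) (cong (λ z → at e₁ z + at e₁ z - evenPoly e₁ j + 2ℚ) (sym (ιℕ-suc j))))
    where
    r : ∀ n → 0ℚ + 1ℚ * ((1ℚ + (1ℚ + n)) * ((1ℚ + (1ℚ + n)) * 1ℚ)) + 0ℚ * ((1ℚ + (1ℚ + n)) * ((1ℚ + (1ℚ + n)) * ((1ℚ + (1ℚ + n)) * ((1ℚ + (1ℚ + n)) * 1ℚ)))) + 0ℚ * ((1ℚ + (1ℚ + n)) * ((1ℚ + (1ℚ + n)) * ((1ℚ + (1ℚ + n)) * ((1ℚ + (1ℚ + n)) * ((1ℚ + (1ℚ + n)) * ((1ℚ + (1ℚ + n)) * 1ℚ)))))) + 0ℚ * ((1ℚ + (1ℚ + n)) * ((1ℚ + (1ℚ + n)) * ((1ℚ + (1ℚ + n)) * ((1ℚ + (1ℚ + n)) * ((1ℚ + (1ℚ + n)) * ((1ℚ + (1ℚ + n)) * ((1ℚ + (1ℚ + n)) * ((1ℚ + (1ℚ + n)) * 1ℚ)))))))) ≡ (0ℚ + 1ℚ * ((1ℚ + n) * ((1ℚ + n) * 1ℚ)) + 0ℚ * ((1ℚ + n) * ((1ℚ + n) * ((1ℚ + n) * ((1ℚ + n) * 1ℚ)))) + 0ℚ * ((1ℚ + n) * ((1ℚ + n) * ((1ℚ + n) * ((1ℚ + n) * ((1ℚ + n) * ((1ℚ + n) * 1ℚ)))))) + 0ℚ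 * ((1ℚ + n) * ((1ℚ + n) * ((1ℚ + n) * ((1ℚ + n) * ((1ℚ + n) * ((1ℚ + n) * ((1ℚ + n) * ((1ℚ + n) * 1ℚ))))))))) + (0ℚ + 1ℚ * ((1ℚ + n) * ((1ℚ + n) * 1ℚ)) + 0ℚ * ((1ℚ + n) * ((1ℚ + n) * ((1ℚ + n) * ((1ℚ + n) * 1ℚ)))) + 0ℚ * ((1ℚ + n) * ((1ℚ + n) * ((1ℚ + n) * ((1ℚ + n) * ((1ℚ + n) * ((1ℚ + n) * 1ℚ)))))) + 0ℚ * ((1ℚ + n) * ((1ℚ + n) * ((1ℚ + n) * ((1ℚ + n) * ((1ℚ + n) * ((1ℚ + n) * ((1ℚ + n) * ((1ℚ + n) * 1ℚ))))))))) - (0ℚ + 1ℚ * (n * (n * 1ℚ)) + 0ℚ * (n * (n * (n * (n * 1ℚ)))) + 0ℚ * (n * (n * (n * (n * (n * (n * 1ℚ)))))) + 0ℚ * (n * (n * (n * (n * (n * (n * (n * (n * 1ℚ))))))))) + (1ℚ + 1ℚ)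
    r = solve-∀ ℚring

  e₂-rec : ∀ j → evenPoly e₂ (suc (suc j)) ≡ evenPoly e₂ (suc j) + evenPoly e₂ (suc j) - evenPoly e₂ j + evenPoly e₁ (suc j)
  e₂-rec j = trans (cong (at e₂) (trans (ιℕ-suc (suc j)) (cong (1ℚ +_) (ιℕ-suc j)))) (trans (r (ιℕ j)) (cong (λ z → at e₂ z + at e₂ z - evenPoly e₂ j + at e₁ z) (sym (ιℕ-suc j))))
    where
    r : ∀ n → 0ℚ + (ℤ.- (ℤ.+ 1) / 12) * ((1ℚ + (1ℚ + n)) * ((1ℚ + (1ℚ + n)) * 1ℚ)) + (ℤ.+ 1 / 12) * ((1ℚ + (1ℚ + n)) * ((1ℚ + (1ℚ + n)) * ((1ℚ + (1ℚ + n)) * ((1ℚ + (1ℚ + n)) * 1ℚ)))) + 0ℚ * ((1ℚ + (1ℚ + n)) * ((1ℚ + (1ℚ + n)) * ((1ℚ + (1ℚ + n)) * ((1ℚ + (1ℚ + n)) * ((1ℚ + (1ℚ + n)) * ((1ℚ + (1ℚ + n)) * 1ℚ)))))) + 0ℚ * ((1ℚ + (1ℚ + n)) * ((1ℚ + (1ℚ + n)) * ((1ℚ + (1ℚ + n)) * ((1ℚ + (1ℚ + n)) * ((1ℚ + (1ℚ + n)) * ((1ℚ + (1ℚ + n)) * ((1ℚ + (1ℚ + n)) * ((1ℚ + (1ℚ + n)) * 1ℚ)))))))) ≡ (0ℚ + (ℤ.- (ℤ.+ 1) / 12) * ((1ℚ + n) * ((1ℚ + n) * 1ℚ)) + (ℤ.+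 1 / 12) * ((1ℚ + n) * ((1ℚ + n) * ((1ℚ + n) * ((1ℚ + n) * 1ℚ)))) + 0ℚ * ((1ℚ + n) * ((1ℚ + n) * ((1ℚ + n) * ((1ℚ + n) * ((1ℚ + n) * ((1ℚ + n) * 1ℚ)))))) + 0ℚ * ((1ℚ + n) * ((1ℚ + n) * ((1ℚ + n) * ((1ℚ + n) * ((1ℚ + n) * ((1ℚ + n) * ((1ℚ + n) * ((1ℚ + n) * 1ℚ))))))))) + (0ℚ + (ℤ.- (ℤ.+ 1) / 12) * ((1ℚ + n) * ((1ℚ + n) * 1ℚ)) + (ℤ.+ 1 / 12) * ((1ℚ + n) * ((1ℚ + n) * ((1ℚ + n) * ((1ℚ + n) * 1ℚ)))) + 0ℚ * ((1ℚ + n) * ((1ℚ + n) * ((1ℚ + n) * ((1ℚ + n) * ((1ℚ + n) * ((1ℚ + n) * 1ℚ)))))) + 0ℚ * ((1ℚ + n) * ((1ℚ + n) * ((1ℚ + n) * ((1ℚ + n) * ((1ℚ + n) * ((1ℚ + n) * ((1ℚ + n) * ((1ℚ + n) * 1ℚ))))))))) - (0ℚ + (ℤ.- (ℤ.+ 1) / 12) * (n * (n * 1ℚ)) + (ℤ.+ 1 / 12) * (n * (n * (n * (n * 1ℚ)))) + 0ℚ * (n * (n * (n * (n * (n * (n * 1ℚ)))))) + 0ℚ * (n * (n * (n * (n * (n * (n * (n * (n * 1ℚ))))))))) + (0ℚ + 1ℚ * ((1ℚ + n) * ((1ℚ + n) * 1ℚ)) + 0ℚ * ((1ℚ + n) *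 ((1ℚ + n) * ((1ℚ + n) * ((1ℚ + n) * 1ℚ)))) + 0ℚ * ((1ℚ + n) * ((1ℚ + n) * ((1ℚ + n) * ((1ℚ + n) * ((1ℚ + n) * ((1ℚ + n) * 1ℚ)))))) + 0ℚ * ((1ℚ + n) * ((1ℚ + n) * ((1ℚ + n) * ((1ℚ + n) * ((1ℚ + n) * ((1ℚ + n) * ((1ℚ + n) * ((1ℚ + n) * 1ℚ)))))))))
    r = solve-∀ ℚring

  e₃-rec : ∀ j → evenPoly e₃ (suc (suc j)) ≡ evenPoly e₃ (suc j) + evenPoly e₃ (suc j) - evenPoly e₃ j + evenPoly e₂ (suc j)
  e₃-rec j = trans (cong (at e₃) (trans (ιℕ-suc (suc j)) (cong (1ℚ +_) (ιℕ-suc j)))) (trans (r (ιℕ j)) (cong (λ z → at e₃ z + at e₃ z - evenPoly e₃ j + at e₂ z) (sym (ιℕ-suc j))))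
    where
    r : ∀ n → 0ℚ + (ℤ.+ 1 / 90) * ((1ℚ + (1ℚ + n)) * ((1ℚ + (1ℚ + n)) * 1ℚ)) + (ℤ.- (ℤ.+ 1) / 72) * ((1ℚ + (1ℚ + n)) * ((1ℚ + (1ℚ + n)) * ((1ℚ + (1ℚ + n)) * ((1ℚ + (1ℚ + n)) * 1ℚ)))) + (ℤ.+ 1 / 360) * ((1ℚ + (1ℚ + n)) * ((1ℚ + (1ℚ + n)) * ((1ℚ + (1ℚ + n)) * ((1ℚ + (1ℚ + n)) * ((1ℚ + (1ℚ + n)) * ((1ℚ + (1ℚ + n)) * 1ℚ)))))) + 0ℚ * ((1ℚ + (1ℚ + n)) * ((1ℚ + (1ℚ + n)) * ((1ℚ + (1ℚ + n)) * ((1ℚ + (1ℚ + n)) * ((1ℚ + (1ℚ + n)) * ((1ℚ + (1ℚ + n)) * ((1ℚ + (1ℚ + n)) * ((1ℚ + (1ℚ + n)) * 1ℚ)))))))) ≡ (0ℚ + (ℤ.+ 1 / 90) * ((1ℚ + n) * ((1ℚ + n) * 1ℚ)) + (ℤ.- (ℤ.+ 1) / 72) * ((1ℚ + n) * ((1ℚ + n) * ((1ℚ + n) * ((1ℚ + n) * 1ℚ)))) + (ℤ.+ 1 / 360) * ((1ℚ + n) * ((1ℚ + n) * ((1ℚ + n) * ((1ℚ + n) * ((1ℚ + n) * ((1ℚ + n) * 1ℚ)))))) + 0ℚ * ((1ℚ + n) * ((1ℚ + n) * ((1ℚ + n) * ((1ℚ + n) * ((1ℚ + n) * ((1ℚ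 + n) * ((1ℚ + n) * ((1ℚ + n) * 1ℚ))))))))) + (0ℚ + (ℤ.+ 1 / 90) * ((1ℚ + n) * ((1ℚ + n) * 1ℚ)) + (ℤ.- (ℤ.+ 1) / 72) * ((1ℚ + n) * ((1ℚ + n) * ((1ℚ + n) * ((1ℚ + n) * 1ℚ)))) + (ℤ.+ 1 / 360) * ((1ℚ + n) * ((1ℚ + n) * ((1ℚ + n) * ((1ℚ + n) * ((1ℚ + n) * ((1ℚ + n) * 1ℚ)))))) + 0ℚ * ((1ℚ + n) * ((1ℚ + n) * ((1ℚ + n) * ((1ℚ + n) * ((1ℚ + n) * ((1ℚ + n) * ((1ℚ + n) * ((1ℚ + n) * 1ℚ))))))))) - (0ℚ + (ℤ.+ 1 / 90) * (n * (n * 1ℚ)) + (ℤ.- (ℤ.+ 1) / 72) * (n * (n * (n * (n * 1ℚ)))) + (ℤ.+ 1 / 360) * (n * (n * (n * (n * (n * (n * 1ℚ)))))) + 0ℚ * (n * (n * (n * (n * (n * (n * (n * (n * 1ℚ))))))))) + (0ℚ + (ℤ.- (ℤ.+ 1) / 12) * ((1ℚ + n) * ((1ℚ + n) * 1ℚ)) + (ℤ.+ 1 / 12) * ((1ℚ + n) * ((1ℚ + n) * ((1ℚ + n) * ((1ℚ + n) * 1ℚ)))) + 0ℚ * ((1ℚ + n) * ((1ℚ + n) * ((1ℚ + n) * ((1ℚ + n) * ((1ℚ + n) * ((1ℚ + n) * 1ℚ)))))) + 0ℚ * ((1ℚ + n) * ((1ℚ + n) * ((1ℚ + n) * ((1ℚ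 + n) * ((1ℚ + n) * ((1ℚ + n) * ((1ℚ + n) * ((1ℚ + n) * 1ℚ)))))))))
    r = solve-∀ ℚring

  e₄-rec : ∀ j → evenPoly e₄ (suc (suc j)) ≡ evenPoly e₄ (suc j) + evenPoly e₄ (suc j) - evenPoly e₄ j + evenPoly e₃ (suc j)
  e₄-rec j = trans (cong (at e₄) (trans (ιℕ-suc (suc j)) (cong (1ℚ +_) (ιℕ-suc j)))) (trans (r (ιℕ j)) (cong (λ z → at e₄ z + at e₄ z - evenPoly e₄ j + at e₃ z) (sym (ιℕ-suc j))))
    where
    r : ∀ n → 0ℚ + (ℤ.- (ℤ.+ 1) / 560) * ((1ℚ + (1ℚ + n)) * ((1ℚ + (1ℚ + n)) * 1ℚ)) + (ℤ.+ 7 / 2880) * ((1ℚ + (1ℚ + n)) * ((1ℚ + (1ℚ + n)) * ((1ℚ + (1ℚ + n)) * ((1ℚ + (1ℚ + n)) * 1ℚ)))) + (ℤ.- (ℤ.+ 1) / 1440) * ((1ℚ + (1ℚ + n)) * ((1ℚ + (1ℚ + n)) * ((1ℚ + (1ℚ + n)) * ((1ℚ + (1ℚ + n)) * ((1ℚ + (1ℚ + n)) * ((1ℚ + (1ℚ + n)) * 1ℚ)))))) + (ℤ.+ 1 / 20160) * ((1ℚ + (1ℚ + n)) * ((1ℚ + (1ℚ + n)) * ((1ℚ + (1ℚ + n)) * ((1ℚ + (1ℚ + n)) * ((1ℚ + (1ℚ + n)) * ((1ℚ + (1ℚ + n)) * ((1ℚ + (1ℚ + n)) * ((1ℚ + (1ℚ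 + n)) * 1ℚ)))))))) ≡ (0ℚ + (ℤ.- (ℤ.+ 1) / 560) * ((1ℚ + n) * ((1ℚ + n) * 1ℚ)) + (ℤ.+ 7 / 2880) * ((1ℚ + n) * ((1ℚ + n) * ((1ℚ + n) * ((1ℚ + n) * 1ℚ)))) + (ℤ.- (ℤ.+ 1) / 1440) * ((1ℚ + n) * ((1ℚ + n) * ((1ℚ + n) * ((1ℚ + n) * ((1ℚ + n) * ((1ℚ + n) * 1ℚ)))))) + (ℤ.+ 1 / 20160) * ((1ℚ + n) * ((1ℚ + n) * ((1ℚ + n) * ((1ℚ + n) * ((1ℚ + n) * ((1ℚ + n) * ((1ℚ + n) * ((1ℚ + n) * 1ℚ))))))))) + (0ℚ + (ℤ.- (ℤ.+ 1) / 560) * ((1ℚ + n) * ((1ℚ + n) * 1ℚ)) + (ℤ.+ 7 / 2880) * ((1ℚ + n) * ((1ℚ + n) * ((1ℚ + n) * ((1ℚ + n) * 1ℚ)))) + (ℤ.- (ℤ.+ 1) / 1440) * ((1ℚ + n) * ((1ℚ + n) * ((1ℚ + n) * ((1ℚ + n) * ((1ℚ + n) * ((1ℚ + n) * 1ℚ)))))) + (ℤ.+ 1 / 20160) * ((1ℚ + n) * ((1ℚ + n) * ((1ℚ + n) * ((1ℚ + n) * ((1ℚ + n) * ((1ℚ + n) * ((1ℚ + n) * ((1ℚ + n) * 1ℚ))))))))) - (0ℚ + (ℤ.- (ℤ.+ 1) / 560) * (n * (n * 1ℚ)) + (ℤ.+ 7 / 2880) * (n * (n * (n * (n * 1ℚ))))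 + (ℤ.- (ℤ.+ 1) / 1440) * (n * (n * (n * (n * (n * (n * 1ℚ)))))) + (ℤ.+ 1 / 20160) * (n * (n * (n * (n * (n * (n * (n * (n * 1ℚ))))))))) + (0ℚ + (ℤ.+ 1 / 90) * ((1ℚ + n) * ((1ℚ + n) * 1ℚ)) + (ℤ.- (ℤ.+ 1) / 72) * ((1ℚ + n) * ((1ℚ + n) * ((1ℚ + n) * ((1ℚ + n) * 1ℚ)))) + (ℤ.+ 1 / 360) * ((1ℚ + n) * ((1ℚ + n) * ((1ℚ + n) * ((1ℚ + n) * ((1ℚ + n) * ((1ℚ + n) * 1ℚ)))))) + 0ℚ * ((1ℚ + n) * ((1ℚ + n) * ((1ℚ + n) * ((1ℚ + n) * ((1ℚ + n) * ((1ℚ + n) * ((1ℚ + n) * ((1ℚ + n) * 1ℚ)))))))))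
    r = solve-∀ ℚring

module ZetaLimits (q : ℚ) (q≤½ : ∣ q ∣ * 2ℚ ≤ 1ℚ) (1-q≢0 : (i : ℕ) → 1ℚ - q ↑ suc i ≢ 0ℚ)
  (ρ : ℕ → ℚ) (ρ-lim : (s : ℕ) → s ℕ.< 4 → Lim (rect q (2 ℕ.* s ℕ.+ 2)) (ρ s)) where

  open Sizes q q≤½ using (Q; 0≤Q; Q≤1; Q^≤Q)
  open ZetaSums q q≤½ 1-q≢0

  Summable : (ℚ → ℚ) → Set
  Summable F = ∃ λ L → Lim (λ K → ∑ K (λ i → F (W i))) L

  summable-cong : ∀ {F G : ℚ → ℚ} → (∀ w → F w ≡ G w) → Summable F → Summable G
  summable-cong h (L , l) = L , lim-cong (λ K → ∑-cong K (λ i _ → h (W i))) l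

  summable-+ : ∀ (F G : ℚ → ℚ) → Summable F → Summable G → Summable (λ w → F w + G w)
  summable-+ F G (L , l) (L′ , l′) = L + L′ , lim-cong (λ K → sym (∑-+ K (λ i → F (W i)) (λ i → G (W i)))) (lim-+ l l′)

  summable-0 : ∀ {F : ℚ → ℚ} → (∀ w → F w ≡ 0ℚ) → Summable F
  summable-0 h = 0ℚ , lim (null-cong (λ K → sym (trans (cong (_- 0ℚ) (∑-0 K (λ i _ → h (W i)))) refl)) null-0)

  -- Interchanging the summations turns the sum over i of the series in q^(i+1) into the combination
  -- of the ρ s with coefficients e s. The inner series is truncated at a length that grows with K,
  -- and the error bound in `GF` makes the truncation harmless.
  summable-GF : ∀ e (F : ℚ → ℚ) k C → 0ℚ ≤ C → k ℕ.≤ 5 → (∀ i → GF (q ↑ suc i) k (evenPoly e) (F (W i)) C) → Summable F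
  -- After a shift by 3 the inner sums have at least 5 terms, enough for every k ≤ 5.
  summable-GF e F k C 0≤C k≤5 g = ∑ 4 (λ s → e s * ρ s) , lim-unshift 3 (lim-null difference-null (lim-shift 3 double-lim))
    where
    inner : ℕ → ℕ → ℚ
    inner K i = ∑ (suc (suc K)) (λ j → evenPoly e j * (q ↑ suc i) ↑ j)
    double : ℕ → ℚ
    double K = ∑ K (inner K)
    summand : ℕ → ℕ → ℕ → ℚ
    summand i d s = e s * (ιℕ (suc d) ↑ (2 ℕ.* s ℕ.+ 2) * q ↑ (suc i ℕ.* suc d))
    inner≡ : ∀ K i → inner K i ≡ ∑ 4 (λ s → e s * ∑ (suc K) (λ d → ιℕ (suc d) ↑ (2 ℕ.* s ℕ.+ 2) * q ↑ (suc i ℕ.* suc d)))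
    inner≡ K i = trans (∑-head (suc K) (λ j → evenPoly e j * (q ↑ suc i) ↑ j)) (trans (cong₂ _+_ (trans (cong (_* 1ℚ) (evenPoly-0 e)) refl)
        (∑-cong (suc K) {λ d → evenPoly e (suc d) * (q ↑ suc i) ↑ suc d} {λ d → ∑ 4 (summand i d)} (λ d _ → trans (cong (evenPoly e (suc d) *_) (trans (sym (↑-* q (suc d) (suc i))) (cong (q ↑_) (ℕP.*-comm (suc d) (suc i)))))
          (trans (sym (∑-*ʳ 4 (q ↑ (suc i ℕ.* suc d)) (λ s → e s * ιℕ (suc d) ↑ (2 ℕ.* s ℕ.+ 2)))) (∑-cong 4 {λ s → e s * ιℕ (suc d) ↑ (2 ℕ.* s ℕ.+ 2) * q ↑ (suc i ℕ.* suc d)} {summand i d} (λ s _ → *-assoc (e s) (ιℕ (suc d) ↑ (2 ℕ.* s ℕ.+ 2)) (q ↑ (suc i ℕ.* suc d))))))))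
      (trans (+-identityˡ (∑ (suc K) (λ d → ∑ 4 (summand i d)))) (trans (∑-swap (suc K) 4 (summand i)) (∑-cong 4 {λ s → ∑ (suc K) (λ d → summand i d s)} (λ s _ → ∑-*ˡ (suc K) (e s) (λ d → ιℕ (suc d) ↑ (2 ℕ.* s ℕ.+ 2) * q ↑ (suc i ℕ.* suc d)))))))
    double≡ : ∀ K → double K ≡ ∑ 4 (λ s → e s * rect q (2 ℕ.* s ℕ.+ 2) K)
    double≡ K = trans (∑-cong K (λ i _ → inner≡ K i)) (trans (∑-swap K 4 (λ i s → e s * row s i)) (∑-cong 4 {λ s → ∑ K (λ i → e s * row s i)} {λ s → e s * ∑ K (row s)} (λ s _ → ∑-*ˡ K (e s) (row s))))
      where
      row : ℕ → ℕ → ℚ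
      row s i = ∑ (suc K) (λ d → ιℕ (suc d) ↑ (2 ℕ.* s ℕ.+ 2) * q ↑ (suc i ℕ.* suc d))
    double-lim : Lim double (∑ 4 (λ s → e s * ρ s))
    double-lim = lim-cong (λ K → sym (double≡ K)) (lim-∑ 4 (λ s K → e s * rect q (2 ℕ.* s ℕ.+ 2) K) (λ s → e s * ρ s) (λ s h → lim-*ˡ (e s) (ρ-lim s h)))
    envelope : ℕ → ℚ
    envelope n = C * (ιℕ (suc n) ↑ 9 * Q ↑ n)
    0≤envelope : ∀ n → 0ℚ ≤ envelope n
    0≤envelope n = 0≤* 0≤C (0≤* (0≤↑ 9 (0≤ιℕ (suc n))) (0≤↑ n 0≤Q))
    difference-null : Null (λ K → ∑ (3 ℕ.+ K) (λ i → F (W i)) - double (3 ℕ.+ K))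
    difference-null = null-dom (λ K → ≤-trans (bound K) (≤-reflexive (sym (abs≡ (0≤envelope (5 ℕ.+ K))))))
        (null-cong (λ K → cong envelope (ℕP.+-comm K 5)) (null-shift 5 (null-geometric Q 0≤Q q≤½ 9 C 0≤C (λ K → ≤-reflexive (abs≡ (0≤envelope K))))))
      where
      r : ∀ a b → a - b ≡ - (b - a)
      r = solve-∀ ℚring
      r₂ : ∀ n c z m → n * (c * (z * m)) ≡ c * (n * m * z)
      r₂ = solve-∀ ℚring
      bound : ∀ K → ∣ ∑ (3 ℕ.+ K) (λ i → F (W i)) - double (3 ℕ.+ K) ∣ ≤ envelope (5 ℕ.+ K)
      bound K = ≤-trans (≤-reflexive (cong ∣_∣ (sym (∑-- (3 ℕ.+ K) (λ i → F (W i)) (inner (3 ℕ.+ K)))))) (≤-trans (∑-abs (3 ℕ.+ K) (λ i → F (W i) - inner (3 ℕ.+ K) i))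
          (≤-trans (∑-mono (3 ℕ.+ K) {λ i → ∣ F (W i) - inner (3 ℕ.+ K) i ∣} {λ _ → C * (Q ↑ N * ιℕ N ↑ 8)} (λ i _ → ≤-trans (≤-reflexive (trans (cong ∣_∣ (r (F (W i)) (inner (3 ℕ.+ K) i))) (∣-p∣≡∣p∣ (inner (3 ℕ.+ K) i - F (W i)))))
              (≤-trans (g i N (ℕP.≤-trans k≤5 (ℕP.m≤m+n 5 K))) (*-monoˡ 0≤C (*-monoʳ (0≤↑ 8 (0≤ιℕ N)) (↑-mono N (0≤∣p∣ (q ↑ suc i)) (Q^≤Q i)))))))
            (≤-trans (≤-reflexive (trans (∑-const (3 ℕ.+ K) (C * (Q ↑ N * ιℕ N ↑ 8))) (r₂ (ιℕ (3 ℕ.+ K)) C (Q ↑ N) (ιℕ N ↑ 8))))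
              (*-monoˡ 0≤C (*-monoʳ (0≤↑ N 0≤Q) (*-mono-nonNeg (0≤ιℕ (3 ℕ.+ K)) (ιℕ-mono (ℕP.m≤n+m (3 ℕ.+ K) 3)) (0≤↑ 8 (0≤ιℕ N)) (↑-mono 8 (0≤ιℕ N) (ιℕ-mono (ℕP.n≤1+n N)))))))))
        where N = 5 ℕ.+ K

  centre : ℚ → ℚ
  centre w = w + w - 1ℚ

  record Power (t : ℕ) (a : ℕ → ℚ) : Set where
    constructor power
    field
      bound : ℚ
      0≤bound : 0ℚ ≤ bound
      gf : ∀ i → GF (q ↑ suc i) (suc t) a (v (W i) ↑ t * centre (W i)) bound

  power-step : ∀ t (a : ℕ → ℚ) e → evenPoly e 1 ≡ a 0 →
    (∀ j → evenPoly e (suc (suc j)) ≡ evenPoly e (suc j) + evenPoly e (suc j) - evenPoly e j + a (suc j)) → Power t a → Power (suc t) (evenPoly e)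
  power-step t a e e1 rec (power C 0≤C g) = power _ (0≤* (0≤* 0≤2 0≤2) (0≤+ 0≤C (0≤* (0≤* 0≤2 0≤2) 0≤B)))
      (λ i → subst (λ z → GF (q ↑ suc i) (suc (suc t)) (evenPoly e) z (2ℚ * 2ℚ * (C + 2ℚ * 2ℚ * B))) (sym (*-assoc (v (W i)) (v (W i) ↑ t) (centre (W i))))
        (GF-step i t a (evenPoly e) (v (W i) ↑ t * centre (W i)) C B 0≤C 0≤B (evenPoly-0 e) e1 rec (evenPoly-abs e) (g i)))
    where
    B = ∑ 4 (λ s → ∣ e s ∣)
    0≤B : 0ℚ ≤ B
    0≤B = ≤-trans (≤-reflexive (sym (∑-0 4 {λ _ → 0ℚ} (λ _ _ → refl)))) (∑-mono 4 {λ _ → 0ℚ} {λ s → ∣ e s ∣} (λ s _ → 0≤∣p∣ (e s)))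

  -- From t = 2 on the polynomials contain the factor j² - 1.
  evenPoly-1 : ∀ e → at e 1ℚ ≡ 0ℚ → ∀ e′ → evenPoly e 1 ≡ evenPoly e′ 0
  evenPoly-1 e h e′ = trans (cong (at e) ι1) (trans h (sym (evenPoly-0 e′)))

  power₁ : Power 1 (evenPoly e₁)
  power₁ = power-step 0 κ₀ e₁ (trans (cong (at e₁) ι1) refl) e₁-rec
    (power (2ℚ * 2ℚ) (0≤* 0≤2 0≤2) (λ i → subst (λ z → GF (q ↑ suc i) 1 κ₀ z (2ℚ * 2ℚ)) (sym (*-identityˡ (centre (W i)))) (GF-base i)))

  power₂ : Power 2 (evenPoly e₂)
  power₂ = power-step 1 (evenPoly e₁) e₂ (evenPoly-1 e₂ refl e₁) e₂-rec power₁

  power₃ : Power 3 (evenPoly e₃)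
  power₃ = power-step 2 (evenPoly e₂) e₃ (evenPoly-1 e₃ refl e₂) e₃-rec power₂

  power₄ : Power 4 (evenPoly e₄)
  power₄ = power-step 3 (evenPoly e₃) e₄ (evenPoly-1 e₄ refl e₃) e₄-rec power₃

  summable-power : ∀ t e → suc t ℕ.≤ 5 → Power t (evenPoly e) → Summable (λ w → v w ↑ t * centre w)
  summable-power t e h (power C 0≤C g) = summable-GF e (λ w → v w ↑ t * centre w) (suc t) C 0≤C h g

  summable-powers : ∀ t → t ℕ.< 4 → Summable (λ w → v w ↑ suc t * centre w)
  summable-powers 0 _ = summable-power 1 e₁ (ℕP.m≤m+n 2 3) power₁
  summable-powers 1 _ = summable-power 2 e₂ (ℕP.m≤m+n 3 2) power₂
  summable-powers 2 _ = summable-power 3 e₃ (ℕP.m≤m+n 4 1) power₃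
  summable-powers 3 _ = summable-power 4 e₄ ℕP.≤-refl power₄
  summable-powers (suc (suc (suc (suc t)))) (s≤s (s≤s (s≤s (s≤s ()))))

  -- Both ω and 1 - ω satisfy z² = z + v with v = ω² - ω, so Hd (s + 2) = Hd (s + 1) + v Hd s + v
  -- (2ω - 1), starting from Hd 0 = Hd 1 = 0. Only terms (2ω - 1) v^t with t ≥ 1 arise, and the
  -- bound 2j + s ≤ 9 keeps t ≤ 4.
  summable-Hd : ∀ s j → j ℕ.+ j ℕ.+ s ℕ.≤ 9 → Summable (λ w → v w ↑ j * Hd s w)
  summable-Hd 0 j _ = summable-0 (λ w → r (v w ↑ j) w)
    where
    r : ∀ x w → x * ((w * 1ℚ - (1ℚ - w) * 1ℚ) - (w - (1ℚ - w))) ≡ 0ℚ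
    r = solve-∀ ℚring
  summable-Hd 1 j _ = summable-0 (λ w → r (v w ↑ j) w)
    where
    r : ∀ x w → x * ((w * (w * 1ℚ) - (1ℚ - w) * ((1ℚ - w) * 1ℚ)) - (w - (1ℚ - w))) ≡ 0ℚ
    r = solve-∀ ℚring
  summable-Hd (suc (suc s)) j h = summable-cong {λ w → X₁ w + X₂ w + v w ↑ suc j * centre w} (λ w → r w (v w ↑ j) (w ↑ suc s) ((1ℚ - w) ↑ suc s))
      (summable-+ (λ w → X₁ w + X₂ w) (λ w → v w ↑ suc j * centre w) (summable-+ X₁ X₂ (summable-Hd (suc s) j (ℕP.≤-trans (ℕP.+-monoʳ-≤ (j ℕ.+ j) (ℕP.n≤1+n (suc s))) h)) (summable-Hd s (suc j) (ℕP.≤-trans (ℕP.≤-reflexive (eq j s)) h)))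
        (summable-powers j (small j (ℕP.≤-trans (ℕP.m≤m+n (suc j ℕ.+ suc j) s) (ℕP.≤-trans (ℕP.≤-reflexive (eq j s)) h)))))
    where
    X₁ X₂ : ℚ → ℚ
    X₁ w = v w ↑ j * Hd (suc s) w
    X₂ w = v w ↑ suc j * Hd s w
    eq : ∀ j s → suc j ℕ.+ suc j ℕ.+ s ≡ j ℕ.+ j ℕ.+ suc (suc s)
    eq = ℕ-solve-∀
    small : ∀ j → suc j ℕ.+ suc j ℕ.≤ 9 → j ℕ.< 4
    small j h = ℕP.≰⇒> (λ 4≤j → ℕP.<⇒≱ (ℕP.≤-refl {10}) (ℕP.≤-trans (ℕP.+-mono-≤ (s≤s 4≤j) (s≤s 4≤j)) h))
    r : ∀ w x a b → x * ((w * a - (1ℚ - w) * b) - (w - (1ℚ - w))) + (w * w - w) * x * ((a - b) - (w - (1ℚ - w))) + (w * w - w) * x * (w + w - 1ℚ) ≡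
      x * ((w * (w * a) - (1ℚ - w) * ((1ℚ - w) * b)) - (w - (1ℚ - w)))
    r = solve-∀ ℚring

  Hd-limit : ∀ s → s ℕ.< 10 → Summable (Hd s)
  Hd-limit s s<10 = summable-cong (λ w → *-identityˡ (Hd s w)) (summable-Hd s 0 (ℕP.≤-pred s<10))

-- Conclusion: integrality against smallness.

finite-choice : ∀ N {P : ℕ → ℚ → Set} → (∀ s → s ℕ.< N → ∃ (P s)) → ∃ λ (f : ℕ → ℚ) → ∀ s → s ℕ.< N → P s (f s)
finite-choice N {P} h = (λ s → pick s (s ℕP.<? N)) , λ s s<N → picked s s<N (s ℕP.<? N)
  where
  pick : ∀ s → Dec (s ℕ.< N) → ℚ
  pick s (yes s<N) = proj₁ (h s s<N)
  pick s (no _) = 0ℚ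
  picked : ∀ s → s ℕ.< N → (d : Dec (s ℕ.< N)) → P s (pick s d)
  picked s s<N (yes s<N′) = proj₂ (h s s<N′)
  picked s s<N (no ¬h) = ⊥-elim (¬h s<N)

denominator-clears : ∀ x → Integral (ιℕ (suc (ℚ.denominator-1 x)) * x)
denominator-clears x@(mkℚ n d c) = n , toℚᵘ-injective (ℚᵘP.≃-trans (toℚᵘ-homo-* (ιℕ (suc d)) x) (ℚᵘP.≃-trans (ℚᵘP.*-cong (toιᵘ (ℤ.+ suc d)) ℚᵘP.≃-refl)
  (ℚᵘP.≃-trans (ℚᵘ.*≡* (trans (ℤP.*-identityʳ (ℤ.+ suc d ℤ.* n)) (trans (ℤP.*-comm (ℤ.+ suc d) n) (cong (λ z → n ℤ.* ℤ.+ z) (sym (ℕP.+-identityʳ (suc d))))))) (ℚᵘP.≃-sym (toιᵘ n)))))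

common-denominator : ∀ N (f : ℕ → ℚ) → ∃ λ b → ∀ s → s ℕ.< N → Integral (ιℕ (suc b) * f s)
common-denominator zero f = 0 , λ s ()
common-denominator (suc N) f = b ℕ.+ d ℕ.* suc b , λ s s<N → go s (ℕP.m<1+n⇒m<n∨m≡n s<N)
  where
  b = proj₁ (common-denominator N f)
  d = ℚ.denominator-1 (f N)
  r₁ : ∀ d b x → d * (b * x) ≡ d * b * x
  r₁ = solve-∀ ℚring
  r₂ : ∀ d b x → b * (d * x) ≡ d * b * x
  r₂ = solve-∀ ℚring
  go : ∀ s → s ℕ.< N ⊎ s ≡ N → Integral (ιℕ (suc d ℕ.* suc b) * f s)
  go s (inj₁ s<N) = subst Integral (trans (r₁ (ιℕ (suc d)) (ιℕ (suc b)) (f s)) (cong (_* f s) (sym (ιℕ-* (suc d) (suc b))))) (integral-* (integral-ι (ℤ.+ suc d)) (proj₂ (common-denominator N f) s s<N))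
  go s (inj₂ refl) = subst Integral (trans (r₂ (ιℕ (suc d)) (ιℕ (suc b)) (f s)) (cong (_* f s) (sym (ιℕ-* (suc d) (suc b))))) (integral-* (integral-ι (ℤ.+ suc b)) (denominator-clears (f s)))

geometric-threshold : ∀ C Q → 0ℚ < Q → Q * 2ℚ ≤ 1ℚ → ∃ λ m → 4 ℕ.≤ m × C * Q ↑ m < 1ℚ
geometric-threshold C Q 0<Q h = m , ℕP.m≤m+n 4 N , <-≤-trans (*-monoˡ-<-pos (Q ↑ m) {{positive (0<↑ m 0<Q)}} C<) (≤-trans (≤-reflexive (trans (*-comm (2ℚ ↑ m) (Q ↑ m)) (sym (↑-*ˡ Q 2ℚ m)))) (↑≤1 m (0≤* (<⇒≤ 0<Q) 0≤2) h))
  where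
  N = proj₁ (abs-numerator C)
  m = 4 ℕ.+ N
  C< : C < 2ℚ ↑ m
  C< = ≤-<-trans (≤-trans (proj₂ (abs-numerator C)) (ιℕ-mono (ℕP.m≤n+m N 4))) (<-≤-trans lt (≤-trans (ιℕ-mono (suc≤2^ m)) (≤-reflexive (trans (ιℕ-^ 2 m) (cong (_↑ m) ι2)))))
    where
    lt : ιℕ m < ιℕ (suc m)
    lt = subst₂ _<_ (+-identityˡ (ιℕ m)) (sym (ιℕ-suc m)) (+-monoˡ-< (ιℕ m) (positive⁻¹ 1ℚ))

module Forms (p : ℤ) (2≤p : 2 ℕ.≤ ℤ.∣ p ∣) (q : ℚ) (qP : q * ι p ≡ 1ℚ) (q≤½ : ∣ q ∣ * 2ℚ ≤ 1ℚ) (m : ℕ) (4≤m : 4 ℕ.≤ m)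
  (L : ℕ → ℚ) (L-lim : (s : ℕ) → s ℕ.< 10 → Lim (λ K → ∑ K (λ i → Hd s (inv (1ℚ - q ↑ suc i)))) (L s)) where

  open FormSizes p 2≤p q qP m q≤½ 4≤m

  W-abs : ∀ i → ∣ W i ∣ ≤ 2ℚ
  W-abs = ZetaSums.W-abs q q≤½ 1-q^≢0

  1-W-null : ∀ i → Null (λ K → 1ℚ - W (K ℕ.+ i))
  1-W-null i = null-shift i (null-geometric Q 0≤Q q≤½ {λ K → 1ℚ - W K} 0 2ℚ 0≤2 (λ K → ≤-trans (≤-reflexive (trans (cong ∣_∣ (1-W K)) (trans (∣-p∣≡∣p∣ (q ↑ suc K * W K)) (trans (∣p*q∣≡∣p∣*∣q∣ (q ↑ suc K) (W K)) (*-comm (∣ q ↑ suc K ∣) (∣ W K ∣))))))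
    (*-mono-nonNeg (0≤∣p∣ (W K)) (W-abs K) (0≤∣p∣ (q ↑ suc K)) (≤-trans (≤-reflexive (↑-abs q (suc K))) (≤-trans (↑-anti {Q} {K} {suc K} 0≤Q Q≤1 (ℕP.n≤1+n K)) (≤-reflexive (sym (*-identityˡ (Q ↑ K)))))))))

  W-power-null : ∀ i s → Null (λ K → W (K ℕ.+ i) ↑ s - 1ℚ)
  W-power-null i zero = null-0
  W-power-null i (suc s) = null-cong (λ K → r (W (K ℕ.+ i)) (W (K ℕ.+ i) ↑ s)) (null-+ (null-bounded {λ K → W (K ℕ.+ i) ↑ s - 1ℚ} {λ K → W (K ℕ.+ i)} 2ℚ (positive⁻¹ 2ℚ) (λ K → W-abs (K ℕ.+ i)) (W-power-null i s)) (null-neg (1-W-null i)))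
    where
    r : ∀ w z → w * (z - 1ℚ) + - (1ℚ - w) ≡ w * z - 1ℚ
    r = solve-∀ ℚring

  1-W-power-null : ∀ i s → Null (λ K → (1ℚ - W (K ℕ.+ i)) ↑ suc s)
  1-W-power-null i zero = null-cong (λ K → sym (*-identityʳ (1ℚ - W (K ℕ.+ i)))) (1-W-null i)
  1-W-power-null i (suc s) = null-bounded {λ K → (1ℚ - W (K ℕ.+ i)) ↑ suc s} {λ K → 1ℚ - W (K ℕ.+ i)} (1ℚ + 2ℚ) (positive⁻¹ (1ℚ + 2ℚ)) (λ K → ≤-trans (∣x-y∣≤ 1ℚ (W (K ℕ.+ i))) (+-monoʳ-≤ 1ℚ (W-abs (K ℕ.+ i)))) (1-W-power-null i s)

  tail-null : Null tailSum
  tail-null = null-+ (null-∑ (suc n) (λ j K → ∑ j (λ i → AA j (W (K ℕ.+ i)))) (λ j → null-∑ j (λ i K → AA j (W (K ℕ.+ i))) (λ i → null-∑ 10 (λ s K → coeff j (suc s) * (W (K ℕ.+ i) ↑ suc s - 1ℚ)) (λ s → null-*ˡ (coeff j (suc s)) (W-power-null i (suc s))))))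
    (null-neg (null-∑ (suc n) (λ j K → ∑ (n ℕ.∸ j) (λ i → BB j (W (K ℕ.+ i)))) (λ j → null-∑ (n ℕ.∸ j) (λ i K → BB j (W (K ℕ.+ i))) (λ i → null-∑ 10 (λ s K → coeff j (suc s) * (1ℚ - W (K ℕ.+ i)) ↑ suc s) (λ s → null-*ˡ (coeff j (suc s)) (1-W-power-null i s))))))

  -- The limit of the partial sums of 2R(q^k), k ≥ 1; it is rational because the limits L s are.
  Λ : ℚ
  Λ = ∑ 10 (λ s → γ s * L s) - constant

  Λ-lim : Lim partialSum Λ
  Λ-lim = lim (null-cong eq (null-+ (Lim.difference main) tail-null))
    where
    S : ℕ → ℚ
    S K = ∑ 10 (λ s → γ s * ∑ K (λ i → Hd s (W i)))
    main : Lim S (∑ 10 (λ s → γ s * L s))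
    main = lim-∑ 10 (λ s K → γ s * ∑ K (λ i → Hd s (W i))) (λ s → γ s * L s) (λ s h → lim-*ˡ (γ s) (L-lim s h))
    r : ∀ a t c l → a - l + t ≡ (a + t - c) - (l - c)
    r = solve-∀ ℚring
    S≡ : ∀ K → ∑ K (λ i → ∑ 10 (λ s → γ s * Hd s (W i))) ≡ S K
    S≡ K = trans (∑-swap K 10 (λ i s → γ s * Hd s (W i))) (∑-cong 10 {λ s → ∑ K (λ i → γ s * Hd s (W i))} {λ s → γ s * ∑ K (λ i → Hd s (W i))} (λ s _ → ∑-*ˡ K (γ s) (λ i → Hd s (W i))))
    eq : ∀ K → S K - ∑ 10 (λ s → γ s * L s) + tailSum K ≡ partialSum K - Λ
    eq K = trans (r (S K) (tailSum K) constant (∑ 10 (λ s → γ s * L s))) (cong (_- Λ) (sym (trans (form K) (cong (λ z → z + tailSum K - constant) (S≡ K)))))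

  Λ-lower : ∣ t₀ ∣ ≤ ∣ Λ ∣
  Λ-lower = lim-lower (suc k₀) Λ-lim partial-lower

  Λ-upper : ∣ Λ ∣ ≤ ∣ t₀ ∣ + ∣ t₀ ∣ + ∣ t₀ ∣
  Λ-upper = lim-upper (suc k₀) Λ-lim partial-upper

  Δ≢0 : Δ ≢ 0ℚ
  Δ≢0 e = *-≢0 (*-≢0 (∏L-≢0 up {qfact} (λ x → ∏ℚ-≢0 x U≢0)) (∏L-≢0 down {qfact⁻¹} (λ x → ∏ℚ-≢0 x inv≢0))) (↑-≢0 gain q≢0) (trans (sym Δ-def) e)
    where
    inv≢0 : ∀ i → inv (P ↑ suc i - 1ℚ) ≢ 0ℚ
    inv≢0 i = *≡1⇒≢0 (trans (*-comm (inv (P ↑ suc i - 1ℚ)) (P ↑ suc i - 1ℚ)) (*-inv (U≢0 i)))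
    ∏L-≢0 : ∀ xs {f : ℕ → ℚ} → (∀ x → f x ≢ 0ℚ) → ∏L xs (λ i → f (i ℕ.* m)) ≢ 0ℚ
    ∏L-≢0 [] h = 1≢0
    ∏L-≢0 (x ∷ xs) {f} h = *-≢0 (h (x ℕ.* m)) (∏L-≢0 xs {f} h)

  ΔΛ-integral : ∀ b → (∀ s → s ℕ.< 10 → Integral (ιℕ b * L s)) → Integral (ιℕ b * (Δ * Λ))
  ΔΛ-integral b h = subst Integral (r (ιℕ b) Δ (∑ 10 (λ s → γ s * L s)) constant)
      (integral-+ (subst Integral eq (integral-∑ 10 (λ s s<10 → integral-* (γ-integral s s<10) (h s s<10)))) (integral-neg (integral-* (integral-ι (ℤ.+ b)) constant-integral)))
    where
    r : ∀ b d s c → b * d * s + - (b * (d * c)) ≡ b * (d * (s - c))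
    r = solve-∀ ℚring
    r₂ : ∀ b d g l → d * g * (b * l) ≡ b * d * (g * l)
    r₂ = solve-∀ ℚring
    eq : ∑ 10 (λ s → Δ * γ s * (ιℕ b * L s)) ≡ ιℕ b * Δ * ∑ 10 (λ s → γ s * L s)
    eq = trans (∑-cong 10 {λ s → Δ * γ s * (ιℕ b * L s)} {λ s → ιℕ b * Δ * (γ s * L s)} (λ s _ → r₂ (ιℕ b) Δ (γ s) (L s))) (∑-*ˡ 10 (ιℕ b * Δ) (λ s → γ s * L s))

  ΔΛ-small : ∀ b → ∣ ιℕ b * (Δ * Λ) ∣ ≤ ιℕ b * ((1ℚ + 2ℚ) * 2ℚ ↑ 110) * Q ↑ m
  ΔΛ-small b = ≤-trans (≤-reflexive (trans (∣p*q∣≡∣p∣*∣q∣ (ιℕ b) (Δ * Λ)) (cong₂ _*_ (abs≡ (0≤ιℕ b)) (∣p*q∣≡∣p∣*∣q∣ Δ Λ))))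
    (≤-trans (*-monoˡ (0≤ιℕ b) (≤-trans (*-monoˡ (0≤∣p∣ Δ) Λ-upper) (≤-trans (≤-reflexive (r (∣ Δ ∣) (∣ t₀ ∣))) (*-monoˡ (<⇒≤ (positive⁻¹ (1ℚ + 2ℚ))) Δt₀-small))))
      (≤-reflexive (r₂ (ιℕ b) (1ℚ + 2ℚ) (Q ↑ m) (2ℚ ↑ 110))))
    where
    r : ∀ d t → d * (t + t + t) ≡ (1ℚ + (1ℚ + 1ℚ)) * (d * t)
    r = solve-∀ ℚring
    r₂ : ∀ b c x y → b * (c * (x * y)) ≡ b * (c * y) * x
    r₂ = solve-∀ ℚring

  contradiction : ∀ b → (∀ s → s ℕ.< 10 → Integral (ιℕ (suc b) * L s)) → ¬ (ιℕ (suc b) * ((1ℚ + 2ℚ) * 2ℚ ↑ 110) * Q ↑ m < 1ℚ)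
  contradiction b h small = *-≢0 (0<⇒≢0 (ιℕ-pos b)) (*-≢0 Δ≢0 Λ≢0) (small-integral (ΔΛ-integral (suc b) h) (≤-<-trans (ΔΛ-small (suc b)) small))
    where
    Λ≢0 : Λ ≢ 0ℚ
    Λ≢0 e = <⇒≢ (<-≤-trans t₀≢0 (≤-trans Λ-lower (≤-reflexive (cong ∣_∣ e)))) refl

-- The limits depend on q alone, so their common denominator is fixed first; m is then chosen so
-- large that |q|^m beats it.
Hd-limits-contradict : ∀ p → 2 ℕ.≤ ℤ.∣ p ∣ → ∀ q → q * ι p ≡ 1ℚ → (q≤½ : ∣ q ∣ * 2ℚ ≤ 1ℚ) →
  ¬ (∀ s → s ℕ.< 10 → ∃ λ L → Lim (λ K → ∑ K (λ i → Hd s (inv (1ℚ - q ↑ suc i)))) L)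
Hd-limits-contradict p 2≤p q qP q≤½ h = Forms.contradiction p 2≤p q qP q≤½ (proj₁ T) (proj₁ (proj₂ T)) (proj₁ ch) (proj₂ ch) (proj₁ cd) (proj₂ cd) (proj₂ (proj₂ T))
  where
  ch = finite-choice 10 h
  cd = common-denominator 10 (proj₁ ch)
  T = geometric-threshold (ιℕ (suc (proj₁ cd)) * ((1ℚ + 2ℚ) * 2ℚ ↑ 110)) (∣ q ∣) (abs>0 (*≡1⇒≢0 qP)) q≤½

theorem1p3 : (q : ℚ) (p : ℤ) → q * (p / 1) ≡ 1ℚ → p ≢ ℤ.+ 1 → p ≢ ℤ.- (ℤ.+ 1) →
    ¬ (ζRational q 3 × ζRational q 5 × ζRational q 7 × ζRational q 9)
theorem1p3 q p qp p≢1 p≢-1 ((r₃ , c₃) , (r₅ , c₅) , (r₇ , c₇) , (r₉ , c₉)) = Hd-limits-contradict p 2≤p q qP q≤½ (ZetaLimits.Hd-limit q q≤½ 1-q^≢0 ρ ρ-lim)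
  where
  qP : q * ι p ≡ 1ℚ
  qP = trans (cong (q *_) (ι≡/1 p)) qp
  p≢0 : p ≢ ℤ.+ 0
  p≢0 e = 1≢0 (trans (sym qP) (trans (cong (q *_) (trans (cong ι e) ι0)) (*-zeroʳ q)))
  large : ∀ p → p ≢ ℤ.+ 0 → p ≢ ℤ.+ 1 → p ≢ -[1+ 0 ] → 2 ℕ.≤ ℤ.∣ p ∣
  large (ℤ.+ 0) h _ _ = ⊥-elim (h refl)
  large (ℤ.+ 1) _ h _ = ⊥-elim (h refl)
  large (ℤ.+ suc (suc n)) _ _ _ = s≤s (s≤s z≤n)
  large -[1+ 0 ] _ _ h = ⊥-elim (h refl)
  large -[1+ suc n ] _ _ _ = s≤s (s≤s z≤n)
  2≤p : 2 ℕ.≤ ℤ.∣ p ∣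
  2≤p = large p p≢0 p≢1 p≢-1
  q≤½ : ∣ q ∣ * 2ℚ ≤ 1ℚ
  q≤½ = ≤-trans (*-monoˡ (0≤∣p∣ q) (≤-trans (≤-reflexive (sym ι2)) (≤-trans (ιℕ-mono 2≤p) (≤-reflexive (sym (ι-abs p)))))) (≤-reflexive (trans (sym (∣p*q∣≡∣p∣*∣q∣ q (ι p))) (cong ∣_∣ qP)))
  1-q^≢0 : ∀ i → 1ℚ - q ↑ suc i ≢ 0ℚ
  1-q^≢0 = LinearForm.1-q^≢0 p 2≤p q qP 0
  -- ρ s is ζ_q(2s + 3), the limit of `rect` with exponent 2s + 2.
  ρ : ℕ → ℚ
  ρ 0 = r₃
  ρ 1 = r₅
  ρ 2 = r₇
  ρ _ = r₉
  ρ-lim : ∀ s → s ℕ.< 4 → Lim (rect q (2 ℕ.* s ℕ.+ 2)) (ρ s)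
  ρ-lim 0 _ = ZetaSums.rect-lim q q≤½ 1-q^≢0 2 r₃ c₃
  ρ-lim 1 _ = ZetaSums.rect-lim q q≤½ 1-q^≢0 4 r₅ c₅
  ρ-lim 2 _ = ZetaSums.rect-lim q q≤½ 1-q^≢0 6 r₇ c₇
  ρ-lim 3 _ = ZetaSums.rect-lim q q≤½ 1-q^≢0 8 r₉ c₉
  ρ-lim (suc (suc (suc (suc s)))) (s≤s (s≤s (s≤s (s≤s ()))))
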